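{- Let $d\ge 2$ and let $f(X_1,\dots,X_{d-1})$ be a polynomial with integer coefficients in which the order of multiplication of the variables in each monomial is fixed (i.e. a $\mathbb{Z}$-linear combination of words in $X_1,\dots,X_{d-1}$). For a finite ring $R$ let $V_f(R)=\{(x_1,\dots,x_d)\in R^d : x_d=f(x_1,\dots,x_{d-1})\}$. Let $\{R_i\}_{i=1}^\infty$ be a sequence of finite rings with $|R_i|\to\infty$, and suppose that there is a constant $C$ such that $V_f(R_i)$ is a $C$-Salem set in $R_i^d$ for every $i$. Then all but finitely many of the rings $R_i$ are fields or are isomorphic to matrix rings $M_{n\times n}(F)$, $F$ a finite field, of small dimension relative to $d$. Moreover, in the case $f(X_1,\dots,X_{d-1})=X_1^2+\dots+X_{d-1}^2$, all but finitely many of the rings $R_i$ are fields.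
   Context: Rings are unital with $1\neq 0$ and not necessarily commutative. For a finite ring $R$, a set $S\subseteq R^d$ and a character $\psi$ of the additive group of $R^d$, put $\widehat{S}(\psi)=\frac{1}{|R|^d}\sum_{x\in S}\psi(x)$. The set $S$ is called $C$-Salem if $|\widehat{S}(\psi)|\le C\,|R|^{ -d}\,|S|^{1/2}$ for all nontrivial additive characters $\psi$ of $R^d$. A matrix ring $M_{n\times n}(F)$ over a finite field $F$ is said to have small dimension relative to $d$ if one of the following holds: $n=2$; or $n=3$ and $d\in\{2,3\}$; or $n=4$ and $d=2$. -}

module Defs where

open import Algebra.Bundles using (Ring)
open import Algebra.Bundles.Raw using (RawMonoid; RawRing)
import Algebra.Construct.Pointwise as Pointwise
import Algebra.Definitions.RawMonoid as RawMonoidDefs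
open import Algebra.Morphism.Structures using (IsMonoidHomomorphism; IsRingIsomorphism)
open import Data.Bool.Base using (if_then_else_)
open import Data.Empty using (⊥-elim)
open import Data.Fin.Base using (Fin; finToFun)
open import Data.Fin.Properties using (nonZeroIndex) renaming (_≟_ to _≟Fin_)
import Data.Integer.Base as ℤ
import Data.Integer.Properties as ℤₚ
open import Data.List.Base as List using (List; []; _∷_; allFin; filter; foldr; length)
open import Data.Nat.Base as ℕ using (ℕ; zero; suc; NonZero)
import Data.Nat.DivMod as ℕ
import Data.Nat.Properties as ℕₚ
open import Data.Product.Base using (Σ; ∃-syntax; _×_; _,_; proj₁; proj₂)
open import Data.Rational.Base as ℚ using (ℚ; 0ℚ; 1ℚ; ½; ↥_; ↧_; ↧ₙ_)
import Data.Rational.Properties as ℚₚ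
open import Data.Rational.Solver using (module +-*-Solver)
import Data.Rational.Unnormalised.Base as ℚᵘ
import Data.Rational.Unnormalised.Properties as ℚᵘₚ
open import Data.Sum.Base using (_⊎_; inj₁; inj₂)
open import Data.Vec.Functional using (Vector; init; last)
open import Function.Base using (_∘_)
open import Function.Bundles using (Inverse)
open import Function.Properties.Inverse using (Inverse⇒Injection)
open import Level using (Level; 0ℓ; _⊔_) renaming (suc to lsuc)
open import Relation.Binary.Definitions using (Decidable)
open import Relation.Binary.PropositionalEquality as ≡
  using (_≡_; refl; sym; trans; cong; cong₂; subst; subst₂)
open import Relation.Nullary using (¬_; yes; no)
open import Relation.Nullary.Decidable using (⌊_⌋; via-injection)
open import Relation.Unary as U using (Pred)

private
  variable
    c ℓ p : Level

------------------------------------------------------------------------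
-- Real numbers: Cauchy sequences of rationals, with the setoid equality
-- "the difference tends to 0".

record ℝ : Set where
  constructor mkℝ
  field
    seq    : ℕ → ℚ
    cauchy : ∀ ε → 0ℚ ℚ.< ε →
             ∃[ N ] (∀ m n → N ℕ.≤ m → N ℕ.≤ n → ℚ.∣ seq m ℚ.- seq n ∣ ℚ.≤ ε)

open ℝ

infix 4 _≃ᴿ_ _≤ᴿ_

_≃ᴿ_ : ℝ → ℝ → Set
x ≃ᴿ y = ∀ ε → 0ℚ ℚ.< ε →
         ∃[ N ] (∀ n → N ℕ.≤ n → ℚ.∣ seq x n ℚ.- seq y n ∣ ℚ.≤ ε)

_≤ᴿ_ : ℝ → ℝ → Set
x ≤ᴿ y = ∀ ε → 0ℚ ℚ.< ε →
         ∃[ N ] (∀ n → N ℕ.≤ n → seq x n ℚ.≤ seq y n ℚ.+ ε)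

-- ⌊ √m ⌋; the step is a separate function so that isqrt m is shared.
isqrtStep : ℕ → ℕ → ℕ
isqrtStep m r = if ⌊ suc r ℕ.* suc r ℕₚ.≤? m ⌋ then suc r else r

isqrt : ℕ → ℕ
isqrt zero    = 0
isqrt (suc m) = isqrtStep (suc m) (isqrt m)

-- ⌊ √(max 0 x) · (n + 1) ⌋ / (n + 1)
sqrtApprox : ℕ → ℚ → ℚ
sqrtApprox n x =
  let k = ℤ.+ suc n ℚ./ 1
  in ℤ.+ isqrt ℤ.∣ ℚ.floor ((x ℚ.⊔ 0ℚ) ℚ.* (k ℚ.* k)) ∣ ℚ./ suc n

module RealLemmas where

  toℚ : ℕ → ℚ
  toℚ k = ℤ.+ k ℚ./ 1

  1/suc : ℕ → ℚ
  1/suc n = ℤ.+ 1 ℚ./ suc n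

  ≡⇒≤ : ∀ {x y} → x ≡ y → x ℚ.≤ y
  ≡⇒≤ = ℚₚ.≤-reflexive

  toℚᵘ-/ : ∀ i n .{{_ : NonZero n}} → ℚ.toℚᵘ (i ℚ./ n) ℚᵘ.≃ i ℚᵘ./ n
  toℚᵘ-/ i (suc n) = ℚₚ.toℚᵘ-fromℚᵘ (ℚᵘ.mkℚᵘ i n)

  toℚ-* : ∀ m n → toℚ (m ℕ.* n) ≡ toℚ m ℚ.* toℚ n
  toℚ-* m n = ℚₚ.toℚᵘ-injective (begin-equality
    ℚ.toℚᵘ (toℚ (m ℕ.* n))                ≃⟨ toℚᵘ-/ (ℤ.+ (m ℕ.* n)) 1 ⟩
    ℤ.+ (m ℕ.* n) ℚᵘ./ 1                  ≃⟨ ℚᵘ.*≡* (cong (ℤ._* ℤ.+ 1) (ℤₚ.pos-* m n)) ⟩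
    (ℤ.+ m ℚᵘ./ 1) ℚᵘ.* (ℤ.+ n ℚᵘ./ 1)    ≃⟨ ℚᵘₚ.*-cong (toℚᵘ-/ (ℤ.+ m) 1) (toℚᵘ-/ (ℤ.+ n) 1) ⟨
    ℚ.toℚᵘ (toℚ m) ℚᵘ.* ℚ.toℚᵘ (toℚ n)    ≃⟨ ℚₚ.toℚᵘ-homo-* (toℚ m) (toℚ n) ⟨
    ℚ.toℚᵘ (toℚ m ℚ.* toℚ n)              ∎)
    where open ℚᵘₚ.≤-Reasoning

  toℚ-suc : ∀ m → toℚ (suc m) ≡ toℚ m ℚ.+ 1ℚ
  toℚ-suc m = ℚₚ.toℚᵘ-injective (begin-equality
    ℚ.toℚᵘ (toℚ (suc m))                 ≃⟨ toℚᵘ-/ (ℤ.+ suc m) 1 ⟩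
    ℤ.+ suc m ℚᵘ./ 1                     ≃⟨ ℚᵘ.*≡* (cong (ℤ._* ℤ.+ 1) lem) ⟩
    (ℤ.+ m ℚᵘ./ 1) ℚᵘ.+ ℚᵘ.1ℚᵘ           ≃⟨ ℚᵘₚ.+-congˡ ℚᵘ.1ℚᵘ (toℚᵘ-/ (ℤ.+ m) 1) ⟨
    ℚ.toℚᵘ (toℚ m) ℚᵘ.+ ℚ.toℚᵘ 1ℚ        ≃⟨ ℚₚ.toℚᵘ-homo-+ (toℚ m) 1ℚ ⟨
    ℚ.toℚᵘ (toℚ m ℚ.+ 1ℚ)                ∎)
    where
    open ℚᵘₚ.≤-Reasoning
    lem : ℤ.+ suc m ≡ ℤ.+ m ℤ.* ℤ.+ 1 ℤ.+ ℤ.+ 1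
    lem = trans (cong ℤ.+_ (ℕₚ.+-comm 1 m))
                (cong (ℤ._+ ℤ.+ 1) (sym (ℤₚ.*-identityʳ (ℤ.+ m))))

  toℚ-mono : ∀ {m n} → m ℕ.≤ n → toℚ m ℚ.≤ toℚ n
  toℚ-mono {m} {n} m≤n = ℚₚ.toℚᵘ-cancel-≤ (begin
    ℚ.toℚᵘ (toℚ m)   ≃⟨ toℚᵘ-/ (ℤ.+ m) 1 ⟩
    ℤ.+ m ℚᵘ./ 1     ≤⟨ ℚᵘ.*≤* (ℤₚ.*-monoʳ-≤-nonNeg (ℤ.+ 1) (ℤ.+≤+ m≤n)) ⟩
    ℤ.+ n ℚᵘ./ 1     ≃⟨ toℚᵘ-/ (ℤ.+ n) 1 ⟨
    ℚ.toℚᵘ (toℚ n)   ∎)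
    where open ℚᵘₚ.≤-Reasoning

  /suc : ∀ q n → ℤ.+ q ℚ./ suc n ≡ toℚ q ℚ.* 1/suc n
  /suc q n = ℚₚ.toℚᵘ-injective (begin-equality
    ℚ.toℚᵘ (ℤ.+ q ℚ./ suc n)                 ≃⟨ toℚᵘ-/ (ℤ.+ q) (suc n) ⟩
    ℤ.+ q ℚᵘ./ suc n                         ≃⟨ ℚᵘ.*≡* lem ⟩
    (ℤ.+ q ℚᵘ./ 1) ℚᵘ.* (ℤ.+ 1 ℚᵘ./ suc n)   ≃⟨ ℚᵘₚ.*-cong (toℚᵘ-/ (ℤ.+ q) 1) (toℚᵘ-/ (ℤ.+ 1) (suc n)) ⟨
    ℚ.toℚᵘ (toℚ q) ℚᵘ.* ℚ.toℚᵘ (1/suc n)     ≃⟨ ℚₚ.toℚᵘ-homo-* (toℚ q) (1/suc n) ⟨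
    ℚ.toℚᵘ (toℚ q ℚ.* 1/suc n)               ∎)
    where
    open ℚᵘₚ.≤-Reasoning
    lem : ℤ.+ q ℤ.* ℤ.+ suc (n ℕ.+ 0) ≡ ℤ.+ q ℤ.* ℤ.+ 1 ℤ.* ℤ.+ suc n
    lem = cong₂ ℤ._*_ (sym (ℤₚ.*-identityʳ (ℤ.+ q)))
                      (cong (ℤ.+_ ∘ suc) (ℕₚ.+-identityʳ n))

  suc*1/suc : ∀ n → toℚ (suc n) ℚ.* 1/suc n ≡ 1ℚ
  suc*1/suc n = trans (sym (/suc (suc n) n)) (ℚₚ.toℚᵘ-injective (begin-equality
    ℚ.toℚᵘ (ℤ.+ suc n ℚ./ suc n)   ≃⟨ toℚᵘ-/ (ℤ.+ suc n) (suc n) ⟩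
    ℤ.+ suc n ℚᵘ./ suc n           ≃⟨ ℚᵘ.*≡* (ℤₚ.*-comm (ℤ.+ suc n) (ℤ.+ 1)) ⟩
    ℚᵘ.1ℚᵘ                         ∎))
    where open ℚᵘₚ.≤-Reasoning

  1/suc-antimono : ∀ {m n} → m ℕ.≤ n → 1/suc n ℚ.≤ 1/suc m
  1/suc-antimono {m} {n} m≤n = ℚₚ.toℚᵘ-cancel-≤ (begin
    ℚ.toℚᵘ (1/suc n)   ≃⟨ toℚᵘ-/ (ℤ.+ 1) (suc n) ⟩
    ℤ.+ 1 ℚᵘ./ suc n   ≤⟨ ℚᵘ.*≤* (ℤₚ.*-monoˡ-≤-nonNeg (ℤ.+ 1) (ℤ.+≤+ (ℕ.s≤s m≤n))) ⟩
    ℤ.+ 1 ℚᵘ./ suc m   ≃⟨ toℚᵘ-/ (ℤ.+ 1) (suc m) ⟨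
    ℚ.toℚᵘ (1/suc m)   ∎)
    where open ℚᵘₚ.≤-Reasoning

  0<1/suc : ∀ n → 0ℚ ℚ.< 1/suc n
  0<1/suc n = ℚₚ.positive⁻¹ (1/suc n) {{ℚₚ.normalize-pos 1 (suc n)}}

  archimedean : ∀ ε → 0ℚ ℚ.< ε → ∃[ N ] 1/suc N ℚ.≤ ε
  archimedean ε@(ℚ.mkℚ (ℤ.+ 0) d _) 0<ε = ⊥-elim (ℕₚ.n≮n 0 (ℤₚ.drop‿+<+
    (subst (ℤ._< ℤ.+ 0) refl (ℚₚ.drop-*<* 0<ε))))
  archimedean ε@(ℚ.mkℚ ℤ.-[1+ n ] d _) 0<ε with ℚₚ.drop-*<* 0<ε
  ... | ()
  archimedean ε@(ℚ.mkℚ ℤ.+[1+ a ] d _) 0<ε = d , ℚₚ.toℚᵘ-cancel-≤ (begin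
    ℚ.toℚᵘ (1/suc d)     ≃⟨ toℚᵘ-/ (ℤ.+ 1) (suc d) ⟩
    ℤ.+ 1 ℚᵘ./ suc d     ≤⟨ ℚᵘ.*≤* (ℤₚ.*-monoʳ-≤-nonNeg (ℤ.+ suc d) (ℤ.+≤+ (ℕ.s≤s (ℕ.z≤n {a})))) ⟩
    ℚᵘ.mkℚᵘ ℤ.+[1+ a ] d ∎)
    where open ℚᵘₚ.≤-Reasoning

  floor-bounds : ∀ x → 0ℚ ℚ.≤ x →
    let m = ℤ.∣ ℚ.floor x ∣ in toℚ m ℚ.≤ x × x ℚ.≤ toℚ (suc m)
  floor-bounds (ℚ.mkℚ ℤ.-[1+ _ ] _ _) 0≤x with ℚₚ.drop-*≤* 0≤x
  ... | ()
  floor-bounds x@(ℚ.mkℚ (ℤ.+ a) d _) 0≤x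
    rewrite cong ℤ.∣_∣ (ℤₚ.*-identityˡ (ℤ.+ (a ℕ./ suc d))) = lower , upper
    where
    open ℚᵘₚ.≤-Reasoning
    D = suc d
    m = a ℕ./ D
    lower : toℚ m ℚ.≤ x
    lower = ℚₚ.toℚᵘ-cancel-≤ (begin
      ℚ.toℚᵘ (toℚ m)      ≃⟨ toℚᵘ-/ (ℤ.+ m) 1 ⟩
      ℤ.+ m ℚᵘ./ 1        ≤⟨ ℚᵘ.*≤* (subst₂ ℤ._≤_ (ℤₚ.pos-* m D) (sym (ℤₚ.*-identityʳ (ℤ.+ a)))
                               (ℤ.+≤+ (ℕ.m/n*n≤m a D))) ⟩
      ℚᵘ.mkℚᵘ (ℤ.+ a) d   ∎)
    a≤ : a ℕ.≤ suc m ℕ.* D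
    a≤ = ℕₚ.≤-trans (ℕₚ.≤-reflexive (ℕ.m≡m%n+[m/n]*n a D))
                    (ℕₚ.+-monoˡ-≤ (m ℕ.* D) (ℕₚ.<⇒≤ (ℕ.m%n<n a D)))
    upper : x ℚ.≤ toℚ (suc m)
    upper = ℚₚ.toℚᵘ-cancel-≤ (begin
      ℚᵘ.mkℚᵘ (ℤ.+ a) d      ≤⟨ ℚᵘ.*≤* (subst₂ ℤ._≤_ (sym (ℤₚ.*-identityʳ (ℤ.+ a))) (ℤₚ.pos-* (suc m) D)
                                 (ℤ.+≤+ a≤)) ⟩
      ℤ.+ suc m ℚᵘ./ 1       ≃⟨ toℚᵘ-/ (ℤ.+ suc m) 1 ⟨
      ℚ.toℚᵘ (toℚ (suc m))   ∎)

  isqrt-lower : ∀ m → isqrt m ℕ.* isqrt m ℕ.≤ m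
  isqrt-lower zero = ℕ.z≤n
  isqrt-lower (suc m) with suc (isqrt m) ℕ.* suc (isqrt m) ℕₚ.≤? suc m
  ... | yes le = le
  ... | no _   = ℕₚ.m≤n⇒m≤1+n (isqrt-lower m)

  isqrt-upper : ∀ m → suc m ℕ.≤ suc (isqrt m) ℕ.* suc (isqrt m)
  isqrt-upper zero = ℕ.s≤s ℕ.z≤n
  isqrt-upper (suc m) with suc (isqrt m) ℕ.* suc (isqrt m) ℕₚ.≤? suc m
  ... | yes _ = ℕₚ.≤-<-trans (isqrt-upper m)
                  (ℕₚ.*-mono-< (ℕₚ.n<1+n (suc (isqrt m))) (ℕₚ.n<1+n (suc (isqrt m))))
  ... | no gt = ℕₚ.≰⇒> gt

  nn : ∀ {x} → 0ℚ ℚ.≤ x → ℚ.NonNegative x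
  nn = ℚ.nonNegative

  *-mono : ∀ {a b x y} → 0ℚ ℚ.≤ a → 0ℚ ℚ.≤ y → a ℚ.≤ b → x ℚ.≤ y → a ℚ.* x ℚ.≤ b ℚ.* y
  *-mono {a} {b} {x} {y} 0≤a 0≤y a≤b x≤y = ℚₚ.≤-trans
    (ℚₚ.*-monoˡ-≤-nonNeg a {{nn 0≤a}} x≤y)
    (ℚₚ.*-monoʳ-≤-nonNeg y {{nn 0≤y}} a≤b)

  0≤toℚ : ∀ n → 0ℚ ℚ.≤ toℚ n
  0≤toℚ n = toℚ-mono {0} {n} ℕ.z≤n

  0≤* : ∀ {x y} → 0ℚ ℚ.≤ x → 0ℚ ℚ.≤ y → 0ℚ ℚ.≤ x ℚ.* y
  0≤* {x} {y} 0≤x 0≤y = subst (ℚ._≤ x ℚ.* y) (ℚₚ.*-zeroʳ x)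
    (ℚₚ.*-monoˡ-≤-nonNeg x {{nn 0≤x}} 0≤y)

  0<* : ∀ {x y} → 0ℚ ℚ.< x → 0ℚ ℚ.< y → 0ℚ ℚ.< x ℚ.* y
  0<* {x} {y} 0<x 0<y = subst (ℚ._< x ℚ.* y) (ℚₚ.*-zeroʳ x)
    (ℚₚ.*-monoʳ-<-pos x {{ℚ.positive 0<x}} 0<y)

  sqrtApprox-bounds : ∀ n x → let s = sqrtApprox n x ; δ = 1/suc n in
    0ℚ ℚ.≤ s × s ℚ.* s ℚ.≤ x ℚ.⊔ 0ℚ × x ℚ.⊔ 0ℚ ℚ.≤ (s ℚ.+ δ) ℚ.* (s ℚ.+ δ)
  sqrtApprox-bounds n x =
      subst (0ℚ ℚ.≤_) (sym s≡) (0≤* (0≤toℚ q) (ℚₚ.<⇒≤ (0<1/suc n)))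
    , (begin
        s ℚ.* s                         ≡⟨ cong₂ ℚ._*_ s≡ s≡ ⟩
        toℚ q ℚ.* δ ℚ.* (toℚ q ℚ.* δ)   ≡⟨ swap (toℚ q) ⟩
        toℚ q ℚ.* toℚ q ℚ.* (δ ℚ.* δ)   ≤⟨ ℚₚ.*-monoʳ-≤-nonNeg (δ ℚ.* δ) {{nn 0≤δδ}} q²≤ ⟩
        y ℚ.* (k ℚ.* k) ℚ.* (δ ℚ.* δ)   ≡⟨ cancel ⟩
        y                               ∎)
    , (begin
        y                               ≡⟨ cancel ⟨
        y ℚ.* (k ℚ.* k) ℚ.* (δ ℚ.* δ)   ≤⟨ ℚₚ.*-monoʳ-≤-nonNeg (δ ℚ.* δ) {{nn 0≤δδ}} ≤q² ⟩
        toℚ (suc q) ℚ.* toℚ (suc q) ℚ.* (δ ℚ.* δ)       ≡⟨ swap (toℚ (suc q)) ⟨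
        toℚ (suc q) ℚ.* δ ℚ.* (toℚ (suc q) ℚ.* δ)       ≡⟨ cong₂ ℚ._*_ s+δ≡ s+δ≡ ⟨
        (s ℚ.+ δ) ℚ.* (s ℚ.+ δ)                         ∎)
    where
    open ℚₚ.≤-Reasoning
    open +-*-Solver
    δ = 1/suc n
    k = toℚ (suc n)
    y = x ℚ.⊔ 0ℚ
    a = y ℚ.* (k ℚ.* k)
    m = ℤ.∣ ℚ.floor a ∣
    q = isqrt m
    s = sqrtApprox n x
    s≡ : s ≡ toℚ q ℚ.* δ
    s≡ = /suc q n
    s+δ≡ : s ℚ.+ δ ≡ toℚ (suc q) ℚ.* δ
    s+δ≡ = trans (cong (ℚ._+ δ) s≡) (trans
      (solve 2 (λ u d → u :* d :+ d := (u :+ con 1ℚ) :* d) refl (toℚ q) δ)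
      (cong (ℚ._* δ) (sym (toℚ-suc q))))
    swap : ∀ u → u ℚ.* δ ℚ.* (u ℚ.* δ) ≡ u ℚ.* u ℚ.* (δ ℚ.* δ)
    swap u = solve 2 (λ u d → u :* d :* (u :* d) := u :* u :* (d :* d)) refl u δ
    0≤a : 0ℚ ℚ.≤ a
    0≤a = 0≤* (ℚₚ.p≤q⊔p x 0ℚ) (0≤* (0≤toℚ (suc n)) (0≤toℚ (suc n)))
    0≤δδ : 0ℚ ℚ.≤ δ ℚ.* δ
    0≤δδ = 0≤* (ℚₚ.<⇒≤ (0<1/suc n)) (ℚₚ.<⇒≤ (0<1/suc n))
    cancel : y ℚ.* (k ℚ.* k) ℚ.* (δ ℚ.* δ) ≡ y
    cancel = trans
      (solve 3 (λ y k d → y :* (k :* k) :* (d :* d) := y :* ((k :* d) :* (k :* d))) refl y k δ)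
      (trans (cong (λ t → y ℚ.* (t ℚ.* t)) (suc*1/suc n)) (ℚₚ.*-identityʳ y))
    q²≤ : toℚ q ℚ.* toℚ q ℚ.≤ a
    q²≤ = begin
      toℚ q ℚ.* toℚ q   ≡⟨ toℚ-* q q ⟨
      toℚ (q ℕ.* q)     ≤⟨ toℚ-mono (isqrt-lower m) ⟩
      toℚ m             ≤⟨ proj₁ (floor-bounds a 0≤a) ⟩
      a                 ∎
    ≤q² : a ℚ.≤ toℚ (suc q) ℚ.* toℚ (suc q)
    ≤q² = begin
      a                             ≤⟨ proj₂ (floor-bounds a 0≤a) ⟩
      toℚ (suc m)                   ≤⟨ toℚ-mono (isqrt-upper m) ⟩
      toℚ (suc q ℕ.* suc q)         ≡⟨ toℚ-* (suc q) (suc q) ⟩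
      toℚ (suc q) ℚ.* toℚ (suc q)   ∎

  ∣∣≤⇒≤+ : ∀ {a b ε} → ℚ.∣ a ℚ.- b ∣ ℚ.≤ ε → a ℚ.≤ b ℚ.+ ε
  ∣∣≤⇒≤+ {a} {b} {ε} h = begin
    a                  ≡⟨ solve 2 (λ a b → a := b :+ (a :- b)) refl a b ⟩
    b ℚ.+ (a ℚ.- b)    ≤⟨ ℚₚ.+-monoʳ-≤ b (x≤∣x∣ (a ℚ.- b)) ⟩
    b ℚ.+ ℚ.∣ a ℚ.- b ∣ ≤⟨ ℚₚ.+-monoʳ-≤ b h ⟩
    b ℚ.+ ε            ∎
    where
    open ℚₚ.≤-Reasoning
    open +-*-Solver
    x≤∣x∣ : ∀ x → x ℚ.≤ ℚ.∣ x ∣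
    x≤∣x∣ x with ℚₚ.≤-total 0ℚ x
    ... | inj₁ 0≤x = ≡⇒≤ (sym (ℚₚ.0≤p⇒∣p∣≡p 0≤x))
    ... | inj₂ x≤0 = ℚₚ.≤-trans x≤0 (ℚₚ.0≤∣p∣ x)

  ≤+⇒∣∣≤ : ∀ {a b ε} → a ℚ.≤ b ℚ.+ ε → b ℚ.≤ a ℚ.+ ε → ℚ.∣ a ℚ.- b ∣ ℚ.≤ ε
  ≤+⇒∣∣≤ {a} {b} {ε} h h′ with ℚₚ.∣p∣≡p∨∣p∣≡-p (a ℚ.- b)
  ... | inj₁ eq = begin
    ℚ.∣ a ℚ.- b ∣     ≡⟨ eq ⟩
    a ℚ.- b           ≤⟨ ℚₚ.+-monoˡ-≤ (ℚ.- b) h ⟩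
    b ℚ.+ ε ℚ.- b     ≡⟨ solve 2 (λ b e → b :+ e :- b := e) refl b ε ⟩
    ε                 ∎
    where
    open ℚₚ.≤-Reasoning
    open +-*-Solver
  ... | inj₂ eq = begin
    ℚ.∣ a ℚ.- b ∣     ≡⟨ eq ⟩
    ℚ.- (a ℚ.- b)     ≡⟨ solve 2 (λ a b → :- (a :- b) := b :- a) refl a b ⟩
    b ℚ.- a           ≤⟨ ℚₚ.+-monoˡ-≤ (ℚ.- a) h′ ⟩
    a ℚ.+ ε ℚ.- a     ≡⟨ solve 2 (λ b e → b :+ e :- b := e) refl a ε ⟩
    ε                 ∎
    where
    open ℚₚ.≤-Reasoning
    open +-*-Solver

  ∣∣-sym : ∀ a b → ℚ.∣ a ℚ.- b ∣ ≡ ℚ.∣ b ℚ.- a ∣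
  ∣∣-sym a b = trans
    (cong ℚ.∣_∣ (solve 2 (λ a b → a :- b := :- (b :- a)) refl a b)) (ℚₚ.∣-p∣≡∣p∣ (b ℚ.- a))
    where open +-*-Solver

  0<½ : 0ℚ ℚ.< ½
  0<½ = ℚₚ.positive⁻¹ ½

  ½+½ : ∀ ε → ½ ℚ.* ε ℚ.+ ½ ℚ.* ε ≡ ε
  ½+½ ε = trans (sym (ℚₚ.*-distribʳ-+ ε ½ ½)) (ℚₚ.*-identityˡ ε)

  max-≤ˡ : ∀ {m n k} → m ℕ.⊔ n ℕ.≤ k → m ℕ.≤ k
  max-≤ˡ {m} {n} = ℕₚ.≤-trans (ℕₚ.m≤m⊔n m n)

  max-≤ʳ : ∀ {m n k} → m ℕ.⊔ n ℕ.≤ k → n ℕ.≤ k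
  max-≤ʳ {m} {n} = ℕₚ.≤-trans (ℕₚ.m≤n⊔m m n)

  -- If t approximates √b from below within η ≤ δ and a ≤ b + δ², then
  -- any s with s² ≤ a satisfies s ≤ t + (δ + δ).
  sqrt-step : ∀ {a b s t η δ} → 0ℚ ℚ.≤ t → 0ℚ ℚ.≤ η → η ℚ.≤ δ → 0ℚ ℚ.< δ →
    s ℚ.* s ℚ.≤ a → b ℚ.≤ (t ℚ.+ η) ℚ.* (t ℚ.+ η) → a ℚ.≤ b ℚ.+ δ ℚ.* δ →
    s ℚ.≤ t ℚ.+ (δ ℚ.+ δ)
  sqrt-step {a} {b} {s} {t} {η} {δ} 0≤t 0≤η η≤δ 0<δ ss≤a b≤ a≤ = ℚₚ.≮⇒≥ λ lt →
    let u     = t ℚ.+ (δ ℚ.+ δ)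
        0<u   = ℚₚ.<-≤-trans (ℚₚ.+-mono-< 0<δ 0<δ) (≤+ʳ 0≤t)
        uu<ss = ℚₚ.<-trans (ℚₚ.*-monoʳ-<-pos u {{ℚ.positive 0<u}} lt)
                           (ℚₚ.*-monoˡ-<-pos s {{ℚ.positive (ℚₚ.<-trans 0<u lt)}} lt)
    in ℚₚ.<-irrefl refl (begin-strict
      s ℚ.* s                                     ≤⟨ ss≤a ⟩
      a                                           ≤⟨ a≤ ⟩
      b ℚ.+ δ ℚ.* δ                               ≤⟨ ℚₚ.+-monoˡ-≤ (δ ℚ.* δ) b≤ ⟩
      (t ℚ.+ η) ℚ.* (t ℚ.+ η) ℚ.+ δ ℚ.* δ         ≤⟨ ℚₚ.+-monoˡ-≤ (δ ℚ.* δ)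
        (*-mono (0≤+ 0≤t 0≤η) (0≤+ 0≤t 0≤δ) (ℚₚ.+-monoʳ-≤ t η≤δ) (ℚₚ.+-monoʳ-≤ t η≤δ)) ⟩
      (t ℚ.+ δ) ℚ.* (t ℚ.+ δ) ℚ.+ δ ℚ.* δ         ≤⟨ ≤+ˡ (0≤+ (0≤* 0≤δ 0≤δ) (0≤+ (0≤* 0≤δ 0≤δ) (0≤+ (0≤* 0≤t 0≤δ) (0≤* 0≤t 0≤δ)))) ⟩
      (t ℚ.+ δ) ℚ.* (t ℚ.+ δ) ℚ.+ δ ℚ.* δ ℚ.+
        (δ ℚ.* δ ℚ.+ (δ ℚ.* δ ℚ.+ (t ℚ.* δ ℚ.+ t ℚ.* δ)))
                                                  ≡⟨ solve 2 (λ t d →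
        (t :+ d) :* (t :+ d) :+ d :* d :+ (d :* d :+ (d :* d :+ (t :* d :+ t :* d)))
          := (t :+ (d :+ d)) :* (t :+ (d :+ d))) refl t δ ⟩
      u ℚ.* u                                     <⟨ uu<ss ⟩
      s ℚ.* s                                     ∎)
    where
    open ℚₚ.≤-Reasoning
    open +-*-Solver
    0≤δ = ℚₚ.<⇒≤ 0<δ
    0≤+ : ∀ {x y} → 0ℚ ℚ.≤ x → 0ℚ ℚ.≤ y → 0ℚ ℚ.≤ x ℚ.+ y
    0≤+ = ℚₚ.+-mono-≤
    ≤+ʳ : ∀ {x y} → 0ℚ ℚ.≤ x → y ℚ.≤ x ℚ.+ y
    ≤+ʳ {x} {y} 0≤x = subst (ℚ._≤ x ℚ.+ y) (ℚₚ.+-identityˡ y) (ℚₚ.+-monoˡ-≤ y 0≤x)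
    ≤+ˡ : ∀ {x y} → 0ℚ ℚ.≤ y → x ℚ.≤ x ℚ.+ y
    ≤+ˡ {x} {y} 0≤y = subst (ℚ._≤ x ℚ.+ y) (ℚₚ.+-identityʳ x) (ℚₚ.+-monoʳ-≤ x 0≤y)

  ⊔0-step : ∀ {a b ε} → 0ℚ ℚ.≤ ε → a ℚ.≤ b ℚ.+ ε → a ℚ.⊔ 0ℚ ℚ.≤ (b ℚ.⊔ 0ℚ) ℚ.+ ε
  ⊔0-step {a} {b} {ε} 0≤ε h = ℚₚ.⊔-lub
    (ℚₚ.≤-trans h (ℚₚ.+-monoˡ-≤ ε (ℚₚ.p≤p⊔q b 0ℚ)))
    (ℚₚ.+-mono-≤ (ℚₚ.p≤q⊔p b 0ℚ) 0≤ε)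

  bound : ∀ x → ∃[ K ] (0ℚ ℚ.< K × ∃[ N ] (∀ n → N ℕ.≤ n → ℚ.∣ seq x n ∣ ℚ.≤ K))
  bound x with cauchy x 1ℚ (ℚₚ.positive⁻¹ 1ℚ)
  ... | N , h = ℚ.∣ seq x N ∣ ℚ.+ 1ℚ
    , ℚₚ.+-mono-≤-< (ℚₚ.0≤∣p∣ (seq x N)) (ℚₚ.positive⁻¹ 1ℚ)
    , N , λ n N≤n → begin
      ℚ.∣ seq x n ∣
        ≡⟨ cong ℚ.∣_∣ (solve 2 (λ a b → a := b :+ (a :- b)) refl (seq x n) (seq x N)) ⟩
      ℚ.∣ seq x N ℚ.+ (seq x n ℚ.- seq x N) ∣
        ≤⟨ ℚₚ.∣p+q∣≤∣p∣+∣q∣ (seq x N) (seq x n ℚ.- seq x N) ⟩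
      ℚ.∣ seq x N ∣ ℚ.+ ℚ.∣ seq x n ℚ.- seq x N ∣
        ≤⟨ ℚₚ.+-monoʳ-≤ ℚ.∣ seq x N ∣ (h n N N≤n ℕₚ.≤-refl) ⟩
      ℚ.∣ seq x N ∣ ℚ.+ 1ℚ ∎
    where
    open ℚₚ.≤-Reasoning
    open +-*-Solver

  divide : ∀ ε K → 0ℚ ℚ.< ε → 0ℚ ℚ.< K → ∃[ δ ] (0ℚ ℚ.< δ × K ℚ.* δ ≡ ε)
  divide ε K 0<ε 0<K = ε ℚ.* 1/K
    , 0<* 0<ε (ℚₚ.positive⁻¹ 1/K {{ℚₚ.1/pos⇒pos K {{ℚ.positive 0<K}}}})
    , (begin-equality
       K ℚ.* (ε ℚ.* 1/K)   ≡⟨ solve 3 (λ k e i → k :* (e :* i) := e :* (k :* i)) refl K ε 1/K ⟩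
       ε ℚ.* (K ℚ.* 1/K)   ≡⟨ cong (ε ℚ.*_) (ℚₚ.*-inverseʳ K {{nz}}) ⟩
       ε ℚ.* 1ℚ            ≡⟨ ℚₚ.*-identityʳ ε ⟩
       ε                   ∎)
    where
    open ℚₚ.≤-Reasoning
    open +-*-Solver
    nz = ℚₚ.pos⇒nonZero K {{ℚ.positive 0<K}}
    1/K = (ℚ.1/ K) {{nz}}

open RealLemmas

infix  8 -ᴿ_
infixl 7 _*ᴿ_
infixl 6 _+ᴿ_ _-ᴿ_

fromℚ : ℚ → ℝ
fromℚ q = mkℝ (λ _ → q) λ ε 0<ε →
  0 , λ _ _ _ _ → subst (ℚ._≤ ε) (sym (cong ℚ.∣_∣ (ℚₚ.+-inverseʳ q))) (ℚₚ.<⇒≤ 0<ε)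

_+ᴿ_ : ℝ → ℝ → ℝ
x +ᴿ y = mkℝ (λ n → seq x n ℚ.+ seq y n) λ ε 0<ε →
  let M , hx = cauchy x (½ ℚ.* ε) (0<* 0<½ 0<ε)
      N , hy = cauchy y (½ ℚ.* ε) (0<* 0<½ 0<ε)
  in M ℕ.⊔ N , λ m n p q → begin
    ℚ.∣ seq x m ℚ.+ seq y m ℚ.- (seq x n ℚ.+ seq y n) ∣
      ≡⟨ cong ℚ.∣_∣ (solve 4 (λ a b c d → a :+ b :- (c :+ d) := (a :- c) :+ (b :- d)) refl
           (seq x m) (seq y m) (seq x n) (seq y n)) ⟩
    ℚ.∣ (seq x m ℚ.- seq x n) ℚ.+ (seq y m ℚ.- seq y n) ∣
      ≤⟨ ℚₚ.∣p+q∣≤∣p∣+∣q∣ (seq x m ℚ.- seq x n) (seq y m ℚ.- seq y n) ⟩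
    ℚ.∣ seq x m ℚ.- seq x n ∣ ℚ.+ ℚ.∣ seq y m ℚ.- seq y n ∣
      ≤⟨ ℚₚ.+-mono-≤ (hx m n (max-≤ˡ p) (max-≤ˡ q)) (hy m n (max-≤ʳ {M} p) (max-≤ʳ {M} q)) ⟩
    ½ ℚ.* ε ℚ.+ ½ ℚ.* ε
      ≡⟨ ½+½ ε ⟩
    ε ∎
  where
  open ℚₚ.≤-Reasoning
  open +-*-Solver

-ᴿ_ : ℝ → ℝ
-ᴿ x = mkℝ (λ n → ℚ.- seq x n) λ ε 0<ε →
  let N , h = cauchy x ε 0<ε
  in N , λ m n p q → subst (ℚ._≤ ε)
       (trans (∣∣-sym (seq x m) (seq x n)) (cong ℚ.∣_∣
         (solve 2 (λ a b → b :- a := :- a :- :- b) refl (seq x m) (seq x n))))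
       (h m n p q)
  where open +-*-Solver

_-ᴿ_ : ℝ → ℝ → ℝ
x -ᴿ y = x +ᴿ (-ᴿ y)

_*ᴿ_ : ℝ → ℝ → ℝ
x *ᴿ y = mkℝ (λ n → seq x n ℚ.* seq y n) λ ε 0<ε →
  let K , 0<K , A , bx = bound x
      L , 0<L , B , by = bound y
      δ , 0<δ , eq     = divide ε (K ℚ.+ L) 0<ε (ℚₚ.+-mono-< 0<K 0<L)
      M , hx           = cauchy x δ 0<δ
      N , hy           = cauchy y δ 0<δ
  in (A ℕ.⊔ B) ℕ.⊔ (M ℕ.⊔ N) , λ m n p q → begin
    ℚ.∣ seq x m ℚ.* seq y m ℚ.- seq x n ℚ.* seq y n ∣
      ≡⟨ cong ℚ.∣_∣ (solve 4 (λ a b c d → a :* b :- c :* d := a :* (b :- d) :+ d :* (a :- c)) refl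
           (seq x m) (seq y m) (seq x n) (seq y n)) ⟩
    ℚ.∣ seq x m ℚ.* (seq y m ℚ.- seq y n) ℚ.+ seq y n ℚ.* (seq x m ℚ.- seq x n) ∣
      ≤⟨ ℚₚ.∣p+q∣≤∣p∣+∣q∣ (seq x m ℚ.* (seq y m ℚ.- seq y n)) (seq y n ℚ.* (seq x m ℚ.- seq x n)) ⟩
    ℚ.∣ seq x m ℚ.* (seq y m ℚ.- seq y n) ∣ ℚ.+ ℚ.∣ seq y n ℚ.* (seq x m ℚ.- seq x n) ∣
      ≡⟨ cong₂ ℚ._+_ (ℚₚ.∣p*q∣≡∣p∣*∣q∣ (seq x m) (seq y m ℚ.- seq y n))
                     (ℚₚ.∣p*q∣≡∣p∣*∣q∣ (seq y n) (seq x m ℚ.- seq x n)) ⟩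
    ℚ.∣ seq x m ∣ ℚ.* ℚ.∣ seq y m ℚ.- seq y n ∣ ℚ.+ ℚ.∣ seq y n ∣ ℚ.* ℚ.∣ seq x m ℚ.- seq x n ∣
      ≤⟨ ℚₚ.+-mono-≤
           (*-mono (ℚₚ.0≤∣p∣ (seq x m)) (ℚₚ.<⇒≤ 0<δ)
             (bx m (max-≤ˡ {A} {B} (max-≤ˡ p)))
             (hy m n (max-≤ʳ {M} {N} (max-≤ʳ {A ℕ.⊔ B} p)) (max-≤ʳ {M} {N} (max-≤ʳ {A ℕ.⊔ B} q))))
           (*-mono (ℚₚ.0≤∣p∣ (seq y n)) (ℚₚ.<⇒≤ 0<δ)
             (by n (max-≤ʳ {A} {B} (max-≤ˡ q)))
             (hx m n (max-≤ˡ {M} {N} (max-≤ʳ {A ℕ.⊔ B} p)) (max-≤ˡ {M} {N} (max-≤ʳ {A ℕ.⊔ B} q)))) ⟩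
    K ℚ.* δ ℚ.+ L ℚ.* δ
      ≡⟨ ℚₚ.*-distribʳ-+ δ K L ⟨
    (K ℚ.+ L) ℚ.* δ
      ≡⟨ eq ⟩
    ε ∎
  where
  open ℚₚ.≤-Reasoning
  open +-*-Solver

-- Agrees with the square root for x ≥ 0; extended by 0 to x < 0.
√ᴿ : ℝ → ℝ
√ᴿ x = mkℝ (λ n → sqrtApprox n (seq x n)) λ ε 0<ε →
  let δ    = ½ ℚ.* ε
      0<δ  = 0<* 0<½ 0<ε
      M , hx = cauchy x (δ ℚ.* δ) (0<* 0<δ 0<δ)
      N , hN = archimedean δ 0<δ
      step : ∀ m n → M ℕ.⊔ N ℕ.≤ m → M ℕ.⊔ N ℕ.≤ n →
             sqrtApprox m (seq x m) ℚ.≤ sqrtApprox n (seq x n) ℚ.+ ε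
      step m n p q =
        let _   , s² , _  = sqrtApprox-bounds m (seq x m)
            0≤t , _  , t² = sqrtApprox-bounds n (seq x n)
        in subst (λ e → sqrtApprox m (seq x m) ℚ.≤ sqrtApprox n (seq x n) ℚ.+ e) (½+½ ε)
             (sqrt-step 0≤t (ℚₚ.<⇒≤ (0<1/suc n))
               (ℚₚ.≤-trans (1/suc-antimono (max-≤ʳ {M} q)) hN) 0<δ s² t²
               (⊔0-step {seq x m} {seq x n} (ℚₚ.<⇒≤ (0<* 0<δ 0<δ))
                 (∣∣≤⇒≤+ {seq x m} {seq x n} (hx m n (max-≤ˡ p) (max-≤ˡ q)))))
  in M ℕ.⊔ N , λ m n p q → ≤+⇒∣∣≤ (step m n p q) (step n m q p)

------------------------------------------------------------------------
-- Complex numbers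

infixl 7 _*ᶜ_ _·ᶜ_
infixl 6 _+ᶜ_
infix  4 _≃ᶜ_

record ℂ : Set where
  constructor _+i_
  field
    re im : ℝ

open ℂ

_≃ᶜ_ : ℂ → ℂ → Set
z ≃ᶜ w = re z ≃ᴿ re w × im z ≃ᴿ im w

0ᶜ 1ᶜ : ℂ
0ᶜ = fromℚ 0ℚ +i fromℚ 0ℚ
1ᶜ = fromℚ 1ℚ +i fromℚ 0ℚ

_+ᶜ_ _*ᶜ_ : ℂ → ℂ → ℂ
z +ᶜ w = (re z +ᴿ re w) +i (im z +ᴿ im w)
z *ᶜ w = (re z *ᴿ re w -ᴿ im z *ᴿ im w) +i (re z *ᴿ im w +ᴿ im z *ᴿ re w)

_·ᶜ_ : ℝ → ℂ → ℂ
r ·ᶜ z = (r *ᴿ re z) +i (r *ᴿ im z)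

∣_∣ᶜ : ℂ → ℝ
∣ z ∣ᶜ = √ᴿ (re z *ᴿ re z +ᴿ im z *ᴿ im z)

ℂ-*-rawMonoid : RawMonoid 0ℓ 0ℓ
ℂ-*-rawMonoid = record { Carrier = ℂ ; _≈_ = _≃ᶜ_ ; _∙_ = _*ᶜ_ ; ε = 1ᶜ }

------------------------------------------------------------------------
-- Finite rings, finite fields, matrix rings

record FiniteRing c ℓ : Set (lsuc (c ⊔ ℓ)) where
  field
    ring        : Ring c ℓ
    card        : ℕ
    enumeration : Inverse (Ring.setoid ring) (≡.setoid (Fin card))
  open Ring ring public
  field
    1≉0 : ¬ 1# ≈ 0#

  _≟_ : Decidable _≈_
  _≟_ = via-injection (Inverse⇒Injection enumeration) _≟Fin_

  instance
    card-nonZero : NonZero card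
    card-nonZero = nonZeroIndex (Inverse.to enumeration 0#)

module _ (R : FiniteRing c ℓ) where
  open FiniteRing R

  IsField : Set (c ⊔ ℓ)
  IsField = (∀ x y → x * y ≈ y * x) × (∀ x → ¬ x ≈ 0# → ∃[ y ] x * y ≈ 1#)

  matrixRing : ℕ → RawRing c ℓ
  matrixRing n = record
    { Carrier = Fin n → Fin n → Carrier
    ; _≈_     = λ A B → ∀ i j → A i j ≈ B i j
    ; _+_     = λ A B i j → A i j + B i j
    ; _*_     = λ A B i j → sum λ k → A i k * B k j
    ; -_      = λ A i j → - A i j
    ; 0#      = λ _ _ → 0#
    ; 1#      = λ i j → if ⌊ i ≟Fin j ⌋ then 1# else 0#
    }
    where open RawMonoidDefs +-rawMonoid using (sum)

SmallDimension : (n d : ℕ) → Set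
SmallDimension n d =
  n ≡ 2 ⊎ (n ≡ 3 × (d ≡ 2 ⊎ d ≡ 3)) ⊎ (n ≡ 4 × d ≡ 2)

IsSmallMatrixRing : ℕ → FiniteRing c ℓ → Set (lsuc (c ⊔ ℓ))
IsSmallMatrixRing {c} {ℓ} d R =
  Σ (FiniteRing c ℓ) λ F → IsField F ×
  ∃[ n ] (SmallDimension n d ×
  ∃[ φ ] IsRingIsomorphism (FiniteRing.rawRing R) (matrixRing F n) φ)

------------------------------------------------------------------------
-- Characters, Fourier coefficients and Salem sets

module _ (R : FiniteRing c ℓ) (d : ℕ) where
  open FiniteRing R

  module Space = Ring (Pointwise.ring (Fin d) ring)

  -- A monoid homomorphism from a group to (ℂ, ·) takes invertible
  -- values, so this is the same as a homomorphism to ℂˣ.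
  IsCharacter : (Space.Carrier → ℂ) → Set (c ⊔ ℓ)
  IsCharacter = IsMonoidHomomorphism Space.+-rawMonoid ℂ-*-rawMonoid

  Nontrivial : (Space.Carrier → ℂ) → Set c
  Nontrivial ψ = ¬ (∀ x → ψ x ≃ᶜ 1ᶜ)

  -- Every element of R^d, exactly once up to ≈.
  points : List Space.Carrier
  points = List.map (λ k → Inverse.from enumeration ∘ finToFun k) (allFin (card ℕ.^ d))

  module _ {S : Pred Space.Carrier p} (S? : U.Decidable S) where

    elements : List Space.Carrier
    elements = filter S? points

    ∣R∣^-d : ℝ
    ∣R∣^-d = fromℚ ((ℤ.+ 1 ℚ./ (card ℕ.^ d)) {{ℕₚ.m^n≢0 card d}})

    fourier : (Space.Carrier → ℂ) → ℂ
    fourier ψ = ∣R∣^-d ·ᶜ foldr _+ᶜ_ 0ᶜ (List.map ψ elements)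

    IsSalem : ℝ → Set (c ⊔ ℓ)
    IsSalem C = ∀ ψ → IsCharacter ψ → Nontrivial ψ →
      ∣ fourier ψ ∣ᶜ ≤ᴿ C *ᴿ ∣R∣^-d *ᴿ √ᴿ (fromℚ (ℤ.+ length elements ℚ./ 1))

------------------------------------------------------------------------
-- Noncommutative integer polynomials in k variables

-- The empty word is the constant monomial.  The list of pairs (a , w) denotes the formal sum of the terms a·w.
Polynomial : ℕ → Set
Polynomial k = List (ℤ.ℤ × List (Fin k))

sumOfSquares : (k : ℕ) → Polynomial k
sumOfSquares k = List.map (λ i → ℤ.+ 1 , i ∷ i ∷ []) (allFin k)

module _ (R : FiniteRing c ℓ) where
  open FiniteRing R
  open RawMonoidDefs +-rawMonoid using () renaming (_×_ to _ℕ·_)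

  _ℤ·_ : ℤ.ℤ → Carrier → Carrier
  (ℤ.+ n)     ℤ· x = n ℕ· x
  ℤ.-[1+ n ]  ℤ· x = - (suc n ℕ· x)

  evaluate : ∀ {k} → Polynomial k → Vector Carrier k → Carrier
  evaluate f x = foldr _+_ 0# (List.map term f)
    where
    term : ℤ.ℤ × List _ → Carrier
    term (a , w) = a ℤ· foldr _*_ 1# (List.map x w)

  V : ∀ {k} → Polynomial k → Pred (Vector Carrier (suc k)) ℓ
  V f x = last x ≈ evaluate f (init x)

  V? : ∀ {k} (f : Polynomial k) → U.Decidable (V f)
  V? f x = last x ≟ evaluate f (init x)

------------------------------------------------------------------------
-- Sequences

TendsToInfinity : (ℕ → ℕ) → Set
TendsToInfinity u = ∀ M → ∃[ N ] (∀ i → N ℕ.≤ i → M ℕ.≤ u i)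

AllButFinitelyMany : (ℕ → Set p) → Set p
AllButFinitelyMany P = ∃[ N ] (∀ i → N ℕ.≤ i → P i)

{-# OPTIONS --safe #-}
-- The Salem hypothesis bounds the Fourier coefficients of the graph of f, and hence the second moments of the sums of
-- χ(f(x)) over cosets, for a nontrivial additive character χ.  If χ(f(x)) depends only on x modulo a subgroup H then
-- |H| is bounded by a constant B, and if it is constant on H^(d-1) then |H|² ≤ B |R|.  As f is well defined modulo
-- ideals, every proper ideal J has at most B elements; R / Ann J acts faithfully on J, so |R| ≤ |J|^|J| |Ann J|, which
-- makes a large R simple.  For an idempotent e ≠ 0 the value e f(x) e is constant on the kernel of x ↦ x e, whose order
-- is therefore at most (B |R|)^(1/2); since three orthogonal idempotents with sum 1 have kernels with product of orders
-- at least |R|², they do not exist when R is large.  So a large R has a trivial set of idempotents, and is a division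
-- ring and by Wedderburn's theorem a field, or it is M₂(D) with D a field.  If f is a sum of squares, e f(x) e is
-- invariant under translation by (1 - e) R (1 - e), which bounds |D| in the second case.
--
-- Wedderburn's theorem: in a minimal counterexample centralizers of noncentral elements are commutative.  Take r minimal
-- with a^r central for some noncentral a.  Conjugation by a has an eigenvector b, say b a = l a b, and l can be taken
-- central.  The cosets of the r-th powers of central units by the powers of a^r cover the centre, so that some k
-- commuting with a makes (k b)^r a sign.  If it is 1 then k b is a power of l and central, a contradiction; the other
-- case only arises for r = 2, where a solution of u² + v² = -1 in the centre yields a noncentral square root of 1.
module Submission where

open import Defs
open import Algebra.Bundles using (Ring; RawRing; CommutativeRing; CommutativeMonoid)
import Algebra.Definitions.RawMonoid as RawMonoidDefs
import Algebra.Morphism.RingMonomorphism as RingMono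
open import Algebra.Morphism.Structures using (IsRingMonomorphism; IsRingIsomorphism)
import Algebra.Properties.AbelianGroup as AbelianGroupProperties
import Algebra.Properties.CommutativeMonoid.Sum as MonoidSum
import Algebra.Properties.CommutativeSemigroup as CommutativeSemigroupProperties
import Algebra.Properties.Group as GroupProperties
import Algebra.Properties.Monoid.Mult as MonoidMult
import Algebra.Properties.Semiring.Exp as Exp
import Algebra.Properties.Semiring.Mult as SemiringMult
import Algebra.Properties.Semiring.Sum as Sum
import Algebra.Solver.CommutativeMonoid as CMSolver
import Algebra.Solver.Ring.NaturalCoefficients.Default as SemiringSolver
open import Algebra.Structures using (IsRing)
open import Data.Empty using (⊥; ⊥-elim)
open import Data.Fin.Base as Fin
  using (Fin; zero; suc; toℕ; fromℕ<; combine; remQuot; punchOut; finToFun; funToFin; fromℕ; inject₁)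
import Data.Fin.Properties as Finₚ
import Data.Integer.Base as ℤ
open import Data.List.Base as List using (List; []; _∷_; allFin; map; filter; foldr; tabulate; length)
open import Data.List.Membership.Propositional using (_∈_)
open import Data.List.Membership.Propositional.Properties using (∈-allFin)
open import Data.List.Relation.Unary.All as All using (All; []; _∷_)
open import Data.List.Relation.Unary.Any using (here; there)
open import Data.Nat.Base as ℕ using (ℕ; zero; suc; z≤n; s≤s; _≤_)
open import Data.Nat.Coprimality using (Coprime; coprime-Bézout; prime⇒coprime)
import Data.Nat.DivMod as ℕ
open import Data.Nat.Divisibility using (_∣_)
open import Data.Nat.GCD using (module Bézout)
open import Data.Nat.ListAction using (product)
open import Data.Nat.Primality using (Prime; prime⇒nonTrivial)
open import Data.Nat.Primality.Factorisation using (factorise; PrimeFactorisation)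
import Data.Nat.Properties as ℕₚ
import Data.Nat.Solver
open import Data.Product.Base using (∃-syntax; _×_; _,_; proj₁; proj₂; uncurry)
open import Data.Rational.Base as ℚ using (ℚ; 0ℚ; 1ℚ; ½)
import Data.Rational.Properties as ℚₚ
open import Data.Rational.Solver using (module +-*-Solver)
open import Data.Sum.Base using (_⊎_; inj₁; inj₂)
open import Data.Unit.Base using (⊤; tt)
open import Data.Vec.Base using (Vec; []; _∷_; replicate; tail)
open import Data.Vec.Functional using (init; last)
open import Data.Vec.Properties using (∷-injective)
open import Function.Base using (_∘_)
open import Function.Bundles using (Inverse)
open import Level using (0ℓ; Lift; lift; lower)
open import Relation.Binary.Definitions using (tri<; tri≈; tri>)
open import Relation.Binary.PropositionalEquality as ≡
  using (_≡_; _≢_; refl; sym; trans; cong; cong₂; subst; subst₂; module ≡-Reasoning; _≗_)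
import Relation.Binary.Reasoning.Setoid as SetoidReasoning
open import Relation.Nullary using (¬_; Dec; yes; no; contradiction)
open import Relation.Nullary.Decidable using (¬?; _×-dec_; decidable-stable)
open import Relation.Unary using (Decidable; Pred)

open ℝ
open ℂ
open RealLemmas

-- Decidable subsets of Fin n

-- Nontrivial characters have to be constructed, from roots of unity that are themselves limits of
-- rational sequences with undecidable equality. Those constructed take values in the p-th roots of
-- unity for a prime p, so every subgroup fed into the Fourier argument has to contain p A. Hence an
-- ideal is first enlarged by p A, and idempotents are treated only after simplicity, which forces p
-- A = 0. The Salem bound is uniform in the character ψ of the variables of f, provided that the
-- character χ of the last coordinate is nontrivial. So χ(f(x)) may be multiplied by any ψ and
-- averaged. Averaging over the powers of one character of order p inserts the indicator of one
-- congruence; doing so for a family that separates the points outside H leaves the congruence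
-- modulo H^(d-1), and no count of the dual group of A / H enters. The two results compare |A|^(d-1)
-- |H|^(d-1), respectively |H|^(2(d-1)), with B |A|^(d-1). Rings are carried by Fin N so that
-- quantifiers over elements are decidable and existence follows by contradiction.

record Enumeration {n} (P : Fin n → Set) : Set where
  field
    size  : ℕ
    ι     : Fin size → Fin n
    ι-inj : ∀ {i j} → ι i ≡ ι j → i ≡ j
    ι∈    : ∀ i → P (ι i)
    index : ∀ {x} → P x → Fin size
    ι-index : ∀ {x} (p : P x) → ι (index p) ≡ x

  index-inj : ∀ {x y} (p : P x) (q : P y) → index p ≡ index q → x ≡ y
  index-inj p q eq = trans (sym (ι-index p)) (trans (cong ι eq) (ι-index q))

enumerate : ∀ {n} {P : Fin n → Set} → Decidable P → Enumeration P
enumerate {zero} P? = record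
  { size = 0 ; ι = λ () ; ι-inj = λ {} ; ι∈ = λ () ; index = λ { {()} } ; ι-index = λ { {()} } }
enumerate {suc n} {P} P? with P? zero | enumerate (P? ∘ suc)
... | yes p₀ | E = record
  { size = suc size ; ι = ι′ ; ι-inj = ι′-inj ; ι∈ = ι′∈ ; index = index′ ; ι-index = ι′-index }
  where
  open Enumeration E
  ι′ : Fin (suc size) → Fin (suc n)
  ι′ zero    = zero
  ι′ (suc i) = suc (ι i)
  ι′-inj : ∀ {i j} → ι′ i ≡ ι′ j → i ≡ j
  ι′-inj {zero}  {zero}  _  = refl
  ι′-inj {suc i} {suc j} eq = cong suc (ι-inj (Finₚ.suc-injective eq))
  ι′∈ : ∀ i → P (ι′ i)
  ι′∈ zero    = p₀
  ι′∈ (suc i) = ι∈ i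
  index′ : ∀ {x} → P x → Fin (suc size)
  index′ {zero}  p = zero
  index′ {suc x} p = suc (index p)
  ι′-index : ∀ {x} (p : P x) → ι′ (index′ p) ≡ x
  ι′-index {zero}  p = refl
  ι′-index {suc x} p = cong suc (ι-index p)
... | no ¬p₀ | E = record
  { size = size ; ι = suc ∘ ι ; ι-inj = ι-inj ∘ Finₚ.suc-injective ; ι∈ = ι∈
  ; index = index′ ; ι-index = ι′-index }
  where
  open Enumeration E
  index′ : ∀ {x} → P x → Fin size
  index′ {zero}  p = contradiction p ¬p₀
  index′ {suc x} p = index p
  ι′-index : ∀ {x} (p : P x) → suc (ι (index′ p)) ≡ x
  ι′-index {zero}  p = contradiction p ¬p₀
  ι′-index {suc x} p = cong suc (ι-index p)

module _ {n} {P : Fin n → Set} (E : Enumeration P) where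
  open Enumeration E

  size-lower : ∀ {m} (f : Fin m → Fin n) → (∀ {i j} → f i ≡ f j → i ≡ j) → (∀ i → P (f i)) → m ℕ.≤ size
  size-lower f f-inj f∈ = Finₚ.injective⇒≤ {f = λ i → index (f∈ i)}
    (λ {i} {j} eq → f-inj (index-inj (f∈ i) (f∈ j) eq))

module _ {n} {P Q : Fin n → Set} (E : Enumeration P) (F : Enumeration Q) (P⊆Q : ∀ {x} → P x → Q x) where
  open Enumeration E

  size-mono : size ℕ.≤ Enumeration.size F
  size-mono = size-lower F ι ι-inj (P⊆Q ∘ ι∈)

  size-strict : ∀ {y} → Q y → ¬ P y → size ℕ.< Enumeration.size F
  size-strict {y} Qy ¬Py = size-lower F f f-inj f∈
    where
    f : Fin (suc size) → Fin _
    f zero    = y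
    f (suc i) = ι i
    f-inj : ∀ {i j} → f i ≡ f j → i ≡ j
    f-inj {zero}  {zero}  _  = refl
    f-inj {zero}  {suc j} eq = contradiction (subst P (sym eq) (ι∈ j)) ¬Py
    f-inj {suc i} {zero}  eq = contradiction (subst P eq (ι∈ i)) ¬Py
    f-inj {suc i} {suc j} eq = cong suc (ι-inj eq)
    f∈ : ∀ i → Q (f i)
    f∈ zero    = Qy
    f∈ (suc i) = P⊆Q (ι∈ i)

whole : ∀ {n} → Enumeration {n} (λ _ → ⊤)
whole {n} = record { size = n ; ι = λ i → i ; ι-inj = λ eq → eq ; ι∈ = λ _ → tt
                   ; index = λ {x} _ → x ; ι-index = λ _ → refl }

size<n : ∀ {n} {P : Fin n → Set} (E : Enumeration P) {y} → ¬ P y → Enumeration.size E ℕ.< n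
size<n E ¬Py = size-strict E whole (λ _ → tt) tt ¬Py

≤-product : ∀ {a b c} (f : Fin a → Fin b) (g : Fin a → Fin c) →
            (∀ {i j} → f i ≡ f j → g i ≡ g j → i ≡ j) → a ℕ.≤ b ℕ.* c
≤-product f g inj = Finₚ.injective⇒≤ {f = λ i → Fin.combine (f i) (g i)} λ {i} {j} eq →
  inj (Finₚ.combine-injectiveˡ (f i) (g i) (f j) (g j) eq)
      (Finₚ.combine-injectiveʳ (f i) (g i) (f j) (g j) eq)

product-size : ∀ {a b n} {P : Fin n → Set} (E : Enumeration P) (f : Fin a → Fin b → Fin n) →
               (∀ {i j k l} → f i j ≡ f k l → (i , j) ≡ (k , l)) → (∀ i j → P (f i j)) →
               a ℕ.* b ℕ.≤ Enumeration.size E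
product-size {a} {b} E f inj f∈ = size-lower E (λ i → uncurry f (Fin.remQuot {a} b i))
  (λ {i} {j} eq → trans (sym (Finₚ.combine-remQuot {a} b i))
    (trans (cong (uncurry Fin.combine) (inj eq)) (Finₚ.combine-remQuot {a} b j)))
  (λ i → f∈ _ _)

-- Finite rings carried by Fin N

record FinRing : Set where
  infixl 7 _*_
  infixl 6 _+_
  infix  8 -_
  field
    N   : ℕ
    _+_ : Fin N → Fin N → Fin N
    _*_ : Fin N → Fin N → Fin N
    -_  : Fin N → Fin N
    0#  : Fin N
    1#  : Fin N
    isRing : IsRing _≡_ _+_ _*_ -_ 0# 1#
    1≢0 : 1# ≢ 0#

  ring : Ring 0ℓ 0ℓ
  ring = record { isRing = isRing }

  open Ring ring public using (rawRing; _-_)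
  open IsRing isRing public
    using ( +-assoc; +-comm; +-identityˡ; +-identityʳ; -‿inverseˡ; -‿inverseʳ
          ; *-assoc; *-identityˡ; *-identityʳ; distribˡ; distribʳ; zeroˡ; zeroʳ )

-- The unit e of the subring need not be that of A.
record SubRing (A : FinRing) : Set₁ where
  open FinRing A
  field
    P   : Fin N → Set
    P?  : Decidable P
    +∈  : ∀ {x y} → P x → P y → P (x + y)
    *∈  : ∀ {x y} → P x → P y → P (x * y)
    -∈  : ∀ {x} → P x → P (- x)
    0∈  : P 0#
    e   : Fin N
    e∈  : P e
    e≢0 : e ≢ 0#
    eˡ  : ∀ {x} → P x → e * x ≡ x
    eʳ  : ∀ {x} → P x → x * e ≡ x

module SubRingAsRing {A : FinRing} (S : SubRing A) (E : Enumeration (SubRing.P S)) where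
  open FinRing A
  open SubRing S
  open Enumeration E public

  subRing : FinRing
  subRing = record
    { N   = size
    ; _+_ = λ i j → index (+∈ (ι∈ i) (ι∈ j))
    ; _*_ = λ i j → index (*∈ (ι∈ i) (ι∈ j))
    ; -_  = λ i → index (-∈ (ι∈ i))
    ; 0#  = index 0∈
    ; 1#  = index e∈
    ; isRing = isRing′
    ; 1≢0 = λ eq → e≢0 (index-inj e∈ 0∈ eq)
    }
    where
    _⊞_ = λ i j → index (+∈ (ι∈ i) (ι∈ j))
    _⊠_ = λ i j → index (*∈ (ι∈ i) (ι∈ j))
    ⊟_  = λ i → index (-∈ (ι∈ i))
    ι-⊞ : ∀ i j → ι (i ⊞ j) ≡ ι i + ι j
    ι-⊞ i j = ι-index _
    ι-⊠ : ∀ i j → ι (i ⊠ j) ≡ ι i * ι j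
    ι-⊠ i j = ι-index _
    by : ∀ {i j x y} → ι i ≡ x → ι j ≡ y → x ≡ y → i ≡ j
    by p q r = ι-inj (trans p (trans r (sym q)))
    +ˡ : ∀ i j k → ι ((i ⊞ j) ⊞ k) ≡ (ι i + ι j) + ι k
    +ˡ i j k = trans (ι-⊞ _ k) (cong (_+ ι k) (ι-⊞ i j))
    +ʳ : ∀ i j k → ι (i ⊞ (j ⊞ k)) ≡ ι i + (ι j + ι k)
    +ʳ i j k = trans (ι-⊞ i _) (cong (ι i +_) (ι-⊞ j k))
    isRing′ : IsRing _≡_ _⊞_ _⊠_ ⊟_ (index 0∈) (index e∈)
    isRing′ = record
      { +-isAbelianGroup = record
        { isGroup = record
          { isMonoid = record
            { isSemigroup = record
              { isMagma = record
                { isEquivalence = ≡.isEquivalence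
                ; ∙-cong = cong₂ _⊞_ }
              ; assoc = λ i j k → by (+ˡ i j k) (+ʳ i j k) (+-assoc _ _ _) }
            ; identity =
                (λ i → by (trans (ι-⊞ _ i) (cong (_+ ι i) (ι-index 0∈))) refl (+-identityˡ _))
              , (λ i → by (trans (ι-⊞ i _) (cong (ι i +_) (ι-index 0∈))) refl (+-identityʳ _)) }
          ; inverse =
              (λ i → by (trans (ι-⊞ _ i) (cong (_+ ι i) (ι-index _))) (ι-index 0∈) (-‿inverseˡ _))
            , (λ i → by (trans (ι-⊞ i _) (cong (ι i +_) (ι-index _))) (ι-index 0∈) (-‿inverseʳ _))
          ; ⁻¹-cong = cong ⊟_ }
        ; comm = λ i j → by (ι-⊞ i j) (ι-⊞ j i) (+-comm _ _) }
      ; *-cong = cong₂ _⊠_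
      ; *-assoc = λ i j k → by (trans (ι-⊠ _ k) (cong (_* ι k) (ι-⊠ i j)))
                               (trans (ι-⊠ i _) (cong (ι i *_) (ι-⊠ j k))) (*-assoc _ _ _)
      ; *-identity =
            (λ i → by (trans (ι-⊠ _ i) (cong (_* ι i) (ι-index e∈))) refl (eˡ (ι∈ i)))
          , (λ i → by (trans (ι-⊠ i _) (cong (ι i *_) (ι-index e∈))) refl (eʳ (ι∈ i)))
      ; distrib =
            (λ i j k → by (trans (ι-⊠ i _) (cong (ι i *_) (ι-⊞ j k)))
                          (trans (ι-⊞ _ _) (cong₂ _+_ (ι-⊠ i j) (ι-⊠ i k))) (distribˡ _ _ _))
          , (λ i j k → by (trans (ι-⊠ _ i) (cong (_* ι i) (ι-⊞ j k)))
                          (trans (ι-⊞ _ _) (cong₂ _+_ (ι-⊠ j i) (ι-⊠ k i))) (distribʳ _ _ _))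
      }

  open FinRing subRing public using () renaming (_+_ to _⊞_; _*_ to _⊠_; -_ to ⊟_)

  ι-⊞ : ∀ i j → ι (i ⊞ j) ≡ ι i + ι j
  ι-⊞ i j = ι-index _

  ι-⊠ : ∀ i j → ι (i ⊠ j) ≡ ι i * ι j
  ι-⊠ i j = ι-index _

  ι-⊟ : ∀ i → ι (⊟ i) ≡ - ι i
  ι-⊟ i = ι-index _

  ι-0 : ι (FinRing.0# subRing) ≡ 0#
  ι-0 = ι-index 0∈

  ι-1 : ι (FinRing.1# subRing) ≡ e
  ι-1 = ι-index e∈

module Transport {c ℓ} (R : FiniteRing c ℓ) where
  private module R = FiniteRing R
  open Inverse R.enumeration public
    using (to; from; to-cong; strictlyInverseˡ; strictlyInverseʳ)

  to-inj : ∀ {x y} → to x ≡ to y → x R.≈ y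
  to-inj {x} {y} eq = R.trans (R.sym (strictlyInverseʳ x))
    (R.trans (R.reflexive (cong from eq)) (strictlyInverseʳ y))

  from-inj : ∀ {i j} → from i R.≈ from j → i ≡ j
  from-inj {i} {j} eq = trans (sym (strictlyInverseˡ i)) (trans (to-cong eq) (strictlyInverseˡ j))

  -- The setoid equality of the ring becomes equality of indices, which makes every quantifier over
  -- elements decidable.
  raw : RawRing 0ℓ 0ℓ
  raw = record
    { Carrier = Fin R.card
    ; _≈_ = _≡_
    ; _+_ = λ i j → to (from i R.+ from j)
    ; _*_ = λ i j → to (from i R.* from j)
    ; -_  = λ i → to (R.- from i)
    ; 0#  = to R.0#
    ; 1#  = to R.1#
    }

  from-mono : IsRingMonomorphism raw R.rawRing from
  from-mono = record
    { isRingHomomorphism = record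
      { isSemiringHomomorphism = record
        { isNearSemiringHomomorphism = record
          { +-isMonoidHomomorphism = record
            { isMagmaHomomorphism = record
              { isRelHomomorphism = record { cong = λ eq → R.reflexive (cong from eq) }
              ; homo = λ _ _ → strictlyInverseʳ _ }
            ; ε-homo = strictlyInverseʳ _ }
          ; *-homo = λ _ _ → strictlyInverseʳ _ }
        ; 1#-homo = strictlyInverseʳ _ }
      ; -‿homo = λ _ → strictlyInverseʳ _ }
    ; injective = from-inj }

  finRing : FinRing
  finRing = record
    { N = R.card
    ; isRing = RingMono.isRing from-mono R.isRing
    ; 1≢0 = λ eq → R.1≉0 (to-inj eq)
    }

module ℕS = Data.Nat.Solver.+-*-Solver

least : {P : ℕ → Set} → Decidable P → ∀ n → P n → ∃[ m ] (P m × (∀ j → j ℕ.< m → ¬ P j))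
least P? zero p = 0 , p , λ _ ()
least {P} P? (suc n) p with P? 0
... | yes p₀ = 0 , p₀ , λ _ ()
... | no ¬p₀ with least (P? ∘ suc) n p
...   | m , pm , below = suc m , pm , λ { zero _ → ¬p₀ ; (suc j) (s≤s j<m) → below j j<m }

module RingTools (A : FinRing) where
  open FinRing A public
  open import Algebra.Properties.Semiring.Exp (Ring.semiring ring) public
    using (_^_; ^-homo-*; ^-assocʳ)
  open import Algebra.Properties.Ring ring public
    using (-‿distribˡ-*; -‿distribʳ-*; -1*x≈-x)
  open import Algebra.Properties.Group (Ring.+-group ring) public
    using () renaming ( ∙-cancelˡ to +-cancelˡ; ∙-cancelʳ to +-cancelʳ
                      ; x∙y⁻¹≈ε⇒x≈y to x-y≡0⇒x≡y; ⁻¹-involutive to -‿involutive)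
  open import Algebra.Solver.Monoid (Ring.*-monoid ring) public
    using (solve; _⊜_; _⊕_)
  open ≡-Reasoning

  infix 4 _≟_
  _≟_ : (x y : Fin N) → Dec (x ≡ y)
  _≟_ = Finₚ._≟_

  x-y+y≡x : ∀ x y → (x - y) + y ≡ x
  x-y+y≡x x y = trans (+-assoc x (- y) y) (trans (cong (x +_) (-‿inverseˡ y)) (+-identityʳ x))

  1^ : ∀ n → 1# ^ n ≡ 1#
  1^ zero    = refl
  1^ (suc n) = trans (*-identityˡ _) (1^ n)

  Comm : Fin N → Fin N → Set
  Comm x y = x * y ≡ y * x

  Comm? : ∀ x y → Dec (Comm x y)
  Comm? x y = x * y ≟ y * x

  comm-1 : ∀ x → Comm 1# x
  comm-1 x = trans (*-identityˡ x) (sym (*-identityʳ x))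

  comm-0 : ∀ x → Comm 0# x
  comm-0 x = trans (zeroˡ x) (sym (zeroʳ x))

  comm-+ : ∀ {x y z} → Comm x z → Comm y z → Comm (x + y) z
  comm-+ {x} {y} {z} p q = trans (distribʳ z x y) (trans (cong₂ _+_ p q) (sym (distribˡ z x y)))

  comm-* : ∀ {x y z} → Comm x z → Comm y z → Comm (x * y) z
  comm-* {x} {y} {z} p q = begin
    x * y * z     ≡⟨ *-assoc x y z ⟩
    x * (y * z)   ≡⟨ cong (x *_) q ⟩
    x * (z * y)   ≡⟨ *-assoc x z y ⟨
    x * z * y     ≡⟨ cong (_* y) p ⟩
    z * x * y     ≡⟨ *-assoc z x y ⟩
    z * (x * y)   ∎

  comm-- : ∀ {x z} → Comm x z → Comm (- x) z
  comm-- {x} {z} p = trans (sym (-‿distribˡ-* x z)) (trans (cong -_ p) (-‿distribʳ-* z x))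

  comm-^ : ∀ {x z} → Comm x z → ∀ n → Comm (x ^ n) z
  comm-^ p zero    = comm-1 _
  comm-^ p (suc n) = comm-* p (comm-^ p n)

  comm-inv : ∀ {x x′ z} → x * x′ ≡ 1# → x′ * x ≡ 1# → Comm x z → Comm x′ z
  comm-inv {x} {x′} {z} r l p = begin
    x′ * z               ≡⟨ *-identityʳ _ ⟨
    x′ * z * 1#          ≡⟨ cong (x′ * z *_) r ⟨
    x′ * z * (x * x′)    ≡⟨ solve 4 (λ a b c d → (a ⊕ b) ⊕ (c ⊕ d) ⊜ a ⊕ ((b ⊕ c) ⊕ d)) refl x′ z x x′ ⟩
    x′ * (z * x * x′)    ≡⟨ cong (λ u → x′ * (u * x′)) p ⟨
    x′ * (x * z * x′)    ≡⟨ solve 4 (λ a b c d → a ⊕ ((b ⊕ c) ⊕ d) ⊜ ((a ⊕ b) ⊕ c) ⊕ d) refl x′ x z x′ ⟩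
    x′ * x * z * x′      ≡⟨ cong (λ u → u * z * x′) l ⟩
    1# * z * x′          ≡⟨ cong (_* x′) (*-identityˡ z) ⟩
    z * x′               ∎

  ^-distrib-* : ∀ {x y} → Comm y x → ∀ n → (x * y) ^ n ≡ x ^ n * y ^ n
  ^-distrib-* p zero = sym (*-identityˡ 1#)
  ^-distrib-* {x} {y} p (suc n) = begin
    x * y * (x * y) ^ n        ≡⟨ cong (x * y *_) (^-distrib-* p n) ⟩
    x * y * (x ^ n * y ^ n)    ≡⟨ solve 4 (λ a b c d → (a ⊕ b) ⊕ (c ⊕ d) ⊜ a ⊕ ((b ⊕ c) ⊕ d)) refl x y (x ^ n) (y ^ n) ⟩
    x * (y * x ^ n * y ^ n)    ≡⟨ cong (λ u → x * (u * y ^ n)) (comm-^ (sym p) n) ⟨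
    x * (x ^ n * y * y ^ n)    ≡⟨ solve 4 (λ a b c d → a ⊕ ((b ⊕ c) ⊕ d) ⊜ (a ⊕ b) ⊕ (c ⊕ d)) refl x (x ^ n) y (y ^ n) ⟩
    x * x ^ n * (y * y ^ n)    ∎

  Central : Fin N → Set
  Central z = ∀ x → Comm z x

  Central? : Decidable Central
  Central? z = Finₚ.all? (λ x → Comm? z x)

  abstract
    ^-collision : ∀ x → ∃[ i ] ∃[ d ] x ^ (suc d ℕ.+ i) ≡ x ^ i
    ^-collision x with Finₚ.pigeonhole (ℕₚ.n<1+n N) (λ i → x ^ toℕ i)
    ... | i , j , i<j , eq = toℕ i , d , trans (cong (x ^_) j≡) (sym eq)
      where
      d : ℕ
      d = toℕ j ℕ.∸ suc (toℕ i)
      j≡ : suc d ℕ.+ toℕ i ≡ toℕ j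
      j≡ = trans (sym (ℕₚ.+-suc d (toℕ i))) (ℕₚ.m∸n+n≡m i<j)

  -- With x^i = x^(i+d), the power x^((i+1)d) is idempotent.
  abstract
    ^-idempotent : ∀ x → ∃[ m ] x ^ suc m * x ^ suc m ≡ x ^ suc m
    ^-idempotent x with ^-collision x
    ... | i , d , eq = d ℕ.+ i ℕ.* suc d , (begin
      x ^ M * x ^ M                       ≡⟨ ^-homo-* x M M ⟨
      x ^ (M ℕ.+ M)                       ≡⟨ cong (λ u → x ^ (M ℕ.+ u)) M≡ ⟩
      x ^ (suc i ℕ.* suc d ℕ.+ (i ℕ.+ k)) ≡⟨ shift (suc i) k ⟩
      x ^ (i ℕ.+ k)                       ≡⟨ cong (x ^_) M≡ ⟨
      x ^ M                               ∎)
      where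
      M k : ℕ
      M = suc i ℕ.* suc d
      k = suc (d ℕ.+ i ℕ.* d)
      M≡ : M ≡ i ℕ.+ k
      M≡ = ℕS.solve 2 (λ i d → (ℕS.con 1 ℕS.:+ i) ℕS.:* (ℕS.con 1 ℕS.:+ d)
                             ℕS.:= i ℕS.:+ (ℕS.con 1 ℕS.:+ (d ℕS.:+ i ℕS.:* d))) refl i d
      shift : ∀ c k → x ^ (c ℕ.* suc d ℕ.+ (i ℕ.+ k)) ≡ x ^ (i ℕ.+ k)
      shift zero    k = refl
      shift (suc c) k = begin
        x ^ (suc d ℕ.+ c ℕ.* suc d ℕ.+ (i ℕ.+ k))
          ≡⟨ cong (x ^_) (ℕS.solve 4 (λ d c i k → d ℕS.:+ c ℕS.:+ (i ℕS.:+ k)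
               ℕS.:= d ℕS.:+ i ℕS.:+ (c ℕS.:+ k)) refl (suc d) (c ℕ.* suc d) i k) ⟩
        x ^ (suc d ℕ.+ i ℕ.+ (c ℕ.* suc d ℕ.+ k))
          ≡⟨ ^-homo-* x (suc d ℕ.+ i) _ ⟩
        x ^ (suc d ℕ.+ i) * x ^ (c ℕ.* suc d ℕ.+ k)
          ≡⟨ cong (_* x ^ (c ℕ.* suc d ℕ.+ k)) eq ⟩
        x ^ i * x ^ (c ℕ.* suc d ℕ.+ k)
          ≡⟨ ^-homo-* x i _ ⟨
        x ^ (i ℕ.+ (c ℕ.* suc d ℕ.+ k))
          ≡⟨ cong (x ^_) (ℕS.solve 3 (λ c i k → i ℕS.:+ (c ℕS.:+ k) ℕS.:= c ℕS.:+ (i ℕS.:+ k))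
               refl (c ℕ.* suc d) i k) ⟩
        x ^ (c ℕ.* suc d ℕ.+ (i ℕ.+ k))
          ≡⟨ shift c k ⟩
        x ^ (i ℕ.+ k) ∎

  IsDivision : Set
  IsDivision = ∀ x → x ≢ 0# → ∃[ y ] (x * y ≡ 1# × y * x ≡ 1#)

-- Finite division rings

module DivisionRing (A : FinRing) (div : RingTools.IsDivision A) where
  open RingTools A
  open ≡-Reasoning

  abstract
    inv : ∀ {x} → x ≢ 0# → Fin N
    inv x≢0 = proj₁ (div _ x≢0)

    invʳ : ∀ {x} (p : x ≢ 0#) → x * inv p ≡ 1#
    invʳ p = proj₁ (proj₂ (div _ p))

    invˡ : ∀ {x} (p : x ≢ 0#) → inv p * x ≡ 1#
    invˡ p = proj₂ (proj₂ (div _ p))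

  cancelˡ : ∀ {x y z} → x ≢ 0# → x * y ≡ x * z → y ≡ z
  cancelˡ {x} {y} {z} p eq = begin
    y                 ≡⟨ *-identityˡ y ⟨
    1# * y            ≡⟨ cong (_* y) (invˡ p) ⟨
    inv p * x * y     ≡⟨ *-assoc _ x y ⟩
    inv p * (x * y)   ≡⟨ cong (inv p *_) eq ⟩
    inv p * (x * z)   ≡⟨ *-assoc _ x z ⟨
    inv p * x * z     ≡⟨ cong (_* z) (invˡ p) ⟩
    1# * z            ≡⟨ *-identityˡ z ⟩
    z                 ∎

  cancelʳ : ∀ {x y z} → x ≢ 0# → y * x ≡ z * x → y ≡ z
  cancelʳ {x} {y} {z} p eq = begin
    y                 ≡⟨ *-identityʳ y ⟨
    y * 1#            ≡⟨ cong (y *_) (invʳ p) ⟨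
    y * (x * inv p)   ≡⟨ *-assoc y x _ ⟨
    y * x * inv p     ≡⟨ cong (_* inv p) eq ⟩
    z * x * inv p     ≡⟨ *-assoc z x _ ⟩
    z * (x * inv p)   ≡⟨ cong (z *_) (invʳ p) ⟩
    z * 1#            ≡⟨ *-identityʳ z ⟩
    z                 ∎

  *≢0 : ∀ {x y} → x ≢ 0# → y ≢ 0# → x * y ≢ 0#
  *≢0 {x} p q eq = q (cancelˡ p (trans eq (sym (zeroʳ x))))

  ^≢0 : ∀ {x} → x ≢ 0# → ∀ n → x ^ n ≢ 0#
  ^≢0 p zero    = 1≢0
  ^≢0 p (suc n) = *≢0 p (^≢0 p n)

  inv≢0 : ∀ {x} (p : x ≢ 0#) → inv p ≢ 0#
  inv≢0 {x} p eq = 1≢0 (trans (sym (invʳ p)) (trans (cong (x *_) eq) (zeroʳ x)))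

  central-+ : ∀ {x y} → Central x → Central y → Central (x + y)
  central-+ p q z = comm-+ (p z) (q z)

  central-* : ∀ {x y} → Central x → Central y → Central (x * y)
  central-* p q z = comm-* (p z) (q z)

  central-^ : ∀ {x} → Central x → ∀ n → Central (x ^ n)
  central-^ p n z = comm-^ (p z) n

  central-inv : ∀ {x} (p : x ≢ 0#) → Central x → Central (inv p)
  central-inv p c z = comm-inv (invʳ p) (invˡ p) (c z)

  noncentral≢0 : ∀ {x} → ¬ Central x → x ≢ 0#
  noncentral≢0 nc refl = nc comm-0

  abstract
    ^-order : ∀ {x} → x ≢ 0# → ∃[ m ] x ^ suc m ≡ 1#
    ^-order {x} p with ^-idempotent x
    ... | m , e = m , cancelˡ (^≢0 p (suc m)) (trans e (sym (*-identityʳ _)))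

  inv-^ : ∀ {x} (p : x ≢ 0#) n → inv p ^ n * x ^ n ≡ 1#
  inv-^ p n = trans (sym (^-distrib-* (trans (invʳ p) (sym (invˡ p))) n))
                    (trans (cong (_^ n) (invˡ p)) (1^ n))

  -- Polynomials with coefficients on the right of the variable.

  ev : ∀ {n} → Fin N → Vec (Fin N) n → Fin N
  ev t []       = 0#
  ev t (v ∷ vs) = v + t * ev t vs

  ev-0 : ∀ t n → ev t (replicate n 0#) ≡ 0#
  ev-0 t zero    = refl
  ev-0 t (suc n) = trans (+-identityˡ _) (trans (cong (t *_) (ev-0 t n)) (zeroʳ t))

  -- Synthetic division: the coefficients of (p(t) - p(s)) / (t - s) are the values at s of the
  -- successive tails of p.
  quot : ∀ {n} → Fin N → Vec (Fin N) (suc n) → Vec (Fin N) n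
  quot s (v ∷ [])     = []
  quot s (v ∷ w ∷ ws) = ev s (w ∷ ws) ∷ quot s (w ∷ ws)

  -- This is p(t) - p(s) = (t - s) q(t) with the subtractions moved across. Since the coefficients
  -- stand to the right of the variable, only s and t have to commute.
  ev-quot : ∀ {n s t} → Comm s t → (p : Vec (Fin N) (suc n)) →
            ev t p + s * ev t (quot s p) ≡ ev s p + t * ev t (quot s p)
  ev-quot {s = s} {t} st (v ∷ []) = cong₂ _+_
    (cong (v +_) (trans (zeroʳ t) (sym (zeroʳ s)))) (trans (zeroʳ s) (sym (zeroʳ t)))
  ev-quot {s = s} {t} st (v ∷ p@(_ ∷ _)) = begin
    v + t * pt + s * (ps + t * qt)             ≡⟨ cong (v + t * pt +_) (distribˡ s ps _) ⟩
    v + t * pt + (s * ps + s * (t * qt))       ≡⟨ cong (λ u → v + t * pt + (s * ps + u)) sw ⟩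
    v + t * pt + (s * ps + t * (s * qt))       ≡⟨ +-assoc v _ _ ⟩
    v + (t * pt + (s * ps + t * (s * qt)))     ≡⟨ cong (v +_) (+-assoc (t * pt) _ _) ⟨
    v + (t * pt + s * ps + t * (s * qt))       ≡⟨ cong (λ u → v + (u + t * (s * qt))) (+-comm (t * pt) (s * ps)) ⟩
    v + (s * ps + t * pt + t * (s * qt))       ≡⟨ cong (v +_) (+-assoc (s * ps) _ _) ⟩
    v + (s * ps + (t * pt + t * (s * qt)))     ≡⟨ +-assoc v _ _ ⟨
    v + s * ps + (t * pt + t * (s * qt))       ≡⟨ cong (v + s * ps +_) (distribˡ t pt _) ⟨
    v + s * ps + t * (pt + s * qt)             ≡⟨ cong (λ u → v + s * ps + t * u) (ev-quot st p) ⟩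
    v + s * ps + t * (ps + t * qt)             ∎
    where
    pt = ev t p
    ps = ev s p
    qt = ev t (quot s p)
    sw : s * (t * qt) ≡ t * (s * qt)
    sw = trans (sym (*-assoc s t qt)) (trans (cong (_* qt) st) (*-assoc t s qt))

  -- The last entry of the quotient is the leading coefficient, and each earlier entry is a
  -- coefficient plus s times a value formed from later ones; so they vanish one after another from
  -- the top.
  quot-0 : ∀ {n} s (p : Vec (Fin N) (suc n)) → quot s p ≡ replicate n 0# → tail p ≡ replicate n 0#
  quot-0 s (v ∷ []) _ = refl
  quot-0 {suc n} s (v ∷ w ∷ ws) eq with ∷-injective eq
  ... | e₁ , e₂ = cong₂ _∷_ w≡0 ws≡0
    where
    ws≡0 : ws ≡ replicate n 0#
    ws≡0 = quot-0 s (w ∷ ws) e₂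
    w≡0 : w ≡ 0#
    w≡0 = begin
      w                ≡⟨ +-identityʳ w ⟨
      w + 0#           ≡⟨ cong (w +_) (zeroʳ s) ⟨
      w + s * 0#       ≡⟨ cong (λ u → w + s * u) (trans (cong (ev s) ws≡0) (ev-0 s n)) ⟨
      w + s * ev s ws  ≡⟨ e₁ ⟩
      0#               ∎

  -- Division at the first point s leaves a quotient that vanishes at every other point t′: with
  -- both values of p zero, the division identity reads s X = t′ X, which forces X = 0 in a division
  -- ring. The coefficients may be noncentral, as they are for the orbits of a conjugation.
  roots⇒0 : ∀ {n} (t : Fin n → Fin N) → (∀ i j → t i ≡ t j → i ≡ j) → (∀ i j → Comm (t i) (t j)) →
            (p : Vec (Fin N) n) → (∀ i → ev (t i) p ≡ 0#) → p ≡ replicate n 0#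
  roots⇒0 {zero} t inj comm [] r = refl
  roots⇒0 {suc n} t inj comm p@(v ∷ vs) r = cong₂ _∷_ v≡0 vs≡0
    where
    s = t zero
    vs≡0 : vs ≡ replicate n 0#
    vs≡0 = quot-0 s p (roots⇒0 (t ∘ suc) (λ i j eq → Finₚ.suc-injective (inj _ _ eq))
      (λ i j → comm _ _) (quot s p) root)
      where
      root : ∀ i → ev (t (suc i)) (quot s p) ≡ 0#
      root i = decidable-stable (_ ≟ _) λ X≢0 →
        Finₚ.0≢1+n (inj _ _ (cancelʳ X≢0 (+-cancelˡ 0# _ _ (begin
          0# + s * X           ≡⟨ cong (_+ s * X) (r (suc i)) ⟨
          ev t′ p + s * X      ≡⟨ ev-quot (comm zero (suc i)) p ⟩
          ev s p + t′ * X      ≡⟨ cong (_+ t′ * X) (r zero) ⟩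
          0# + t′ * X          ∎))))
        where
        t′ = t (suc i)
        X = ev t′ (quot s p)
    v≡0 : v ≡ 0#
    v≡0 = begin
      v                ≡⟨ +-identityʳ v ⟨
      v + 0#           ≡⟨ cong (v +_) (zeroʳ s) ⟨
      v + s * 0#       ≡⟨ cong (λ u → v + s * u) (trans (cong (ev s) vs≡0) (ev-0 s n)) ⟨
      v + s * ev s vs  ≡⟨ r zero ⟩
      0#               ∎

  powers-distinct : ∀ {x} → x ≢ 0# → ∀ {n} → (∀ j → 0 ℕ.< j → j ℕ.< n → x ^ j ≢ 1#) →
                    (i j : Fin n) → x ^ toℕ i ≡ x ^ toℕ j → i ≡ j
  powers-distinct {x} p {n} min i j eq = Finₚ.toℕ-injective (ℕₚ.≤-antisym
    (ℕₚ.≮⇒≥ λ lt → go j i lt (sym eq)) (ℕₚ.≮⇒≥ λ lt → go i j lt eq))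
    where
    go : (i j : Fin n) → toℕ i ℕ.< toℕ j → x ^ toℕ i ≢ x ^ toℕ j
    go i j i<j e = min (toℕ j ℕ.∸ toℕ i) (ℕₚ.m<n⇒0<n∸m i<j)
      (ℕₚ.≤-<-trans (ℕₚ.m∸n≤m (toℕ j) (toℕ i)) (Finₚ.toℕ<n j))
      (cancelˡ (^≢0 p (toℕ i)) (begin
        x ^ toℕ i * x ^ (toℕ j ℕ.∸ toℕ i)   ≡⟨ ^-homo-* x (toℕ i) _ ⟨
        x ^ (toℕ i ℕ.+ (toℕ j ℕ.∸ toℕ i))   ≡⟨ cong (x ^_) (ℕₚ.m+[n∸m]≡n (ℕₚ.<⇒≤ i<j)) ⟩
        x ^ toℕ j                           ≡⟨ e ⟨
        x ^ toℕ i                           ≡⟨ *-identityʳ _ ⟨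
        x ^ toℕ i * 1#                      ∎))

  -- Conjugation by a has an eigenvector for some eigenvalue λ = a^(-i) ≠ 1: with n the order of
  -- a, the vectors Σ_{j<n} a^{ij} c^j(y) cannot vanish for all 0 < i < n unless c(y) = y.
  module Eigenvector (a : Fin N) (a-nc : ¬ Central a) where
    a≢0 : a ≢ 0#
    a≢0 = noncentral≢0 a-nc

    a⁻ : Fin N
    a⁻ = inv a≢0

    c : Fin N → Fin N
    c x = a * x * a⁻

    c^ : ℕ → Fin N → Fin N
    c^ zero    x = x
    c^ (suc n) x = c^ n (c x)

    orbit : ∀ n → Fin N → Vec (Fin N) n
    orbit zero    x = []
    orbit (suc n) x = x ∷ orbit n (c x)

    c-+ : ∀ x y → c (x + y) ≡ c x + c y
    c-+ x y = trans (cong (_* a⁻) (distribˡ a x y)) (distribʳ a⁻ _ _)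

    c-0 : c 0# ≡ 0#
    c-0 = trans (cong (_* a⁻) (zeroʳ a)) (zeroˡ a⁻)

    c-* : ∀ {t} → Comm t a → ∀ x → c (t * x) ≡ t * c x
    c-* {t} ta x = begin
      a * (t * x) * a⁻     ≡⟨ solve 4 (λ a t x b → (a ⊕ (t ⊕ x)) ⊕ b ⊜ ((a ⊕ t) ⊕ x) ⊕ b) refl a t x a⁻ ⟩
      a * t * x * a⁻       ≡⟨ cong (λ u → u * x * a⁻) ta ⟨
      t * a * x * a⁻       ≡⟨ solve 4 (λ a t x b → ((t ⊕ a) ⊕ x) ⊕ b ⊜ t ⊕ ((a ⊕ x) ⊕ b)) refl a t x a⁻ ⟩
      t * (a * x * a⁻)     ∎

    ev-orbit-+ : ∀ t n x y → ev t (orbit n (x + y)) ≡ ev t (orbit n x) + ev t (orbit n y)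
    ev-orbit-+ t zero    x y = sym (+-identityˡ 0#)
    ev-orbit-+ t (suc n) x y = begin
      x + y + t * ev t (orbit n (c (x + y)))
        ≡⟨ cong (λ u → x + y + t * u) (trans (cong (λ w → ev t (orbit n w)) (c-+ x y)) (ev-orbit-+ t n (c x) (c y))) ⟩
      x + y + t * (X + Y)             ≡⟨ cong (x + y +_) (distribˡ t X Y) ⟩
      x + y + (t * X + t * Y)         ≡⟨ +-assoc x y _ ⟩
      x + (y + (t * X + t * Y))       ≡⟨ cong (x +_) (+-assoc y _ _) ⟨
      x + (y + t * X + t * Y)         ≡⟨ cong (λ u → x + (u + t * Y)) (+-comm y _) ⟩
      x + (t * X + y + t * Y)         ≡⟨ cong (x +_) (+-assoc _ y _) ⟩
      x + (t * X + (y + t * Y))       ≡⟨ +-assoc x _ _ ⟨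
      x + t * X + (y + t * Y)         ∎
      where
      X = ev t (orbit n (c x))
      Y = ev t (orbit n (c y))

    c-ev : ∀ {t} → Comm t a → ∀ n x → c (ev t (orbit n x)) ≡ ev t (orbit n (c x))
    c-ev ta zero    x = c-0
    c-ev {t} ta (suc n) x = trans (c-+ x _) (cong (c x +_)
      (trans (c-* ta _) (cong (t *_) (c-ev ta n (c x)))))

    -- The sum of t^j c^j(x) over j ≤ n, split once at its last and once at its first term.
    ev-orbit-snoc : ∀ t n x → ev t (orbit n x) + t ^ n * c^ n x ≡ x + t * ev t (orbit n (c x))
    ev-orbit-snoc t zero    x = trans (+-identityˡ _) (trans (*-identityˡ x)
      (sym (trans (cong (x +_) (zeroʳ t)) (+-identityʳ x))))
    ev-orbit-snoc t (suc n) x = begin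
      x + t * X + t * t ^ n * c^ n (c x)       ≡⟨ +-assoc x _ _ ⟩
      x + (t * X + t * t ^ n * c^ n (c x))     ≡⟨ cong (λ u → x + (t * X + u)) (*-assoc t _ _) ⟩
      x + (t * X + t * (t ^ n * c^ n (c x)))   ≡⟨ cong (x +_) (distribˡ t _ _) ⟨
      x + t * (X + t ^ n * c^ n (c x))         ≡⟨ cong (λ u → x + t * u) (ev-orbit-snoc t n (c x)) ⟩
      x + t * (c x + t * ev t (orbit n (c (c x)))) ∎
      where X = ev t (orbit n (c x))

    c^-conj : ∀ n x → c^ n x * a ^ n ≡ a ^ n * x
    c^-conj zero    x = trans (*-identityʳ x) (sym (*-identityˡ x))
    c^-conj (suc n) x = begin
      c^ n (c x) * (a * a ^ n)     ≡⟨ cong (c^ n (c x) *_) (comm-^ {a} {a} refl n) ⟨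
      c^ n (c x) * (a ^ n * a)     ≡⟨ *-assoc _ _ a ⟨
      c^ n (c x) * a ^ n * a       ≡⟨ cong (_* a) (c^-conj n (c x)) ⟩
      a ^ n * (a * x * a⁻) * a     ≡⟨ solve 4 (λ p a x b → (p ⊕ ((a ⊕ x) ⊕ b)) ⊕ a ⊜ ((p ⊕ a) ⊕ x) ⊕ (b ⊕ a)) refl (a ^ n) a x a⁻ ⟩
      a ^ n * a * x * (a⁻ * a)     ≡⟨ cong₂ (λ u w → u * x * w) (comm-^ {a} {a} refl n) (invˡ a≢0) ⟩
      a * a ^ n * x * 1#           ≡⟨ *-identityʳ _ ⟩
      a * a ^ n * x                ∎

    abstract
      order : ∃[ n ] ((0 ℕ.< n × a ^ n ≡ 1#) × (∀ j → j ℕ.< n → ¬ (0 ℕ.< j × a ^ j ≡ 1#)))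
      order with ^-order a≢0
      ... | m , eq = least (λ n → (0 ℕₚ.<? n) ×-dec (a ^ n ≟ 1#)) (suc m) (s≤s z≤n , eq)

    n = proj₁ order
    0<n = proj₁ (proj₁ (proj₂ order))
    aⁿ≡1 = proj₂ (proj₁ (proj₂ order))

    E : ℕ → Fin N → Fin N
    E i x = ev (a ^ i) (orbit n x)

    -- With t = a^i, applying c and multiplying by t shifts the terms of the orbit sum cyclically,
    -- because t^n = 1 and c^n is the identity.
    E-fixed : ∀ i x → a ^ i * c (E i x) ≡ E i x
    E-fixed i x = +-cancelˡ x _ _ (begin
      x + t * c (E i x)              ≡⟨ cong (λ u → x + t * u) (c-ev (comm-^ refl i) n x) ⟩
      x + t * ev t (orbit n (c x))   ≡⟨ ev-orbit-snoc t n x ⟨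
      E i x + t ^ n * c^ n x         ≡⟨ cong (E i x +_) (cong₂ _*_ tⁿ≡1 c^n) ⟩
      E i x + 1# * x                 ≡⟨ cong (E i x +_) (*-identityˡ x) ⟩
      E i x + x                      ≡⟨ +-comm _ x ⟩
      x + E i x                      ∎)
      where
      t = a ^ i
      tⁿ≡1 : t ^ n ≡ 1#
      tⁿ≡1 = trans (^-assocʳ a i n) (trans (cong (a ^_) (ℕₚ.*-comm i n))
        (trans (sym (^-assocʳ a n i)) (trans (cong (_^ i) aⁿ≡1) (1^ i))))
      c^n : c^ n x ≡ x
      c^n = trans (sym (*-identityʳ _)) (trans (cong (c^ n x *_) (sym aⁿ≡1))
        (trans (c^-conj n x) (trans (cong (_* x) aⁿ≡1) (*-identityˡ x))))

    abstract
      noncommuting : ∃[ y ] ¬ Comm a y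
      noncommuting with Finₚ.¬∀⟶∃¬ N (Comm a) (Comm? a) a-nc
      ... | y , p = y , p

    y = proj₁ noncommuting
    z = c y + - y

    z≢0 : z ≢ 0#
    z≢0 eq = proj₂ noncommuting (begin
      a * y             ≡⟨ *-identityʳ _ ⟨
      a * y * 1#        ≡⟨ cong (a * y *_) (invˡ a≢0) ⟨
      a * y * (a⁻ * a)  ≡⟨ *-assoc _ a⁻ a ⟨
      c y * a           ≡⟨ cong (_* a) (x-y≡0⇒x≡y _ _ eq) ⟩
      y * a             ∎)

    abstract
      -- Otherwise every `E i` takes equal values at c(y) and y: where a^i = 1 it is invariant under
      -- c, elsewhere it vanishes at both. The orbit of z = c(y) - y would then be the coefficients
      -- of a polynomial with n distinct roots a^i, and z would be zero.
      found : ∃[ i ] (a ^ toℕ {n} i ≢ 1# × E (toℕ i) y ≢ 0#)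
      found = decidable-stable (Finₚ.any? λ i → ¬? (a ^ toℕ i ≟ 1#) ×-dec ¬? (E (toℕ i) y ≟ 0#)) λ none →
        let vanish : ∀ i → E (toℕ {n} i) z ≡ 0#
            vanish i = begin
              E (toℕ i) (c y + - y)           ≡⟨ ev-orbit-+ _ n (c y) (- y) ⟩
              E (toℕ i) (c y) + E (toℕ i) (- y)
                ≡⟨ cong (_+ E (toℕ i) (- y)) (E-c i (decidable-stable ((a ^ toℕ i ≟ 1#) ⊎-dec′ (E (toℕ i) y ≟ 0#))
                     λ q → none (i , (λ e → q (inj₁ e)) , λ e → q (inj₂ e)))) ⟩
              E (toℕ i) y + E (toℕ i) (- y)   ≡⟨ ev-orbit-+ _ n y (- y) ⟨
              E (toℕ i) (y + - y)             ≡⟨ cong (E (toℕ i)) (-‿inverseʳ y) ⟩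
              E (toℕ i) 0#                    ≡⟨ E-0 (toℕ i) ⟩
              0#                              ∎
        in z≢0 (head0 n 0<n z (roots⇒0 (λ i → a ^ toℕ i)
             (powers-distinct a≢0 (λ j 0<j j<n e → proj₂ (proj₂ order) j j<n (0<j , e)))
             (λ i j → comm-^ (sym (comm-^ refl (toℕ j))) (toℕ i)) (orbit n z) vanish))
        where
        open import Relation.Nullary.Decidable using () renaming (_⊎-dec_ to _⊎-dec′_)
        E-0 : ∀ i → E i 0# ≡ 0#
        E-0 i = +-cancelˡ (E i 0#) _ _ (trans (sym (ev-orbit-+ _ n 0# 0#))
          (trans (cong (E i) (+-identityˡ 0#)) (sym (+-identityʳ _))))
        E-c : ∀ i → a ^ toℕ {n} i ≡ 1# ⊎ E (toℕ i) y ≡ 0# → E (toℕ i) (c y) ≡ E (toℕ i) y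
        E-c i (inj₁ e) = begin
          E (toℕ i) (c y)              ≡⟨ c-ev (comm-^ refl (toℕ i)) n y ⟨
          c (E (toℕ i) y)              ≡⟨ *-identityˡ _ ⟨
          1# * c (E (toℕ i) y)         ≡⟨ cong (_* c (E (toℕ i) y)) e ⟨
          a ^ toℕ i * c (E (toℕ i) y)  ≡⟨ E-fixed (toℕ i) y ⟩
          E (toℕ i) y                  ∎
        E-c i (inj₂ e) = begin
          E (toℕ i) (c y)   ≡⟨ c-ev (comm-^ refl (toℕ i)) n y ⟨
          c (E (toℕ i) y)   ≡⟨ cong c e ⟩
          c 0#              ≡⟨ c-0 ⟩
          0#                ≡⟨ e ⟨
          E (toℕ i) y       ∎
        head0 : ∀ n → 0 ℕ.< n → ∀ z → orbit n z ≡ replicate n 0# → z ≡ 0#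
        head0 (suc n) _ z eq = proj₁ (∷-injective eq)

    E-eigen : ∀ i x → E i x * a ≡ a ^ suc i * E i x
    E-eigen i y = begin
      x * a                      ≡⟨ cong (_* a) (E-fixed i y) ⟨
      a ^ i * (a * x * a⁻) * a   ≡⟨ solve 4 (λ p a x b → (p ⊕ ((a ⊕ x) ⊕ b)) ⊕ a ⊜ ((p ⊕ a) ⊕ x) ⊕ (b ⊕ a)) refl (a ^ i) a x a⁻ ⟩
      a ^ i * a * x * (a⁻ * a)   ≡⟨ cong₂ (λ u w → u * x * w) (comm-^ {a} {a} refl i) (invˡ a≢0) ⟩
      a * a ^ i * x * 1#         ≡⟨ *-identityʳ _ ⟩
      a * a ^ i * x              ∎
      where x = E i y

    eigenvector : ∃[ x ] ∃[ m ] (x * a ≡ a ^ m * x × ¬ Comm x a)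
    eigenvector = E (toℕ i) y , suc (toℕ i) , E-eigen (toℕ i) y , λ xa → proj₁ (proj₂ found) (cancelˡ a≢0
        (trans (cancelʳ (proj₂ (proj₂ found)) (trans (sym (E-eigen (toℕ i) y)) xa)) (sym (*-identityʳ a))))
      where
      i = proj₁ found

-- This is n(n-1)/2, the exponent collected in (k b)^n when every b is moved to the right. For odd n
-- it is a multiple of n.
triangle : ℕ → ℕ
triangle zero    = 0
triangle (suc n) = n ℕ.+ triangle n

triangle-odd : ∀ t → triangle (1 ℕ.+ t ℕ.* 2) ≡ (1 ℕ.+ t ℕ.* 2) ℕ.* t
triangle-odd zero    = refl
triangle-odd (suc t) = trans (cong (λ u → suc (suc (t ℕ.* 2)) ℕ.+ (suc (t ℕ.* 2) ℕ.+ u)) (triangle-odd t))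
  (ℕS.solve 1 (λ t → let s = t ℕS.:* ℕS.con 2 in
    ℕS.con 2 ℕS.:+ s ℕS.:+ (ℕS.con 1 ℕS.:+ s ℕS.:+ (ℕS.con 1 ℕS.:+ s) ℕS.:* t)
    ℕS.:= (ℕS.con 3 ℕS.:+ s) ℕS.:* (ℕS.con 1 ℕS.:+ t)) refl t)

parity : ∀ n → ∃[ t ] (n ≡ t ℕ.* 2 ⊎ n ≡ 1 ℕ.+ t ℕ.* 2)
parity zero = 0 , inj₁ refl
parity (suc n) with parity n
... | t , inj₁ eq = t , inj₂ (cong suc eq)
... | t , inj₂ eq = suc t , inj₁ (cong suc eq)

-- Central roots of unity and cosets of powers in the centre

module _ (A : FinRing) (div : RingTools.IsDivision A) where
  open RingTools A
  open DivisionRing A div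
  open ≡-Reasoning

  intertwine-^ : ∀ {x t t′} → x * t ≡ t′ * x → ∀ k → x * t ^ k ≡ t′ ^ k * x
  intertwine-^ {x} p zero = trans (*-identityʳ x) (sym (*-identityˡ x))
  intertwine-^ {x} {t} {t′} p (suc k) = begin
    x * (t * t ^ k)      ≡⟨ *-assoc x t _ ⟨
    x * t * t ^ k        ≡⟨ cong (_* t ^ k) p ⟩
    t′ * x * t ^ k       ≡⟨ *-assoc t′ x _ ⟩
    t′ * (x * t ^ k)     ≡⟨ cong (t′ *_) (intertwine-^ p k) ⟩
    t′ * (t′ ^ k * x)    ≡⟨ *-assoc t′ _ x ⟨
    t′ * t′ ^ k * x      ∎

  module RootsOfUnity {r l} (l-central : Central l) (l≢0 : l ≢ 0#) (lʳ≡1 : l ^ suc r ≡ 1#)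
    (l-prim : ∀ j → 0 ℕ.< j → j ℕ.< suc r → l ^ j ≢ 1#) where

    monomial : ∀ n → Vec (Fin N) (suc n)
    monomial zero    = 1# ∷ []
    monomial (suc n) = 0# ∷ monomial n

    ev-monomial : ∀ t n → ev t (monomial n) ≡ t ^ n
    ev-monomial t zero    = trans (cong (1# +_) (zeroʳ t)) (+-identityʳ 1#)
    ev-monomial t (suc n) = trans (+-identityˡ _) (cong (t *_) (ev-monomial t n))

    abstract
      -- Otherwise X^(r+1) - 1 would have r + 2 distinct commuting roots, y and the r + 1 powers of
      -- l; its constant coefficient -1 would then vanish.
      root-power : ∀ {y} → y ^ suc r ≡ 1# → ∃[ i ] y ≡ l ^ toℕ {suc r} i
      root-power {y} yʳ≡1 = decidable-stable (Finₚ.any? λ i → y ≟ l ^ toℕ i) λ none →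
        let pt : Fin (suc (suc r)) → Fin N
            pt = λ { zero → y ; (suc i) → l ^ toℕ i }
            inj : ∀ i j → pt i ≡ pt j → i ≡ j
            inj = λ { zero zero _ → refl ; zero (suc j) eq → contradiction (j , eq) none
                    ; (suc i) zero eq → contradiction (i , sym eq) none
                    ; (suc i) (suc j) eq → cong suc (powers-distinct l≢0 l-prim i j eq) }
            comm : ∀ i j → Comm (pt i) (pt j)
            comm = λ { zero zero → refl ; zero (suc j) → sym (central-^ l-central (toℕ j) y)
                     ; (suc i) j → central-^ l-central (toℕ i) (pt j) }
            ev≡0 : ∀ t → t ^ suc r ≡ 1# → ev t (- 1# ∷ monomial r) ≡ 0#
            ev≡0 t p = trans (cong (λ u → - 1# + t * u) (ev-monomial t r))
                             (trans (cong (- 1# +_) p) (-‿inverseˡ 1#))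
            root : ∀ i → ev (pt i) (- 1# ∷ monomial r) ≡ 0#
            root = λ { zero → ev≡0 y yʳ≡1 ; (suc i) → ev≡0 (l ^ toℕ i)
                       (trans (^-assocʳ l (toℕ i) (suc r)) (trans (cong (l ^_) (ℕₚ.*-comm (toℕ i) (suc r)))
                       (trans (sym (^-assocʳ l (suc r) (toℕ i))) (trans (cong (_^ toℕ i) lʳ≡1) (1^ (toℕ i)))))) }
        in 1≢0 (trans (sym (-‿involutive 1#)) (trans
             (cong -_ (proj₁ (∷-injective (roots⇒0 pt inj comm (- 1# ∷ monomial r) root))))
             (trans (sym (+-identityˡ _)) (-‿inverseʳ 0#))))

    root-central : ∀ {y} → y ^ suc r ≡ 1# → Central y
    root-central p with root-power p
    ... | i , refl = central-^ l-central (toℕ i)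

    Unit : Fin N → Set
    Unit z = Central z × z ≢ 0#

    unit-* : ∀ {x y} → Unit x → Unit y → Unit (x * y)
    unit-* (p , p′) (q , q′) = central-* p q , *≢0 p′ q′

    unit-^ : ∀ {x} → Unit x → ∀ n → Unit (x ^ n)
    unit-^ (p , p′) n = central-^ p n , ^≢0 p′ n

    unit-inv : ∀ {x} (u : Unit x) → Unit (inv (proj₂ u))
    unit-inv (p , p′) = central-inv p′ p , inv≢0 p′

    Unit? : Decidable Unit
    Unit? z = Central? z ×-dec ¬? (z ≟ 0#)

    Power : Fin N → Set
    Power h = Unit h × ∃[ g ] (Unit g × h ≡ g ^ suc r)

    Power? : Decidable Power
    Power? h = Unit? h ×-dec Finₚ.any? (λ g → Unit? g ×-dec (h ≟ g ^ suc r))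

    -- The r-th power map on central units has fibres of size at most r, so the r cosets
    -- α^j (Z*)^r, which are distinct, cover Z*.
    module Cosets {a} (αc : Central (a ^ suc r)) (a-nc : ∀ j → 0 ℕ.< j → j ℕ.< suc r → ¬ Central (a ^ j))
      (a≢0 : a ≢ 0#) (EU : Enumeration Unit) (EH : Enumeration Power) where

      private
        module U = Enumeration EU
        module H = Enumeration EH
      α = a ^ suc r

      αU : Unit α
      αU = αc , ^≢0 a≢0 (suc r)

      root-of : ∀ k → Fin N
      root-of k = proj₁ (proj₂ (H.ι∈ k))

      root-unit : ∀ k → Unit (root-of k)
      root-unit k = proj₁ (proj₂ (proj₂ (H.ι∈ k)))

      root-^ : ∀ k → H.ι k ≡ root-of k ^ suc r
      root-^ k = proj₂ (proj₂ (proj₂ (H.ι∈ k)))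

      ratio-root : ∀ {x g} (u : Unit g) → x ^ suc r ≡ g ^ suc r → (x * inv (proj₂ u)) ^ suc r ≡ 1#
      ratio-root {x} {g} u eq = begin
        (x * inv (proj₂ u)) ^ suc r           ≡⟨ ^-distrib-* (proj₁ (unit-inv u) x) (suc r) ⟩
        x ^ suc r * inv (proj₂ u) ^ suc r     ≡⟨ cong (_* inv (proj₂ u) ^ suc r) eq ⟩
        g ^ suc r * inv (proj₂ u) ^ suc r     ≡⟨ central-^ (proj₁ u) (suc r) _ ⟩
        inv (proj₂ u) ^ suc r * g ^ suc r     ≡⟨ inv-^ (proj₂ u) (suc r) ⟩
        1#                                    ∎

      undo-ratio : ∀ {x y g} (u : Unit g) → x * inv (proj₂ u) ≡ y → x ≡ y * g
      undo-ratio {x} {y} {g} (_ , g≢0) eq = begin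
        x                  ≡⟨ *-identityʳ x ⟨
        x * 1#             ≡⟨ cong (x *_) (invˡ g≢0) ⟨
        x * (inv g≢0 * g)  ≡⟨ *-assoc x (inv g≢0) g ⟨
        x * inv g≢0 * g    ≡⟨ cong (_* g) eq ⟩
        y * g              ∎

      pow∈ : ∀ i → Power (U.ι i ^ suc r)
      pow∈ i = unit-^ (U.ι∈ i) (suc r) , U.ι i , U.ι∈ i , refl

      pow : Fin U.size → Fin H.size
      pow i = H.index (pow∈ i)

      pow-root : ∀ i → U.ι i ^ suc r ≡ root-of (pow i) ^ suc r
      pow-root i = trans (sym (H.ι-index (pow∈ i))) (root-^ (pow i))

      ratio : ∀ i → ∃[ j ] U.ι i * inv (proj₂ (root-unit (pow i))) ≡ l ^ toℕ {suc r} j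
      ratio i = root-power (ratio-root (root-unit (pow i)) (pow-root i))

      which : Fin U.size → Fin (suc r)
      which i = proj₁ (ratio i)

      recover : ∀ i → U.ι i ≡ l ^ toℕ (which i) * root-of (pow i)
      recover i = undo-ratio (root-unit (pow i)) (proj₂ (ratio i))

      -- A unit is recovered from its `suc r`-th power and from the power of l by which it differs
      -- from the chosen root of that power.
      units≤ : U.size ℕ.≤ suc r ℕ.* H.size
      units≤ = ≤-product which pow λ {i} {j} p q → U.ι-inj (trans (recover i) (trans
        (cong₂ (λ u v → l ^ toℕ u * root-of v) p q) (sym (recover j))))

      coset : Fin (suc r) → Fin H.size → Fin N
      coset j k = α ^ toℕ j * H.ι k

      coset-unit : ∀ j k → Unit (coset j k)
      coset-unit j k = unit-* (unit-^ αU (toℕ j)) (proj₁ (H.ι∈ k))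

      -- If the cosets met, then for d = j′ - j the elements a^d g′ and g would have the same
      -- `suc r`-th power. Their quotient would be a power of l, hence central, and a^d would be
      -- central although 0 < d < `suc r`.
      distinct : ∀ j j′ k k′ → toℕ j ℕ.< toℕ j′ → coset j k ≢ coset j′ k′
      distinct j j′ k k′ lt eq = a-nc d (ℕₚ.m<n⇒0<n∸m lt)
        (ℕₚ.≤-<-trans (ℕₚ.m∸n≤m (toℕ j′) (toℕ j)) (Finₚ.toℕ<n j′)) aᵈ-central
        where
        d = toℕ j′ ℕ.∸ toℕ j
        g = root-of k
        g′ = root-of k′
        gU = root-unit k
        g′U = root-unit k′
        α≡ : α ^ toℕ j * α ^ d ≡ α ^ toℕ j′
        α≡ = trans (sym (^-homo-* α (toℕ j) d)) (cong (α ^_) (ℕₚ.m+[n∸m]≡n (ℕₚ.<⇒≤ lt)))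
        h≡ : H.ι k ≡ α ^ d * H.ι k′
        h≡ = cancelˡ (^≢0 (proj₂ αU) (toℕ j)) (trans eq (trans
          (cong (_* H.ι k′) (sym α≡)) (*-assoc _ _ _)))
        powers : (a ^ d * g′) ^ suc r ≡ g ^ suc r
        powers = begin
          (a ^ d * g′) ^ suc r          ≡⟨ ^-distrib-* (proj₁ g′U (a ^ d)) (suc r) ⟩
          (a ^ d) ^ suc r * g′ ^ suc r  ≡⟨ cong₂ _*_ (trans (^-assocʳ a d (suc r)) (trans
                                             (cong (a ^_) (ℕₚ.*-comm d (suc r))) (sym (^-assocʳ a (suc r) d)))) (sym (root-^ k′)) ⟩
          α ^ d * H.ι k′                ≡⟨ h≡ ⟨
          H.ι k                         ≡⟨ root-^ k ⟩
          g ^ suc r                     ∎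
        y-central : Central (a ^ d * g′ * inv (proj₂ gU))
        y-central = root-central (ratio-root gU powers)
        aᵈ-central : Central (a ^ d)
        aᵈ-central = subst Central (begin
          a ^ d * g′ * inv (proj₂ gU) * (g * inv (proj₂ g′U))
            ≡⟨ solve 5 (λ a b c d e → ((a ⊕ b) ⊕ c) ⊕ (d ⊕ e) ⊜ (a ⊕ (b ⊕ ((c ⊕ d) ⊕ e)))) refl (a ^ d) g′ (inv (proj₂ gU)) g (inv (proj₂ g′U)) ⟩
          a ^ d * (g′ * (inv (proj₂ gU) * g * inv (proj₂ g′U)))
            ≡⟨ cong (λ u → a ^ d * (g′ * (u * inv (proj₂ g′U)))) (invˡ (proj₂ gU)) ⟩
          a ^ d * (g′ * (1# * inv (proj₂ g′U)))
            ≡⟨ cong (λ u → a ^ d * (g′ * u)) (*-identityˡ _) ⟩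
          a ^ d * (g′ * inv (proj₂ g′U))
            ≡⟨ cong (a ^ d *_) (invʳ (proj₂ g′U)) ⟩
          a ^ d * 1#
            ≡⟨ *-identityʳ _ ⟩
          a ^ d ∎)
          (central-* y-central (central-* (proj₁ gU) (proj₁ (unit-inv g′U))))

      coset-inj : ∀ {j k j′ k′} → coset j k ≡ coset j′ k′ → (j , k) ≡ (j′ , k′)
      coset-inj {j} {k} {j′} {k′} eq with ℕₚ.<-cmp (toℕ j) (toℕ j′)
      ... | tri< lt _ _ = contradiction eq (distinct j j′ k k′ lt)
      ... | tri> _ _ gt = contradiction (sym eq) (distinct j′ j k′ k gt)
      ... | tri≈ _ e _ with Finₚ.toℕ-injective e
      ...   | refl = cong (j ,_) (H.ι-inj (cancelˡ (^≢0 (proj₂ αU) (toℕ j)) eq))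

      abstract
        -- If β were missed, the `suc r` disjoint cosets would all fit into the units other than β,
        -- which are too few by `units≤`.
        cover : ∀ {β} → Unit β → ∃[ j ] ∃[ g ] (Unit g × β ≡ α ^ toℕ {suc r} j * g ^ suc r)
        cover {β} βU = decidable-stable
          (Finₚ.any? λ j → Finₚ.any? λ g → Unit? g ×-dec (β ≟ α ^ toℕ j * g ^ suc r)) λ none →
          let EQ = enumerate (λ z → Unit? z ×-dec ¬? (z ≟ β))
          in ℕₚ.<-irrefl refl (ℕₚ.≤-<-trans units≤ (ℕₚ.≤-<-trans
               (product-size EQ coset coset-inj (λ j k → coset-unit j k , λ eq →
                 none (j , root-of k , root-unit k , trans (sym eq) (cong (α ^ toℕ j *_) (root-^ k)))))
               (size-strict EQ EU proj₁ βU (λ q → proj₂ q refl))))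

-- Symbol algebras

module Herstein (A : FinRing) (div : RingTools.IsDivision A)
  (M : ∀ {a x y} → ¬ RingTools.Central A a → RingTools.Comm A x a → RingTools.Comm A y a → RingTools.Comm A x y) where
  open RingTools A
  open DivisionRing A div
  open ≡-Reasoning

  -- the data of a symbol algebra: b a = l a b with l, a^r, b^r central
  module Symbol (r : ℕ) (below : ∀ j → 0 ℕ.< j → j ℕ.< suc r → ∀ {x} → ¬ Central x → ¬ Central (x ^ j))
    {a b l : Fin N} (a-nc : ¬ Central a) (αc : Central (a ^ suc r)) (lc : Central l)
    (ba : b * a ≡ l * (a * b)) (ba≢ : ¬ Comm b a) where

    b-nc : ¬ Central b
    b-nc bc = ba≢ (bc a)

    a≢0 : a ≢ 0#
    a≢0 = noncentral≢0 a-nc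

    b≢0 : b ≢ 0#
    b≢0 = noncentral≢0 b-nc

    l≢0 : l ≢ 0#
    l≢0 l≡0 = *≢0 b≢0 a≢0 (trans ba (trans (cong (_* (a * b)) l≡0) (zeroˡ _)))

    ba^ : ∀ j → b * a ^ j ≡ l ^ j * a ^ j * b
    ba^ j = trans (intertwine-^ A div (trans ba (sym (*-assoc l a b))) j)
                  (cong (_* b) (^-distrib-* (sym (lc a)) j))

    b^a : ∀ j → b ^ j * a ≡ l ^ j * (a * b ^ j)
    b^a zero = trans (*-identityˡ a) (sym (trans (*-identityˡ _) (*-identityʳ a)))
    b^a (suc j) = begin
      b * b ^ j * a             ≡⟨ *-assoc b _ a ⟩
      b * (b ^ j * a)           ≡⟨ cong (b *_) (b^a j) ⟩
      b * (l ^ j * (a * b ^ j)) ≡⟨ solve 4 (λ b p a q → b ⊕ (p ⊕ (a ⊕ q)) ⊜ (b ⊕ p) ⊕ (a ⊕ q)) refl b (l ^ j) a (b ^ j) ⟩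
      b * l ^ j * (a * b ^ j)   ≡⟨ cong (_* (a * b ^ j)) (central-^ lc j b) ⟨
      l ^ j * b * (a * b ^ j)   ≡⟨ solve 4 (λ b p a q → (p ⊕ b) ⊕ (a ⊕ q) ⊜ p ⊕ ((b ⊕ a) ⊕ q)) refl b (l ^ j) a (b ^ j) ⟩
      l ^ j * (b * a * b ^ j)   ≡⟨ cong (λ u → l ^ j * (u * b ^ j)) ba ⟩
      l ^ j * (l * (a * b) * b ^ j)
        ≡⟨ solve 5 (λ p l a b q → p ⊕ ((l ⊕ (a ⊕ b)) ⊕ q) ⊜ (p ⊕ l) ⊕ (a ⊕ (b ⊕ q))) refl (l ^ j) l a b (b ^ j) ⟩
      l ^ j * l * (a * (b * b ^ j)) ≡⟨ cong (_* (a * (b * b ^ j))) (lc (l ^ j)) ⟨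
      l * l ^ j * (a * (b * b ^ j)) ∎

    l^≡1⇒comm : ∀ j → l ^ j ≡ 1# → Comm b (a ^ j)
    l^≡1⇒comm j eq = trans (ba^ j) (cong (_* b) (trans (cong (_* a ^ j) eq) (*-identityˡ _)))

    lʳ≡1 : l ^ suc r ≡ 1#
    lʳ≡1 = cancelʳ (*≢0 (^≢0 a≢0 (suc r)) b≢0) (begin
      l ^ suc r * (a ^ suc r * b)   ≡⟨ *-assoc (l ^ suc r) _ b ⟨
      l ^ suc r * a ^ suc r * b     ≡⟨ ba^ (suc r) ⟨
      b * a ^ suc r                 ≡⟨ αc b ⟨
      a ^ suc r * b                 ≡⟨ *-identityˡ _ ⟨
      1# * (a ^ suc r * b)          ∎)

    -- If l^j = 1, both a and b commute with a^j. As a^j is noncentral for such small j, its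
    -- centralizer is commutative, and a and b would commute.
    l-prim : ∀ j → 0 ℕ.< j → j ℕ.< suc r → l ^ j ≢ 1#
    l-prim j 0<j j<r eq = ba≢ (M (below j 0<j j<r a-nc) (l^≡1⇒comm j eq) (sym (comm-^ refl j)))

    -- Since the `suc r`-th power of l is 1, that of b commutes with a as well as with b; were it
    -- noncentral, its commutative centralizer would contain both.
    βc : Central (b ^ suc r)
    βc = decidable-stable (Central? (b ^ suc r)) λ nc → ba≢ (M nc (sym (comm-^ refl (suc r)))
      (sym (trans (b^a (suc r)) (trans (cong (_* (a * b ^ suc r)) lʳ≡1) (*-identityˡ _)))))

    open RootsOfUnity A div lc l≢0 lʳ≡1 l-prim

    module _ {x : Fin N} (x-nc : ¬ Central x) (xc : Central (x ^ suc r)) where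
      open Cosets xc (λ j 0<j j<r → below j 0<j j<r x-nc) (noncentral≢0 x-nc)
        (enumerate Unit?) (enumerate Power?) public using (cover)

    commutes-with-product : ∀ {k} → k ≢ 0# → Comm a k → Central (k * b) → ⊥
    commutes-with-product {k} k≢0 ak kbc = ba≢ (cancelˡ k≢0 (begin
      k * (b * a)   ≡⟨ *-assoc k b a ⟨
      k * b * a     ≡⟨ kbc a ⟩
      a * (k * b)   ≡⟨ *-assoc a k b ⟨
      a * k * b     ≡⟨ cong (_* b) ak ⟩
      k * a * b     ≡⟨ *-assoc k a b ⟩
      k * (a * b)   ∎))

    -- In the step from n to n + 1 one b passes n factors k, and each passage costs a factor m.
    product-^ : ∀ {k m} → Central m → b * k ≡ m * (k * b) → ∀ n →
                (k * b) ^ n ≡ m ^ triangle n * (k ^ n * b ^ n)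
    product-^ mc bk zero = sym (trans (*-identityˡ _) (*-identityˡ 1#))
    product-^ {k} {m} mc bk (suc n) = begin
      k * b * (k * b) ^ n
        ≡⟨ cong (k * b *_) (product-^ mc bk n) ⟩
      k * b * (T * (k ^ n * b ^ n))
        ≡⟨ solve 5 (λ k b T p q → (k ⊕ b) ⊕ (T ⊕ (p ⊕ q)) ⊜ ((k ⊕ b) ⊕ T) ⊕ (p ⊕ q)) refl k b T (k ^ n) (b ^ n) ⟩
      k * b * T * (k ^ n * b ^ n)
        ≡⟨ cong (_* (k ^ n * b ^ n)) (central-^ mc (triangle n) (k * b)) ⟨
      T * (k * b) * (k ^ n * b ^ n)
        ≡⟨ solve 5 (λ k b T p q → (T ⊕ (k ⊕ b)) ⊕ (p ⊕ q) ⊜ (T ⊕ k) ⊕ ((b ⊕ p) ⊕ q)) refl k b T (k ^ n) (b ^ n) ⟩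
      T * k * (b * k ^ n * b ^ n)
        ≡⟨ cong (λ u → T * k * (u * b ^ n)) (trans (intertwine-^ A div (trans bk (sym (*-assoc m k b))) n)
             (cong (_* b) (^-distrib-* (sym (mc k)) n))) ⟩
      T * k * (m ^ n * k ^ n * b * b ^ n)
        ≡⟨ solve 6 (λ T k m p b q → (T ⊕ k) ⊕ (((m ⊕ p) ⊕ b) ⊕ q) ⊜ T ⊕ ((k ⊕ m) ⊕ (p ⊕ (b ⊕ q)))) refl T k (m ^ n) (k ^ n) b (b ^ n) ⟩
      T * (k * m ^ n * (k ^ n * (b * b ^ n)))
        ≡⟨ cong (λ u → T * (u * (k ^ n * (b * b ^ n)))) (central-^ mc n k) ⟨
      T * (m ^ n * k * (k ^ n * (b * b ^ n)))
        ≡⟨ solve 6 (λ T k m p b q → T ⊕ ((m ⊕ k) ⊕ (p ⊕ (b ⊕ q))) ⊜ (T ⊕ m) ⊕ ((k ⊕ p) ⊕ (b ⊕ q))) refl T k (m ^ n) (k ^ n) b (b ^ n) ⟩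
      T * m ^ n * (k * k ^ n * (b * b ^ n))
        ≡⟨ cong (_* (k * k ^ n * (b * b ^ n))) (trans (central-^ mc (triangle n) (m ^ n)) (sym (^-homo-* m n (triangle n)))) ⟩
      m ^ (n ℕ.+ triangle n) * (k * k ^ n * (b * b ^ n)) ∎
      where T = m ^ triangle n

    -- k = a^j g with (a^j)^r g^r = b^{-r}, so that y = k b satisfies y^r = (l^j)^{r(r-1)/2}
    record Normalised : Set where
      field
        j   : Fin (suc r)
        g   : Fin N
        g-unit : Unit g
      k = a ^ toℕ j * g
      y = k * b
      field
        yʳ : y ^ suc r ≡ (l ^ toℕ j) ^ triangle (suc r)

      k≢0 : k ≢ 0#
      k≢0 = *≢0 (^≢0 a≢0 (toℕ j)) (proj₂ g-unit)

      ak : Comm a k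
      ak = sym (comm-* (comm-^ refl (toℕ j)) (proj₁ g-unit a))

      y-noncentral : ¬ Central y
      y-noncentral = commutes-with-product k≢0 ak

    normalised : Normalised
    normalised = record { j = j ; g = g ; g-unit = gU ; yʳ = yʳ }
      where
      β-unit : Unit (b ^ suc r)
      β-unit = βc , ^≢0 b≢0 (suc r)
      c = cover a-nc αc (unit-inv β-unit)
      j = proj₁ c
      g = proj₁ (proj₂ c)
      gU = proj₁ (proj₂ (proj₂ c))
      eq = proj₂ (proj₂ (proj₂ c))
      calc : ∀ i {g β⁻} → Central g → β⁻ * b ^ suc r ≡ 1# → β⁻ ≡ (a ^ suc r) ^ i * g ^ suc r →
             (a ^ i * g * b) ^ suc r ≡ (l ^ i) ^ triangle (suc r)
      calc i {g} {β⁻} gc βl e = begin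
        (a ^ i * g * b) ^ suc r
          ≡⟨ product-^ (central-^ lc i) bk (suc r) ⟩
        (l ^ i) ^ triangle (suc r) * ((a ^ i * g) ^ suc r * b ^ suc r)
          ≡⟨ cong (λ u → (l ^ i) ^ triangle (suc r) * (u * b ^ suc r)) kʳ ⟩
        (l ^ i) ^ triangle (suc r) * (β⁻ * b ^ suc r)
          ≡⟨ cong ((l ^ i) ^ triangle (suc r) *_) βl ⟩
        (l ^ i) ^ triangle (suc r) * 1#
          ≡⟨ *-identityʳ _ ⟩
        (l ^ i) ^ triangle (suc r) ∎
        where
        kʳ : (a ^ i * g) ^ suc r ≡ β⁻
        kʳ = trans (^-distrib-* (gc (a ^ i)) (suc r)) (trans (cong (_* g ^ suc r)
          (trans (^-assocʳ a i (suc r)) (trans (cong (a ^_) (ℕₚ.*-comm i (suc r))) (sym (^-assocʳ a (suc r) i))))) (sym e))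
        bk : b * (a ^ i * g) ≡ l ^ i * (a ^ i * g * b)
        bk = begin
          b * (a ^ i * g)             ≡⟨ *-assoc b _ g ⟨
          b * a ^ i * g               ≡⟨ cong (_* g) (ba^ i) ⟩
          l ^ i * a ^ i * b * g       ≡⟨ *-assoc _ b g ⟩
          l ^ i * a ^ i * (b * g)     ≡⟨ cong (l ^ i * a ^ i *_) (gc b) ⟨
          l ^ i * a ^ i * (g * b)     ≡⟨ solve 4 (λ l a g b → (l ⊕ a) ⊕ (g ⊕ b) ⊜ l ⊕ ((a ⊕ g) ⊕ b)) refl (l ^ i) (a ^ i) g b ⟩
          l ^ i * (a ^ i * g * b)     ∎
      yʳ : (a ^ toℕ j * g * b) ^ suc r ≡ (l ^ toℕ j) ^ triangle (suc r)
      yʳ = calc (toℕ j) (proj₁ gU) (invˡ (proj₂ β-unit)) eq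

    -- The order `suc r` is odd here, so it divides its triangle number and the `suc r`-th power of
    -- y is 1. This makes y a power of l, hence central.
    odd : ∀ t → r ≡ t ℕ.* 2 → ⊥
    odd t refl = y-noncentral (root-central (trans yʳ (begin
      (l ^ toℕ j) ^ triangle (suc r)   ≡⟨ cong ((l ^ toℕ j) ^_) (triangle-odd t) ⟩
      (l ^ toℕ j) ^ (suc r ℕ.* t)      ≡⟨ ^-assocʳ l (toℕ j) _ ⟩
      l ^ (toℕ j ℕ.* (suc r ℕ.* t))    ≡⟨ cong (l ^_) (ℕS.solve 3 (λ j r t → j ℕS.:* (r ℕS.:* t) ℕS.:= r ℕS.:* (j ℕS.:* t)) refl (toℕ j) (suc r) t) ⟩
      l ^ (suc r ℕ.* (toℕ j ℕ.* t))    ≡⟨ ^-assocʳ l (suc r) (toℕ j ℕ.* t) ⟨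
      (l ^ suc r) ^ (toℕ j ℕ.* t)      ≡⟨ cong (_^ (toℕ j ℕ.* t)) lʳ≡1 ⟩
      1# ^ (toℕ j ℕ.* t)               ≡⟨ 1^ (toℕ j ℕ.* t) ⟩
      1#                               ∎)))
      where open Normalised normalised

  -- The remaining case of order 2, where y² = l. It turns out that l = -1, so that a and y
  -- anticommute.
  module Quaternion (below : ∀ j → 0 ℕ.< j → j ℕ.< 2 → ∀ {x} → ¬ Central x → ¬ Central (x ^ j))
    {a y l : Fin N} (a-nc : ¬ Central a) (αc : Central (a ^ 2)) (lc : Central l)
    (ya : y * a ≡ l * (a * y)) (ya≢ : ¬ Comm y a) (y²≡l : y ^ 2 ≡ l) where
    open Symbol 1 below a-nc αc lc ya ya≢
      renaming (b-nc to y-nc; lʳ≡1 to l²≡1)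
    open RootsOfUnity A div lc l≢0 l²≡1 l-prim

    yc : Central (y ^ 2)
    yc = subst Central (sym y²≡l) lc

    sq : Fin N → Fin N
    sq x = x * x

    ^2≡sq : ∀ x → x ^ 2 ≡ sq x
    ^2≡sq x = cong (x *_) (*-identityʳ x)

    ll≡1 : l * l ≡ 1#
    ll≡1 = trans (sym (^2≡sq l)) l²≡1

    1+l≡0 : 1# + l ≡ 0#
    1+l≡0 = decidable-stable (_ ≟ _) λ ≢0 → l-prim 1 (s≤s z≤n) ℕₚ.≤-refl (trans (*-identityʳ l)
      (cancelˡ ≢0 (begin
        (1# + l) * l    ≡⟨ distribʳ l 1# l ⟩
        1# * l + l * l  ≡⟨ cong₂ _+_ (*-identityˡ l) ll≡1 ⟩
        l + 1#          ≡⟨ +-comm l 1# ⟩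
        1# + l          ≡⟨ *-identityʳ _ ⟨
        (1# + l) * 1#   ∎)))

    sq-* : ∀ {x g} → Central g → sq (x * g) ≡ sq x * sq g
    sq-* {x} {g} gc = trans (sym (^2≡sq (x * g))) (trans (^-distrib-* (gc x) 2) (cong₂ _*_ (^2≡sq x) (^2≡sq g)))

    -- Here the covering by cosets is taken for y in place of a, which makes the powers of y² = l
    -- the representatives.
    cover₂ : ∀ {z} → Unit z → ∃[ g ] (Unit g × (z ≡ sq g ⊎ z ≡ l * sq g))
    cover₂ zU with cover y-nc yc zU
    ... | zero , g , gU , eq = g , gU , inj₁ (trans eq (trans (*-identityˡ _) (^2≡sq g)))
    ... | suc zero , g , gU , eq = g , gU , inj₂ (trans eq (cong₂ _*_ (trans (*-identityʳ _) y²≡l) (^2≡sq g)))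

    TwoSquares : Set
    TwoSquares = ∃[ u ] ∃[ v ] (Central u × Central v × sq u + sq v ≡ l)

    -- If it fails, the multiples n · 1 are all squares by induction: when 1 + g² is nonzero and not
    -- a square it is l h², and then l = (1/h)² + (g/h)². But l = -1 is itself such a multiple,
    -- hence g² + 0² for some central g.
    two-squares : TwoSquares
    two-squares = decidable-stable (Finₚ.any? λ u → Finₚ.any? λ v →
      Central? u ×-dec (Central? v ×-dec (sq u + sq v ≟ l))) λ none →
      let g , gc , eq = square none (proj₁ multiple)
      in none (g , 0# , gc , comm-0 , trans (cong (sq g +_) (zeroˡ 0#)) (trans (+-identityʳ _)
           (trans (sym eq) (proj₂ multiple))))
      where
      open import Algebra.Properties.Monoid.Mult (Ring.+-monoid ring)
        using () renaming (_×_ to _·_; ×-homo-+ to ·-homo-+)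
      square : ¬ TwoSquares → ∀ n → ∃[ g ] (Central g × n · 1# ≡ sq g)
      square none zero = 0# , comm-0 , sym (zeroˡ 0#)
      square none (suc n) with square none n
      ... | g , gc , eq with 1# + sq g ≟ 0#
      ...   | yes ≡0 = 0# , comm-0 , trans (cong (1# +_) eq) (trans ≡0 (sym (zeroˡ 0#)))
      ...   | no ≢0 with cover₂ (central-+ comm-1 (central-* gc gc) , ≢0)
      ...     | h , hU , inj₁ eq′ = h , proj₁ hU , trans (cong (1# +_) eq) eq′
      ...     | h , hU , inj₂ eq′ = contradiction
        (h⁻ , g * h⁻ , h⁻c , central-* gc h⁻c , (begin
          sq h⁻ + sq (g * h⁻)            ≡⟨ cong₂ _+_ (sym (*-identityˡ _)) (sq-* h⁻c) ⟩
          1# * sq h⁻ + sq g * sq h⁻      ≡⟨ distribʳ (sq h⁻) 1# (sq g) ⟨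
          (1# + sq g) * sq h⁻            ≡⟨ cong (_* sq h⁻) eq′ ⟩
          l * sq h * sq h⁻               ≡⟨ *-assoc l _ _ ⟩
          l * (sq h * sq h⁻)             ≡⟨ cong (l *_) (sq-* h⁻c) ⟨
          l * sq (h * h⁻)                ≡⟨ cong (λ u → l * sq u) (invʳ (proj₂ hU)) ⟩
          l * (1# * 1#)                  ≡⟨ cong (l *_) (*-identityˡ 1#) ⟩
          l * 1#                         ≡⟨ *-identityʳ l ⟩
          l                              ∎)) none
        where
        h⁻ = inv (proj₂ hU)
        h⁻c = proj₁ (unit-inv hU)
      multiple : ∃[ n ] n · 1# ≡ l
      multiple with Finₚ.pigeonhole (ℕₚ.n<1+n N) (λ i → toℕ i · 1#)
      ... | i , j , i<j , eq = d , +-cancelˡ 1# _ _ (trans (+-cancelˡ (toℕ i · 1#) _ _ (begin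
        toℕ i · 1# + suc d · 1#   ≡⟨ ·-homo-+ 1# (toℕ i) (suc d) ⟨
        (toℕ i ℕ.+ suc d) · 1#    ≡⟨ cong (_· 1#) (trans (ℕₚ.+-suc (toℕ i) d) (ℕₚ.m+[n∸m]≡n i<j)) ⟩
        toℕ j · 1#                ≡⟨ eq ⟨
        toℕ i · 1#                ≡⟨ +-identityʳ _ ⟨
        toℕ i · 1# + 0#           ∎)) (sym 1+l≡0))
        where d = toℕ j ℕ.∸ suc (toℕ i)

    -- w = (u + v y) a′ has w² = -(u² + v²) = 1, so w is central
    impossible : ∀ {a′} → sq a′ ≡ l → y * a′ ≡ l * (a′ * y) → ¬ Comm y a′ → ⊥
    impossible {a′} a′² ya′ ya′≢ = ya′≢ (cancelˡ s≢0 (begin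
      s * (y * a′)   ≡⟨ *-assoc s y a′ ⟨
      s * y * a′     ≡⟨ cong (_* a′) sy ⟩
      y * s * a′     ≡⟨ *-assoc y s a′ ⟩
      y * w          ≡⟨ w-central y ⟨
      w * y          ≡⟨ *-assoc s a′ y ⟩
      s * (a′ * y)   ∎))
      where
      u = proj₁ two-squares
      v = proj₁ (proj₂ two-squares)
      uc = proj₁ (proj₂ (proj₂ two-squares))
      vc = proj₁ (proj₂ (proj₂ (proj₂ two-squares)))
      s = u + v * y
      -- The conjugate u - v y of s. Moving `a′` past s conjugates it, and s times its conjugate is
      -- u² - v² y² = u² + v².
      s̄ = u + l * (v * y)
      w = s * a′
      sy : Comm s y
      sy = comm-+ (uc y) (comm-* (vc y) refl)
      a′y : a′ * y ≡ l * (y * a′)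
      a′y = begin
        a′ * y               ≡⟨ *-identityˡ _ ⟨
        1# * (a′ * y)        ≡⟨ cong (_* (a′ * y)) ll≡1 ⟨
        l * l * (a′ * y)     ≡⟨ *-assoc l l _ ⟩
        l * (l * (a′ * y))   ≡⟨ cong (l *_) ya′ ⟨
        l * (y * a′)         ∎
      a′s : a′ * s ≡ s̄ * a′
      a′s = begin
        a′ * (u + v * y)                 ≡⟨ distribˡ a′ u _ ⟩
        a′ * u + a′ * (v * y)            ≡⟨ cong₂ _+_ (sym (uc a′)) (sym (*-assoc a′ v y)) ⟩
        u * a′ + a′ * v * y              ≡⟨ cong (λ z → u * a′ + z * y) (sym (vc a′)) ⟩
        u * a′ + v * a′ * y              ≡⟨ cong (u * a′ +_) (trans (*-assoc v a′ y) (cong (v *_) a′y)) ⟩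
        u * a′ + v * (l * (y * a′))      ≡⟨ cong (u * a′ +_) (solve 4 (λ v l y a → v ⊕ (l ⊕ (y ⊕ a)) ⊜ ((v ⊕ l) ⊕ y) ⊕ a) refl v l y a′) ⟩
        u * a′ + v * l * y * a′          ≡⟨ cong (λ z → u * a′ + z * y * a′) (vc l) ⟩
        u * a′ + l * v * y * a′          ≡⟨ cong (λ z → u * a′ + z * a′) (*-assoc l v y) ⟩
        u * a′ + l * (v * y) * a′        ≡⟨ distribʳ a′ u _ ⟨
        s̄ * a′                           ∎
      vy : sq (v * y) ≡ sq v * l
      vy = begin
        v * y * (v * y)   ≡⟨ ^2≡sq (v * y) ⟨
        (v * y) ^ 2       ≡⟨ ^-distrib-* (sym (vc y)) 2 ⟩
        v ^ 2 * y ^ 2     ≡⟨ cong₂ _*_ (^2≡sq v) y²≡l ⟩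
        sq v * l          ∎
      ss̄ : s * s̄ ≡ l
      ss̄ = begin
        (u + p) * (u + l * p)                    ≡⟨ distribʳ _ u p ⟩
        u * (u + l * p) + p * (u + l * p)        ≡⟨ cong₂ _+_ (distribˡ u u _) (distribˡ p u _) ⟩
        sq u + u * (l * p) + (p * u + p * (l * p))
          ≡⟨ cong₂ (λ x z → sq u + x + (p * u + z))
               (trans (sym (*-assoc u l p)) (trans (cong (_* p) (uc l)) (*-assoc l u p)))
               (trans (sym (*-assoc p l p)) (trans (cong (_* p) (sym (lc p))) (*-assoc l p p))) ⟩
        sq u + l * (u * p) + (p * u + l * (p * p))
          ≡⟨ cong₂ (λ x z → sq u + l * (u * p) + (x + z)) (trans (sym (uc p)) (sym (*-identityˡ _)))
               (trans (cong (l *_) (trans vy (sym (lc (sq v))))) (trans (sym (*-assoc l l _)) (trans (cong (_* sq v) ll≡1) (*-identityˡ _)))) ⟩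
        sq u + l * (u * p) + (1# * (u * p) + sq v)   ≡⟨ +-assoc (sq u) _ _ ⟩
        sq u + (l * (u * p) + (1# * (u * p) + sq v)) ≡⟨ cong (sq u +_) (+-assoc _ _ _) ⟨
        sq u + (l * (u * p) + 1# * (u * p) + sq v)   ≡⟨ cong (λ z → sq u + (z + sq v)) (trans (sym (distribʳ (u * p) l 1#))
                                                          (trans (cong (_* (u * p)) (trans (+-comm l 1#) 1+l≡0)) (zeroˡ _))) ⟩
        sq u + (0# + sq v)                           ≡⟨ cong (sq u +_) (+-identityˡ _) ⟩
        sq u + sq v                                  ≡⟨ proj₂ (proj₂ (proj₂ (proj₂ two-squares))) ⟩
        l                                            ∎
        where p = v * y
      w²≡1 : w ^ 2 ≡ 1#
      w²≡1 = begin
        w ^ 2                 ≡⟨ ^2≡sq w ⟩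
        s * a′ * (s * a′)     ≡⟨ solve 4 (λ s a t b → (s ⊕ a) ⊕ (t ⊕ b) ⊜ s ⊕ ((a ⊕ t) ⊕ b)) refl s a′ s a′ ⟩
        s * (a′ * s * a′)     ≡⟨ cong (λ z → s * (z * a′)) a′s ⟩
        s * (s̄ * a′ * a′)     ≡⟨ solve 3 (λ s t a → s ⊕ ((t ⊕ a) ⊕ a) ⊜ (s ⊕ t) ⊕ (a ⊕ a)) refl s s̄ a′ ⟩
        s * s̄ * sq a′         ≡⟨ cong₂ _*_ ss̄ a′² ⟩
        l * l                 ≡⟨ ll≡1 ⟩
        1#                    ∎
      w-central : Central w
      w-central = root-central w²≡1
      s≢0 : s ≢ 0#
      s≢0 s≡0 = 1≢0 (trans (sym w²≡1) (trans (cong (_^ 2) (trans (cong (_* a′) s≡0) (zeroˡ a′))) (zeroˡ _)))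

    square-case : ∀ {g} → Unit g → a ^ 2 ≡ sq g → ⊥
    square-case {g} (gc , g≢0) eq = a-nc (subst Central undo (central-* ratio-central gc))
      where
      g⁻ = inv g≢0
      g⁻c : Central g⁻
      g⁻c = central-inv g≢0 gc
      undo : a * g⁻ * g ≡ a
      undo = trans (*-assoc a g⁻ g) (trans (cong (a *_) (invˡ g≢0)) (*-identityʳ a))
      ratio-central : Central (a * g⁻)
      ratio-central = root-central (begin
        (a * g⁻) ^ 2     ≡⟨ ^-distrib-* (g⁻c a) 2 ⟩
        a ^ 2 * g⁻ ^ 2   ≡⟨ cong (_* g⁻ ^ 2) (trans eq (sym (^2≡sq g))) ⟩
        g ^ 2 * g⁻ ^ 2   ≡⟨ ^-distrib-* (g⁻c g) 2 ⟨
        (g * g⁻) ^ 2     ≡⟨ cong (_^ 2) (invʳ g≢0) ⟩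
        1# ^ 2           ≡⟨ 1^ 2 ⟩
        1#               ∎)

    -- Division by the central g turns a into an element of square -1 that still anticommutes with
    -- y.
    nonsquare-case : ∀ {g} → Unit g → a ^ 2 ≡ l * sq g → ⊥
    nonsquare-case {g} (gc , g≢0) eq = impossible sq≡ ya′ noncomm
      where
      g⁻ = inv g≢0
      g⁻c : Central g⁻
      g⁻c = central-inv g≢0 gc
      sq≡ : sq (a * g⁻) ≡ l
      sq≡ = begin
        sq (a * g⁻)          ≡⟨ sq-* g⁻c ⟩
        sq a * sq g⁻         ≡⟨ cong (_* sq g⁻) (trans (sym (^2≡sq a)) eq) ⟩
        l * sq g * sq g⁻     ≡⟨ *-assoc l (sq g) (sq g⁻) ⟩
        l * (sq g * sq g⁻)   ≡⟨ cong (l *_) (sq-* g⁻c) ⟨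
        l * sq (g * g⁻)      ≡⟨ cong (λ z → l * sq z) (invʳ g≢0) ⟩
        l * (1# * 1#)        ≡⟨ cong (l *_) (*-identityˡ 1#) ⟩
        l * 1#               ≡⟨ *-identityʳ l ⟩
        l                    ∎
      ya′ : y * (a * g⁻) ≡ l * (a * g⁻ * y)
      ya′ = begin
        y * (a * g⁻)         ≡⟨ *-assoc y a g⁻ ⟨
        y * a * g⁻           ≡⟨ cong (_* g⁻) ya ⟩
        l * (a * y) * g⁻     ≡⟨ solve 4 (λ l a y g → (l ⊕ (a ⊕ y)) ⊕ g ⊜ l ⊕ (a ⊕ (y ⊕ g))) refl l a y g⁻ ⟩
        l * (a * (y * g⁻))   ≡⟨ cong (λ z → l * (a * z)) (g⁻c y) ⟨
        l * (a * (g⁻ * y))   ≡⟨ cong (l *_) (*-assoc a g⁻ y) ⟨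
        l * (a * g⁻ * y)     ∎
      noncomm : ¬ Comm y (a * g⁻)
      noncomm c = ya≢ (cancelʳ (inv≢0 g≢0) (begin
        y * a * g⁻     ≡⟨ *-assoc y a g⁻ ⟩
        y * (a * g⁻)   ≡⟨ c ⟩
        a * g⁻ * y     ≡⟨ *-assoc a g⁻ y ⟩
        a * (g⁻ * y)   ≡⟨ cong (a *_) (g⁻c y) ⟩
        a * (y * g⁻)   ≡⟨ *-assoc a y g⁻ ⟨
        a * y * g⁻     ∎))

    quaternion : ⊥
    quaternion with cover₂ (αc , ^≢0 a≢0 2)
    ... | _ , gU , inj₁ eq = square-case gU eq
    ... | _ , gU , inj₂ eq = nonsquare-case gU eq

-- Wedderburn's little theorem

module MinimalCounterexample (A : FinRing) (div : RingTools.IsDivision A)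
  (M : ∀ {a x y} → ¬ RingTools.Central A a → RingTools.Comm A x a → RingTools.Comm A y a → RingTools.Comm A x y) where
  open RingTools A
  open DivisionRing A div
  open Herstein A div M
  open ≡-Reasoning

  -- Minimality leaves only odd orders and order 2: for an order 2 t with t ≥ 2, the power a^t would
  -- be noncentral with central square, against `below` at exponent 2.
  symbol-impossible : ∀ r → (∀ j → 0 ℕ.< j → j ℕ.< suc r → ∀ {x} → ¬ Central x → ¬ Central (x ^ j)) →
    ∀ {a b l} → ¬ Central a → Central (a ^ suc r) → Central l → b * a ≡ l * (a * b) → ¬ Comm b a → ⊥
  symbol-impossible r below {a} {b} {l} a-nc αc lc ba ba≢ with parity (suc r)
  ... | t , inj₂ eq = Symbol.odd r below a-nc αc lc ba ba≢ t (ℕₚ.suc-injective eq)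
  ... | suc (suc t) , inj₁ eq = below (suc (suc t)) (s≤s z≤n) t<r a-nc
        (decidable-stable (Central? (a ^ suc (suc t))) λ nc → below 2 (s≤s z≤n) 2<r nc
          (subst Central (trans (cong (a ^_) eq) (sym (^-assocʳ a (suc (suc t)) 2))) αc))
    where
    2<r : 2 ℕ.< suc r
    2<r = subst (2 ℕ.<_) (sym eq) (s≤s (s≤s (s≤s z≤n)))
    t<r : suc (suc t) ℕ.< suc r
    t<r = subst (suc (suc t) ℕ.<_) (sym eq) (ℕₚ.m<m*n (suc (suc t)) 2 ℕₚ.≤-refl)
  ... | suc zero , inj₁ refl = case-j (toℕ j) (Finₚ.toℕ<n j) refl
    where
    open Symbol 1 below a-nc αc lc ba ba≢
    open RootsOfUnity A div lc l≢0 lʳ≡1 l-prim using (root-central)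
    open Normalised normalised
    -- The triangle number of 2 is 1, so y² = l^j. For j = 0 this makes y central; for j = 1 it
    -- gives y² = l.
    case-j : ∀ i → i ℕ.< 2 → toℕ j ≡ i → ⊥
    case-j 0 _ eq = y-noncentral (root-central (trans yʳ
      (trans (cong (λ i → (l ^ i) ^ 1) eq) (1^ 1))))
    case-j 1 _ eq = Quaternion.quaternion below a-nc αc lc ya ya≢
      (trans yʳ (trans (cong (λ i → (l ^ i) ^ 1) eq) (trans (*-identityʳ _) (*-identityʳ l))))
      where
      ya : y * a ≡ l * (a * y)
      ya = begin
        k * b * a            ≡⟨ *-assoc k b a ⟩
        k * (b * a)          ≡⟨ cong (k *_) ba ⟩
        k * (l * (a * b))    ≡⟨ *-assoc k l (a * b) ⟨
        k * l * (a * b)      ≡⟨ cong (_* (a * b)) (lc k) ⟨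
        l * k * (a * b)      ≡⟨ solve 4 (λ l k a b → (l ⊕ k) ⊕ (a ⊕ b) ⊜ l ⊕ ((k ⊕ a) ⊕ b)) refl l k a b ⟩
        l * (k * a * b)      ≡⟨ cong (λ u → l * (u * b)) ak ⟨
        l * (a * k * b)      ≡⟨ cong (l *_) (*-assoc a k b) ⟩
        l * (a * (k * b))    ∎
      ya≢ : ¬ Comm y a
      ya≢ c = ba≢ (cancelˡ k≢0 (begin
        k * (b * a)   ≡⟨ *-assoc k b a ⟨
        k * b * a     ≡⟨ c ⟩
        a * (k * b)   ≡⟨ *-assoc a k b ⟨
        a * k * b     ≡⟨ cong (_* b) ak ⟩
        k * a * b     ≡⟨ *-assoc k a b ⟩
        k * (a * b)   ∎))
    case-j (suc (suc _)) (s≤s (s≤s ())) _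

  -- If x a = a^m x then x^s a = a^(m^s) x^s; two of the exponents m^u, m^v with u < v < r agree
  -- modulo r, and b = x^(v-u) satisfies b a^(m^u) = l a^(m^u) b with l central.
  module Minimal (r : ℕ) (below : ∀ j → 0 ℕ.< j → j ℕ.< suc r → ∀ {x} → ¬ Central x → ¬ Central (x ^ j))
    {a : Fin N} (a-nc : ¬ Central a) (αc : Central (a ^ suc r))
    {x m} (xa : x * a ≡ a ^ m * x) (xa≢ : ¬ Comm x a) where

    x-nc : ¬ Central x
    x-nc c = xa≢ (c a)

    x≢0 : x ≢ 0#
    x≢0 = noncentral≢0 x-nc

    a≢0 : a ≢ 0#
    a≢0 = noncentral≢0 a-nc

    x^a : ∀ s → x ^ s * a ≡ a ^ (m ℕ.^ s) * x ^ s
    x^a zero = trans (*-identityˡ a) (sym (trans (*-identityʳ _) (*-identityʳ a)))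
    x^a (suc s) = begin
      x * x ^ s * a                     ≡⟨ *-assoc x _ a ⟩
      x * (x ^ s * a)                   ≡⟨ cong (x *_) (x^a s) ⟩
      x * (a ^ (m ℕ.^ s) * x ^ s)       ≡⟨ *-assoc x _ _ ⟨
      x * a ^ (m ℕ.^ s) * x ^ s         ≡⟨ cong (_* x ^ s) (intertwine-^ A div xa (m ℕ.^ s)) ⟩
      (a ^ m) ^ (m ℕ.^ s) * x * x ^ s   ≡⟨ cong (λ u → u * x * x ^ s) (^-assocʳ a m (m ℕ.^ s)) ⟩
      a ^ (m ℕ.* m ℕ.^ s) * x * x ^ s   ≡⟨ *-assoc _ x _ ⟩
      a ^ (m ℕ.* m ℕ.^ s) * (x * x ^ s) ∎

    -- x^s conjugates a to a^(m^s), and a central element is equal to each of its conjugates.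
    conj-central⇒ : ∀ s → ¬ Central (a ^ (m ℕ.^ s))
    conj-central⇒ s c = a-nc (subst Central (sym (cancelˡ (^≢0 x≢0 s) (trans (x^a s) (c (x ^ s))))) c)

    α = a ^ suc r

    α≢0 : α ≢ 0#
    α≢0 = ^≢0 a≢0 (suc r)

    split : ∀ k → a ^ k ≡ α ^ (k ℕ./ suc r) * a ^ (k ℕ.% suc r)
    split k = begin
      a ^ k                                          ≡⟨ cong (a ^_) (ℕ.m≡m%n+[m/n]*n k (suc r)) ⟩
      a ^ (k ℕ.% suc r ℕ.+ k ℕ./ suc r ℕ.* suc r)    ≡⟨ ^-homo-* a (k ℕ.% suc r) _ ⟩
      a ^ (k ℕ.% suc r) * a ^ (k ℕ./ suc r ℕ.* suc r)
        ≡⟨ cong (a ^ (k ℕ.% suc r) *_) (trans (cong (a ^_) (ℕₚ.*-comm (k ℕ./ suc r) (suc r))) (sym (^-assocʳ a (suc r) (k ℕ./ suc r)))) ⟩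
      a ^ (k ℕ.% suc r) * α ^ (k ℕ./ suc r)          ≡⟨ central-^ αc (k ℕ./ suc r) _ ⟨
      α ^ (k ℕ./ suc r) * a ^ (k ℕ.% suc r)          ∎

    -- An exponent divisible by `suc r` would make a^(m^s) a power of the central α.
    residue≢0 : ∀ s → m ℕ.^ s ℕ.% suc r ≢ 0
    residue≢0 s eq = conj-central⇒ s (subst Central (sym (trans (split (m ℕ.^ s))
      (trans (cong (λ i → α ^ (m ℕ.^ s ℕ./ suc r) * a ^ i) eq) (*-identityʳ _)))) (central-^ αc (m ℕ.^ s ℕ./ suc r)))

    residue : ℕ → Fin (suc r)
    residue s = fromℕ< (ℕ.m%n<n (m ℕ.^ s) (suc r))

    residue≢zero : ∀ s → zero ≢ residue s
    residue≢zero s eq = residue≢0 s (trans (sym (Finₚ.toℕ-fromℕ< (ℕ.m%n<n (m ℕ.^ s) (suc r)))) (cong toℕ (sym eq)))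

    minimal-impossible : ⊥
    -- The residue 0 is punched out, which leaves r values for the r + 1 exponents m^0, ..., m^r.
    minimal-impossible with Finₚ.pigeonhole (ℕₚ.n<1+n r) (λ i → punchOut (residue≢zero (toℕ i)))
    ... | i , j , u<v , eq = symbol-impossible r below a′-nc a′ʳ lc ba′ ba′≢
      where
      u = toℕ i
      v = toℕ j
      s = v ℕ.∸ u
      b = x ^ s
      a′ = a ^ (m ℕ.^ u)
      residue≡ : m ℕ.^ u ℕ.% suc r ≡ m ℕ.^ v ℕ.% suc r
      residue≡ = trans (sym (Finₚ.toℕ-fromℕ< (ℕ.m%n<n (m ℕ.^ u) (suc r)))) (trans
        (cong toℕ (Finₚ.punchOut-injective (residue≢zero u) (residue≢zero v) eq))
        (Finₚ.toℕ-fromℕ< (ℕ.m%n<n (m ℕ.^ v) (suc r))))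
      αu = α ^ (m ℕ.^ u ℕ./ suc r)
      αv = α ^ (m ℕ.^ v ℕ./ suc r)
      αu≢0 : αu ≢ 0#
      αu≢0 = ^≢0 α≢0 (m ℕ.^ u ℕ./ suc r)
      -- Since m^u and m^v leave the same remainder, a^(m^v) and a^(m^u) differ by a quotient of
      -- powers of the central α.
      l = αv * inv αu≢0
      lc : Central l
      lc = central-* (central-^ αc (m ℕ.^ v ℕ./ suc r)) (central-inv αu≢0 (central-^ αc (m ℕ.^ u ℕ./ suc r)))
      a′-nc = conj-central⇒ u
      a′ʳ : Central (a′ ^ suc r)
      a′ʳ = subst Central (trans (^-assocʳ a (suc r) (m ℕ.^ u)) (trans
        (cong (a ^_) (ℕₚ.*-comm (suc r) (m ℕ.^ u))) (sym (^-assocʳ a (m ℕ.^ u) (suc r))))) (central-^ αc (m ℕ.^ u))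
      la′ : a ^ (m ℕ.^ v) ≡ l * a′
      la′ = sym (begin
        αv * inv αu≢0 * a′                                  ≡⟨ cong (l *_) (split (m ℕ.^ u)) ⟩
        αv * inv αu≢0 * (αu * a ^ (m ℕ.^ u ℕ.% suc r))
          ≡⟨ solve 4 (λ p q s t → (p ⊕ q) ⊕ (s ⊕ t) ⊜ p ⊕ ((q ⊕ s) ⊕ t)) refl αv (inv αu≢0) αu (a ^ (m ℕ.^ u ℕ.% suc r)) ⟩
        αv * (inv αu≢0 * αu * a ^ (m ℕ.^ u ℕ.% suc r))      ≡⟨ cong (λ w → αv * (w * a ^ (m ℕ.^ u ℕ.% suc r))) (invˡ αu≢0) ⟩
        αv * (1# * a ^ (m ℕ.^ u ℕ.% suc r))                 ≡⟨ cong (αv *_) (*-identityˡ _) ⟩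
        αv * a ^ (m ℕ.^ u ℕ.% suc r)                        ≡⟨ cong (λ w → αv * a ^ w) residue≡ ⟩
        αv * a ^ (m ℕ.^ v ℕ.% suc r)                        ≡⟨ split (m ℕ.^ v) ⟨
        a ^ (m ℕ.^ v)                                       ∎)
      xᵛ : b * x ^ u ≡ x ^ v
      xᵛ = trans (sym (^-homo-* x s u)) (cong (x ^_) (ℕₚ.m∸n+n≡m (ℕₚ.<⇒≤ u<v)))
      ba′ : b * a′ ≡ l * (a′ * b)
      ba′ = cancelʳ (^≢0 x≢0 u) (begin
        b * a′ * x ^ u          ≡⟨ *-assoc b a′ _ ⟩
        b * (a′ * x ^ u)        ≡⟨ cong (b *_) (x^a u) ⟨
        b * (x ^ u * a)         ≡⟨ *-assoc b _ a ⟨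
        b * x ^ u * a           ≡⟨ cong (_* a) xᵛ ⟩
        x ^ v * a               ≡⟨ x^a v ⟩
        a ^ (m ℕ.^ v) * x ^ v   ≡⟨ cong₂ _*_ la′ (sym xᵛ) ⟩
        l * a′ * (b * x ^ u)    ≡⟨ solve 4 (λ l a b x → (l ⊕ a) ⊕ (b ⊕ x) ⊜ (l ⊕ (a ⊕ b)) ⊕ x) refl l a′ b (x ^ u) ⟩
        l * (a′ * b) * x ^ u    ∎)
      s<r : s ℕ.< suc r
      s<r = ℕₚ.≤-<-trans (ℕₚ.m∸n≤m v u) (Finₚ.toℕ<n j)
      -- Otherwise x and `a′` both commute with the noncentral b = x^s, so they commute with each
      -- other. But x^u conjugates a to `a′`, so a = `a′` and x would commute with a.
      ba′≢ : ¬ Comm b a′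
      ba′≢ c = xa≢ (trans (cong (x *_) (sym a′≡a)) (trans xa′ (cong (_* x) a′≡a)))
        where
        xa′ : Comm x a′
        xa′ = M (below s (ℕₚ.m<n⇒0<n∸m u<v) s<r x-nc) (sym (comm-^ refl s)) (sym c)
        a′≡a : a′ ≡ a
        a′≡a = sym (cancelˡ (^≢0 x≢0 u) (trans (x^a u) (sym (comm-^ xa′ u))))

  commutative : ∀ x y → Comm x y
  commutative x y = decidable-stable (Comm? x y) λ xy≢ → contra x λ c → xy≢ (c y)
    where
    P : ℕ → Set
    P r = ∃[ x ] (¬ Central x × Central (x ^ suc r))
    contra : ∀ x → ¬ Central x → ⊥
    contra x nc with ^-order (noncentral≢0 nc)
    ... | n , eq with least (λ r → Finₚ.any? λ x → ¬? (Central? x) ×-dec Central? (x ^ suc r)) n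
                        (x , nc , subst Central (sym eq) comm-1)
    ...   | r , (a , a-nc , αc) , min = go (Eigenvector.eigenvector a a-nc)
      where
      go : ∃[ x ] ∃[ m ] (x * a ≡ a ^ m * x × ¬ Comm x a) → ⊥
      go (x , m , xa , xa≢) = Minimal.minimal-impossible r
        (λ { (suc j) _ (s≤s j<r) {x} nc c → min j j<r (x , nc , c) }) a-nc αc {x} {m} xa xa≢

centralizer : (A : FinRing) → let open FinRing A in Fin N → SubRing A
centralizer A a = record
  { P = λ x → Comm x a ; P? = λ x → Comm? x a ; +∈ = comm-+ ; *∈ = comm-* ; -∈ = comm--
  ; 0∈ = comm-0 a ; e = 1# ; e∈ = comm-1 a ; e≢0 = 1≢0 ; eˡ = λ _ → *-identityˡ _ ; eʳ = λ _ → *-identityʳ _ }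
  where open RingTools A

wedderburn′ : ∀ n (A : FinRing) → FinRing.N A ℕ.< n → RingTools.IsDivision A →
              ∀ x y → RingTools.Comm A x y
wedderburn′ (suc n) A (s≤s N≤n) div = MinimalCounterexample.commutative A div M
  where
  open RingTools A
  open DivisionRing A div
  M : ∀ {a x y} → ¬ Central a → Comm x a → Comm y a → Comm x y
  M {a} {x} {y} a-nc xa ya = by-centralizer (enumerate (λ x → Comm? x a))
    where
    by-centralizer : Enumeration (λ x → Comm x a) → Comm x y
    by-centralizer E = trans (cong₂ _*_ (sym (ι-index xa)) (sym (ι-index ya)))
      (trans (sym (ι-⊠ _ _)) (trans (cong ι (wedderburn′ n subRing
        (ℕₚ.<-≤-trans (size<n E {proj₁ outside} (λ c → proj₂ outside (sym c))) N≤n) division (index xa) (index ya)))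
      (trans (ι-⊠ _ _) (cong₂ _*_ (ι-index ya) (ι-index xa)))))
      where
      open SubRingAsRing (centralizer A a) E
      outside : ∃[ y ] ¬ Comm a y
      outside with Finₚ.¬∀⟶∃¬ N (Comm a) (Comm? a) a-nc
      ... | y , p = y , p
      division : RingTools.IsDivision subRing
      division i i≢0 = index x⁻∈
        , ι-inj (trans (ι-⊠ _ _) (trans (cong (ι i *_) (ι-index x⁻∈)) (trans (invʳ x≢0) (sym (ι-index _)))))
        , ι-inj (trans (ι-⊠ _ _) (trans (cong (_* ι i) (ι-index x⁻∈)) (trans (invˡ x≢0) (sym (ι-index _)))))
        where
        x≢0 : ι i ≢ 0#
        x≢0 eq = i≢0 (ι-inj (trans eq (sym (ι-index _))))
        x⁻∈ : Comm (inv x≢0) a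
        x⁻∈ = comm-inv (invʳ x≢0) (invˡ x≢0) (ι∈ i)

wedderburn : (A : FinRing) → RingTools.IsDivision A → ∀ x y → RingTools.Comm A x y
wedderburn A = wedderburn′ (suc (FinRing.N A)) A ℕₚ.≤-refl

-- Ideals, idempotents and matrix units

record Ideal (A : FinRing) : Set₁ where
  open FinRing A
  field
    I   : Fin N → Set
    I?  : Decidable I
    0∈  : I 0#
    +∈  : ∀ {x y} → I x → I y → I (x + y)
    *∈ˡ : ∀ r {x} → I x → I (r * x)
    *∈ʳ : ∀ {x} → I x → ∀ r → I (x * r)

  -∈ : ∀ {x} → I x → I (- x)
  -∈ {x} p = subst I (RingTools.-1*x≈-x A x) (*∈ˡ (- 1#) p)

zeroIdeal : (A : FinRing) → Ideal A
zeroIdeal A = record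
  { I = _≡ 0# ; I? = λ x → x Finₚ.≟ 0# ; 0∈ = refl ; +∈ = λ { refl refl → +-identityˡ 0# }
  ; *∈ˡ = λ { r refl → zeroʳ r } ; *∈ʳ = λ { refl r → zeroˡ r } }
  where open FinRing A

Simple : FinRing → Set₁
Simple A = (J : Ideal A) → ∀ {x} → Ideal.I J x → x ≢ 0# → Ideal.I J 1#
  where open FinRing A

module _ (A : FinRing) where
  open RingTools A
  open ≡-Reasoning

  IsUnit : Fin N → Set
  IsUnit x = ∃[ y ] (x * y ≡ 1# × y * x ≡ 1#)

  left-inverse-^ : ∀ {x z} → z * x ≡ 1# → ∀ n → z ^ n * x ^ n ≡ 1#
  left-inverse-^ p zero = *-identityˡ 1#
  left-inverse-^ {x} {z} p (suc n) = begin
    z * z ^ n * (x * x ^ n)     ≡⟨ cong (_* (x * x ^ n)) (comm-^ {z} {z} refl n) ⟨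
    z ^ n * z * (x * x ^ n)     ≡⟨ solve 4 (λ a b c d → (a ⊕ b) ⊕ (c ⊕ d) ⊜ a ⊕ ((b ⊕ c) ⊕ d)) refl (z ^ n) z x (x ^ n) ⟩
    z ^ n * (z * x * x ^ n)     ≡⟨ cong (λ u → z ^ n * (u * x ^ n)) p ⟩
    z ^ n * (1# * x ^ n)        ≡⟨ cong (z ^ n *_) (*-identityˡ _) ⟩
    z ^ n * x ^ n               ≡⟨ left-inverse-^ p n ⟩
    1#                          ∎

  module Local (trivial : ∀ e → e * e ≡ e → e ≡ 0# ⊎ e ≡ 1#) where

    NonUnit : Fin N → Set
    NonUnit x = ¬ IsUnit x

    -- Some positive power of x is idempotent, hence 0 or 1; the value 1 would make x a unit.
    nilpotent : ∀ {x} → NonUnit x → ∃[ n ] x ^ n ≡ 0#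
    nilpotent {x} nu with ^-idempotent x
    ... | m , idem with trivial (x ^ suc m) idem
    ...   | inj₁ ≡0 = suc m , ≡0
    ...   | inj₂ ≡1 = contradiction (x ^ m , ≡1 , trans (comm-^ {x} {x} refl m) ≡1) nu

    no-left-inverse : ∀ {x z} → NonUnit x → z * x ≢ 1#
    no-left-inverse {x} {z} nu eq with nilpotent nu
    ... | n , ≡0 = 1≢0 (trans (sym (left-inverse-^ eq n)) (trans (cong (z ^ n *_) ≡0) (zeroʳ _)))

    no-right-inverse : ∀ {x z} → NonUnit x → x * z ≢ 1#
    no-right-inverse {x} {z} nu eq with nilpotent nu
    ... | n , ≡0 = 1≢0 (trans (sym (left-inverse-^ eq n)) (trans (cong (_* z ^ n) ≡0) (zeroˡ _)))

    *-nonunitˡ : ∀ r {x} → NonUnit x → NonUnit (r * x)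
    *-nonunitˡ r {x} nu (y , _ , l) = no-left-inverse nu (trans (*-assoc y r x) l)

    *-nonunitʳ : ∀ {x} → NonUnit x → ∀ r → NonUnit (x * r)
    *-nonunitʳ {x} nu r (y , rt , _) = no-right-inverse nu (trans (sym (*-assoc x r y)) rt)

    -- From t + w = 1 and t^(m+1) = 0 it follows that w t^m = t^m, so t^m = w^n t^m = 0. The
    -- exponent of t thus descends to t^0 = 1 = 0.
    nilpotents-sum≢1 : ∀ {t w m n} → t ^ m ≡ 0# → w ^ n ≡ 0# → t + w ≢ 1#
    nilpotents-sum≢1 {m = zero} tᵐ wⁿ eq = 1≢0 tᵐ
    nilpotents-sum≢1 {t} {w} {suc m} {n} tᵐ wⁿ eq = nilpotents-sum≢1 {m = m} {n} tm≡0 wⁿ eq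
      where
      wt : w * t ^ m ≡ t ^ m
      wt = begin
        w * t ^ m                ≡⟨ +-identityˡ _ ⟨
        0# + w * t ^ m           ≡⟨ cong (_+ w * t ^ m) tᵐ ⟨
        t * t ^ m + w * t ^ m    ≡⟨ distribʳ (t ^ m) t w ⟨
        (t + w) * t ^ m          ≡⟨ cong (_* t ^ m) eq ⟩
        1# * t ^ m               ≡⟨ *-identityˡ _ ⟩
        t ^ m                    ∎
      wkt : ∀ k → w ^ k * t ^ m ≡ t ^ m
      wkt zero    = *-identityˡ _
      wkt (suc k) = trans (*-assoc w _ _) (trans (cong (w *_) (wkt k)) wt)
      tm≡0 : t ^ m ≡ 0#
      tm≡0 = trans (sym (wkt n)) (trans (cong (_* t ^ m) wⁿ) (zeroˡ _))

    nonUnits : Ideal A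
    nonUnits = record
      { I = NonUnit
      ; I? = λ x → ¬? (Finₚ.any? λ y → (x * y ≟ 1#) ×-dec (y * x ≟ 1#))
      ; 0∈ = λ (y , p , _) → 1≢0 (trans (sym p) (zeroˡ y))
      -- If v inverts x + y, then v x and v y are nonunits, hence nilpotent, with sum 1.
      ; +∈ = λ {x} {y} nx ny (v , _ , l) →
          let m , p = nilpotent (*-nonunitˡ v nx)
              n , q = nilpotent (*-nonunitˡ v ny)
          in nilpotents-sum≢1 {m = m} {n} p q (trans (sym (distribˡ v x y)) l)
      ; *∈ˡ = *-nonunitˡ
      ; *∈ʳ = *-nonunitʳ
      }

    simple⇒division : Simple A → IsDivision
    simple⇒division simple x x≢0 = decidable-stable
      (Finₚ.any? λ y → (x * y ≟ 1#) ×-dec (y * x ≟ 1#))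
      λ nu → simple nonUnits nu x≢0 (1# , *-identityˡ 1# , *-identityˡ 1#)

module _ (A : FinRing) where
  open RingTools A
  open ≡-Reasoning

  module Corner {e} (ee : e * e ≡ e) (e≢0 : e ≢ 0#) where
    corner : SubRing A
    corner = record
      { P   = λ x → e * x ≡ x × x * e ≡ x
      ; P?  = λ x → (e * x ≟ x) ×-dec (x * e ≟ x)
      ; +∈  = λ (p , p′) (q , q′) → trans (distribˡ e _ _) (cong₂ _+_ p q) , trans (distribʳ e _ _) (cong₂ _+_ p′ q′)
      ; *∈  = λ (p , p′) (q , q′) → trans (sym (*-assoc e _ _)) (cong (_* _) p) , trans (*-assoc _ _ e) (cong (_ *_) q′)
      ; -∈  = λ (p , p′) → trans (sym (-‿distribʳ-* e _)) (cong -_ p) , trans (sym (-‿distribˡ-* _ e)) (cong -_ p′)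
      ; 0∈  = zeroʳ e , zeroˡ e
      ; e   = e
      ; e∈  = ee , ee
      ; e≢0 = e≢0
      ; eˡ  = proj₁
      ; eʳ  = proj₂
      }

    cut∈ : ∀ z → SubRing.P corner (e * z * e)
    cut∈ z = trans (sym (*-assoc e (e * z) e)) (cong (_* e) (trans (sym (*-assoc e e z)) (cong (_* z) ee)))
           , trans (*-assoc (e * z) e e) (cong (e * z *_) ee)

    module AsRing (E : Enumeration (SubRing.P corner)) where
      open SubRingAsRing corner E public
      private module D = FinRing subRing

      cut : Fin N → Fin size
      cut z = index (cut∈ z)

      ι-cut : ∀ z → ι (cut z) ≡ e * z * e
      ι-cut z = ι-index (cut∈ z)

      cut-+ : ∀ y z → cut (y + z) ≡ cut y ⊞ cut z
      cut-+ y z = ι-inj (begin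
        ι (cut (y + z))               ≡⟨ ι-cut (y + z) ⟩
        e * (y + z) * e               ≡⟨ trans (cong (_* e) (distribˡ e y z)) (distribʳ e (e * y) (e * z)) ⟩
        e * y * e + e * z * e         ≡⟨ cong₂ _+_ (ι-cut y) (ι-cut z) ⟨
        ι (cut y) + ι (cut z)         ≡⟨ ι-⊞ (cut y) (cut z) ⟨
        ι (cut y ⊞ cut z)             ∎)

      cut-* : ∀ r i s → cut (r * ι i * s) ≡ cut r ⊠ i ⊠ cut s
      cut-* r i s = ι-inj (begin
        ι (cut (r * ι i * s))             ≡⟨ ι-cut _ ⟩
        e * (r * ι i * s) * e             ≡⟨ cong (λ u → e * (r * u * s) * e) (trans (cong (_* e) (proj₁ (ι∈ i))) (proj₂ (ι∈ i))) ⟨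
        e * (r * (e * ι i * e) * s) * e   ≡⟨ solve 4 (λ e r i s → (e ⊕ ((r ⊕ ((e ⊕ i) ⊕ e)) ⊕ s)) ⊕ e ⊜ (((e ⊕ r) ⊕ e) ⊕ i) ⊕ ((e ⊕ s) ⊕ e)) refl e r (ι i) s ⟩
        e * r * e * ι i * (e * s * e)     ≡⟨ cong₂ (λ u v → u * ι i * v) (ι-cut r) (ι-cut s) ⟨
        ι (cut r) * ι i * ι (cut s)       ≡⟨ cong (_* ι (cut s)) (ι-⊠ (cut r) i) ⟨
        ι (cut r ⊠ i) * ι (cut s)         ≡⟨ ι-⊠ (cut r ⊠ i) (cut s) ⟨
        ι (cut r ⊠ i ⊠ cut s)             ∎)

      cut-0 : cut 0# ≡ D.0#
      cut-0 = ι-inj (trans (ι-cut 0#) (trans (trans (cong (_* e) (zeroʳ e)) (zeroˡ e)) (sym (ι-index _))))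

      -- An ideal I of eAe gives the ideal {x | e r x s e ∈ I for all r, s} of A.
      pullback : Ideal subRing → Ideal A
      pullback J = record
        { I   = λ x → ∀ r s → I (cut (r * x * s))
        ; I?  = λ x → Finₚ.all? λ r → Finₚ.all? λ s → I? (cut (r * x * s))
        ; 0∈  = λ r s → subst I (sym (trans (cong cut (trans (cong (_* s) (zeroʳ r)) (zeroˡ s))) cut-0)) 0∈
        ; +∈  = λ {x} {y} p q r s → subst I (sym (trans (cong cut (trans (cong (_* s) (distribˡ r x y))
                  (distribʳ s (r * x) (r * y)))) (cut-+ (r * x * s) (r * y * s)))) (+∈ (p r s) (q r s))
        ; *∈ˡ = λ t {x} p r s → subst (I ∘ cut) (cong (_* s) (*-assoc r t x)) (p (r * t) s)
        ; *∈ʳ = λ {x} p t r s → subst (I ∘ cut) (solve 4 (λ r x t s → (r ⊕ x) ⊕ (t ⊕ s) ⊜ (r ⊕ (x ⊕ t)) ⊕ s) refl r x t s) (p r (t * s))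
        }
        where open Ideal J

      corner-simple : Simple A → Simple subRing
      corner-simple simple J {i} i∈ i≢0 = subst I 1-cut (simple (pullback J) {ι i}
        (λ r s → subst I (sym (cut-* r i s)) (*∈ʳ (*∈ˡ (cut r) i∈) (cut s)))
        (λ eq → i≢0 (ι-inj (trans eq (sym (ι-index _))))) 1# 1#)
        where
        open Ideal J
        1-cut : cut (1# * 1# * 1#) ≡ D.1#
        1-cut = ι-inj (trans (ι-cut _) (trans (cong (λ u → e * u * e) (trans (*-identityʳ _) (*-identityʳ 1#)))
          (trans (cong (_* e) (*-identityʳ e)) (trans ee (sym (ι-index _))))))

  Primitive : Fin N → Set
  Primitive e = ∀ f → f * f ≡ f → e * f ≡ f → f * e ≡ f → f ≡ 0# ⊎ f ≡ e

  -- p₁ = a ∈ eAe′ and q₁ = b ∈ e′Ae with ab = e, ba = e′ where e′ = 1 - e; p₀ = q₀ = e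
  record MatrixUnits (e : Fin N) : Set where
    field
      ee : e * e ≡ e
      e≢0 : e ≢ 0#
      p q : Fin 2 → Fin N
      ep : ∀ i → e * p i ≡ p i
      qe : ∀ i → q i * e ≡ q i
      pq-diag : ∀ i → p i * q i ≡ e
      pq-off  : ∀ i j → i ≢ j → p i * q j ≡ 0#
      qp-sum  : q zero * p zero + q (suc zero) * p (suc zero) ≡ 1#

  module _ {e} (ee : e * e ≡ e) (e≢0 : e ≢ 0#) (e-prim : Primitive e) (simple : Simple A)
    (E : Enumeration (SubRing.P (Corner.corner ee e≢0))) where
    open Corner ee e≢0
    open AsRing E
    private module D = FinRing subRing

    corner-division : RingTools.IsDivision subRing
    corner-division = Local.simple⇒division subRing trivial (corner-simple simple)
      where
      trivial : ∀ i → i ⊠ i ≡ i → i ≡ D.0# ⊎ i ≡ D.1#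
      trivial i ii with e-prim (ι i) (trans (sym (ι-⊠ i i)) (cong ι ii)) (proj₁ (ι∈ i)) (proj₂ (ι∈ i))
      ... | inj₁ eq = inj₁ (ι-inj (trans eq (sym (ι-index _))))
      ... | inj₂ eq = inj₂ (ι-inj (trans eq (sym (ι-index _))))

    module Complementary {e′} (sum : e + e′ ≡ 1#) (e′≢0 : e′ ≢ 0#) (e′-prim : Primitive e′) where
      ee′ : e * e′ ≡ 0#
      ee′ = +-cancelˡ e _ _ (begin
        e + e * e′        ≡⟨ cong (_+ e * e′) ee ⟨
        e * e + e * e′    ≡⟨ distribˡ e e e′ ⟨
        e * (e + e′)      ≡⟨ cong (e *_) sum ⟩
        e * 1#            ≡⟨ *-identityʳ e ⟩
        e                 ≡⟨ +-identityʳ e ⟨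
        e + 0#            ∎)

      e′e : e′ * e ≡ 0#
      e′e = +-cancelˡ e _ _ (begin
        e + e′ * e        ≡⟨ cong (_+ e′ * e) ee ⟨
        e * e + e′ * e    ≡⟨ distribʳ e e e′ ⟨
        (e + e′) * e      ≡⟨ cong (_* e) sum ⟩
        1# * e            ≡⟨ *-identityˡ e ⟩
        e                 ≡⟨ +-identityʳ e ⟨
        e + 0#            ∎)

      e′e′ : e′ * e′ ≡ e′
      e′e′ = begin
        e′ * e′              ≡⟨ +-identityˡ _ ⟨
        0# + e′ * e′         ≡⟨ cong (_+ e′ * e′) ee′ ⟨
        e * e′ + e′ * e′     ≡⟨ distribʳ e′ e e′ ⟨
        (e + e′) * e′        ≡⟨ cong (_* e′) sum ⟩
        1# * e′              ≡⟨ *-identityˡ e′ ⟩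
        e′                   ∎

      -- Were every e r e′ s e zero, the nonzero e′ would lie in the pullback of the zero ideal of
      -- the corner. By simplicity that ideal contains 1, which gives e = 0.
      linked : ∃[ r ] ∃[ s ] cut (r * e′ * s) ≢ D.0#
      linked = decidable-stable (Finₚ.any? λ r → Finₚ.any? λ s → ¬? (cut (r * e′ * s) Finₚ.≟ D.0#)) λ none →
        D.1≢0 (trans (sym (trans (cong cut (trans (*-identityʳ _) (*-identityʳ 1#))) cut-1))
          (simple (pullback (zeroIdeal subRing)) {e′} (λ r s → decidable-stable (_ Finₚ.≟ D.0#) λ ≢0 → none (r , s , ≢0))
            e′≢0 1# 1#))
        where
        cut-1 : cut 1# ≡ D.1#
        cut-1 = ι-inj (trans (ι-cut _) (trans (cong (_* e) (*-identityʳ e)) (trans ee (sym (ι-index _)))))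

      -- With c inverting e r e′ s e in the corner, a = e r e′ and b = e′ s e c satisfy a b = e.
      -- Then b a is a nonzero idempotent under e′, and primitivity of e′ identifies the two.
      from-linked : ∀ r s i → cut (r * e′ * s) ⊠ i ≡ D.1# → MatrixUnits e
      from-linked r s i inverse = record
        { ee = ee ; e≢0 = e≢0
        ; p = λ { zero → e ; (suc zero) → a }
        ; q = λ { zero → e ; (suc zero) → b }
        ; ep = λ { zero → ee ; (suc zero) → ea }
        ; qe = λ { zero → ee ; (suc zero) → be }
        ; pq-diag = λ { zero → ee ; (suc zero) → ab }
        ; pq-off = λ { zero zero ne → contradiction refl ne ; zero (suc zero) _ → eb ; (suc zero) zero _ → ae
                     ; (suc zero) (suc zero) ne → contradiction refl ne }
        ; qp-sum = trans (cong₂ _+_ ee ba) sum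
        }
        where
        c = ι i
        c∈ = ι∈ i
        a = e * r * e′
        b = e′ * s * e * c
        ea : e * a ≡ a
        ea = trans (sym (*-assoc e _ e′)) (cong (_* e′) (trans (sym (*-assoc e e r)) (cong (_* r) ee)))
        be : b * e ≡ b
        be = trans (*-assoc _ c e) (cong (e′ * s * e *_) (proj₂ c∈))
        ae : a * e ≡ 0#
        ae = trans (*-assoc _ e′ e) (trans (cong (e * r *_) e′e) (zeroʳ _))
        eb : e * b ≡ 0#
        eb = trans (solve 5 (λ e e′ s e c → e ⊕ (((e′ ⊕ s) ⊕ e) ⊕ c) ⊜ (e ⊕ e′) ⊕ ((s ⊕ e) ⊕ c)) refl e e′ s e c)
                   (trans (cong (_* (s * e * c)) ee′) (zeroˡ _))
        e′b : e′ * b ≡ b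
        e′b = trans (solve 4 (λ e′ s e c → e′ ⊕ (((e′ ⊕ s) ⊕ e) ⊕ c) ⊜ (((e′ ⊕ e′) ⊕ s) ⊕ e) ⊕ c) refl e′ s e c)
                    (cong (λ u → u * s * e * c) e′e′)
        ae′ : a * e′ ≡ a
        ae′ = trans (*-assoc _ e′ e′) (cong (e * r *_) e′e′)
        ab : a * b ≡ e
        ab = begin
          e * r * e′ * (e′ * s * e * c)
            ≡⟨ solve 5 (λ e r e′ s c → ((e ⊕ r) ⊕ e′) ⊕ (((e′ ⊕ s) ⊕ e) ⊕ c) ⊜ ((e ⊕ ((r ⊕ (e′ ⊕ e′)) ⊕ s)) ⊕ e) ⊕ c) refl e r e′ s c ⟩
          e * (r * (e′ * e′) * s) * e * c       ≡⟨ cong (λ u → e * (r * u * s) * e * c) e′e′ ⟩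
          e * (r * e′ * s) * e * c              ≡⟨ cong (_* c) (ι-cut _) ⟨
          ι (cut (r * e′ * s)) * c              ≡⟨ ι-⊠ (cut (r * e′ * s)) i ⟨
          ι (cut (r * e′ * s) ⊠ i)              ≡⟨ cong ι inverse ⟩
          ι D.1#                                ≡⟨ ι-index _ ⟩
          e                                     ∎
        ba≢0 : b * a ≢ 0#
        ba≢0 eq = e≢0 (begin
          e                  ≡⟨ ee ⟨
          e * e              ≡⟨ cong₂ _*_ ab ab ⟨
          a * b * (a * b)    ≡⟨ solve 4 (λ a b c d → (a ⊕ b) ⊕ (c ⊕ d) ⊜ a ⊕ ((b ⊕ c) ⊕ d)) refl a b a b ⟩
          a * (b * a * b)    ≡⟨ cong (λ u → a * (u * b)) eq ⟩
          a * (0# * b)       ≡⟨ cong (a *_) (zeroˡ b) ⟩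
          a * 0#             ≡⟨ zeroʳ a ⟩
          0#                 ∎)
        ba² : b * a * (b * a) ≡ b * a
        ba² = begin
          b * a * (b * a)   ≡⟨ solve 4 (λ b a c d → (b ⊕ a) ⊕ (c ⊕ d) ⊜ b ⊕ ((a ⊕ c) ⊕ d)) refl b a b a ⟩
          b * (a * b * a)   ≡⟨ cong (λ u → b * (u * a)) ab ⟩
          b * (e * a)       ≡⟨ cong (b *_) ea ⟩
          b * a             ∎
        ba : b * a ≡ e′
        ba = case-≢0 (e′-prim (b * a) ba² (trans (sym (*-assoc e′ b a)) (cong (_* a) e′b))
                                          (trans (*-assoc b a e′) (cong (b *_) ae′)))
          where
          case-≢0 : b * a ≡ 0# ⊎ b * a ≡ e′ → b * a ≡ e′
          case-≢0 (inj₁ eq) = contradiction eq ba≢0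
          case-≢0 (inj₂ eq) = eq

      matrixUnits : MatrixUnits e
      matrixUnits = by-linked linked
        where
        by-linked : ∃[ r ] ∃[ s ] cut (r * e′ * s) ≢ D.0# → MatrixUnits e
        by-linked (r , s , ≢0) = let i , right , _ = corner-division (cut (r * e′ * s)) ≢0
                                 in from-linked r s i right

-- Complex numbers

module KTools (𝕂 : CommutativeRing 0ℓ 0ℓ) where
  open CommutativeRing 𝕂 public
    hiding (zero; ring) renaming (refl to ≈refl; sym to ≈sym; trans to ≈trans)
  open Exp semiring public using (_^_; ^-homo-*; ^-congˡ; ^-assocʳ)
  open Sum semiring public
    using (sum; sum-cong-≋; ∑-distrib-+; ∑-comm; *-distribˡ-sum; *-distribʳ-sum; sum-replicate; sum-replicate-zero)
  open SemiringMult semiring public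
    using (×-congʳ; ×-homo-+; ×-assocˡ; ×-comm-*; ×-assoc-*) renaming (_×_ to _·_)
  open GroupProperties +-group public using () renaming (∙-cancelʳ to +-cancelʳ)
  open CommutativeSemigroupProperties *-commutativeSemigroup public using () renaming (interchange to *-interchange)
  module Solver = SemiringSolver commutativeSemiring
  module ≈-Reasoning = SetoidReasoning setoid

Eventually : (ℕ → Set) → Set
Eventually P = ∃[ M ] (∀ n → M ℕ.≤ n → P n)

module _ {P Q : ℕ → Set} where
  ev-map : (∀ {n} → P n → Q n) → Eventually P → Eventually Q
  ev-map f (M , h) = M , λ n le → f (h n le)

  ev-map₂ : {R : ℕ → Set} → (∀ {n} → P n → Q n → R n) → Eventually P → Eventually Q → Eventually R
  ev-map₂ f (M , h) (L , k) = M ℕ.⊔ L , λ n le → f (h n (max-≤ˡ le)) (k n (max-≤ʳ {M} le))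

ev-all : ∀ {m} {P : Fin m → ℕ → Set} → (∀ i → Eventually (P i)) → Eventually (λ n → ∀ i → P i n)
ev-all {zero}  h = 0 , λ _ _ ()
ev-all {suc m} h = ev-map₂ (λ { p q zero → p ; p q (suc i) → q i }) (h zero) (ev-all (h ∘ suc))

ev-witness : ∀ {P : ℕ → Set} → Eventually P → ∃[ n ] P n
ev-witness (M , h) = M , h M ℕₚ.≤-refl

-- The equality `x ≃ᴿ y` unfolds to `Null` of the difference, so congruence of the operations
-- reduces to closure properties of null sequences.
Null : (ℕ → ℚ) → Set
Null s = ∀ ε → 0ℚ ℚ.< ε → Eventually (λ n → ℚ.∣ s n ∣ ℚ.≤ ε)

null-resp : ∀ {s t} → (∀ n → s n ≡ t n) → Null s → Null t
null-resp eq h ε 0<ε = ev-map (λ {n} → subst (λ x → ℚ.∣ x ∣ ℚ.≤ ε) (eq n)) (h ε 0<ε)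

null-0 : Null (λ _ → 0ℚ)
null-0 ε 0<ε = 0 , λ _ _ → ℚₚ.<⇒≤ 0<ε

null-+ : ∀ {s t} → Null s → Null t → Null (λ n → s n ℚ.+ t n)
null-+ {s} {t} hs ht ε 0<ε = ev-map₂
  (λ {n} p q → ℚₚ.≤-trans (ℚₚ.∣p+q∣≤∣p∣+∣q∣ (s n) (t n)) (subst (_ ℚ.≤_) (½+½ ε) (ℚₚ.+-mono-≤ p q)))
  (hs (½ ℚ.* ε) (0<* 0<½ 0<ε)) (ht (½ ℚ.* ε) (0<* 0<½ 0<ε))

null-neg : ∀ {s} → Null s → Null (λ n → ℚ.- s n)
null-neg {s} h ε 0<ε = ev-map (λ {n} → subst (ℚ._≤ ε) (sym (ℚₚ.∣-p∣≡∣p∣ (s n)))) (h ε 0<ε)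

null-* : ∀ (x : ℝ) {s} → Null s → Null (λ n → seq x n ℚ.* s n)
null-* x {s} h ε 0<ε =
  let K , 0<K , bx = bound x
      δ , 0<δ , eq = divide ε K 0<ε 0<K
  in ev-map₂ (λ {n} p q → ℚₚ.≤-trans (≡⇒≤ (ℚₚ.∣p*q∣≡∣p∣*∣q∣ (seq x n) (s n)))
       (subst (_ ℚ.≤_) eq (*-mono (ℚₚ.0≤∣p∣ (seq x n)) (ℚₚ.<⇒≤ 0<δ) p q))) bx (h δ 0<δ)

≃-pointwise : ∀ {x y} → (∀ n → seq x n ≡ seq y n) → x ≃ᴿ y
≃-pointwise {x} {y} eq = null-resp (λ n → sym (trans (cong (ℚ._- seq y n) (eq n)) (ℚₚ.+-inverseʳ (seq y n)))) null-0

≃-refl : ∀ {x} → x ≃ᴿ x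
≃-refl {x} = ≃-pointwise {x} {x} (λ _ → refl)

≃-sym : ∀ {x y} → x ≃ᴿ y → y ≃ᴿ x
≃-sym {x} {y} h = null-resp (λ n → solve 2 (λ a b → :- (a :- b) := b :- a) refl (seq x n) (seq y n)) (null-neg h)
  where open +-*-Solver

≃-trans : ∀ {x y z} → x ≃ᴿ y → y ≃ᴿ z → x ≃ᴿ z
≃-trans {x} {y} {z} h k = null-resp
  (λ n → solve 3 (λ a b c → (a :- b) :+ (b :- c) := a :- c) refl (seq x n) (seq y n) (seq z n)) (null-+ h k)
  where open +-*-Solver

+ᴿ-cong : ∀ {x y u v} → x ≃ᴿ y → u ≃ᴿ v → x +ᴿ u ≃ᴿ y +ᴿ v
+ᴿ-cong {x} {y} {u} {v} h k = null-resp
  (λ n → solve 4 (λ a b c d → (a :- b) :+ (c :- d) := (a :+ c) :- (b :+ d)) refl (seq x n) (seq y n) (seq u n) (seq v n))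
  (null-+ h k)
  where open +-*-Solver

-ᴿ-cong : ∀ {x y} → x ≃ᴿ y → -ᴿ x ≃ᴿ -ᴿ y
-ᴿ-cong {x} {y} h = null-resp (λ n → solve 2 (λ a b → :- (a :- b) := (:- a) :- (:- b)) refl (seq x n) (seq y n)) (null-neg h)
  where open +-*-Solver

*ᴿ-cong : ∀ {x y u v} → x ≃ᴿ y → u ≃ᴿ v → x *ᴿ u ≃ᴿ y *ᴿ v
*ᴿ-cong {x} {y} {u} {v} h k = null-resp
  (λ n → solve 4 (λ a b c d → a :* (c :- d) :+ d :* (a :- b) := a :* c :- b :* d) refl (seq x n) (seq y n) (seq u n) (seq v n))
  (null-+ (null-* x k) (null-* v h))
  where open +-*-Solver

-ᶜ_ : ℂ → ℂ
-ᶜ z = (-ᴿ re z) +i (-ᴿ im z)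

conjugate : ℂ → ℂ
conjugate z = re z +i (-ᴿ im z)

≃ᶜ-pointwise : ∀ {z w} → (∀ n → seq (re z) n ≡ seq (re w) n) → (∀ n → seq (im z) n ≡ seq (im w) n) → z ≃ᶜ w
≃ᶜ-pointwise {z} {w} p q = ≃-pointwise {re z} {re w} p , ≃-pointwise {im z} {im w} q

-- Each ring law holds exactly at every index of the approximating sequences.
module _ where
  open +-*-Solver

  private
    _⟨_⟩ : ℂ → ℕ → ℚ × ℚ
    z ⟨ n ⟩ = seq (re z) n , seq (im z) n

  ℂ-commutativeRing : CommutativeRing 0ℓ 0ℓ
  ℂ-commutativeRing = record
    { Carrier = ℂ ; _≈_ = _≃ᶜ_ ; _+_ = _+ᶜ_ ; _*_ = _*ᶜ_ ; -_ = -ᶜ_ ; 0# = 0ᶜ ; 1# = 1ᶜ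
    ; isCommutativeRing = record
      { isRing = record
        { +-isAbelianGroup = record
          { isGroup = record
            { isMonoid = record
              { isSemigroup = record
                { isMagma = record
                  { isEquivalence = record
                    { refl  = λ {z} → ≃-refl {re z} , ≃-refl {im z}
                    ; sym   = λ {z} {w} (p , q) → ≃-sym {re z} {re w} p , ≃-sym {im z} {im w} q
                    ; trans = λ {z} {w} {v} (p , q) (p′ , q′) →
                        ≃-trans {re z} {re w} {re v} p p′ , ≃-trans {im z} {im w} {im v} q q′ }
                  ; ∙-cong = λ {z} {w} {u} {v} (p , q) (p′ , q′) →
                      +ᴿ-cong {re z} {re w} {re u} {re v} p p′ , +ᴿ-cong {im z} {im w} {im u} {im v} q q′ }
                ; assoc = λ x y z → ≃ᶜ-pointwise {(x +ᶜ y) +ᶜ z} {x +ᶜ (y +ᶜ z)}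
                    (λ n → ℚₚ.+-assoc (seq (re x) n) (seq (re y) n) (seq (re z) n))
                    (λ n → ℚₚ.+-assoc (seq (im x) n) (seq (im y) n) (seq (im z) n)) }
              ; identity =
                  (λ x → ≃ᶜ-pointwise {0ᶜ +ᶜ x} {x} (λ n → ℚₚ.+-identityˡ (seq (re x) n)) (λ n → ℚₚ.+-identityˡ (seq (im x) n)))
                , (λ x → ≃ᶜ-pointwise {x +ᶜ 0ᶜ} {x} (λ n → ℚₚ.+-identityʳ (seq (re x) n)) (λ n → ℚₚ.+-identityʳ (seq (im x) n))) }
            ; inverse =
                (λ x → ≃ᶜ-pointwise { -ᶜ x +ᶜ x} {0ᶜ} (λ n → ℚₚ.+-inverseˡ (seq (re x) n)) (λ n → ℚₚ.+-inverseˡ (seq (im x) n)))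
              , (λ x → ≃ᶜ-pointwise {x +ᶜ -ᶜ x} {0ᶜ} (λ n → ℚₚ.+-inverseʳ (seq (re x) n)) (λ n → ℚₚ.+-inverseʳ (seq (im x) n)))
            ; ⁻¹-cong = λ {z} {w} (p , q) → -ᴿ-cong {re z} {re w} p , -ᴿ-cong {im z} {im w} q }
          ; comm = λ x y → ≃ᶜ-pointwise {x +ᶜ y} {y +ᶜ x} (λ n → ℚₚ.+-comm (seq (re x) n) (seq (re y) n)) (λ n → ℚₚ.+-comm (seq (im x) n) (seq (im y) n)) }
        ; *-cong = λ {z} {w} {u} {v} (p , q) (p′ , q′) →
              +ᴿ-cong {re z *ᴿ re u} {re w *ᴿ re v} { -ᴿ (im z *ᴿ im u)} { -ᴿ (im w *ᴿ im v)}
                (*ᴿ-cong {re z} {re w} {re u} {re v} p p′)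
                (-ᴿ-cong {im z *ᴿ im u} {im w *ᴿ im v} (*ᴿ-cong {im z} {im w} {im u} {im v} q q′))
            , +ᴿ-cong {re z *ᴿ im u} {re w *ᴿ im v} {im z *ᴿ re u} {im w *ᴿ re v}
                (*ᴿ-cong {re z} {re w} {im u} {im v} p q′) (*ᴿ-cong {im z} {im w} {re u} {re v} q p′)
        ; *-assoc = λ x y z → ≃ᶜ-pointwise {(x *ᶜ y) *ᶜ z} {x *ᶜ (y *ᶜ z)}
            (λ n → solve 6 (λ a b c d e f → (a :* c :- b :* d) :* e :- (a :* d :+ b :* c) :* f
                    := a :* (c :* e :- d :* f) :- b :* (c :* f :+ d :* e)) refl
                    (seq (re x) n) (seq (im x) n) (seq (re y) n) (seq (im y) n) (seq (re z) n) (seq (im z) n))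
            (λ n → solve 6 (λ a b c d e f → (a :* c :- b :* d) :* f :+ (a :* d :+ b :* c) :* e
                    := a :* (c :* f :+ d :* e) :+ b :* (c :* e :- d :* f)) refl
                    (seq (re x) n) (seq (im x) n) (seq (re y) n) (seq (im y) n) (seq (re z) n) (seq (im z) n))
        ; *-identity =
            (λ x → ≃ᶜ-pointwise {1ᶜ *ᶜ x} {x}
              (λ n → solve 2 (λ a b → con 1ℚ :* a :- con 0ℚ :* b := a) refl (seq (re x) n) (seq (im x) n))
              (λ n → solve 2 (λ a b → con 1ℚ :* b :+ con 0ℚ :* a := b) refl (seq (re x) n) (seq (im x) n)))
          , (λ x → ≃ᶜ-pointwise {x *ᶜ 1ᶜ} {x}
              (λ n → solve 2 (λ a b → a :* con 1ℚ :- b :* con 0ℚ := a) refl (seq (re x) n) (seq (im x) n))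
              (λ n → solve 2 (λ a b → a :* con 0ℚ :+ b :* con 1ℚ := b) refl (seq (re x) n) (seq (im x) n)))
        ; distrib =
            (λ x y z → ≃ᶜ-pointwise {x *ᶜ (y +ᶜ z)} {x *ᶜ y +ᶜ x *ᶜ z}
              (λ n → solve 6 (λ a b c d e f → a :* (c :+ e) :- b :* (d :+ f)
                      := (a :* c :- b :* d) :+ (a :* e :- b :* f)) refl
                    (seq (re x) n) (seq (im x) n) (seq (re y) n) (seq (im y) n) (seq (re z) n) (seq (im z) n))
              (λ n → solve 6 (λ a b c d e f → a :* (d :+ f) :+ b :* (c :+ e)
                      := (a :* d :+ b :* c) :+ (a :* f :+ b :* e)) refl
                    (seq (re x) n) (seq (im x) n) (seq (re y) n) (seq (im y) n) (seq (re z) n) (seq (im z) n)))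
          , (λ x y z → ≃ᶜ-pointwise {(y +ᶜ z) *ᶜ x} {y *ᶜ x +ᶜ z *ᶜ x}
              (λ n → solve 6 (λ a b c d e f → (c :+ e) :* a :- (d :+ f) :* b
                      := (c :* a :- d :* b) :+ (e :* a :- f :* b)) refl
                    (seq (re x) n) (seq (im x) n) (seq (re y) n) (seq (im y) n) (seq (re z) n) (seq (im z) n))
              (λ n → solve 6 (λ a b c d e f → (c :+ e) :* b :+ (d :+ f) :* a
                      := (c :* b :+ d :* a) :+ (e :* b :+ f :* a)) refl
                    (seq (re x) n) (seq (im x) n) (seq (re y) n) (seq (im y) n) (seq (re z) n) (seq (im z) n))) }
      ; *-comm = λ x y → ≃ᶜ-pointwise {x *ᶜ y} {y *ᶜ x}
          (λ n → solve 4 (λ a b c d → a :* c :- b :* d := c :* a :- d :* b) refl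
                    (seq (re x) n) (seq (im x) n) (seq (re y) n) (seq (im y) n))
          (λ n → solve 4 (λ a b c d → a :* d :+ b :* c := c :* b :+ d :* a) refl
                    (seq (re x) n) (seq (im x) n) (seq (re y) n) (seq (im y) n)) } }

  conjugate-cong : ∀ {z w} → z ≃ᶜ w → conjugate z ≃ᶜ conjugate w
  conjugate-cong {z} {w} (p , q) = p , -ᴿ-cong {im z} {im w} q

  conjugate-+ : ∀ z w → conjugate (z +ᶜ w) ≃ᶜ conjugate z +ᶜ conjugate w
  conjugate-+ z w = ≃ᶜ-pointwise {conjugate (z +ᶜ w)} {conjugate z +ᶜ conjugate w} (λ _ → refl)
    (λ n → ℚₚ.neg-distrib-+ (seq (im z) n) (seq (im w) n))

  conjugate-* : ∀ z w → conjugate (z *ᶜ w) ≃ᶜ conjugate z *ᶜ conjugate w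
  conjugate-* z w = ≃ᶜ-pointwise {conjugate (z *ᶜ w)} {conjugate z *ᶜ conjugate w}
    (λ n → solve 4 (λ a b c d → a :* c :- b :* d := a :* c :- (:- b) :* (:- d)) refl
             (seq (re z) n) (seq (im z) n) (seq (re w) n) (seq (im w) n))
    (λ n → solve 4 (λ a b c d → :- (a :* d :+ b :* c) := a :* (:- d) :+ (:- b) :* c) refl
             (seq (re z) n) (seq (im z) n) (seq (re w) n) (seq (im w) n))

  conjugate-1 : conjugate 1ᶜ ≃ᶜ 1ᶜ
  conjugate-1 = ≃ᶜ-pointwise {conjugate 1ᶜ} {1ᶜ} (λ _ → refl) (λ _ → refl)

-- re z ≤ q
Below : ℂ → ℚ → Set
Below z q = ∀ ε → 0ℚ ℚ.< ε → Eventually (λ n → seq (re z) n ℚ.≤ q ℚ.+ ε)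

below-resp : ∀ {z w q} → z ≃ᶜ w → Below z q → Below w q
below-resp {z} {w} {q} (p , _) h ε 0<ε = ev-map₂
  (λ {n} a b → begin
    seq (re w) n                 ≤⟨ ∣∣≤⇒≤+ (subst (ℚ._≤ ½ ℚ.* ε) (∣∣-sym (seq (re z) n) (seq (re w) n)) a) ⟩
    seq (re z) n ℚ.+ ½ ℚ.* ε     ≤⟨ ℚₚ.+-monoˡ-≤ (½ ℚ.* ε) b ⟩
    q ℚ.+ ½ ℚ.* ε ℚ.+ ½ ℚ.* ε    ≡⟨ trans (ℚₚ.+-assoc q _ _) (cong (q ℚ.+_) (½+½ ε)) ⟩
    q ℚ.+ ε                      ∎)
  (p (½ ℚ.* ε) (0<* 0<½ 0<ε)) (h (½ ℚ.* ε) (0<* 0<½ 0<ε))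
  where open ℚₚ.≤-Reasoning

0≤sq : ∀ x → 0ℚ ℚ.≤ x ℚ.* x
0≤sq x with ℚₚ.∣p∣≡p∨∣p∣≡-p x
... | inj₁ eq = subst (λ u → 0ℚ ℚ.≤ u ℚ.* u) eq (0≤* (ℚₚ.0≤∣p∣ x) (ℚₚ.0≤∣p∣ x))
... | inj₂ eq = subst (0ℚ ℚ.≤_) (solve 1 (λ u → (:- u) :* (:- u) := u :* u) refl x)
      (subst (λ u → 0ℚ ℚ.≤ u ℚ.* u) eq (0≤* (ℚₚ.0≤∣p∣ x) (ℚₚ.0≤∣p∣ x)))
  where
  open +-*-Solver

0≤+ : ∀ {x y} → 0ℚ ℚ.≤ x → 0ℚ ℚ.≤ y → 0ℚ ℚ.≤ x ℚ.+ y
0≤+ = ℚₚ.+-mono-≤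

≤+ʳ : ∀ {x y} → 0ℚ ℚ.≤ y → x ℚ.≤ x ℚ.+ y
≤+ʳ {x} {y} 0≤y = subst (ℚ._≤ x ℚ.+ y) (ℚₚ.+-identityʳ x) (ℚₚ.+-monoʳ-≤ x 0≤y)

-- At every index the real part of r times its conjugate is a sum of two rational squares.
below-drop : ∀ {z q} r → Below z q → Below (z +ᶜ (-ᶜ (r *ᶜ conjugate r))) q
below-drop {z} {q} r h ε 0<ε = ev-map (λ {n} → ℚₚ.≤-trans (begin
    seq (re z) n ℚ.+ ℚ.- (a n ℚ.* a n ℚ.+ ℚ.- (b n ℚ.* ℚ.- b n))
      ≤⟨ ≤+ʳ (0≤+ (0≤sq (a n)) (0≤sq (b n))) ⟩
    seq (re z) n ℚ.+ ℚ.- (a n ℚ.* a n ℚ.+ ℚ.- (b n ℚ.* ℚ.- b n)) ℚ.+ (a n ℚ.* a n ℚ.+ b n ℚ.* b n)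
      ≡⟨ solve 3 (λ z a b → z :+ :- (a :* a :+ :- (b :* :- b)) :+ (a :* a :+ b :* b) := z) refl (seq (re z) n) (a n) (b n) ⟩
    seq (re z) n ∎)) (h ε 0<ε)
  where
  open ℚₚ.≤-Reasoning
  open +-*-Solver
  a b : ℕ → ℚ
  a = seq (re r)
  b = seq (im r)

open KTools ℂ-commutativeRing using () renaming (sum to sumᶜ; _·_ to _×ᶜ_)

below-sum : ∀ {p q} {z : Fin p → ℂ} → (∀ i → Below (z i) q) → Below (sumᶜ z) (toℚ p ℚ.* q)
below-sum {zero} {q} h ε 0<ε = 0 , λ _ _ → subst (0ℚ ℚ.≤_)
  (sym (trans (cong (ℚ._+ ε) (ℚₚ.*-zeroˡ q)) (ℚₚ.+-identityˡ ε))) (ℚₚ.<⇒≤ 0<ε)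
below-sum {suc p} {q} {z} h ε 0<ε = ev-map₂
  (λ {n} a b → begin
    seq (re (z zero)) n ℚ.+ seq (re (sumᶜ (z ∘ suc))) n           ≤⟨ ℚₚ.+-mono-≤ a b ⟩
    q ℚ.+ ½ ℚ.* ε ℚ.+ (toℚ p ℚ.* q ℚ.+ ½ ℚ.* ε)
      ≡⟨ solve 4 (λ q e p h → q :+ h :* e :+ (p :* q :+ h :* e) := (p :+ con 1ℚ) :* q :+ (h :* e :+ h :* e)) refl q ε (toℚ p) ½ ⟩
    (toℚ p ℚ.+ 1ℚ) ℚ.* q ℚ.+ (½ ℚ.* ε ℚ.+ ½ ℚ.* ε)               ≡⟨ cong₂ (λ u v → u ℚ.* q ℚ.+ v) (toℚ-suc p) (sym (½+½ ε)) ⟨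
    toℚ (suc p) ℚ.* q ℚ.+ ε                                      ∎)
  (h zero (½ ℚ.* ε) (0<* 0<½ 0<ε)) (below-sum {p} {q} {z ∘ suc} (h ∘ suc) (½ ℚ.* ε) (0<* 0<½ 0<ε))
  where
  open ℚₚ.≤-Reasoning
  open +-*-Solver

re-· : ∀ m w n → seq (re (m ×ᶜ w)) n ≡ toℚ m ℚ.* seq (re w) n
re-· zero    w n = sym (ℚₚ.*-zeroˡ (seq (re w) n))
re-· (suc m) w n = trans (cong (seq (re w) n ℚ.+_) (re-· m w n)) (trans
  (solve 2 (λ w m → w :+ m :* w := (m :+ con 1ℚ) :* w) refl (seq (re w) n) (toℚ m))
  (cong (ℚ._* seq (re w) n) (sym (toℚ-suc m))))
  where open +-*-Solver

im-· : ∀ m w n → seq (im (m ×ᶜ w)) n ≡ toℚ m ℚ.* seq (im w) n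
im-· zero    w n = sym (ℚₚ.*-zeroˡ (seq (im w) n))
im-· (suc m) w n = trans (cong (seq (im w) n ℚ.+_) (im-· m w n)) (trans
  (solve 2 (λ w m → w :+ m :* w := (m :+ con 1ℚ) :* w) refl (seq (im w) n) (toℚ m))
  (cong (ℚ._* seq (im w) n) (sym (toℚ-suc m))))
  where open +-*-Solver

0<toℚ-suc : ∀ p → 0ℚ ℚ.< toℚ (suc p)
0<toℚ-suc p = ℚₚ.<-≤-trans (ℚₚ.positive⁻¹ 1ℚ) (toℚ-mono {1} {suc p} (s≤s z≤n))

*-cancel-suc : ∀ p {x y} → toℚ (suc p) ℚ.* x ℚ.≤ toℚ (suc p) ℚ.* y → x ℚ.≤ y
*-cancel-suc p = ℚₚ.*-cancelˡ-≤-pos (toℚ (suc p)) {{ℚ.positive (0<toℚ-suc p)}}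

below-cancel : ∀ p {w q} → Below (suc p ×ᶜ w) (toℚ (suc p) ℚ.* q) → Below w q
below-cancel p {w} {q} h ε 0<ε = ev-map
  (λ {n} a → *-cancel-suc p (subst₂ ℚ._≤_ (re-· (suc p) w n) (sym (ℚₚ.*-distribˡ-+ (toℚ (suc p)) q ε)) a))
  (h (toℚ (suc p) ℚ.* ε) (0<* (0<toℚ-suc p) 0<ε))

·-cancel : ∀ p {w} → suc p ×ᶜ w ≃ᶜ 0ᶜ → w ≃ᶜ 0ᶜ
·-cancel p {w} (h , k) = go (seq (re (suc p ×ᶜ w))) (seq (re w)) (re-· (suc p) w) h
                      , go (seq (im (suc p ×ᶜ w))) (seq (im w)) (im-· (suc p) w) k
  where
  go : (s t : ℕ → ℚ) → (∀ n → s n ≡ toℚ (suc p) ℚ.* t n) → Null (λ n → s n ℚ.- 0ℚ) → Null (λ n → t n ℚ.- 0ℚ)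
  go s t eq h ε 0<ε = ev-map (λ {n} a → *-cancel-suc p (subst (ℚ._≤ toℚ (suc p) ℚ.* ε)
    (trans (cong ℚ.∣_∣ (trans (cong (ℚ._- 0ℚ) (eq n)) (solve 2 (λ p t → p :* t :- con 0ℚ := p :* (t :- con 0ℚ)) refl (toℚ (suc p)) (t n))))
      (trans (ℚₚ.∣p*q∣≡∣p∣*∣q∣ (toℚ (suc p)) (t n ℚ.- 0ℚ)) (cong (ℚ._* ℚ.∣ t n ℚ.- 0ℚ ∣) (ℚₚ.0≤p⇒∣p∣≡p (0≤toℚ (suc p)))))) a))
    (h (toℚ (suc p) ℚ.* ε) (0<* (0<toℚ-suc p) 0<ε))
    where open +-*-Solver

-- The sequence of real parts is constant, so a single index with error 1/2 decides between
-- integers.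
below-nat : ∀ {m u} → Below (m ×ᶜ 1ᶜ) (toℚ u) → m ℕ.≤ u
below-nat {m} {u} h with ev-witness (h ½ 0<½)
... | n , le = ℕₚ.≮⇒≥ λ u<m → ℚₚ.<-irrefl refl (begin-strict
  toℚ u ℚ.+ ½            <⟨ ℚₚ.+-monoʳ-< (toℚ u) (ℚ.*<* (ℤ.+<+ ℕₚ.≤-refl)) ⟩
  toℚ u ℚ.+ 1ℚ           ≡⟨ toℚ-suc u ⟨
  toℚ (suc u)            ≤⟨ toℚ-mono u<m ⟩
  toℚ m                  ≡⟨ ℚₚ.*-identityʳ (toℚ m) ⟨
  toℚ m ℚ.* 1ℚ           ≡⟨ re-· m 1ᶜ n ⟨
  seq (re (m ×ᶜ 1ᶜ)) n    ≤⟨ le ⟩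
  toℚ u ℚ.+ ½            ∎)
  where open ℚₚ.≤-Reasoning

-- The cosine of π/p

squeeze : ∀ {s t : ℕ → ℚ} → (∀ n → ℚ.∣ s n ∣ ℚ.≤ t n) → Null t → Null s
squeeze {s} {t} le h ε 0<ε = ev-map (λ {n} p → ℚₚ.≤-trans (le n) (ℚₚ.≤-trans (p≤∣p∣ (t n)) p)) (h ε 0<ε)
  where
  p≤∣p∣ : ∀ x → x ℚ.≤ ℚ.∣ x ∣
  p≤∣p∣ x = subst (ℚ._≤ ℚ.∣ x ∣) (ℚₚ.+-identityˡ x) (subst (0ℚ ℚ.+ x ℚ.≤_) (ℚₚ.+-identityˡ ℚ.∣ x ∣)
    (∣∣≤⇒≤+ {0ℚ ℚ.+ x} {0ℚ} (ℚₚ.≤-reflexive (cong ℚ.∣_∣ (solve 1 (λ x → con 0ℚ :+ x :- con 0ℚ := x) refl x)))))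
    where open +-*-Solver

1/suc-null : Null 1/suc
1/suc-null ε 0<ε = let N , le = archimedean ε 0<ε in
  N , λ n N≤n → ℚₚ.≤-trans (≡⇒≤ (ℚₚ.0≤p⇒∣p∣≡p (ℚₚ.<⇒≤ (0<1/suc n)))) (ℚₚ.≤-trans (1/suc-antimono N≤n) le)

-- With δ = 1/(n+1) the approximation s satisfies s² ≤ x ≤ (s + δ)² at index n, and the gap 2 s δ +
-- δ² is null because s is bounded.
√-sq : ∀ x → (∀ n → 0ℚ ℚ.≤ seq x n) → √ᴿ x *ᴿ √ᴿ x ≃ᴿ x
√-sq x 0≤x = squeeze {t = t} le
  (null-+ (null-+ (null-* s 1/suc-null) (null-* s 1/suc-null)) (null-* 1/sucᴿ 1/suc-null))
  where
  open +-*-Solver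
  s = √ᴿ x
  1/sucᴿ : ℝ
  1/sucᴿ = mkℝ 1/suc λ ε 0<ε →
    let N , h = ev-map₂ (λ {n} p q → p , q) (1/suc-null (½ ℚ.* ε) (0<* 0<½ 0<ε)) (1/suc-null (½ ℚ.* ε) (0<* 0<½ 0<ε))
    in N , λ m n p q → ℚₚ.≤-trans (ℚₚ.∣p-q∣≤∣p∣+∣q∣ (1/suc m) (1/suc n))
         (subst (_ ℚ.≤_) (½+½ ε) (ℚₚ.+-mono-≤ (proj₁ (h m p)) (proj₁ (h n q))))
  t : ℕ → ℚ
  t n = seq s n ℚ.* 1/suc n ℚ.+ seq s n ℚ.* 1/suc n ℚ.+ 1/suc n ℚ.* 1/suc n
  0≤t : ∀ n → 0ℚ ℚ.≤ t n
  0≤t n = let 0≤s , _ = sqrtApprox-bounds n (seq x n) ; 0≤δ = ℚₚ.<⇒≤ (0<1/suc n)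
          in 0≤+ (0≤+ (0≤* 0≤s 0≤δ) (0≤* 0≤s 0≤δ)) (0≤* 0≤δ 0≤δ)
  le : ∀ n → ℚ.∣ seq s n ℚ.* seq s n ℚ.- seq x n ∣ ℚ.≤ t n
  le n = let _ , lower-bound , upper = sqrtApprox-bounds n (seq x n)
             x⊔0 = ℚₚ.p≥q⇒p⊔q≡p (0≤x n)
         in ≤+⇒∣∣≤ {seq s n ℚ.* seq s n} {seq x n}
           (ℚₚ.≤-trans (subst (seq s n ℚ.* seq s n ℚ.≤_) x⊔0 lower-bound) (≤+ʳ (0≤t n)))
           (subst₂ ℚ._≤_ x⊔0 (solve 2 (λ s d → (s :+ d) :* (s :+ d) := s :* s :+ (s :* d :+ s :* d :+ d :* d)) refl (seq s n) (1/suc n)) upper)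

-- chebyshev c m = sin(mθ)/sin θ for c = cos θ
chebyshev : ℚ → ℕ → ℚ
chebyshev c 0             = 0ℚ
chebyshev c 1             = 1ℚ
chebyshev c (suc (suc m)) = (c ℚ.+ c) ℚ.* chebyshev c (suc m) ℚ.- chebyshev c m

chebyshevᴿ : ℝ → ℕ → ℝ
chebyshevᴿ x 0             = fromℚ 0ℚ
chebyshevᴿ x 1             = fromℚ 1ℚ
chebyshevᴿ x (suc (suc m)) = (x +ᴿ x) *ᴿ chebyshevᴿ x (suc m) -ᴿ chebyshevᴿ x m

chebyshevᴿ-cong : ∀ {x y} → x ≃ᴿ y → ∀ m → chebyshevᴿ x m ≃ᴿ chebyshevᴿ y m
chebyshevᴿ-cong p 0 = ≃-refl {fromℚ 0ℚ}
chebyshevᴿ-cong p 1 = ≃-refl {fromℚ 1ℚ}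
chebyshevᴿ-cong {x} {y} p (suc (suc m)) = +ᴿ-cong
  {(x +ᴿ x) *ᴿ chebyshevᴿ x (suc m)} {(y +ᴿ y) *ᴿ chebyshevᴿ y (suc m)} { -ᴿ chebyshevᴿ x m} { -ᴿ chebyshevᴿ y m}
  (*ᴿ-cong {x +ᴿ x} {y +ᴿ y} {chebyshevᴿ x (suc m)} {chebyshevᴿ y (suc m)} (+ᴿ-cong {x} {y} {x} {y} p p) (chebyshevᴿ-cong {x} {y} p (suc m)))
  (-ᴿ-cong {chebyshevᴿ x m} {chebyshevᴿ y m} (chebyshevᴿ-cong {x} {y} p m))

seq-chebyshev : ∀ x m n → seq (chebyshevᴿ x m) n ≡ chebyshev (seq x n) m
seq-chebyshev x 0 n = refl
seq-chebyshev x 1 n = refl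
seq-chebyshev x (suc (suc m)) n = cong₂ (λ u v → (seq x n ℚ.+ seq x n) ℚ.* u ℚ.- v) (seq-chebyshev x (suc m) n) (seq-chebyshev x m n)

-- Bisection for the least c with chebyshev c j ≥ 0 for all j ≤ p, which is cos(π/p).
module Bisection (p : ℕ) (2≤p : 2 ℕ.≤ p) where
  open +-*-Solver

  Good : ℚ → Set
  Good c = ∀ (j : Fin (suc p)) → 0ℚ ℚ.≤ chebyshev c (toℕ j)

  Good? : ∀ c → Dec (Good c)
  Good? c = Finₚ.all? (λ j → 0ℚ ℚₚ.≤? chebyshev c (toℕ j))

  record Bracket : Set where
    field
      lo hi : ℚ
      -1≤lo : ℚ.- 1ℚ ℚ.≤ lo
      hi≤1  : hi ℚ.≤ 1ℚ
      lo≤hi : lo ℚ.≤ hi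
      bad   : ¬ Good lo
      good  : Good hi

  open Bracket

  start : Bracket
  start = record
    { lo = ℚ.- 1ℚ ; hi = 1ℚ ; -1≤lo = ℚₚ.≤-refl ; hi≤1 = ℚₚ.≤-refl
    ; lo≤hi = ℚₚ.≤-trans (ℚ.*≤* ℤ.-≤+) ℚₚ.≤-refl
    -- The second value at -1 is -2, and p ≥ 2 brings it into the range of j.
    ; bad = λ g → case (subst (λ j → 0ℚ ℚ.≤ chebyshev (ℚ.- 1ℚ) j) (Finₚ.toℕ-fromℕ< (s≤s 2≤p)) (g (fromℕ< (s≤s 2≤p))))
    ; good = λ j → subst (0ℚ ℚ.≤_) (sym (at-1 (toℕ j))) (0≤toℚ (toℕ j)) }
    where
    case : ¬ (0ℚ ℚ.≤ chebyshev (ℚ.- 1ℚ) 2)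
    case (ℚ.*≤* ())
    at-1 : ∀ m → chebyshev 1ℚ m ≡ toℚ m
    at-1 0 = refl
    at-1 1 = refl
    at-1 (suc (suc m)) = trans (cong₂ (λ u v → (1ℚ ℚ.+ 1ℚ) ℚ.* u ℚ.- v) (trans (at-1 (suc m)) (toℚ-suc m)) (at-1 m))
      (trans (solve 1 (λ m → (con 1ℚ :+ con 1ℚ) :* (m :+ con 1ℚ) :- m := m :+ con 1ℚ :+ con 1ℚ) refl (toℚ m))
        (sym (trans (toℚ-suc (suc m)) (cong (ℚ._+ 1ℚ) (toℚ-suc m)))))

  mid : Bracket → ℚ
  mid b = ½ ℚ.* (lo b ℚ.+ hi b)

  lo≤mid : ∀ b → lo b ℚ.≤ mid b
  lo≤mid b = begin
    lo b                     ≡⟨ solve 1 (λ l → l := con ½ :* (l :+ l)) refl (lo b) ⟩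
    ½ ℚ.* (lo b ℚ.+ lo b)    ≤⟨ ℚₚ.*-monoˡ-≤-nonNeg ½ (ℚₚ.+-monoʳ-≤ (lo b) (lo≤hi b)) ⟩
    mid b                    ∎
    where open ℚₚ.≤-Reasoning

  mid≤hi : ∀ b → mid b ℚ.≤ hi b
  mid≤hi b = begin
    mid b                    ≤⟨ ℚₚ.*-monoˡ-≤-nonNeg ½ (ℚₚ.+-monoˡ-≤ (hi b) (lo≤hi b)) ⟩
    ½ ℚ.* (hi b ℚ.+ hi b)    ≡⟨ solve 1 (λ l → con ½ :* (l :+ l) := l) refl (hi b) ⟩
    hi b                     ∎
    where open ℚₚ.≤-Reasoning

  next′ : ∀ b → Dec (Good (mid b)) → Bracket
  next′ b (yes g) = record
    { lo = lo b ; hi = mid b ; -1≤lo = -1≤lo b ; hi≤1 = ℚₚ.≤-trans (mid≤hi b) (hi≤1 b)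
    ; lo≤hi = lo≤mid b ; bad = bad b ; good = g }
  next′ b (no ¬g) = record
    { lo = mid b ; hi = hi b ; -1≤lo = ℚₚ.≤-trans (-1≤lo b) (lo≤mid b) ; hi≤1 = hi≤1 b
    ; lo≤hi = mid≤hi b ; bad = ¬g ; good = good b }

  bracket : ℕ → Bracket
  bracket zero    = start
  bracket (suc n) = next′ (bracket n) (Good? (mid (bracket n)))

  width : Bracket → ℚ
  width b = hi b ℚ.- lo b

  next-width : ∀ b d → width (next′ b d) ≡ ½ ℚ.* width b
  next-width b (yes _) = solve 2 (λ l h → con ½ :* (l :+ h) :- l := con ½ :* (h :- l)) refl (lo b) (hi b)
  next-width b (no _)  = solve 2 (λ l h → h :- con ½ :* (l :+ h) := con ½ :* (h :- l)) refl (lo b) (hi b)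

  next-lo : ∀ b d → lo b ℚ.≤ lo (next′ b d)
  next-lo b (yes _) = ℚₚ.≤-refl
  next-lo b (no _)  = lo≤mid b

  next-hi : ∀ b d → hi (next′ b d) ℚ.≤ hi b
  next-hi b (yes _) = mid≤hi b
  next-hi b (no _)  = ℚₚ.≤-refl

  0≤width : ∀ n → 0ℚ ℚ.≤ width (bracket n)
  0≤width n = subst (ℚ._≤ width (bracket n)) (ℚₚ.+-inverseʳ (lo (bracket n)))
    (ℚₚ.+-monoˡ-≤ (ℚ.- lo (bracket n)) (lo≤hi (bracket n)))

  2ℚ : ℚ
  2ℚ = 1ℚ ℚ.+ 1ℚ

  -- Each step halves the width while n + 1 at most doubles; 2 is the initial width.
  width*suc : ∀ n → width (bracket n) ℚ.* toℚ (suc n) ℚ.≤ 2ℚ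
  width*suc zero = ℚₚ.≤-refl
  width*suc (suc n) = begin
    width (bracket (suc n)) ℚ.* toℚ (suc (suc n))      ≡⟨ cong₂ ℚ._*_ (next-width (bracket n) (Good? (mid (bracket n)))) (toℚ-suc (suc n)) ⟩
    ½ ℚ.* w ℚ.* (toℚ (suc n) ℚ.+ 1ℚ)                   ≤⟨ ℚₚ.*-monoˡ-≤-nonNeg (½ ℚ.* w) {{nn (0≤* (ℚₚ.<⇒≤ 0<½) (0≤width n))}}
                                                            (ℚₚ.+-monoʳ-≤ (toℚ (suc n)) (toℚ-mono {1} {suc n} (s≤s z≤n))) ⟩
    ½ ℚ.* w ℚ.* (toℚ (suc n) ℚ.+ toℚ (suc n))          ≡⟨ solve 2 (λ w t → con ½ :* w :* (t :+ t) := w :* t) refl w (toℚ (suc n)) ⟩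
    w ℚ.* toℚ (suc n)                                  ≤⟨ width*suc n ⟩
    2ℚ                                                 ∎
    where
    open ℚₚ.≤-Reasoning
    w = width (bracket n)

  width≤ : ∀ n → width (bracket n) ℚ.≤ 1/suc n ℚ.+ 1/suc n
  width≤ n = begin
    w                                    ≡⟨ ℚₚ.*-identityʳ w ⟨
    w ℚ.* 1ℚ                             ≡⟨ cong (w ℚ.*_) (suc*1/suc n) ⟨
    w ℚ.* (toℚ (suc n) ℚ.* 1/suc n)      ≡⟨ ℚₚ.*-assoc w (toℚ (suc n)) (1/suc n) ⟨
    w ℚ.* toℚ (suc n) ℚ.* 1/suc n        ≤⟨ ℚₚ.*-monoʳ-≤-nonNeg (1/suc n) {{nn (ℚₚ.<⇒≤ (0<1/suc n))}} (width*suc n) ⟩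
    2ℚ ℚ.* 1/suc n                       ≡⟨ solve 1 (λ d → (con 1ℚ :+ con 1ℚ) :* d := d :+ d) refl (1/suc n) ⟩
    1/suc n ℚ.+ 1/suc n                  ∎
    where
    open ℚₚ.≤-Reasoning
    w = width (bracket n)

  width-null : Null (width ∘ bracket)
  width-null = squeeze (λ n → subst (ℚ._≤ _) (sym (ℚₚ.0≤p⇒∣p∣≡p (0≤width n))) (width≤ n)) (null-+ 1/suc-null 1/suc-null)

  lo-mono : ∀ k n → lo (bracket n) ℚ.≤ lo (bracket (k ℕ.+ n))
  lo-mono zero    n = ℚₚ.≤-refl
  lo-mono (suc k) n = ℚₚ.≤-trans (lo-mono k n) (next-lo (bracket (k ℕ.+ n)) (Good? _))

  hi-anti : ∀ k n → hi (bracket (k ℕ.+ n)) ℚ.≤ hi (bracket n)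
  hi-anti zero    n = ℚₚ.≤-refl
  hi-anti (suc k) n = ℚₚ.≤-trans (next-hi (bracket (k ℕ.+ n)) (Good? _)) (hi-anti k n)

  within : ∀ {N n} → N ℕ.≤ n → lo (bracket N) ℚ.≤ lo (bracket n) × hi (bracket n) ℚ.≤ hi (bracket N)
  within {N} {n} le = subst (λ m → lo (bracket N) ℚ.≤ lo (bracket m) × hi (bracket m) ℚ.≤ hi (bracket N))
    (ℕₚ.m∸n+n≡m le) (lo-mono (n ℕ.∸ N) N , hi-anti (n ℕ.∸ N) N)

  nested-cauchy : (f : Bracket → ℚ) → (∀ b → lo b ℚ.≤ f b) → (∀ b → f b ℚ.≤ hi b) →
    ∀ ε → 0ℚ ℚ.< ε → ∃[ N ] (∀ m n → N ℕ.≤ m → N ℕ.≤ n → ℚ.∣ f (bracket m) ℚ.- f (bracket n) ∣ ℚ.≤ ε)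
  nested-cauchy f lower-bound upper ε 0<ε =
    let N , h = width-null ε 0<ε
        hi≤ = ∣∣≤⇒≤+ {hi (bracket N)} {lo (bracket N)} (h N ℕₚ.≤-refl)
        le : ∀ m n → N ℕ.≤ m → N ℕ.≤ n → f (bracket m) ℚ.≤ f (bracket n) ℚ.+ ε
        le m n p q = ℚₚ.≤-trans (upper (bracket m)) (ℚₚ.≤-trans (proj₂ (within p)) (ℚₚ.≤-trans hi≤
          (ℚₚ.+-monoˡ-≤ ε (ℚₚ.≤-trans (proj₁ (within q)) (lower-bound (bracket n))))))
    in N , λ m n p q → ≤+⇒∣∣≤ (le m n p q) (le n m q p)

  loᴿ hiᴿ : ℝ
  loᴿ = mkℝ (lo ∘ bracket) (nested-cauchy lo (λ _ → ℚₚ.≤-refl) lo≤hi)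
  hiᴿ = mkℝ (hi ∘ bracket) (nested-cauchy hi lo≤hi (λ _ → ℚₚ.≤-refl))

  hi≃lo : hiᴿ ≃ᴿ loᴿ
  hi≃lo = width-null

  half^ : ℕ → ℚ
  half^ zero    = 1ℚ
  half^ (suc j) = ½ ℚ.* half^ j

  0<half^ : ∀ j → 0ℚ ℚ.< half^ j
  0<half^ zero    = ℚₚ.positive⁻¹ 1ℚ
  0<half^ (suc j) = 0<* 0<½ (0<half^ j)

  half^-anti : ∀ k j → half^ (k ℕ.+ j) ℚ.≤ half^ j
  half^-anti zero    j = ℚₚ.≤-refl
  half^-anti (suc k) j = ℚₚ.≤-trans (subst (½ ℚ.* half^ (k ℕ.+ j) ℚ.≤_) (½+½ (half^ (k ℕ.+ j)))
    (≤+ʳ (ℚₚ.<⇒≤ (0<* 0<½ (0<half^ (k ℕ.+ j)))))) (half^-anti k j)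

  module Interior {c} (c≤1 : c ℚ.≤ 1ℚ) (g : Good c) where
    nonneg : ∀ {j} → j ℕ.≤ p → 0ℚ ℚ.≤ chebyshev c j
    nonneg {j} j≤p = subst (λ i → 0ℚ ℚ.≤ chebyshev c i) (Finₚ.toℕ-fromℕ< (s≤s j≤p)) (g (fromℕ< (s≤s j≤p)))

    -- A nonnegative next value means S_j ≤ 2 c S_(j+1), and c ≤ 1 then makes every value at least
    -- half of the one before it, beginning with 1.
    lower-bound : ∀ j → suc j ℕ.< p → half^ j ℚ.≤ chebyshev c (suc j)
    lower-bound zero _ = ℚₚ.≤-refl
    lower-bound (suc j) lt = begin
      ½ ℚ.* half^ j                  ≤⟨ ℚₚ.*-monoˡ-≤-nonNeg ½ (ℚₚ.≤-trans (lower-bound j (ℕₚ.<-trans (ℕₚ.n<1+n _) lt)) a≤2b) ⟩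
      ½ ℚ.* (b ℚ.+ b)                ≡⟨ solve 1 (λ b → con ½ :* (b :+ b) := b) refl b ⟩
      b                              ∎
      where
      open ℚₚ.≤-Reasoning
      a = chebyshev c (suc j)
      b = chebyshev c (suc (suc j))
      0≤b : 0ℚ ℚ.≤ b
      0≤b = nonneg (ℕₚ.<⇒≤ lt)
      a≤2b : a ℚ.≤ b ℚ.+ b
      a≤2b = begin
        a                                            ≤⟨ ≤+ʳ (nonneg lt) ⟩
        a ℚ.+ ((c ℚ.+ c) ℚ.* b ℚ.- a)                ≡⟨ solve 3 (λ a b c → a :+ ((c :+ c) :* b :- a) := c :* b :+ c :* b) refl a b c ⟩
        c ℚ.* b ℚ.+ c ℚ.* b                          ≤⟨ ℚₚ.+-mono-≤ cb≤b cb≤b ⟩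
        b ℚ.+ b                                      ∎
        where
        cb≤b : c ℚ.* b ℚ.≤ b
        cb≤b = subst (c ℚ.* b ℚ.≤_) (ℚₚ.*-identityˡ b) (ℚₚ.*-monoʳ-≤-nonNeg b {{nn 0≤b}} c≤1)

  -- Half of a lower bound for the values at `hi` with index strictly between 0 and p: a value at
  -- `lo` within this distance cannot be negative.
  δ : ℚ
  δ = ½ ℚ.* half^ p

  0<δ : 0ℚ ℚ.< δ
  0<δ = 0<* 0<½ (0<half^ p)

  -- Below p the values at hi are bounded away from 0, so it is chebyshev lo p that is negative.
  module Endpoint (b : Bracket)
    (near : ∀ (j : Fin (suc p)) → chebyshev (hi b) (toℕ j) ℚ.≤ chebyshev (lo b) (toℕ j) ℚ.+ δ) where
    open Interior (hi≤1 b) (good b)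

    positive-below : ∀ i → suc i ℕ.< p → chebyshev (hi b) (suc i) ℚ.≤ chebyshev (lo b) (suc i) ℚ.+ δ →
                     ¬ (chebyshev (lo b) (suc i) ℚ.< 0ℚ)
    positive-below i i<p close neg = ℚₚ.<-irrefl refl (begin-strict
      half^ p                          ≡⟨ cong half^ (ℕₚ.m∸n+n≡m (ℕₚ.≤-trans (ℕₚ.n≤1+n i) (ℕₚ.<⇒≤ i<p))) ⟨
      half^ (p ℕ.∸ i ℕ.+ i)            ≤⟨ half^-anti (p ℕ.∸ i) i ⟩
      half^ i                          ≤⟨ lower-bound i i<p ⟩
      chebyshev (hi b) (suc i)         ≤⟨ close ⟩
      chebyshev (lo b) (suc i) ℚ.+ δ   <⟨ ℚₚ.+-monoˡ-< δ neg ⟩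
      0ℚ ℚ.+ δ                         ≤⟨ ℚₚ.+-monoˡ-≤ δ (ℚₚ.<⇒≤ 0<δ) ⟩
      δ ℚ.+ δ                          ≡⟨ ½+½ (half^ p) ⟩
      half^ p                          ∎)
      where open ℚₚ.≤-Reasoning

    negative⇒p : ∀ i → i ℕ.≤ p → chebyshev (hi b) i ℚ.≤ chebyshev (lo b) i ℚ.+ δ →
                 chebyshev (lo b) i ℚ.< 0ℚ → i ≡ p
    negative⇒p zero    _ _ neg = ⊥-elim (ℚₚ.<-irrefl refl neg)
    negative⇒p (suc i) i≤p close neg =
      ℕₚ.≤-antisym i≤p (ℕₚ.≮⇒≥ λ i<p → positive-below i i<p close neg)

    lo-negative : chebyshev (lo b) p ℚ.< 0ℚ
    lo-negative = negative (Finₚ.¬∀⟶∃¬ (suc p) _ (λ j → 0ℚ ℚₚ.≤? chebyshev (lo b) (toℕ j)) (bad b))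
      where
      negative : (∃[ j ] ¬ (0ℚ ℚ.≤ chebyshev (lo b) (toℕ {suc p} j))) → chebyshev (lo b) p ℚ.< 0ℚ
      negative (j , neg) = subst (λ i → chebyshev (lo b) i ℚ.< 0ℚ)
        (negative⇒p (toℕ j) (ℕₚ.≤-pred (Finₚ.toℕ<n j)) (near j) (ℚₚ.≰⇒> neg)) (ℚₚ.≰⇒> neg)

    small : ∀ {ε} → 0ℚ ℚ.< ε → chebyshev (hi b) p ℚ.≤ chebyshev (lo b) p ℚ.+ ε →
            ℚ.∣ chebyshev (hi b) p ℚ.- 0ℚ ∣ ℚ.≤ ε
    small {ε} 0<ε close = ≤+⇒∣∣≤ {b = 0ℚ}
      (ℚₚ.≤-trans close (ℚₚ.+-monoˡ-≤ ε (ℚₚ.<⇒≤ lo-negative)))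
      (0≤+ (nonneg ℕₚ.≤-refl) (ℚₚ.<⇒≤ 0<ε))

  -- Once the values at both ends are close for all indices up to p, the p-th one is negative at
  -- `lo` and nonnegative at `hi`; their difference tends to 0, so the value at `hi` does too.
  root : chebyshevᴿ hiᴿ p ≃ᴿ fromℚ 0ℚ
  root ε 0<ε = ev-map₂ (λ {n} near near-p →
      subst (λ u → ℚ.∣ u ℚ.- 0ℚ ∣ ℚ.≤ ε) (sym (seq-chebyshev hiᴿ p n))
        (Endpoint.small (bracket n) (λ j → values (toℕ j) n (near j)) 0<ε (values p n near-p)))
    (ev-all {suc p} (λ j → chebyshevᴿ-cong {hiᴿ} {loᴿ} hi≃lo (toℕ j) δ 0<δ))
    (chebyshevᴿ-cong {hiᴿ} {loᴿ} hi≃lo p ε 0<ε)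
    where
    values : ∀ {ε} j n → ℚ.∣ seq (chebyshevᴿ hiᴿ j) n ℚ.- seq (chebyshevᴿ loᴿ j) n ∣ ℚ.≤ ε →
             chebyshev (hi (bracket n)) j ℚ.≤ chebyshev (lo (bracket n)) j ℚ.+ ε
    values {ε} j n h = ∣∣≤⇒≤+ (subst₂ (λ u v → ℚ.∣ u ℚ.- v ∣ ℚ.≤ ε) (seq-chebyshev hiᴿ j n) (seq-chebyshev loᴿ j n) h)

-- Roots of unity

module _ (𝕂 : CommutativeRing 0ℓ 0ℓ) where
  open KTools 𝕂
  open ≈-Reasoning
  open Solver

  -- With t = η + η⁻¹ and S the Chebyshev recursion, S_m η^m = (1 + η² + ... + η^(2m-2)) η.
  geometric-chebyshev : ∀ {η η⁻} → η * η⁻ ≈ 1# → (S : ℕ → Carrier) → S 0 ≈ 0# → S 1 ≈ 1# →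
    (∀ m → S (suc (suc m)) + S m ≈ (η + η⁻) * S (suc m)) →
    ∀ p → S p ≈ 0# → sum {p} (λ j → (η * η) ^ toℕ j) ≈ 0#
  geometric-chebyshev {η} {η⁻} ηη⁻ S S0 S1 rec p Sp = begin
    X p                  ≈⟨ *-identityʳ (X p) ⟨
    X p * 1#             ≈⟨ *-congˡ ηη⁻ ⟨
    X p * (η * η⁻)       ≈⟨ *-assoc (X p) η η⁻ ⟨
    X p * η * η⁻         ≈⟨ *-congʳ (proj₁ (claim p)) ⟨
    S p * η ^ p * η⁻     ≈⟨ *-congʳ (*-congʳ Sp) ⟩
    0# * η ^ p * η⁻      ≈⟨ *-congʳ (zeroˡ _) ⟩
    0# * η⁻              ≈⟨ zeroˡ _ ⟩
    0#                   ∎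
    where
    ζ = η * η
    X : ℕ → Carrier
    X m = sum {m} (λ j → ζ ^ toℕ j)
    X-suc : ∀ m → X (suc m) ≈ 1# + ζ * X m
    X-suc m = +-congˡ (≈sym (*-distribˡ-sum ζ (λ j → ζ ^ toℕ {m} j)))
    claim : ∀ m → (S m * η ^ m ≈ X m * η) × (S (suc m) * η ^ suc m ≈ X (suc m) * η)
    claim zero = ≈trans (*-congʳ S0) (≈trans (zeroˡ _) (≈sym (zeroˡ η)))
               , ≈trans (*-cong S1 (*-identityʳ η)) (*-congʳ (≈sym (+-identityʳ 1#)))
    claim (suc m) with claim m
    -- The term with S_m is added on both sides because `rec` is stated as a sum.
    ... | c₀ , c₁ = c₁ , +-cancelʳ (ζ * (S m * η ^ m)) _ _ (begin
      S (suc (suc m)) * (η * (η * η ^ m)) + ζ * (S m * η ^ m)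
        ≈⟨ solve 4 (λ s₂ s₀ e p → s₂ :* (e :* (e :* p)) :+ (e :* e) :* (s₀ :* p) := (s₂ :+ s₀) :* (e :* (e :* p))) ≈refl
             (S (suc (suc m))) (S m) η (η ^ m) ⟩
      (S (suc (suc m)) + S m) * (η * (η * η ^ m))
        ≈⟨ *-congʳ (rec m) ⟩
      (η + η⁻) * S (suc m) * (η * (η * η ^ m))
        ≈⟨ solve 4 (λ e f s p → (e :+ f) :* s :* (e :* (e :* p)) := (e :* e :+ e :* f) :* (s :* (e :* p))) ≈refl η η⁻ (S (suc m)) (η ^ m) ⟩
      (ζ + η * η⁻) * (S (suc m) * (η * η ^ m))
        ≈⟨ *-cong (+-congˡ ηη⁻) c₁ ⟩
      (ζ + 1#) * (X (suc m) * η)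
        ≈⟨ ≈trans (solve 3 (λ z x e → (z :+ con 1) :* (x :* e) := (z :* x :+ x) :* e) ≈refl ζ (X (suc m)) η)
                 (*-congʳ (+-congˡ (X-suc m))) ⟩
      (ζ * X (suc m) + (1# + ζ * X m)) * η
        ≈⟨ solve 4 (λ z y x e → (z :* y :+ (con 1 :+ z :* x)) :* e := (con 1 :+ z :* y) :* e :+ z :* (x :* e)) ≈refl ζ (X (suc m)) (X m) η ⟩
      (1# + ζ * X (suc m)) * η + ζ * (X m * η)
        ≈⟨ +-cong (*-congʳ (≈sym (X-suc (suc m)))) (*-congˡ (≈sym c₀)) ⟩
      X (suc (suc m)) * η + ζ * (S m * η ^ m) ∎)

-- Abstracts from ℂ, whose operations are expensive to unfold; Bd z u stands for re z ≤ u.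
record Scalars : Set₁ where
  field
    𝕂 : CommutativeRing 0ℓ 0ℓ
  open KTools 𝕂 public
  field
    conj      : Carrier → Carrier
    conj-cong : ∀ {x y} → x ≈ y → conj x ≈ conj y
    conj-+    : ∀ x y → conj (x + y) ≈ conj x + conj y
    conj-*    : ∀ x y → conj (x * y) ≈ conj x * conj y
    conj-1    : conj 1# ≈ 1#
    1≉0       : ¬ 1# ≈ 0#
    ·-cancel₀ : ∀ p {x} → suc p · x ≈ 0# → x ≈ 0#
    Bd         : Carrier → ℕ → Set
    bd-resp    : ∀ {x y u} → x ≈ y → Bd x u → Bd y u
    bd-drop    : ∀ {x u} r → Bd x u → Bd (x + - (r * conj r)) u
    bd-average : ∀ p {u} {z : Fin (suc p) → Carrier} {w} → (∀ i → Bd (z i) u) → sum z ≈ suc p · w → Bd w u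
    bd-nat     : ∀ {m u} → Bd (m · 1#) u → m ℕ.≤ u
    root       : ∀ p → 2 ℕ.≤ p → ∃[ ζ ] (ζ * conj ζ ≈ 1# × sum {p} (λ j → ζ ^ toℕ j) ≈ 0#)

-- With c = cos(π/p) and s = √(1 - c²), η is exp(πi/p) and ζ = η² is exp(2πi/p). The vanishing of
-- the p-th Chebyshev value at c becomes the vanishing of the geometric sum of ζ.
module RootOfUnity (p : ℕ) (2≤p : 2 ℕ.≤ p) where
  open Bisection p 2≤p
  open +-*-Solver
  private module K = KTools ℂ-commutativeRing

  c : ℝ
  c = hiᴿ

  1-c² : ℝ
  1-c² = fromℚ 1ℚ -ᴿ c *ᴿ c

  s : ℝ
  s = √ᴿ 1-c²

  η : ℂ
  η = c +i s

  0≤1-c² : ∀ n → 0ℚ ℚ.≤ seq 1-c² n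
  0≤1-c² n = ≡.subst (0ℚ ℚ.≤_) (solve 1 (λ x → (con 1ℚ :+ x) :* (con 1ℚ :- x) := con 1ℚ :- x :* x) ≡.refl x)
    (0≤* (≡.subst (ℚ._≤ 1ℚ ℚ.+ x) (ℚₚ.+-inverseʳ 1ℚ) (ℚₚ.+-monoʳ-≤ 1ℚ (ℚₚ.≤-trans (-1≤lo b) (lo≤hi b))))
         (≡.subst (ℚ._≤ 1ℚ ℚ.- x) (ℚₚ.+-inverseʳ x) (ℚₚ.+-monoˡ-≤ (ℚ.- x) (hi≤1 b))))
    where
    open Bracket
    b = bracket n
    x = hi b

  ηη̄ : η *ᶜ conjugate η ≃ᶜ 1ᶜ
  ηη̄ = null-resp (λ n → solve 2 (λ c s → s :* s :- (con 1ℚ :- c :* c) := (c :* c :- s :* (:- s)) :- con 1ℚ) ≡.refl (seq c n) (seq s n))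
         (√-sq 1-c² 0≤1-c²)
     , ≃-pointwise {im (η *ᶜ conjugate η)} {fromℚ 0ℚ} (λ n → solve 2 (λ c s → c :* (:- s) :+ s :* c := con 0ℚ) ≡.refl (seq c n) (seq s n))

  S : ℕ → ℂ
  S m = chebyshevᴿ c m +i fromℚ 0ℚ

  S-rec : ∀ m → S (suc (suc m)) +ᶜ S m ≃ᶜ (η +ᶜ conjugate η) *ᶜ S (suc m)
  S-rec m = ≃ᶜ-pointwise {S (suc (suc m)) +ᶜ S m} {(η +ᶜ conjugate η) *ᶜ S (suc m)}
    (λ n → solve 4 (λ c s a b → (c :+ c) :* a :- b :+ b := (c :+ c) :* a :- (s :- s) :* con 0ℚ) ≡.refl
             (seq c n) (seq s n) (seq (chebyshevᴿ c (suc m)) n) (seq (chebyshevᴿ c m) n))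
    (λ n → solve 3 (λ c s a → con 0ℚ :+ con 0ℚ := (c :+ c) :* con 0ℚ :+ (s :- s) :* a) ≡.refl
             (seq c n) (seq s n) (seq (chebyshevᴿ c (suc m)) n))

  ζ : ℂ
  ζ = η *ᶜ η

  ζζ̄ : ζ *ᶜ conjugate ζ ≃ᶜ 1ᶜ
  ζζ̄ = K.≈trans {ζ *ᶜ conjugate ζ} {(η *ᶜ conjugate η) *ᶜ (η *ᶜ conjugate η)} {1ᶜ}
    (≃ᶜ-pointwise {ζ *ᶜ conjugate ζ} {(η *ᶜ conjugate η) *ᶜ (η *ᶜ conjugate η)}
      (λ n → solve 2 (λ c s → (c :* c :- s :* s) :* (c :* c :- s :* s) :- (c :* s :+ s :* c) :* (:- (c :* s :+ s :* c))
        := (c :* c :- s :* (:- s)) :* (c :* c :- s :* (:- s)) :- (c :* (:- s) :+ s :* c) :* (c :* (:- s) :+ s :* c)) ≡.refl (seq c n) (seq s n))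
      (λ n → solve 2 (λ c s → (c :* c :- s :* s) :* (:- (c :* s :+ s :* c)) :+ (c :* s :+ s :* c) :* (c :* c :- s :* s)
        := (c :* c :- s :* (:- s)) :* (c :* (:- s) :+ s :* c) :+ (c :* (:- s) :+ s :* c) :* (c :* c :- s :* (:- s))) ≡.refl (seq c n) (seq s n)))
    (K.≈trans {(η *ᶜ conjugate η) *ᶜ (η *ᶜ conjugate η)} {1ᶜ *ᶜ 1ᶜ} {1ᶜ}
      (K.*-cong {η *ᶜ conjugate η} {1ᶜ} {η *ᶜ conjugate η} {1ᶜ} ηη̄ ηη̄) (K.*-identityˡ 1ᶜ))

  Σζ : K.sum {p} (λ j → ζ K.^ toℕ j) ≃ᶜ 0ᶜ
  Σζ = geometric-chebyshev ℂ-commutativeRing {η} {conjugate η} ηη̄ S (K.≈refl {0ᶜ}) (K.≈refl {1ᶜ}) S-rec p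
    (root , ≃-refl {fromℚ 0ℚ})

module _ where
  private module K = KTools ℂ-commutativeRing

  1≄0 : ¬ 1ᶜ ≃ᶜ 0ᶜ
  1≄0 eq = 1≰0 (below-nat {1} {0} (below-resp {0ᶜ} {1 K.· 1ᶜ} {toℚ 0} (K.≈sym {1 K.· 1ᶜ} {0ᶜ}
      (K.≈trans {1 K.· 1ᶜ} {1ᶜ} {0ᶜ} (K.+-identityʳ 1ᶜ) eq)) (λ ε 0<ε → 0 , λ _ _ → ≤+ʳ (ℚₚ.<⇒≤ 0<ε))))
    where
    1≰0 : ¬ (1 ℕ.≤ 0)
    1≰0 ()

  below-average : ∀ p {q} {z : Fin (suc p) → ℂ} {w} → (∀ i → Below (z i) q) → K.sum z ≃ᶜ suc p K.· w → Below w q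
  below-average p {q} {z} {w} h eq = below-cancel p {w} {q}
    (below-resp {K.sum z} {suc p K.· w} {toℚ (suc p) ℚ.* q} eq (below-sum {suc p} {q} {z} h))

-- toℚ, kept from unfolding: comparing normalised fractions is expensive.
abstract
  ℕ⇒ℚ : ℕ → ℚ
  ℕ⇒ℚ = toℚ

  ℕ⇒ℚ≡toℚ : ∀ n → ℕ⇒ℚ n ≡ toℚ n
  ℕ⇒ℚ≡toℚ n = ≡.refl

ℂ-scalars : Scalars
ℂ-scalars = record
  { 𝕂 = ℂ-commutativeRing
  ; conj = conjugate
  ; conj-cong = λ {z} {w} → conjugate-cong {z} {w}
  ; conj-+ = conjugate-+
  ; conj-* = conjugate-*
  ; conj-1 = conjugate-1
  ; 1≉0 = 1≄0
  ; ·-cancel₀ = λ p {x} → ·-cancel p {x}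
  ; Bd = λ z u → Below z (ℕ⇒ℚ u)
  ; bd-resp = λ {z} {w} {u} → below-resp {z} {w} {ℕ⇒ℚ u}
  ; bd-drop = λ {z} {u} r → below-drop {z} {ℕ⇒ℚ u} r
  ; bd-average = λ p {u} {z} {w} → below-average p {ℕ⇒ℚ u} {z} {w}
  ; bd-nat = λ {m} {u} h → below-nat {m} {u} (≡.subst (Below (m K.· 1ᶜ)) (ℕ⇒ℚ≡toℚ u) h)
  ; root = λ p 2≤p → RootOfUnity.ζ p 2≤p , RootOfUnity.ζζ̄ p 2≤p , RootOfUnity.Σζ p 2≤p
  }
  where module K = KTools ℂ-commutativeRing

-- Second moments of twisted sums

module ScalarTools (Sc : Scalars) where
  open Scalars Sc public
  open ≈-Reasoning

  𝟙 : {P : Set} → Dec P → Carrier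
  𝟙 (yes _) = 1#
  𝟙 (no _)  = 0#

  𝟙-yes : {P : Set} (d : Dec P) → P → 𝟙 d ≈ 1#
  𝟙-yes (yes _) p = ≈refl
  𝟙-yes (no ¬p) p = contradiction p ¬p

  sum-0 : ∀ {n} {f : Fin n → Carrier} → (∀ i → f i ≈ 0#) → sum f ≈ 0#
  sum-0 {n} h = ≈trans (sum-cong-≋ h) (sum-replicate-zero n)

  conj-0 : conj 0# ≈ 0#
  conj-0 = +-cancelʳ (conj 0#) _ _ (begin
    conj 0# + conj 0#   ≈⟨ conj-+ 0# 0# ⟨
    conj (0# + 0#)      ≈⟨ conj-cong (+-identityˡ 0#) ⟩
    conj 0#             ≈⟨ +-identityˡ _ ⟨
    0# + conj 0#        ∎)

  conj-sum : ∀ {n} (f : Fin n → Carrier) → conj (sum f) ≈ sum (conj ∘ f)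
  conj-sum {zero}  f = conj-0
  conj-sum {suc n} f = ≈trans (conj-+ _ _) (+-congˡ (conj-sum (f ∘ suc)))

  conj-^ : ∀ x n → conj (x ^ n) ≈ conj x ^ n
  conj-^ x zero    = conj-1
  conj-^ x (suc n) = ≈trans (conj-* x (x ^ n)) (*-congˡ (conj-^ x n))

  conj-· : ∀ n x → conj (n · x) ≈ n · conj x
  conj-· zero    x = conj-0
  conj-· (suc n) x = ≈trans (conj-+ x (n · x)) (+-congˡ (conj-· n x))

  1^ : ∀ n → 1# ^ n ≈ 1#
  1^ zero    = ≈refl
  1^ (suc n) = ≈trans (*-identityˡ _) (1^ n)

  ^-distrib-* : ∀ x y n → (x * y) ^ n ≈ x ^ n * y ^ n
  ^-distrib-* x y zero    = ≈sym (*-identityˡ 1#)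
  ^-distrib-* x y (suc n) = ≈trans (*-congˡ (^-distrib-* x y n))
    (solve 4 (λ x y p q → (x :* y) :* (p :* q) := (x :* p) :* (y :* q)) ≈refl x y (x ^ n) (y ^ n))
    where open Solver

  ·-sum : ∀ {n} m (f : Fin n → Carrier) → sum (λ i → m · f i) ≈ m · sum f
  ·-sum {zero}  m f = ≈sym (·-0 m)
    where
    ·-0 : ∀ m → m · 0# ≈ 0#
    ·-0 zero    = ≈refl
    ·-0 (suc m) = ≈trans (+-identityˡ _) (·-0 m)
  ·-sum {suc n} m f = ≈trans (+-congˡ (·-sum m (f ∘ suc))) (≈sym (distrib-· m (f zero) (sum (f ∘ suc))))
    where
    distrib-· : ∀ m x y → m · (x + y) ≈ m · x + m · y
    distrib-· zero    x y = ≈sym (+-identityˡ 0#)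
    distrib-· (suc m) x y = ≈trans (+-congˡ (distrib-· m x y))
      (solve 4 (λ x y a b → (x :+ y) :+ (a :+ b) := (x :+ a) :+ (y :+ b)) ≈refl x y (m · x) (m · y))
      where open Solver

  sum-𝟙 : ∀ {n} {P : Fin n → Set} (P? : Decidable P) →
          sum (λ y → 𝟙 (P? y)) ≈ Enumeration.size (enumerate P?) · 1#
  sum-𝟙 {zero}  P? = ≈refl
  sum-𝟙 {suc n} P? with P? zero
  ... | yes _ = +-congˡ (sum-𝟙 (P? ∘ suc))
  ... | no _  = ≈trans (+-identityˡ _) (sum-𝟙 (P? ∘ suc))

  sum-≥ : ∀ {n m} (s : Fin n → ℕ) → (∀ i → m ℕ.≤ s i) → ∃[ k ] (n ℕ.* m ℕ.≤ k × sum (λ i → s i · 1#) ≈ k · 1#)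
  sum-≥ {zero}  s h = 0 , z≤n , ≈refl
  sum-≥ {suc n} s h with sum-≥ (s ∘ suc) (h ∘ suc)
  ... | k , le , eq = s zero ℕ.+ k , ℕₚ.+-mono-≤ (h zero) le , ≈trans (+-congˡ eq) (≈sym (×-homo-+ 1# (s zero) k))

module Moments (Sc : Scalars) {n} (o : Fin n) (p′ : ℕ) where
  open ScalarTools Sc
  open ≈-Reasoning
  open Solver

  p : ℕ
  p = suc p′

  -- A unimodular function t with t(x) / t(y) a p-th root of unity, equal to 1 iff R x y.
  record Twist : Set₁ where
    field
      t    : Fin n → Carrier
      t-o  : t o ≈ 1#
      R    : Fin n → Fin n → Set
      R?   : ∀ x y → Dec (R x y)
      orth : ∀ x y → sum {p} (λ m → (t x * conj (t y)) ^ toℕ m) ≈ p · 𝟙 (R? x y)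

  twisted : Twist → ℕ → (Fin n → Carrier) → Fin n → Carrier
  twisted T m g x = g x * Twist.t T x ^ m

  Twists : ℕ → Set₁
  Twists k = Fin k → Twist

  AllR : ∀ {k} → Twists k → Fin n → Fin n → Set
  AllR ts x y = ∀ i → Twist.R (ts i) x y

  AllR? : ∀ {k} (ts : Twists k) x y → Dec (AllR ts x y)
  AllR? ts x y = Finₚ.all? (λ i → Twist.R? (ts i) x y)

  -- The indicator of `AllR ts`, kept as a product because averaging over one twist inserts one
  -- factor.
  W : ∀ {k} → Twists k → Fin n → Fin n → Carrier
  W {zero}  ts x y = 1#
  W {suc k} ts x y = W (ts ∘ suc) x y * 𝟙 (Twist.R? (ts zero) x y)

  W-yes : ∀ {k} (ts : Twists k) {x y} → AllR ts x y → W ts x y ≈ 1#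
  W-yes {zero}  ts r = ≈refl
  W-yes {suc k} ts {x} {y} r = ≈trans (*-cong (W-yes (ts ∘ suc) (r ∘ suc)) (𝟙-yes (Twist.R? (ts zero) x y) (r zero))) (*-identityˡ 1#)

  W-no : ∀ {k} (ts : Twists k) {x y} → ¬ AllR ts x y → W ts x y ≈ 0#
  W-no {zero}  ts ¬r = contradiction (λ ()) ¬r
  W-no {suc k} ts {x} {y} ¬r with Twist.R? (ts zero) x y
  ... | yes r = ≈trans (*-congʳ (W-no (ts ∘ suc) (λ rs → ¬r λ { zero → r ; (suc i) → rs i }))) (zeroˡ _)
  ... | no  _ = zeroʳ _

  norm² : Carrier → Carrier
  norm² z = z * conj z

  -- When `AllR ts` is an equivalence relation, this is the sum over its classes of the squared
  -- moduli of the sums of g.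
  E : ∀ {k} → Twists k → (Fin n → Carrier) → Carrier
  E ts g = sum λ x → sum λ y → W ts x y * (g x * conj (g y))

  E-[] : ∀ (ts : Twists 0) g → norm² (sum g) ≈ E ts g
  E-[] ts g = begin
    sum g * conj (sum g)                         ≈⟨ *-distribʳ-sum (conj (sum g)) g ⟩
    sum (λ x → g x * conj (sum g))               ≈⟨ sum-cong-≋ {n} (λ x → *-congˡ (conj-sum g)) ⟩
    sum (λ x → g x * sum (conj ∘ g))             ≈⟨ sum-cong-≋ {n} (λ x → *-distribˡ-sum (g x) (conj ∘ g)) ⟩
    sum (λ x → sum λ y → g x * conj (g y))       ≈⟨ sum-cong-≋ {n} (λ x → sum-cong-≋ {n} λ y → ≈sym (*-identityˡ (g x * conj (g y)))) ⟩
    E ts g                                       ∎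

  -- Twisting g by t^m multiplies the term of x and y by the m-th power of t(x) times the conjugate
  -- of t(y); the sum over m is p times the indicator of R by orthogonality.
  E-average : ∀ {k} (ts : Twists (suc k)) g →
    sum {p} (λ m → E (ts ∘ suc) (twisted (ts zero) (toℕ m) g)) ≈ p · E ts g
  E-average ts⁺ g = begin
    sum {p} (λ m → sum λ x → sum λ y → W ts x y * (twisted T (toℕ m) g x * conj (twisted T (toℕ m) g y)))
      ≈⟨ sum-cong-≋ {p} (λ m → sum-cong-≋ {n} λ x → sum-cong-≋ {n} λ y → term (toℕ m) x y) ⟩
    sum {p} (λ m → sum λ x → sum λ y → v x y * u x y ^ toℕ m)
      ≈⟨ ∑-comm {p} (λ m x → sum λ y → v x y * u x y ^ toℕ m) ⟩
    sum (λ x → sum {p} λ m → sum λ y → v x y * u x y ^ toℕ m)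
      ≈⟨ sum-cong-≋ {n} (λ x → ∑-comm {p} (λ m y → v x y * u x y ^ toℕ m)) ⟩
    sum (λ x → sum λ y → sum {p} λ m → v x y * u x y ^ toℕ m)
      ≈⟨ sum-cong-≋ {n} (λ x → sum-cong-≋ {n} λ y → inner x y) ⟩
    sum (λ x → sum λ y → p · (W ts⁺ x y * (g x * conj (g y))))
      ≈⟨ sum-cong-≋ {n} (λ x → ·-sum p (λ y → W ts⁺ x y * (g x * conj (g y)))) ⟩
    sum (λ x → p · sum (λ y → W ts⁺ x y * (g x * conj (g y))))
      ≈⟨ ·-sum p (λ x → sum (λ y → W ts⁺ x y * (g x * conj (g y)))) ⟩
    p · E ts⁺ g ∎
    where
    T = ts⁺ zero
    ts = ts⁺ ∘ suc
    open Twist T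
    v u : Fin n → Fin n → Carrier
    v x y = W ts x y * (g x * conj (g y))
    u x y = t x * conj (t y)
    term : ∀ m x y → W ts x y * (twisted T m g x * conj (twisted T m g y)) ≈ v x y * u x y ^ m
    term m x y = begin
      W ts x y * (g x * t x ^ m * conj (g y * t y ^ m))
        ≈⟨ *-congˡ (*-congˡ (≈trans (conj-* (g y) (t y ^ m)) (*-congˡ (conj-^ (t y) m)))) ⟩
      W ts x y * (g x * t x ^ m * (conj (g y) * conj (t y) ^ m))
        ≈⟨ solve 5 (λ w a b c d → w :* ((a :* b) :* (c :* d)) := (w :* (a :* c)) :* (b :* d)) ≈refl
             (W ts x y) (g x) (t x ^ m) (conj (g y)) (conj (t y) ^ m) ⟩
      v x y * (t x ^ m * conj (t y) ^ m)
        ≈⟨ *-congˡ (≈sym (^-distrib-* (t x) (conj (t y)) m)) ⟩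
      v x y * u x y ^ m ∎
    inner : ∀ x y → sum {p} (λ m → v x y * u x y ^ toℕ m) ≈ p · (W ts⁺ x y * (g x * conj (g y)))
    inner x y = begin
      sum {p} (λ m → v x y * u x y ^ toℕ m)   ≈⟨ *-distribˡ-sum {p} (v x y) (λ m → u x y ^ toℕ m) ⟨
      v x y * sum {p} (λ m → u x y ^ toℕ m)   ≈⟨ *-congˡ (orth x y) ⟩
      v x y * (p · 𝟙 (R? x y))                ≈⟨ ×-comm-* p (v x y) (𝟙 (R? x y)) ⟩
      p · (v x y * 𝟙 (R? x y))                ≈⟨ ×-congʳ p (solve 3 (λ w a b → (w :* a) :* b := (w :* b) :* a) ≈refl
                                                   (W ts x y) (g x * conj (g y)) (𝟙 (R? x y))) ⟩
      p · (W ts⁺ x y * (g x * conj (g y))) ∎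

  S : ∀ {k} → Twists k → (Fin n → Carrier) → Carrier
  S ts g = sum λ x → W ts x o * g x

  S-average : ∀ {k} (ts : Twists (suc k)) g →
    sum {p} (λ m → S (ts ∘ suc) (twisted (ts zero) (toℕ m) g)) ≈ p · S ts g
  S-average ts⁺ g = begin
    sum {p} (λ m → sum λ x → W ts x o * (g x * t x ^ toℕ m))
      ≈⟨ ∑-comm {p} (λ m x → W ts x o * (g x * t x ^ toℕ m)) ⟩
    sum (λ x → sum {p} λ m → W ts x o * (g x * t x ^ toℕ m))
      ≈⟨ sum-cong-≋ inner ⟩
    sum (λ x → p · (W ts⁺ x o * g x))
      ≈⟨ ·-sum p (λ x → W ts⁺ x o * g x) ⟩
    p · S ts⁺ g ∎
    where
    T = ts⁺ zero
    ts = ts⁺ ∘ suc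
    open Twist T
    t≈ : ∀ x → t x * conj (t o) ≈ t x
    t≈ x = ≈trans (*-congˡ (≈trans (conj-cong t-o) conj-1)) (*-identityʳ (t x))
    inner : ∀ x → sum {p} (λ m → W ts x o * (g x * t x ^ toℕ m)) ≈ p · (W ts⁺ x o * g x)
    inner x = begin
      sum {p} (λ m → W ts x o * (g x * t x ^ toℕ m))      ≈⟨ sum-cong-≋ {p} (λ m → ≈sym (*-assoc (W ts x o) (g x) (t x ^ toℕ m))) ⟩
      sum {p} (λ m → W ts x o * g x * t x ^ toℕ m)        ≈⟨ *-distribˡ-sum {p} (W ts x o * g x) (λ m → t x ^ toℕ m) ⟨
      W ts x o * g x * sum {p} (λ m → t x ^ toℕ m)        ≈⟨ *-congˡ (sum-cong-≋ {p} (λ m → ^-congˡ (toℕ m) (≈sym (t≈ x)))) ⟩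
      W ts x o * g x * sum {p} (λ m → (t x * conj (t o)) ^ toℕ m) ≈⟨ *-congˡ (orth x o) ⟩
      W ts x o * g x * (p · 𝟙 (R? x o))                   ≈⟨ ×-comm-* p (W ts x o * g x) (𝟙 (R? x o)) ⟩
      p · (W ts x o * g x * 𝟙 (R? x o))                   ≈⟨ ×-congʳ p (solve 3 (λ w a b → (w :* a) :* b := (w :* b) :* a) ≈refl
                                                               (W ts x o) (g x) (𝟙 (R? x o))) ⟩
      p · (W ts⁺ x o * g x) ∎

  -- |mean|² ≤ mean of |·|², since the variance is nonnegative
  norm²-average : ∀ {u} {z : Fin p → Carrier} {w} → (∀ m → Bd (norm² (z m)) u) → sum z ≈ p · w → Bd (norm² w) u
  norm²-average {u} {z} {w} h eq = bd-average p′ {u} {λ m → a m} {norm² w}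
    (λ m → bd-drop (z m + - w) (h m)) (+-cancelʳ (sum d) _ _ (begin
      sum a + sum d                           ≈⟨ ∑-distrib-+ a d ⟨
      sum (λ m → a m + d m)                   ≈⟨ sum-cong-≋ {p} (λ m → undo (norm² (z m)) (d m)) ⟩
      sum (λ m → norm² (z m))                 ≈⟨ +-identityʳ _ ⟨
      sum (λ m → norm² (z m)) + 0#            ≈⟨ variance ⟩
      p · norm² w + sum d                     ∎))
    where
    d a : Fin p → Carrier
    d m = norm² (z m + - w)
    a m = norm² (z m) + - d m
    undo : ∀ x y → x + - y + y ≈ x
    undo x y = ≈trans (+-assoc x (- y) y) (≈trans (+-congˡ (-‿inverseˡ y)) (+-identityʳ x))
    -- |z|² + |w|² = |z - w|² + (z w̄ + w z̄), where Σ (z w̄ + w z̄) = 2 p |w|²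
    expand : ∀ m → norm² (z m) + norm² w ≈ d m + (z m * conj w + w * conj (z m))
    expand m = begin
      norm² (z m) + norm² w
        ≈⟨ +-congʳ (*-cong (≈sym (undo (z m) w)) (≈trans (conj-cong (≈sym (undo (z m) w))) (conj-+ e w))) ⟩
      (e + w) * (conj e + conj w) + w * conj w
        ≈⟨ solve 4 (λ e f w v → (e :+ w) :* (f :+ v) :+ w :* v := e :* f :+ ((e :+ w) :* v :+ w :* (f :+ v))) ≈refl e (conj e) w (conj w) ⟩
      e * conj e + ((e + w) * conj w + w * (conj e + conj w))
        ≈⟨ +-congˡ (+-cong (*-congʳ (undo (z m) w)) (*-congˡ (≈trans (≈sym (conj-+ e w)) (conj-cong (undo (z m) w))))) ⟩
      d m + (z m * conj w + w * conj (z m)) ∎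
      where e = z m + - w
    cross : sum (λ m → z m * conj w + w * conj (z m)) ≈ p · norm² w + p · norm² w
    cross = ≈trans (∑-distrib-+ (λ m → z m * conj w) (λ m → w * conj (z m))) (+-cong
      (≈trans (≈sym (*-distribʳ-sum (conj w) z)) (≈trans (*-congʳ eq) (×-assoc-* p w (conj w))))
      (≈trans (≈sym (*-distribˡ-sum w (conj ∘ z))) (≈trans (*-congˡ (≈trans (≈sym (conj-sum z)) (≈trans (conj-cong eq) (conj-· p w)))) (×-comm-* p w (conj w)))))
    variance : sum (λ m → norm² (z m)) + 0# ≈ p · norm² w + sum d
    variance = +-cancelʳ (p · norm² w) _ _ (begin
      sum (λ m → norm² (z m)) + 0# + p · norm² w        ≈⟨ +-cong (+-identityʳ _) (≈sym (sum-replicate p)) ⟩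
      sum (λ m → norm² (z m)) + sum {p} (λ m → norm² w) ≈⟨ ∑-distrib-+ (λ m → norm² (z m)) (λ m → norm² w) ⟨
      sum (λ m → norm² (z m) + norm² w)                 ≈⟨ sum-cong-≋ expand ⟩
      sum (λ m → d m + (z m * conj w + w * conj (z m))) ≈⟨ ∑-distrib-+ d (λ m → z m * conj w + w * conj (z m)) ⟩
      sum d + sum (λ m → z m * conj w + w * conj (z m)) ≈⟨ +-congˡ cross ⟩
      sum d + (p · norm² w + p · norm² w)               ≈⟨ solve 2 (λ a b → a :+ (b :+ b) := (b :+ a) :+ b) ≈refl (sum d) (p · norm² w) ⟩
      p · norm² w + sum d + p · norm² w                 ∎)

  -- `𝓖` collects functions whose sums obey the bound. An average over a twist calls for the bound
  -- at all its powers, hence the closure conditions.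
  module _ (𝓖 : (Fin n → Carrier) → Set) {u} (bound : ∀ g → 𝓖 g → Bd (norm² (sum g)) u) where

    Closed : Twist → Set
    Closed T = ∀ g → 𝓖 g → ∀ m → 𝓖 (twisted T m g)

    E-bound : ∀ {k} (ts : Twists k) → (∀ i → Closed (ts i)) → ∀ g → 𝓖 g → Bd (E ts g) u
    E-bound {zero}  ts cl g γ = bd-resp (E-[] ts g) (bound g γ)
    E-bound {suc k} ts cl g γ = bd-average p′
      (λ m → E-bound (ts ∘ suc) (cl ∘ suc) (twisted (ts zero) (toℕ m) g) (cl zero g γ (toℕ m))) (E-average ts g)

    S-bound : ∀ {k} (ts : Twists k) → (∀ i → Closed (ts i)) → ∀ g → 𝓖 g → Bd (norm² (S ts g)) u
    S-bound {zero} ts cl g γ = bd-resp (*-cong s (conj-cong s)) (bound g γ)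
      where
      s : sum g ≈ S ts g
      s = sum-cong-≋ {n} (λ x → ≈sym (*-identityˡ (g x)))
    S-bound {suc k} ts cl g γ = norm²-average
      (λ m → S-bound (ts ∘ suc) (cl ∘ suc) (twisted (ts zero) (toℕ m) g) (cl zero g γ (toℕ m))) (S-average ts g)

    -- When g(x) times the conjugate of g(y) is 1 on related pairs, `E` is the number of these
    -- pairs.
    invariant-bound : ∀ {k} (ts : Twists k) → (∀ i → Closed (ts i)) → ∀ g → 𝓖 g →
      (∀ x y → AllR ts x y → g x * conj (g y) ≈ 1#) →
      ∀ {m} → (∀ x → m ℕ.≤ Enumeration.size (enumerate (AllR? ts x))) → n ℕ.* m ℕ.≤ u
    invariant-bound ts cls g γ inv {m} large with sum-≥ (λ x → Enumeration.size (enumerate (AllR? ts x))) large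
    ... | k , le , eq = ℕₚ.≤-trans le (bd-nat (bd-resp (begin
      E ts g                                                 ≈⟨ sum-cong-≋ {n} (λ x → sum-cong-≋ {n} λ y → term x y) ⟩
      sum (λ x → sum λ y → 𝟙 (AllR? ts x y))                 ≈⟨ sum-cong-≋ {n} (λ x → sum-𝟙 (AllR? ts x)) ⟩
      sum (λ x → Enumeration.size (enumerate (AllR? ts x)) · 1#) ≈⟨ eq ⟩
      k · 1#                                                 ∎) (E-bound ts cls g γ)))
      where
      term : ∀ x y → W ts x y * (g x * conj (g y)) ≈ 𝟙 (AllR? ts x y)
      term x y with AllR? ts x y
      ... | yes r = ≈trans (*-cong (W-yes ts r) (inv x y r)) (*-identityˡ 1#)
      ... | no ¬r = ≈trans (*-congʳ (W-no ts ¬r)) (zeroˡ _)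

    -- On the class of the origin g is the unimodular constant c, so `S` is c times the size m of
    -- that class and has squared modulus m².
    constant-bound : ∀ {k} (ts : Twists k) → (∀ i → Closed (ts i)) → ∀ g → 𝓖 g → ∀ {c} → c * conj c ≈ 1# →
      (∀ x → AllR ts x o → g x ≈ c) →
      let m = Enumeration.size (enumerate (λ x → AllR? ts x o)) in m ℕ.* m ℕ.≤ u
    constant-bound ts cls g γ {c} cc̄ const = bd-nat (bd-resp (begin
      norm² (S ts g)                     ≈⟨ *-cong S≈ (≈trans (conj-cong S≈) (conj-· m c)) ⟩
      m · c * (m · conj c)               ≈⟨ ×-comm-* m (m · c) (conj c) ⟩
      m · (m · c * conj c)               ≈⟨ ×-congʳ m (≈trans (×-assoc-* m c (conj c)) (×-congʳ m cc̄)) ⟩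
      m · (m · 1#)                       ≈⟨ ×-assocˡ 1# m m ⟩
      (m ℕ.* m) · 1#                     ∎) (S-bound ts cls g γ))
      where
      m = Enumeration.size (enumerate (λ x → AllR? ts x o))
      term : ∀ x → W ts x o * g x ≈ 𝟙 (AllR? ts x o) * c
      term x with AllR? ts x o
      ... | yes r = *-cong (W-yes ts r) (const x r)
      ... | no ¬r = *-cong-0 (W-no ts ¬r)
        where
        *-cong-0 : ∀ {a b} → a ≈ 0# → a * b ≈ 0# * c
        *-cong-0 eq = ≈trans (*-congʳ eq) (≈trans (zeroˡ _) (≈sym (zeroˡ c)))
      S≈ : S ts g ≈ m · c
      S≈ = begin
        S ts g                               ≈⟨ sum-cong-≋ term ⟩
        sum (λ x → 𝟙 (AllR? ts x o) * c)     ≈⟨ *-distribʳ-sum c (λ x → 𝟙 (AllR? ts x o)) ⟨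
        sum (λ x → 𝟙 (AllR? ts x o)) * c     ≈⟨ *-congʳ (sum-𝟙 (λ x → AllR? ts x o)) ⟩
        m · 1# * c                           ≈⟨ ×-assoc-* m 1# c ⟩
        m · (1# * c)                         ≈⟨ ×-congʳ m (*-identityˡ c) ⟩
        m · c                                ∎

-- Additive subgroups H with p A ⊆ H

module Congruence (A : FinRing) (p′ : ℕ) where
  open RingTools A
  open MonoidMult (Ring.+-monoid ring) public
    using (×-homo-+; ×-assocˡ) renaming (_×_ to _⋆_)
  open AbelianGroupProperties (Ring.+-abelianGroup ring) using (⁻¹-∙-comm)
  open CMSolver (Ring.+-commutativeMonoid ring) using () renaming (solve to solve+; _⊜_ to _⊜+_; _⊕_ to _⊕+_)
  open ≡-Reasoning

  p : ℕ
  p = suc p′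

  record PSubgroup : Set₁ where
    field
      P   : Fin N → Set
      P?  : Decidable P
      0∈  : P 0#
      +∈  : ∀ {x y} → P x → P y → P (x + y)
      -∈  : ∀ {x} → P x → P (- x)
      p⋆∈ : ∀ x → P (p ⋆ x)

  module Mod (H : PSubgroup) where
    open PSubgroup H

    infix 4 _~_
    _~_ : Fin N → Fin N → Set
    x ~ y = P (x - y)

    ~-refl : ∀ {x} → x ~ x
    ~-refl {x} = subst P (sym (-‿inverseʳ x)) 0∈

    ~-reflexive : ∀ {x y} → x ≡ y → x ~ y
    ~-reflexive refl = ~-refl

    ~-sym : ∀ {x y} → x ~ y → y ~ x
    ~-sym {x} {y} h = subst P (trans (sym (⁻¹-∙-comm x (- y))) (trans (cong (- x +_) (-‿involutive y)) (+-comm (- x) y))) (-∈ h)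

    ~-trans : ∀ {x y z} → x ~ y → y ~ z → x ~ z
    ~-trans {x} {y} {z} h k = subst P (trans (sym (+-assoc (x - y) y (- z))) (cong (_+ - z) (x-y+y≡x x y))) (+∈ h k)

    ~-+ : ∀ {x y u v} → x ~ y → u ~ v → x + u ~ y + v
    ~-+ {x} {y} {u} {v} h k = subst P (begin
      x + - y + (u + - v)       ≡⟨ solve+ 4 (λ x y u v → (x ⊕+ y) ⊕+ (u ⊕+ v) ⊜+ (x ⊕+ u) ⊕+ (y ⊕+ v)) refl x (- y) u (- v) ⟩
      x + u + (- y + - v)       ≡⟨ cong (x + u +_) (⁻¹-∙-comm y v) ⟩
      x + u + - (y + v)         ∎) (+∈ h k)

    ~-neg : ∀ {x y} → x ~ y → - x ~ - y
    ~-neg {x} {y} h = subst P (sym (⁻¹-∙-comm x (- y))) (-∈ h)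

    ~-⋆ : ∀ n {x y} → x ~ y → n ⋆ x ~ n ⋆ y
    ~-⋆ zero    h = ~-refl
    ~-⋆ (suc n) h = ~-+ h (~-⋆ n h)

    ∈⇒~0 : ∀ {x} → P x → x ~ 0#
    ∈⇒~0 {x} h = subst P (sym (trans (cong (x +_) (trans (sym (+-identityˡ (- 0#))) (-‿inverseʳ 0#))) (+-identityʳ x))) h

    ~0⇒∈ : ∀ {x} → x ~ 0# → P x
    ~0⇒∈ {x} h = subst P (trans (cong (x +_) (trans (sym (+-identityˡ (- 0#))) (-‿inverseʳ 0#))) (+-identityʳ x)) h

    ⋆-0 : ∀ n → n ⋆ 0# ≡ 0#
    ⋆-0 zero    = refl
    ⋆-0 (suc n) = trans (+-identityˡ _) (⋆-0 n)

    n*⋆~0 : ∀ n {m x} → m ⋆ x ~ 0# → (n ℕ.* m) ⋆ x ~ 0#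
    n*⋆~0 n {m} {x} h = ~-trans (~-reflexive (sym (×-assocˡ x n m))) (~-trans (~-⋆ n h) (~-reflexive (⋆-0 n)))

    p⋆~0 : ∀ n x → (n ℕ.* p) ⋆ x ~ 0#
    p⋆~0 n x = n*⋆~0 n {p} (∈⇒~0 (p⋆∈ x))

    reduce : ∀ j x → j ⋆ x ~ (j ℕ.% p) ⋆ x
    reduce j x = ~-trans (~-reflexive (trans (cong (_⋆ x) (ℕ.m≡m%n+[m/n]*n j p)) (×-homo-+ x (j ℕ.% p) _)))
      (~-trans (~-+ ~-refl (p⋆~0 (j ℕ./ p) x)) (~-reflexive (+-identityʳ _)))

    -- Modulo p the number -1 is p - 1; all coefficients thereby remain natural numbers.
    neg-⋆ : ∀ j x → - (j ⋆ x) ~ (p′ ℕ.* j) ⋆ x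
    neg-⋆ j x = ~-trans (~-reflexive (sym (+-identityˡ _))) (~-trans
      (~-+ (~-sym (~-trans (~-reflexive (trans (+-comm _ (j ⋆ x)) (sym (×-homo-+ x j (p′ ℕ.* j)))))
        (~-trans (~-reflexive (cong (_⋆ x) (ℕₚ.*-comm p j))) (p⋆~0 j x)))) (~-refl { - (j ⋆ x)}))
      (~-reflexive (trans (+-assoc _ (j ⋆ x) (- (j ⋆ x))) (trans (cong ((p′ ℕ.* j) ⋆ x +_) (-‿inverseʳ (j ⋆ x))) (+-identityʳ _)))))

    -- 1 + yi = xp or 1 + xp = yi turns multiplication by i into an invertible operation mod H.
    ⋆-cancel : ∀ {i z} → Coprime p i → i ⋆ z ~ 0# → z ~ 0#
    ⋆-cancel {i} {z} cop h with coprime-Bézout cop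
    ... | Bézout.+- x y eq = ~-trans (~-sym (~-trans (~-+ (~-refl {z}) (n*⋆~0 y h)) (~-reflexive (+-identityʳ z))))
            (~-trans (~-reflexive (cong (_⋆ z) eq)) (p⋆~0 x z))
    ... | Bézout.-+ x y eq = ~-trans (~-sym (~-trans (~-+ (~-refl {z}) (p⋆~0 x z)) (~-reflexive (+-identityʳ z))))
            (~-trans (~-reflexive (cong (_⋆ z) eq)) (n*⋆~0 y h))

    ⋆-invert : ∀ {i x y} → Coprime p i → y ~ i ⋆ x → ∃[ k ] x ~ k ⋆ y
    ⋆-invert {i} {x} {y} cop h with coprime-Bézout cop
    ... | Bézout.+- a k eq = p′ ℕ.* k , ~-trans (~-trans (~-sym x-neg)
            (~-neg (~-sym (~-trans (~-⋆ k h) (~-reflexive (×-assocˡ x k i)))))) (neg-⋆ k y)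
      where
      x-neg : - ((k ℕ.* i) ⋆ x) ~ x
      x-neg = ~-sym (~-trans (~-reflexive (sym (trans (+-assoc x _ _) (trans (cong (x +_) (-‿inverseʳ _)) (+-identityʳ x)))))
        (~-trans (~-+ (~-trans (~-reflexive (cong (_⋆ x) eq)) (p⋆~0 a x)) ~-refl) (~-reflexive (+-identityˡ _))))
    ... | Bézout.-+ a k eq = k , ~-sym (~-trans (~-⋆ k h) (~-trans (~-reflexive (trans (×-assocˡ x k i) (cong (_⋆ x) (sym eq))))
            (~-trans (~-+ ~-refl (p⋆~0 a x)) (~-reflexive (+-identityʳ x)))))

  open PSubgroup using (P; P?)

  Adj : PSubgroup → Fin N → Fin N → Set
  Adj H x z = ∃[ j ] (Mod._~_ H z (toℕ {p} j ⋆ x))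

  adj : ∀ H {x z} j → Mod._~_ H z (j ⋆ x) → Adj H x z
  adj H {x} {z} j h = fromℕ< (ℕ.m%n<n j p) , subst (λ i → z ~ i ⋆ x) (sym (Finₚ.toℕ-fromℕ< (ℕ.m%n<n j p))) (~-trans h (reduce j x))
    where open Mod H

  adjoin : PSubgroup → Fin N → PSubgroup
  adjoin H x = record
    { P = Adj H x
    ; P? = λ z → Finₚ.any? (λ j → P? H (z - toℕ j ⋆ x))
    ; 0∈ = adj H 0 ~-refl
    ; +∈ = λ { (i , h) (j , k) → adj H (toℕ i ℕ.+ toℕ j) (~-trans (~-+ h k) (~-reflexive (sym (×-homo-+ x (toℕ i) (toℕ j))))) }
    ; -∈ = λ { (i , h) → adj H (p′ ℕ.* toℕ i) (~-trans (~-neg h) (neg-⋆ (toℕ i) x)) }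
    ; p⋆∈ = λ z → adj H 0 (∈⇒~0 (PSubgroup.p⋆∈ H z)) }
    where open Mod H

  infix 4 _⊑_
  _⊑_ : PSubgroup → PSubgroup → Set
  H ⊑ K = ∀ {z} → P H z → P K z

  -- When `xs` lists all elements, y is a multiple modulo M of every x outside M. For prime p such a
  -- multiple can be inverted, so A / M is cyclic of order p with generator y.
  record Maximal (H : PSubgroup) (y : Fin N) (xs : List (Fin N)) : Set₁ where
    field
      M     : PSubgroup
      H⊑M   : H ⊑ M
      y∉M   : ¬ P M y
      max   : ∀ {x} → x ∈ xs → P M x ⊎ Adj M x y

  maximal : ∀ H {y} → ¬ P H y → ∀ xs → Maximal H y xs
  maximal H y∉ [] = record { M = H ; H⊑M = λ h → h ; y∉M = y∉ ; max = λ () }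
  maximal H {y} y∉ (x ∷ xs) with P? (adjoin H x) y
  ... | yes a = record { M = M ; H⊑M = H⊑M ; y∉M = y∉M ; max = λ { (here refl) → inj₂ (proj₁ a , H⊑M (proj₂ a)) ; (there i) → max i } }
    where open Maximal (maximal H y∉ xs)
  ... | no ¬a = record { M = M ; H⊑M = λ h → H⊑M (adj H 0 (∈⇒~0 h)) ; y∉M = y∉M
                       ; max = λ { (here refl) → inj₁ (H⊑M (adj H 1 (~-reflexive (sym (+-identityʳ x))))) ; (there i) → max i } }
    where
    open Maximal (maximal (adjoin H x) ¬a xs)
    open Mod H

-- Additive characters separating a point from a subgroup

module Characters (Sc : Scalars) (A : FinRing) where
  open ScalarTools Sc hiding (×-homo-+; ×-assocˡ)
  private module A = RingTools A
  open A using (N)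

  record Char : Set where
    field
      χ      : Fin N → Carrier
      χ-+    : ∀ x y → χ (x A.+ y) ≈ χ x * χ y
      χ-0    : χ A.0# ≈ 1#
      χ-unit : ∀ x → χ x * conj (χ x) ≈ 1#

    χ-- : ∀ x → χ (A.- x) ≈ conj (χ x)
    χ-- x = begin
      χ (A.- x)                       ≈⟨ *-identityʳ _ ⟨
      χ (A.- x) * 1#                  ≈⟨ *-congˡ (χ-unit x) ⟨
      χ (A.- x) * (χ x * conj (χ x))  ≈⟨ *-assoc _ _ _ ⟨
      χ (A.- x) * χ x * conj (χ x)    ≈⟨ *-congʳ (χ-+ (A.- x) x) ⟨
      χ (A.- x A.+ x) * conj (χ x)    ≈⟨ *-congʳ (reflexive (cong χ (A.-‿inverseˡ x))) ⟩
      χ A.0# * conj (χ x)             ≈⟨ *-congʳ χ-0 ⟩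
      1# * conj (χ x)                 ≈⟨ *-identityˡ _ ⟩
      conj (χ x)                      ∎
      where open ≈-Reasoning

    χ-difference : ∀ x y → χ x * conj (χ y) ≈ χ (x A.- y)
    χ-difference x y = ≈trans (*-congˡ (≈sym (χ-- y))) (≈sym (χ-+ x (A.- y)))

  open Char public

  unit-* : ∀ {x y} → x * conj x ≈ 1# → y * conj y ≈ 1# → (x * y) * conj (x * y) ≈ 1#
  unit-* {x} {y} p q = begin
    x * y * conj (x * y)        ≈⟨ *-congˡ (conj-* x y) ⟩
    x * y * (conj x * conj y)   ≈⟨ *-interchange x y (conj x) (conj y) ⟩
    x * conj x * (y * conj y)   ≈⟨ *-cong p q ⟩
    1# * 1#                     ≈⟨ *-identityˡ 1# ⟩
    1#                          ∎
    where open ≈-Reasoning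

  unit-1 : 1# * conj 1# ≈ 1#
  unit-1 = ≈trans (*-identityˡ _) conj-1

  unit-^ : ∀ {x} → x * conj x ≈ 1# → ∀ n → (x ^ n) * conj (x ^ n) ≈ 1#
  unit-^ p zero    = unit-1
  unit-^ p (suc n) = unit-* p (unit-^ p n)

  1-char : Char
  1-char = record { χ = λ _ → 1# ; χ-+ = λ _ _ → ≈sym (*-identityˡ 1#) ; χ-0 = ≈refl ; χ-unit = λ _ → unit-1 }

  _*χ_ : Char → Char → Char
  α *χ β = record
    { χ = λ x → χ α x * χ β x
    ; χ-+ = λ x y → ≈trans (*-cong (χ-+ α x y) (χ-+ β x y))
        (*-interchange (χ α x) (χ α y) (χ β x) (χ β y))
    ; χ-0 = ≈trans (*-cong (χ-0 α) (χ-0 β)) (*-identityˡ 1#)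
    ; χ-unit = λ x → unit-* (χ-unit α x) (χ-unit β x) }

  _^χ_ : Char → ℕ → Char
  α ^χ zero    = 1-char
  α ^χ (suc n) = α *χ (α ^χ n)

  χ-^ : ∀ α n x → χ (α ^χ n) x ≈ χ α x ^ n
  χ-^ α zero    x = ≈refl
  χ-^ α (suc n) x = *-congˡ (χ-^ α n x)

  module Separation (p′ : ℕ) (prime : Prime (suc p′)) where
    open Congruence A p′

    -- `on-M` and `off-M` are the two cases of the orthogonality relation of a `Twist`; membership
    -- in M stands in for the undecidable question whether a value of the character is 1.
    record Separating (H : PSubgroup) (y : Fin N) : Set₁ where
      field
        char : Char
        M    : PSubgroup
        H⊑M  : H ⊑ M
        y∉M  : ¬ PSubgroup.P M y
        on-M  : ∀ {x} → PSubgroup.P M x → χ char x ≈ 1#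
        off-M : ∀ {x} → ¬ PSubgroup.P M x → sum {p} (λ m → χ char x ^ toℕ m) ≈ 0#
        nontrivial : ¬ χ char y ≈ 1#

    module _ {ζ} (ζ-unit : ζ * conj ζ ≈ 1#) (Σζ : sum {p} (λ m → ζ ^ toℕ m) ≈ 0#) where
      open ≈-Reasoning

      sum-snoc : ∀ n w → 1# + w * sum {n} (λ m → w ^ toℕ m) ≈ sum {n} (λ m → w ^ toℕ m) + w ^ n
      sum-snoc zero    w = ≈trans (+-congˡ (zeroʳ w)) (+-comm 1# 0#)
      sum-snoc (suc n) w = begin
        1# + w * (1# + X′)             ≈⟨ +-congˡ (*-congˡ (+-congˡ (≈sym (*-distribˡ-sum {n} w (λ m → w ^ toℕ m))))) ⟩
        1# + w * (1# + w * X)          ≈⟨ +-congˡ (*-congˡ (sum-snoc n w)) ⟩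
        1# + w * (X + w ^ n)           ≈⟨ +-congˡ (distribˡ w X (w ^ n)) ⟩
        1# + (w * X + w * w ^ n)       ≈⟨ +-assoc 1# (w * X) _ ⟨
        1# + w * X + w * w ^ n         ≈⟨ +-congʳ (+-congˡ (*-distribˡ-sum {n} w (λ m → w ^ toℕ m))) ⟩
        1# + X′ + w * w ^ n            ∎
        where
        X = sum {n} (λ m → w ^ toℕ m)
        X′ = sum {n} (λ m → w * w ^ toℕ m)

      ζᵖ≈1 : ζ ^ p ≈ 1#
      ζᵖ≈1 = begin
        ζ ^ p                                       ≈⟨ +-identityˡ _ ⟨
        0# + ζ ^ p                                  ≈⟨ +-congʳ Σζ ⟨
        sum {p} (λ m → ζ ^ toℕ m) + ζ ^ p           ≈⟨ sum-snoc p ζ ⟨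
        1# + ζ * sum {p} (λ m → ζ ^ toℕ m)          ≈⟨ +-congˡ (*-congˡ Σζ) ⟩
        1# + ζ * 0#                                 ≈⟨ +-congˡ (zeroʳ ζ) ⟩
        1# + 0#                                     ≈⟨ +-identityʳ 1# ⟩
        1#                                          ∎

      ζ^[n*p] : ∀ n → ζ ^ (n ℕ.* p) ≈ 1#
      ζ^[n*p] n = begin
        ζ ^ (n ℕ.* p)   ≡⟨ cong (ζ ^_) (ℕₚ.*-comm n p) ⟩
        ζ ^ (p ℕ.* n)   ≈⟨ ^-assocʳ ζ p n ⟨
        (ζ ^ p) ^ n     ≈⟨ ^-congˡ n ζᵖ≈1 ⟩
        1# ^ n          ≈⟨ 1^ n ⟩
        1#              ∎

      ζ≉1 : ¬ ζ ≈ 1#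
      ζ≉1 eq = 1≉0 (·-cancel₀ p′ (begin
        p · 1#                        ≈⟨ sum-replicate p ⟨
        sum {p} (λ m → 1#)            ≈⟨ sum-cong-≋ {p} (λ m → ≈trans (≈sym (1^ (toℕ m))) (^-congˡ (toℕ m) (≈sym eq))) ⟩
        sum {p} (λ m → ζ ^ toℕ m)     ≈⟨ Σζ ⟩
        0#                            ∎))

      -- T = Σ (ζ^j)^m is fixed by multiplication by ζ^j, hence by ζ, hence p T = T Σ ζ^m = 0.
      Σζ^j : ∀ {j} → Coprime p j → sum {p} (λ m → (ζ ^ j) ^ toℕ m) ≈ 0#
      Σζ^j {j} cop = ·-cancel₀ p′ (begin
        p · T                              ≈⟨ sum-replicate p ⟨
        sum {p} (λ m → T)                  ≈⟨ sum-cong-≋ {p} (λ m → ≈sym (fixed-^ Tζ (toℕ m))) ⟩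
        sum {p} (λ m → T * ζ ^ toℕ m)      ≈⟨ *-distribˡ-sum {p} T (λ m → ζ ^ toℕ m) ⟨
        T * sum {p} (λ m → ζ ^ toℕ m)      ≈⟨ *-congˡ Σζ ⟩
        T * 0#                             ≈⟨ zeroʳ T ⟩
        0#                                 ∎)
        where
        w = ζ ^ j
        T = sum {p} (λ m → w ^ toℕ m)
        fixed-^ : ∀ {v} → T * v ≈ T → ∀ n → T * v ^ n ≈ T
        fixed-^ h zero = *-identityʳ T
        fixed-^ {v} h (suc n) = ≈trans (≈sym (*-assoc T v (v ^ n))) (≈trans (*-congʳ h) (fixed-^ h n))
        wᵖ : w ^ p ≈ 1#
        wᵖ = ≈trans (^-assocʳ ζ j p) (ζ^[n*p] j)
        Tw : T * w ≈ T
        Tw = +-cancelʳ 1# _ _ (begin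
          T * w + 1#    ≈⟨ +-comm _ 1# ⟩
          1# + T * w    ≈⟨ +-congˡ (*-comm T w) ⟩
          1# + w * T    ≈⟨ sum-snoc p w ⟩
          T + w ^ p     ≈⟨ +-congˡ wᵖ ⟩
          T + 1#        ∎)
        Tζ^ : ∀ k → T * ζ ^ (k ℕ.* j) ≈ T
        Tζ^ k = ≈trans (*-congˡ (≈trans (reflexive (cong (ζ ^_) (ℕₚ.*-comm k j))) (≈sym (^-assocʳ ζ j k)))) (fixed-^ Tw k)
        Tζ : T * ζ ≈ T
        Tζ with coprime-Bézout cop
        ... | Bézout.+- x y eq = begin
          T * ζ                            ≈⟨ *-congˡ (*-identityʳ ζ) ⟨
          T * (ζ * 1#)                     ≈⟨ *-congʳ (Tζ^ y) ⟨
          T * ζ ^ (y ℕ.* j) * (ζ * 1#)     ≈⟨ Solver.solve 3 (λ t a b → (t Solver.:* a) Solver.:* (b Solver.:* Solver.con 1) Solver.:= t Solver.:* (b Solver.:* a)) (≈refl) T (ζ ^ (y ℕ.* j)) ζ ⟩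
          T * (ζ * ζ ^ (y ℕ.* j))          ≈⟨ *-congˡ (reflexive (cong (ζ ^_) eq)) ⟩
          T * ζ ^ (x ℕ.* p)                ≈⟨ *-congˡ (ζ^[n*p] x) ⟩
          T * 1#                           ≈⟨ *-identityʳ T ⟩
          T                                ∎
        ... | Bézout.-+ x y eq = begin
          T * ζ                            ≈⟨ *-congˡ (*-identityʳ ζ) ⟨
          T * (ζ * 1#)                     ≈⟨ *-congˡ (*-congˡ (ζ^[n*p] x)) ⟨
          T * (ζ * ζ ^ (x ℕ.* p))          ≈⟨ *-congˡ (reflexive (cong (ζ ^_) eq)) ⟩
          T * ζ ^ (y ℕ.* j)                ≈⟨ Tζ^ y ⟩
          T                                ∎

      coprime-residue : ∀ {i} → 0 ℕ.< i → i ℕ.< p → Coprime p i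
      coprime-residue {suc i} _ i<p = prime⇒coprime prime i<p

      -- In the cyclic group A / M every x is congruent to a multiple b y of the generator, and the
      -- character sends x to ζ^b.
      separate′ : ∀ {H y} → Maximal H y (allFin N) → Separating H y
      separate′ {H} {y} mx = record
        { char = record
          { χ = λ x → ζ ^ b x
          ; χ-+ = λ x x′ → ≈trans (ζ-cong {b (x A.+ x′)} {b x ℕ.+ b x′} (~-trans (~-sym (b~ (x A.+ x′)))
                (~-trans (~-+ (b~ x) (b~ x′)) (~-reflexive (sym (×-homo-+ y (b x) (b x′))))))) (^-homo-* ζ (b x) (b x′))
          ; χ-0 = ζ-one {b A.0#} (~-sym (b~ A.0#))
          ; χ-unit = λ x → unit-^ ζ-unit (b x) }
        ; M = M ; H⊑M = H⊑M ; y∉M = y∉M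
        ; on-M = λ {x} h → ζ-one {b x} (~-trans (~-sym (b~ x)) (∈⇒~0 h))
        ; off-M = λ {x} h → ≈trans (sum-cong-≋ {p} (λ m → ^-congˡ (toℕ m) (ζ-% (b x)))) (Σζ^j (coprime-residue
            (ℕₚ.n≢0⇒n>0 λ eq → h (~0⇒∈ (~-trans (b~ x) (~-trans (reduce (b x) y) (~-reflexive (cong (_⋆ y) eq))))))
            (ℕ.m%n<n (b x) p)))
        ; nontrivial = λ eq → ζ≉1 (≈trans (≈sym (≈trans (ζ-cong {b y} {1} (~-trans (~-sym (b~ y))
            (~-reflexive (sym (A.+-identityʳ y))))) (*-identityʳ ζ))) eq) }
        where
        open Maximal mx
        open Mod M
        coefficient : ∀ x → PSubgroup.P M x ⊎ Adj M x y → ∃[ k ] x ~ k ⋆ y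
        coefficient x (inj₁ h) = 0 , ∈⇒~0 h
        -- The coefficient j in y ≡ j x is nonzero because y lies outside M, hence invertible modulo
        -- p.
        coefficient x (inj₂ (j , h)) = ⋆-invert (coprime-residue (ℕₚ.n≢0⇒n>0 λ eq →
          y∉M (~0⇒∈ (subst (λ i → y ~ i ⋆ x) eq h))) (Finₚ.toℕ<n j)) h
        b : Fin N → ℕ
        b x = proj₁ (coefficient x (max (∈-allFin x)))
        b~ : ∀ x → x ~ b x ⋆ y
        b~ x = proj₂ (coefficient x (max (∈-allFin x)))
        ζ-% : ∀ a → ζ ^ a ≈ ζ ^ (a ℕ.% p)
        ζ-% a = begin
          ζ ^ a                                    ≡⟨ cong (ζ ^_) (ℕ.m≡m%n+[m/n]*n a p) ⟩
          ζ ^ (a ℕ.% p ℕ.+ a ℕ./ p ℕ.* p)          ≈⟨ ^-homo-* ζ (a ℕ.% p) (a ℕ./ p ℕ.* p) ⟩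
          ζ ^ (a ℕ.% p) * ζ ^ (a ℕ./ p ℕ.* p)      ≈⟨ *-congˡ (ζ^[n*p] (a ℕ./ p)) ⟩
          ζ ^ (a ℕ.% p) * 1#                       ≈⟨ *-identityʳ _ ⟩
          ζ ^ (a ℕ.% p)                            ∎
        ζ-one : ∀ {a} → a ⋆ y ~ A.0# → ζ ^ a ≈ 1#
        ζ-one {a} h with a ℕ.% p ℕₚ.≟ 0
        ... | yes eq = ≈trans (ζ-% a) (reflexive (cong (ζ ^_) eq))
        ... | no ≢0 = ⊥-elim (y∉M (~0⇒∈ (⋆-cancel (coprime-residue (ℕₚ.n≢0⇒n>0 ≢0) (ℕ.m%n<n a p)) (~-trans (~-sym (reduce a y)) h))))
        ζ-cong : ∀ {a c} → a ⋆ y ~ c ⋆ y → ζ ^ a ≈ ζ ^ c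
        ζ-cong {a} {c} h = begin
          ζ ^ a                                   ≈⟨ *-identityʳ _ ⟨
          -- The factor ζ^(c p) = 1 is split as ζ^c ζ^((p-1) c), so that a - c can be represented by
          -- the natural number a + (p - 1) c.
          ζ ^ a * 1#                              ≈⟨ *-congˡ (ζ^[n*p] c) ⟨
          ζ ^ a * ζ ^ (c ℕ.* p)                   ≡⟨ cong (λ i → ζ ^ a * ζ ^ i) (ℕₚ.*-comm c p) ⟩
          ζ ^ a * ζ ^ (c ℕ.+ p′ ℕ.* c)            ≈⟨ *-congˡ (^-homo-* ζ c (p′ ℕ.* c)) ⟩
          ζ ^ a * (ζ ^ c * ζ ^ (p′ ℕ.* c))        ≈⟨ Solver.solve 3 (λ x y z → x Solver.:* (y Solver.:* z) Solver.:= (x Solver.:* z) Solver.:* y) (≈refl) (ζ ^ a) (ζ ^ c) (ζ ^ (p′ ℕ.* c)) ⟩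
          ζ ^ a * ζ ^ (p′ ℕ.* c) * ζ ^ c          ≈⟨ *-congʳ (^-homo-* ζ a (p′ ℕ.* c)) ⟨
          ζ ^ (a ℕ.+ p′ ℕ.* c) * ζ ^ c            ≈⟨ *-congʳ (ζ-one {a ℕ.+ p′ ℕ.* c} (~-trans (~-reflexive (×-homo-+ y a (p′ ℕ.* c)))
                                                       (~-trans (~-+ h ~-refl) (~-trans (~-reflexive (trans (sym (×-homo-+ y c (p′ ℕ.* c))) (cong (_⋆ y) (ℕₚ.*-comm p c)))) (p⋆~0 c y))))) ⟩
          1# * ζ ^ c                              ≈⟨ *-identityˡ _ ⟩
          ζ ^ c                                   ∎

    separate : ∀ H {y} → ¬ PSubgroup.P H y → Separating H y
    separate H y∉ = let ζ , ζ-unit , Σζ = root p (2≤p prime) in separate′ ζ-unit Σζ (maximal H y∉ (allFin N))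
      where
      2≤p : ∀ {n} → Prime n → 2 ℕ.≤ n
      2≤p pr = ℕ.nonTrivial⇒n>1 _ {{prime⇒nonTrivial pr}}

-- Fourier bounds

funToFin-cong : ∀ {m n} {f g : Fin m → Fin n} → f ≗ g → funToFin f ≡ funToFin g
funToFin-cong {zero}  h = refl
funToFin-cong {suc m} h = cong₂ combine (h zero) (funToFin-cong (h ∘ suc))

finToFun-inj : ∀ {m n} {i j : Fin (n ℕ.^ m)} → finToFun {n} {m} i ≗ finToFun j → i ≡ j
finToFun-inj {m} {n} {i} {j} h = trans (sym (Finₚ.funToFin-finToFin {m} {n} i))
  (trans (funToFin-cong h) (Finₚ.funToFin-finToFin {m} {n} j))

funToFin-inj : ∀ {m n} {f g : Fin m → Fin n} → funToFin f ≡ funToFin g → f ≗ g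
funToFin-inj {f = f} {g} eq i = trans (sym (Finₚ.finToFun-funToFin f i))
  (trans (cong (λ j → finToFun j i) eq) (Finₚ.finToFun-funToFin g i))

module SalemBounds (Sc : Scalars) (A : FinRing) (k : ℕ) where
  open ScalarTools Sc hiding (×-homo-+; ×-assocˡ)
  open Characters Sc A
  private module A = RingTools A
  open A using (N) renaming (_+_ to _⊹_)

  record VChar : Set where
    field
      ψ      : (Fin k → Fin N) → Carrier
      ψ-cong : ∀ {x y} → x ≗ y → ψ x ≈ ψ y
      ψ-+    : ∀ x y → ψ (λ i → x i ⊹ y i) ≈ ψ x * ψ y
      ψ-0    : ψ (λ _ → A.0#) ≈ 1#

  open VChar public

  1-vchar : VChar
  1-vchar = record { ψ = λ _ → 1# ; ψ-cong = λ _ → ≈refl ; ψ-+ = λ _ _ → ≈sym (*-identityˡ 1#) ; ψ-0 = ≈refl }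

  twist-vchar : VChar → Char → Fin k → VChar
  twist-vchar β α c = record
    { ψ = λ x → ψ β x * χ α (x c)
    ; ψ-cong = λ eq → *-cong (ψ-cong β eq) (reflexive (cong (χ α) (eq c)))
    ; ψ-+ = λ x y → ≈trans (*-cong (ψ-+ β x y) (χ-+ α (x c) (y c)))
        (*-interchange (ψ β x) (ψ β y) (χ α (x c)) (χ α (y c)))
    ; ψ-0 = ≈trans (*-cong (ψ-0 β) (χ-0 α)) (*-identityˡ 1#) }

  norm : Carrier → Carrier
  norm z = z * conj z

  graphSum : ((Fin k → Fin N) → Fin N) → Char → VChar → Carrier
  graphSum F ϕ β = sum {N ℕ.^ k} (λ j → χ ϕ (F (finToFun j)) * ψ β (finToFun j))

  graphSum-cong : ∀ F ϕ β {g : Fin (N ℕ.^ k) → Carrier} →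
    (∀ j → g j ≈ χ ϕ (F (finToFun j)) * ψ β (finToFun j)) → ScalarTools.sum Sc g ≈ graphSum F ϕ β
  graphSum-cong F ϕ β h = sum-cong-≋ h

  -- A record rather than a function type, so that it is compared without unfolding.
  record FourierBound (F : (Fin k → Fin N) → Fin N) (B : ℕ) : Set where
    field
      fourier-≤ : ∀ (ϕ : Char) {y} → ¬ χ ϕ y ≈ 1# → (β : VChar) → Bd (norm (graphSum F ϕ β)) (B ℕ.* N ℕ.^ k)

  fourier-bound : ∀ F B → (∀ (ϕ : Char) {y} → ¬ χ ϕ y ≈ 1# → (β : VChar) → ∀ u → u ≡ B ℕ.* N ℕ.^ k →
    Bd (norm (graphSum F ϕ β)) u) → FourierBound F B
  fourier-bound F B h = record { fourier-≤ = λ ϕ nt β → h ϕ nt β _ refl }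

  module _ {F B} (fourier : FourierBound F B) (p′ : ℕ) (prime : Prime (suc p′))
    (ϕ : Char) {y₀} (ϕ-nt : ¬ χ ϕ y₀ ≈ 1#) where
    open Separation p′ prime
    open Congruence A p′ using (PSubgroup)

    o : Fin (N ℕ.^ k)
    o = funToFin {k} (λ _ → A.0#)

    o≡0 : ∀ c → finToFun o c ≡ A.0#
    o≡0 = Finₚ.finToFun-funToFin {k} {N} (λ _ → A.0#)

    open Moments Sc o p′

    x-0≡x : ∀ x → x A.- A.0# ≡ x
    x-0≡x x = trans (cong (x ⊹_) (trans (sym (A.+-identityˡ _)) (A.-‿inverseʳ A.0#))) (A.+-identityʳ x)

    neg-0- : ∀ x → A.- (A.0# A.- x) ≡ x
    neg-0- x = trans (cong A.-_ (A.+-identityˡ (A.- x))) (A.-‿involutive x)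

    -- This fills the places of the y in H, for which there is nothing to separate, so that the
    -- family can be indexed by all pairs of a coordinate and an element.
    trivialTwist : Twist
    trivialTwist = record
      { t = λ _ → 1# ; t-o = ≈refl ; R = λ _ _ → ⊤ ; R? = λ _ _ → yes tt
      ; orth = λ _ _ → ≈trans (sum-cong-≋ {p} (λ m → ≈trans (^-congˡ (toℕ m) unit-1) (1^ (toℕ m)))) (sum-replicate p) }

    module _ (H : PSubgroup) where
      open PSubgroup H

      charTwist : Fin k → ∀ {y} → Separating H y → Twist
      charTwist c sep = record
        { t = λ j → χ char (finToFun j c)
        ; t-o = ≈trans (reflexive (cong (χ char) (o≡0 c))) (χ-0 char)
        ; R = λ a b → PSubgroup.P M (finToFun a c A.- finToFun b c)
        ; R? = λ a b → PSubgroup.P? M (finToFun a c A.- finToFun b c)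
        ; orth = λ a b → ≈trans (sum-cong-≋ {p} (λ m → ^-congˡ (toℕ m) (χ-difference char (finToFun a c) (finToFun b c))))
            (orth′ (finToFun a c A.- finToFun b c) (PSubgroup.P? M _)) }
        where
        open Separating sep
        orth′ : ∀ z (d : Dec (PSubgroup.P M z)) → sum {p} (λ m → χ char z ^ toℕ m) ≈ p · 𝟙 d
        orth′ z (yes h) = ≈trans (sum-cong-≋ {p} (λ m → ≈trans (^-congˡ (toℕ m) (on-M h)) (1^ (toℕ m)))) (sum-replicate p)
        orth′ z (no ¬h) = ≈trans (off-M ¬h) (≈sym (≈trans (≈sym (sum-replicate p)) (sum-0 {p} (λ _ → ≈refl))))

      twist : Fin k → ∀ y → Dec (P y) → Twist
      twist c y (yes _)  = trivialTwist
      twist c y (no y∉H) = charTwist c (separate H y∉H)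

      twists : Twists (k ℕ.* N)
      twists i = let c , y = remQuot N i in twist c y (P? y)

      related : ∀ {a b} → (∀ c → P (finToFun a c A.- finToFun b c)) → AllR twists a b
      related {a} {b} h i = go (proj₁ (remQuot {k} N i)) (proj₂ (remQuot {k} N i)) (P? _)
        where
        go : ∀ c y (d : Dec (P y)) → Twist.R (twist c y d) a b
        go c y (yes _)  = tt
        go c y (no y∉H) = Separating.H⊑M (separate H y∉H) (h c)

      -- If the difference z in coordinate c were outside H, the family would contain the character
      -- separating z from H in that coordinate, and its relation would fail.
      unrelated : ∀ {a b} → AllR twists a b → ∀ c → P (finToFun a c A.- finToFun b c)
      unrelated {a} {b} r c = decidable-stable (P? z) λ z∉H →
        go (P? z) z∉H (subst (λ q → Twist.R (twist (proj₁ q) (proj₂ q) (P? (proj₂ q))) a b)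
                         (Finₚ.remQuot-combine c z) (r (combine c z)))
        where
        z = finToFun a c A.- finToFun b c
        go : (d : Dec (P z)) → ¬ P z → Twist.R (twist c z d) a b → ⊥
        go (yes h)  z∉H _ = z∉H h
        go (no z∉H) _   h = Separating.y∉M (separate H z∉H) h

      -- The products of χ(F(x)) with a character of the k-tuples; twisting by a character of one
      -- coordinate changes only the second factor.
      𝓖 : (Fin (N ℕ.^ k) → Carrier) → Set
      𝓖 g = ∃[ β ] (∀ j → g j ≈ χ ϕ (F (finToFun j)) * ψ β (finToFun j))

      𝓖-bound : ∀ g → 𝓖 g → Bd (norm² (sum g)) (B ℕ.* N ℕ.^ k)
      𝓖-bound g (β , eq) = bd-resp (≈sym (*-cong (sum-cong-≋ eq) (conj-cong (sum-cong-≋ eq)))) (FourierBound.fourier-≤ fourier ϕ ϕ-nt β)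

      closed : ∀ i → Closed 𝓖 𝓖-bound (twists i)
      closed i g (β , eq) m = go (proj₁ (remQuot {k} N i)) (proj₂ (remQuot {k} N i)) (P? _)
        where
        go : ∀ c y (d : Dec (P y)) → 𝓖 (twisted (twist c y d) m g)
        go c y (yes _) = β , λ j → ≈trans (*-cong (eq j) (1^ m)) (*-identityʳ _)
        go c y (no y∉H) = twist-vchar β (α ^χ m) c , λ j → ≈trans (*-cong (eq j) (≈sym (χ-^ α m (finToFun j c)))) (*-assoc _ _ _)
          where α = Separating.char (separate H y∉H)

      g₀ : Fin (N ℕ.^ k) → Carrier
      g₀ j = χ ϕ (F (finToFun j))

      𝓖-g₀ : 𝓖 g₀
      𝓖-g₀ = 1-vchar , λ j → ≈sym (*-identityʳ _)

      module _ (E : Enumeration P) where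
        private module E = Enumeration E

        translate-size : ∀ (x : Fin k → Fin N) (Q : Enumeration (λ j → ∀ c → P (x c A.- finToFun j c))) →
                         E.size ℕ.^ k ℕ.≤ Enumeration.size Q
        translate-size x Q = size-lower Q f f-inj f∈
          where
          point : Fin (E.size ℕ.^ k) → Fin k → Fin N
          point j c = x c A.- E.ι (finToFun j c)
          f : Fin (E.size ℕ.^ k) → Fin (N ℕ.^ k)
          f j = funToFin (point j)
          f-inj : ∀ {i j} → f i ≡ f j → i ≡ j
          f-inj {i} {j} eq = finToFun-inj λ c → E.ι-inj (trans (sym (A.-‿involutive _)) (trans
            (cong A.-_ (A.+-cancelˡ (x c) _ _ (funToFin-inj {f = point i} {point j} eq c))) (A.-‿involutive _)))
          f∈ : ∀ j c → P (x c A.- finToFun (f j) c)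
          f∈ j c = subst P (sym (begin
            x c A.- finToFun (f j) c                  ≡⟨ cong (λ z → x c A.- z) (Finₚ.finToFun-funToFin (point j) c) ⟩
            x c A.- (x c A.- κ)                       ≡⟨ cong (x c ⊹_) (⁻¹-anti-homo‿- (x c) κ) ⟩
            x c ⊹ (κ A.- x c)                         ≡⟨ A.+-assoc (x c) κ _ ⟨
            x c ⊹ κ A.- x c                           ≡⟨ xyx⁻¹≈y (x c) κ ⟩
            κ                                         ∎)) (E.ι∈ (finToFun j c))
            where
            open ≡.≡-Reasoning
            open import Algebra.Properties.AbelianGroup (Ring.+-abelianGroup A.ring) using (⁻¹-anti-homo‿-; xyx⁻¹≈y)
            κ = E.ι (finToFun j c)

        class-size : ∀ a → E.size ℕ.^ k ℕ.≤ Enumeration.size (enumerate (AllR? twists a))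
        class-size a = ℕₚ.≤-trans (translate-size (finToFun a) Q) (size-mono Q (enumerate (AllR? twists a)) related)
          where Q = enumerate (λ j → Finₚ.all? (λ c → P? (finToFun a c A.- finToFun j c)))

        class-size-o : E.size ℕ.^ k ℕ.≤ Enumeration.size (enumerate (λ a → AllR? twists a o))
        class-size-o = ℕₚ.≤-trans (translate-size (λ _ → A.0#) Q) (size-mono Q (enumerate (λ a → AllR? twists a o))
          λ {j} h → related λ c → subst P (trans (neg-0- _) (sym (trans (cong (λ z → finToFun j c A.- z) (o≡0 c)) (x-0≡x _)))) (-∈ (h c)))
          where Q = enumerate (λ j → Finₚ.all? (λ c → P? (A.0# A.- finToFun j c)))

        -- Every point is related to at least |H|^k points, so the second moment is at least N^k
        -- |H|^k, against the bound B N^k.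
        invariant⇒small : (∀ x y → (∀ c → P (x c A.- y c)) → χ ϕ (F x A.- F y) ≈ 1#) → E.size ℕ.^ k ℕ.≤ B
        invariant⇒small inv = ℕₚ.*-cancelˡ-≤ (N ℕ.^ k) {{nz}} (subst (N ℕ.^ k ℕ.* E.size ℕ.^ k ℕ.≤_) (ℕₚ.*-comm B (N ℕ.^ k))
          (invariant-bound 𝓖 𝓖-bound twists closed g₀ 𝓖-g₀
            (λ a b r → ≈trans (χ-difference ϕ _ _) (inv (finToFun a) (finToFun b) (unrelated r))) class-size))
          where
          nz : ℕ.NonZero (N ℕ.^ k)
          nz = Finₚ.nonZeroIndex o

        -- The class of the origin contains at least |H|^k points, and the sum over it has its
        -- squared size as squared modulus.
        constant⇒small : ∀ {c} → c * conj c ≈ 1# → (∀ x → (∀ i → P (x i)) → χ ϕ (F x) ≈ c) →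
                         E.size ℕ.^ k ℕ.* E.size ℕ.^ k ℕ.≤ B ℕ.* N ℕ.^ k
        constant⇒small cc̄ const = ℕₚ.≤-trans (ℕₚ.*-mono-≤ class-size-o class-size-o)
          (constant-bound 𝓖 𝓖-bound twists closed g₀ 𝓖-g₀ cc̄
            (λ a r → const (finToFun a) (λ i → subst P (trans (cong (λ z → finToFun a i A.- z) (o≡0 i)) (x-0≡x _)) (unrelated r i))))

-- Salem sets satisfy a Fourier bound

module FilterSum {c ℓ} (M : CommutativeMonoid c ℓ) where
  open CommutativeMonoid M renaming (_∙_ to _+_; ε to 0#; refl to ≈refl; sym to ≈sym; trans to ≈trans)
  open MonoidSum M using (sum; sum-cong-≋; ∑-comm; sum-replicate-zero)

  select : ∀ {p} {P : Set p} → Dec P → Carrier → Carrier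
  select (yes _) z = z
  select (no _)  z = 0#

  select-yes : ∀ {p} {P : Set p} (d : Dec P) {z} → P → select d z ≈ z
  select-yes (yes _) p = ≈refl
  select-yes (no ¬p) p = contradiction p ¬p

  select-no : ∀ {p} {P : Set p} (d : Dec P) {z} → ¬ P → select d z ≈ 0#
  select-no (yes p) ¬p = contradiction p ¬p
  select-no (no _)  ¬p = ≈refl

  foldr-filter : ∀ {a b p} {X : Set a} {Y : Set b} {P : Y → Set p} (P? : Decidable P) (ψ : Y → Carrier) (g : X → Y)
    {m} (h : Fin m → X) →
    foldr _+_ 0# (map ψ (filter P? (map g (tabulate h)))) ≈ sum (λ j → select (P? (g (h j))) (ψ (g (h j))))
  foldr-filter P? ψ g {zero}  h = ≈refl
  foldr-filter P? ψ g {suc m} h with P? (g (h zero))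
  ... | yes _ = ∙-congˡ (foldr-filter P? ψ g (h ∘ suc))
  ... | no _  = ≈trans (foldr-filter P? ψ g (h ∘ suc)) (≈sym (identityˡ _))

  sum-zero : ∀ {n} {f : Fin n → Carrier} → (∀ i → f i ≈ 0#) → sum f ≈ 0#
  sum-zero {n} h = ≈trans (sum-cong-≋ h) (sum-replicate-zero n)

  sum-single : ∀ {n} (i : Fin n) (z : Fin n → Carrier) → (∀ j → j ≢ i → z j ≈ 0#) → sum z ≈ z i
  sum-single zero    z h = ≈trans (∙-congˡ (sum-zero (λ j → h (suc j) λ ()))) (identityʳ _)
  sum-single (suc i) z h = ≈trans (∙-congʳ (h zero λ ())) (≈trans (identityˡ _)
    (sum-single i (z ∘ suc) (λ j ne → h (suc j) (ne ∘ Finₚ.suc-injective))))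

  -- Both sides are the double sum of f(j) over the pairs (j, a) with j = ι(a), taken in the two
  -- orders.
  select-sum : ∀ {m p} {P : Fin m → Set p} (P? : Decidable P) {n} (ι : Fin n → Fin m) →
    (∀ {a b} → ι a ≡ ι b → a ≡ b) → (∀ a → P (ι a)) → (∀ j → P j → ∃[ a ] ι a ≡ j) →
    (f : Fin m → Carrier) → sum (λ j → select (P? j) (f j)) ≈ sum (f ∘ ι)
  select-sum P? {n} ι ι-inj ι∈ cover f = ≈trans (sum-cong-≋ rows)
    (≈trans (∑-comm (λ j a → select (j Finₚ.≟ ι a) (f j))) (sum-cong-≋ columns))
    where
    rows : ∀ j → select (P? j) (f j) ≈ sum {n} (λ a → select (j Finₚ.≟ ι a) (f j))
    rows j with P? j
    ... | yes p with cover j p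
    ...   | a , eq = ≈sym (≈trans (sum-single a _ (λ b ne → select-no (j Finₚ.≟ ι b) (λ e → ne (ι-inj (trans (sym e) (sym eq))))))
                               (select-yes (j Finₚ.≟ ι a) (sym eq)))
    rows j | no ¬p = ≈sym (sum-zero (λ a → select-no (j Finₚ.≟ ι a) (λ e → ¬p (subst _ (sym e) (ι∈ a)))))
    columns : ∀ a → sum (λ j → select (j Finₚ.≟ ι a) (f j)) ≈ f (ι a)
    columns a = ≈trans (sum-single (ι a) _ (λ j ne → select-no (j Finₚ.≟ ι a) ne)) (select-yes (ι a Finₚ.≟ ι a) refl)

-- Tuples with an appended last coordinate

snoc : ∀ {a} {X : Set a} {k} → (Fin k → X) → X → Fin (suc k) → X
snoc {k = zero}  x y _       = y
snoc {k = suc k} x y zero    = x zero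
snoc {k = suc k} x y (suc i) = snoc (x ∘ suc) y i

init-snoc : ∀ {a} {X : Set a} {k} (x : Fin k → X) y → init (snoc x y) ≗ x
init-snoc {k = suc k} x y zero    = refl
init-snoc {k = suc k} x y (suc i) = init-snoc (x ∘ suc) y i

last-snoc : ∀ {a} {X : Set a} {k} (x : Fin k → X) y → last (snoc x y) ≡ y
last-snoc {k = zero}  x y = refl
last-snoc {k = suc k} x y = last-snoc (x ∘ suc) y

snoc-unique : ∀ {a} {X : Set a} {k} (z : Fin (suc k) → X) x y → x ≗ init z → y ≡ last z → snoc x y ≗ z
snoc-unique {k = zero}  z x y p q zero    = q
snoc-unique {k = suc k} z x y p q zero    = p zero
snoc-unique {k = suc k} z x y p q (suc i) = snoc-unique (z ∘ suc) (x ∘ suc) y (p ∘ suc) q i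

-- From the Salem inequality to a rational bound on the squared modulus

module NormBound (C : ℝ) (K : ℕ) (C≤K : Eventually (λ n → ℚ.∣ seq C n ∣ ℚ.≤ toℚ K)) where
  open +-*-Solver

  constant : ℕ
  constant = 2 ℕ.* (K ℕ.* K) ℕ.+ 2

  ≤∣∣ : ∀ x → x ℚ.≤ ℚ.∣ x ∣
  ≤∣∣ x with ℚₚ.≤-total 0ℚ x
  ... | inj₁ 0≤x = ≡⇒≤ (sym (ℚₚ.0≤p⇒∣p∣≡p 0≤x))
  ... | inj₂ x≤0 = ℚₚ.≤-trans x≤0 (ℚₚ.0≤∣p∣ x)

  square-mono : ∀ {x y} → 0ℚ ℚ.≤ x → x ℚ.≤ y → x ℚ.* x ℚ.≤ y ℚ.* y
  square-mono 0≤x x≤y = *-mono 0≤x (ℚₚ.≤-trans 0≤x x≤y) x≤y x≤y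

  -- (K t + 1)² ≤ 2 K² t² + 2 ≤ (2 K² + 2) L when t² ≤ L and 1 ≤ L
  square-bound : ∀ {t} L → t ℚ.* t ℚ.≤ toℚ (suc L) →
    (toℚ K ℚ.* t ℚ.+ 1ℚ) ℚ.* (toℚ K ℚ.* t ℚ.+ 1ℚ) ℚ.≤ toℚ (constant ℕ.* suc L)
  square-bound {t} L tt≤L = begin
    (κ ℚ.* t ℚ.+ 1ℚ) ℚ.* (κ ℚ.* t ℚ.+ 1ℚ)                      ≤⟨ ≤+ʳ (0≤sq (κ ℚ.* t ℚ.- 1ℚ)) ⟩
    (κ ℚ.* t ℚ.+ 1ℚ) ℚ.* (κ ℚ.* t ℚ.+ 1ℚ) ℚ.+ (κ ℚ.* t ℚ.- 1ℚ) ℚ.* (κ ℚ.* t ℚ.- 1ℚ)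
      ≡⟨ solve 2 (λ k t → (k :* t :+ con 1ℚ) :* (k :* t :+ con 1ℚ) :+ (k :* t :- con 1ℚ) :* (k :* t :- con 1ℚ)
           := con 2ℚ :* (k :* k) :* (t :* t) :+ con 2ℚ :* con 1ℚ) refl κ t ⟩
    2ℚ ℚ.* (κ ℚ.* κ) ℚ.* (t ℚ.* t) ℚ.+ 2ℚ ℚ.* 1ℚ
      ≤⟨ ℚₚ.+-mono-≤ (ℚₚ.*-monoˡ-≤-nonNeg (2ℚ ℚ.* (κ ℚ.* κ)) {{nn (0≤* (0≤toℚ 2) (0≤sq κ))}} tt≤L)
           (ℚₚ.*-monoˡ-≤-nonNeg 2ℚ (toℚ-mono {1} {suc L} (s≤s z≤n))) ⟩
    2ℚ ℚ.* (κ ℚ.* κ) ℚ.* l ℚ.+ 2ℚ ℚ.* l                         ≡⟨ ℚₚ.*-distribʳ-+ l (2ℚ ℚ.* (κ ℚ.* κ)) 2ℚ ⟨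
    (2ℚ ℚ.* (κ ℚ.* κ) ℚ.+ 2ℚ) ℚ.* l                             ≡⟨ cong (ℚ._* l) const≡ ⟨
    toℚ constant ℚ.* l                                          ≡⟨ toℚ-* constant (suc L) ⟨
    toℚ (constant ℕ.* suc L)                                    ∎
    where
    open ℚₚ.≤-Reasoning
    κ = toℚ K
    l = toℚ (suc L)
    2ℚ = toℚ 2
    const≡ : toℚ constant ≡ 2ℚ ℚ.* (κ ℚ.* κ) ℚ.+ 2ℚ
    const≡ = trans (cong toℚ (ℕₚ.+-comm (2 ℕ.* (K ℕ.* K)) 2)) (trans (toℚ-suc (suc (2 ℕ.* (K ℕ.* K))))
      (trans (cong (ℚ._+ 1ℚ) (toℚ-suc (2 ℕ.* (K ℕ.* K)))) (trans
        (cong (λ u → u ℚ.+ 1ℚ ℚ.+ 1ℚ) (trans (toℚ-* 2 (K ℕ.* K)) (cong (2ℚ ℚ.*_) (toℚ-* K K))))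
        (ℚₚ.+-assoc (2ℚ ℚ.* (κ ℚ.* κ)) 1ℚ 1ℚ))))

  -- z, ρ and l are kept apart from their values, which the type checker would otherwise unfold.
  norm-bound : ∀ {z ρ l} (S : ℂ) r → 0ℚ ℚ.< r → ∀ L → z ≡ ρ ·ᶜ S → ρ ≡ fromℚ r → l ≡ fromℚ (toℚ (suc L)) →
    ∣ z ∣ᶜ ≤ᴿ C *ᴿ ρ *ᴿ √ᴿ l → Below (S *ᶜ conjugate S) (toℚ (constant ℕ.* suc L))
  norm-bound S r 0<r L refl refl refl salem ε 0<ε = ev-map₂ (λ {n} C≤ h → at n ε 0<ε C≤ (proj₁ h) (proj₂ h)) C≤K
    (ev-map₂ _,_ (salem (½ ℚ.* r) 0<½r) small-δ)
    where
    0<½r = 0<* 0<½ 0<r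
    0≤r = ℚₚ.<⇒≤ 0<r
    small-δ : Eventually (λ n → 1/suc n ℚ.≤ ½ ℚ.* r)
    small-δ = let M , le = archimedean (½ ℚ.* r) 0<½r in M , λ n M≤n → ℚₚ.≤-trans (1/suc-antimono M≤n) le
    a b : ℕ → ℚ
    a = seq (re S)
    b = seq (im S)
    at : ∀ n ε → 0ℚ ℚ.< ε → ℚ.∣ seq C n ∣ ℚ.≤ toℚ K →
      sqrtApprox n (r ℚ.* a n ℚ.* (r ℚ.* a n) ℚ.+ r ℚ.* b n ℚ.* (r ℚ.* b n)) ℚ.≤
        seq C n ℚ.* r ℚ.* sqrtApprox n (toℚ (suc L)) ℚ.+ ½ ℚ.* r →
      1/suc n ℚ.≤ ½ ℚ.* r →
      a n ℚ.* a n ℚ.- b n ℚ.* ℚ.- b n ℚ.≤ toℚ (constant ℕ.* suc L) ℚ.+ ε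
    at n ε 0<ε C≤ s≤ δ≤ = begin
      a n ℚ.* a n ℚ.- b n ℚ.* ℚ.- b n      ≡⟨ solve 2 (λ a b → a :* a :- b :* (:- b) := a :* a :+ b :* b) refl (a n) (b n) ⟩
      x                                    ≤⟨ ℚₚ.*-cancelˡ-≤-pos (r ℚ.* r) {{ℚ.positive (0<* 0<r 0<r)}} scaled ⟩
      v ℚ.* v                              ≤⟨ square-bound L (subst (t ℚ.* t ℚ.≤_) (ℚₚ.p≥q⇒p⊔q≡p (0≤toℚ (suc L))) (proj₁ (proj₂ t-bounds))) ⟩
      toℚ (constant ℕ.* suc L)             ≤⟨ ≤+ʳ (ℚₚ.<⇒≤ 0<ε) ⟩
      toℚ (constant ℕ.* suc L) ℚ.+ ε       ∎
      where
      open ℚₚ.≤-Reasoning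
      x = a n ℚ.* a n ℚ.+ b n ℚ.* b n
      y = r ℚ.* a n ℚ.* (r ℚ.* a n) ℚ.+ r ℚ.* b n ℚ.* (r ℚ.* b n)
      s = sqrtApprox n y
      t = sqrtApprox n (toℚ (suc L))
      δ = 1/suc n
      v = toℚ K ℚ.* t ℚ.+ 1ℚ
      s-bounds = sqrtApprox-bounds n y
      t-bounds = sqrtApprox-bounds n (toℚ (suc L))
      0≤t = proj₁ t-bounds
      s+δ≤ : s ℚ.+ δ ℚ.≤ r ℚ.* v
      s+δ≤ = begin
        s ℚ.+ δ                                               ≤⟨ ℚₚ.+-mono-≤ s≤ δ≤ ⟩
        seq C n ℚ.* r ℚ.* t ℚ.+ ½ ℚ.* r ℚ.+ ½ ℚ.* r           ≡⟨ ℚₚ.+-assoc (seq C n ℚ.* r ℚ.* t) _ _ ⟩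
        seq C n ℚ.* r ℚ.* t ℚ.+ (½ ℚ.* r ℚ.+ ½ ℚ.* r)         ≡⟨ cong₂ ℚ._+_ (ℚₚ.*-assoc (seq C n) r t) (½+½ r) ⟩
        seq C n ℚ.* (r ℚ.* t) ℚ.+ r                           ≤⟨ ℚₚ.+-monoˡ-≤ r (ℚₚ.*-monoʳ-≤-nonNeg (r ℚ.* t) {{nn (0≤* 0≤r 0≤t)}} (ℚₚ.≤-trans (≤∣∣ (seq C n)) C≤)) ⟩
        toℚ K ℚ.* (r ℚ.* t) ℚ.+ r                             ≡⟨ solve 3 (λ k r t → k :* (r :* t) :+ r := r :* (k :* t :+ con 1ℚ)) refl (toℚ K) r t ⟩
        r ℚ.* v                                               ∎
      scaled : r ℚ.* r ℚ.* x ℚ.≤ r ℚ.* r ℚ.* (v ℚ.* v)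
      scaled = begin
        r ℚ.* r ℚ.* x                  ≡⟨ solve 3 (λ r a b → r :* r :* (a :* a :+ b :* b) := r :* a :* (r :* a) :+ r :* b :* (r :* b)) refl r (a n) (b n) ⟩
        y                              ≤⟨ ℚₚ.p≤p⊔q y 0ℚ ⟩
        y ℚ.⊔ 0ℚ                       ≤⟨ proj₂ (proj₂ s-bounds) ⟩
        (s ℚ.+ δ) ℚ.* (s ℚ.+ δ)        ≤⟨ square-mono (0≤+ (proj₁ s-bounds) (ℚₚ.<⇒≤ (0<1/suc n))) s+δ≤ ⟩
        r ℚ.* v ℚ.* (r ℚ.* v)          ≡⟨ solve 2 (λ r v → r :* v :* (r :* v) := r :* r :* (v :* v)) refl r v ⟩
        r ℚ.* r ℚ.* (v ℚ.* v)          ∎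

natural-bound : ∀ C → ∃[ K ] Eventually (λ n → ℚ.∣ seq C n ∣ ℚ.≤ toℚ K)
natural-bound C = let q , 0<q , h = bound C
                  in suc ℤ.∣ ℚ.floor q ∣ , ev-map (λ le → ℚₚ.≤-trans le (proj₂ (floor-bounds q (ℚₚ.<⇒≤ 0<q)))) h

module _ {c ℓ} (R : FiniteRing c ℓ) where
  open FiniteRing R using (_≈_; _+_; _*_; 0#; 1#; +-cong; *-cong; -‿cong)
  private module R = FiniteRing R
  open RawMonoidDefs R.+-rawMonoid using () renaming (_×_ to _·_)

  ·-cong : ∀ n {x y} → x ≈ y → n · x ≈ n · y
  ·-cong zero    p = R.refl
  ·-cong (suc n) p = +-cong p (·-cong n p)

  ℤ·-cong : ∀ a {x y} → x ≈ y → (R ℤ· a) x ≈ (R ℤ· a) y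
  ℤ·-cong (ℤ.+ n)    p = ·-cong n p
  ℤ·-cong ℤ.-[1+ n ] p = -‿cong (·-cong (suc n) p)

  word-cong : ∀ {k} (w : List (Fin k)) {x y} → (∀ i → x i ≈ y i) →
              foldr _*_ 1# (map x w) ≈ foldr _*_ 1# (map y w)
  word-cong []      h = R.refl
  word-cong (i ∷ w) h = *-cong (h i) (word-cong w h)

  evaluate-cong : ∀ {k} (f : Polynomial k) {x y} → (∀ i → x i ≈ y i) → evaluate R f x ≈ evaluate R f y
  evaluate-cong []            h = R.refl
  evaluate-cong ((a , w) ∷ f) h = +-cong (ℤ·-cong a (word-cong w h)) (evaluate-cong f h)

below-resp-norm : ∀ {z w q} → z ≃ᶜ w → Below (z *ᶜ conjugate z) q → Below (w *ᶜ conjugate w) q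
below-resp-norm {z} {w} {q} eq = below-resp {z *ᶜ conjugate z} {w *ᶜ conjugate w} {q}
  (KTools.*-cong ℂ-commutativeRing {z} {w} {conjugate z} {conjugate w} eq (conjugate-cong {z} {w} eq))

-- For a variable predicate S, so that its decision procedure does not unfold.
module _ {c ℓ p} (R : FiniteRing c ℓ) (d : ℕ) {S : Pred (Space.Carrier R d) p} (S? : Decidable S)
  (C : ℝ) (K₀ : ℕ) (C≤K : Eventually (λ n → ℚ.∣ ℝ.seq C n ∣ ℚ.≤ RealLemmas.toℚ K₀)) where
  open NormBound C K₀ C≤K
  private module R = FiniteRing R

  salem⇒norm-bound : IsSalem R d S? C → ∀ ψ → IsCharacter R d ψ → Nontrivial R d ψ →
    ∀ L → length (elements R d S?) ≡ suc L →
    ∀ {S} → foldr _+ᶜ_ 0ᶜ (map ψ (elements R d S?)) ≃ᶜ S → Below (S *ᶜ conjugate S) (RealLemmas.toℚ (constant ℕ.* suc L))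
  salem⇒norm-bound salem ψ char nt L eq {S} S≃ = below-resp-norm {foldr _+ᶜ_ 0ᶜ (map ψ (elements R d S?))} {S} {RealLemmas.toℚ (constant ℕ.* suc L)} S≃ (norm-bound
    {fourier R d S? ψ} {∣R∣^-d R d S?} {fromℚ (ℤ.+ length (elements R d S?) ℚ./ 1)}
    (foldr _+ᶜ_ 0ᶜ (map ψ (elements R d S?))) r 0<r L refl refl (cong (λ l → fromℚ (ℤ.+ l ℚ./ 1)) eq) (salem ψ char nt))
    where
    r : ℚ
    r = (ℤ.+ 1 ℚ./ (R.card ℕ.^ d)) {{ℕₚ.m^n≢0 R.card d}}
    0<r : 0ℚ ℚ.< r
    0<r = ℚₚ.positive⁻¹ r {{ℚₚ.normalize-pos 1 (R.card ℕ.^ d) {{ℕₚ.m^n≢0 R.card d}}}}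

module SalemTransfer {c ℓ} (R : FiniteRing c ℓ) (k : ℕ) (f : Polynomial k) where
  open Transport R
  private module R = FiniteRing R
  open FinRing finRing using (N) renaming (_+_ to _⊹_)
  open Characters ℂ-scalars finRing
  open SalemBounds ℂ-scalars finRing k using (VChar; ψ; ψ-cong; ψ-+; ψ-0; norm; graphSum; graphSum-cong; FourierBound; fourier-bound)
  private module K = ScalarTools ℂ-scalars

  F : (Fin k → Fin N) → Fin N
  F x = to (evaluate R f (from ∘ x))

  F-cong : ∀ {x y} → x ≗ y → F x ≡ F y
  F-cong h = to-cong (evaluate-cong R f (λ i → R.reflexive (cong from (h i))))

  fun : Fin (N ℕ.^ k) → Fin k → Fin N
  fun = finToFun {N} {k}

  fun⁺ : Fin (N ℕ.^ suc k) → Fin (suc k) → Fin N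
  fun⁺ = finToFun {N} {suc k}

  init′ : ∀ {a} {X : Set a} → (Fin (suc k) → X) → Fin k → X
  init′ = init {n = k}

  last′ : ∀ {a} {X : Set a} → (Fin (suc k) → X) → X
  last′ = last {n = k}

  point : Fin (N ℕ.^ suc k) → Fin (suc k) → R.Carrier
  point j = from ∘ fun⁺ j

  On : Fin (N ℕ.^ suc k) → Set ℓ
  On j = V R f (point j)

  graph : Fin (N ℕ.^ k) → Fin (N ℕ.^ suc k)
  graph a = funToFin {suc k} {N} (snoc (fun a) (F (fun a)))

  graph-point : ∀ a → fun⁺ (graph a) ≗ snoc (fun a) (F (fun a))
  graph-point a = Finₚ.finToFun-funToFin (snoc (fun a) (F (fun a)))

  graph-init : ∀ a → init′ (fun⁺ (graph a)) ≗ fun a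
  graph-init a i = trans (graph-point a (inject₁ i)) (init-snoc (fun a) (F (fun a)) i)

  graph-last : ∀ a → last′ (fun⁺ (graph a)) ≡ F (fun a)
  graph-last a = trans (graph-point a (fromℕ k)) (last-snoc (fun a) (F (fun a)))

  graph-inj : ∀ {a b} → graph a ≡ graph b → a ≡ b
  graph-inj {a} {b} eq = finToFun-inj {k} {N} λ i → trans (sym (graph-init a i))
    (trans (cong (λ j → fun⁺ j (inject₁ i)) eq) (graph-init b i))

  graph-on : ∀ a → On (graph a)
  graph-on a = R.trans (R.reflexive (cong from (graph-last a))) (R.trans (strictlyInverseʳ _)
    (evaluate-cong R f (λ i → R.reflexive (cong from (sym (graph-init a i))))))

  graph-cover : ∀ j → On j → ∃[ a ] graph a ≡ j
  graph-cover j on = a , trans (funToFin-cong {suc k} {N} (snoc-unique (fun⁺ j) (fun a) (F (fun a)) init≡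
      (trans (F-cong init≡) (trans (to-cong {evaluate R f (from ∘ init′ (fun⁺ j))} {from (last′ (fun⁺ j))} (R.sym on))
        (strictlyInverseˡ (last′ (fun⁺ j)))))))
    (Finₚ.funToFin-finToFin {suc k} {N} j)
    where
    a = funToFin {k} {N} (init′ (fun⁺ j))
    init≡ : fun a ≗ init′ (fun⁺ j)
    init≡ = Finₚ.finToFun-funToFin (init′ (fun⁺ j))

  on-size : length (elements R (suc k) (V? R f)) ≡ N ℕ.^ k
  on-size = begin
    length (elements R (suc k) (V? R f))                                             ≡⟨ length-foldr (elements R (suc k) (V? R f)) ⟩
    foldr ℕ._+_ 0 (map (λ _ → 1) (elements R (suc k) (V? R f)))                      ≡⟨ foldr-filter (V? R f) (λ _ → 1) point (λ j → j) ⟩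
    sum (λ j → select (V? R f (point j)) 1)                                    ≡⟨ select-sum (V? R f ∘ point) graph (λ {a} {b} → graph-inj {a} {b}) graph-on graph-cover (λ _ → 1) ⟩
    sum {N ℕ.^ k} (λ _ → 1)                                                    ≡⟨ sum-1 (N ℕ.^ k) ⟩
    N ℕ.^ k                                                                    ∎
    where
    open ≡.≡-Reasoning
    open FilterSum ℕₚ.+-0-commutativeMonoid
    open RawMonoidDefs (CommutativeMonoid.rawMonoid ℕₚ.+-0-commutativeMonoid) using (sum)
    length-foldr : ∀ {a} {X : Set a} (xs : List X) → length xs ≡ foldr ℕ._+_ 0 (map (λ _ → 1) xs)
    length-foldr []       = refl
    length-foldr (x ∷ xs) = cong suc (length-foldr xs)
    sum-1 : ∀ n → sum {n} (λ _ → 1) ≡ n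
    sum-1 zero    = refl
    sum-1 (suc n) = cong suc (sum-1 n)

  module _ (ϕ : Char) (β : VChar) where

    -- Nontriviality of `ϕ` on the last coordinate makes `Ψ` nontrivial for every `β`; the choice of
    -- `β` is the freedom that the averaging exploits.
    Ψ : (Fin (suc k) → R.Carrier) → ℂ
    Ψ x = χ ϕ (to (last′ x)) *ᶜ ψ β (to ∘ init′ x)

    Ψ-cong : ∀ {x y} → (∀ i → x i R.≈ y i) → Ψ x ≃ᶜ Ψ y
    Ψ-cong {x} {y} h = K.*-cong {χ ϕ (to (last′ x))} {χ ϕ (to (last′ y))} {ψ β (to ∘ init′ x)} {ψ β (to ∘ init′ y)}
      (K.reflexive {χ ϕ (to (last′ x))} {χ ϕ (to (last′ y))} (cong (χ ϕ) (to-cong (h (fromℕ k))))) (ψ-cong β (λ i → to-cong (h (inject₁ i))))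

    to-+ : ∀ x y → to (x R.+ y) ≡ to x ⊹ to y
    to-+ x y = to-cong (R.+-cong (R.sym (strictlyInverseʳ x)) (R.sym (strictlyInverseʳ y)))

    Ψ-homo : ∀ x y → Ψ (λ i → x i R.+ y i) ≃ᶜ Ψ x *ᶜ Ψ y
    Ψ-homo x y = K.≈trans {Ψ (λ i → x i R.+ y i)} {(a *ᶜ b) *ᶜ (u *ᶜ v)} {(a *ᶜ u) *ᶜ (b *ᶜ v)}
      (K.*-cong {χ ϕ (to (last′ x R.+ last′ y))} {a *ᶜ b} {ψ β (λ i → to (init′ x i R.+ init′ y i))} {u *ᶜ v}
        (K.≈trans {χ ϕ (to (last′ x R.+ last′ y))} {χ ϕ (to (last′ x) ⊹ to (last′ y))} {a *ᶜ b}
          (K.reflexive {χ ϕ (to (last′ x R.+ last′ y))} {χ ϕ (to (last′ x) ⊹ to (last′ y))} (cong (χ ϕ) (to-+ (last′ x) (last′ y)))) (χ-+ ϕ (to (last′ x)) (to (last′ y))))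
        (K.≈trans {ψ β (λ i → to (init′ x i R.+ init′ y i))} {ψ β (λ i → to (init′ x i) ⊹ to (init′ y i))} {u *ᶜ v}
          (ψ-cong β (λ i → to-+ (init′ x i) (init′ y i))) (ψ-+ β (to ∘ init′ x) (to ∘ init′ y))))
      (K.*-interchange a b u v)
      where
      a = χ ϕ (to (last′ x))
      b = χ ϕ (to (last′ y))
      u = ψ β (to ∘ init′ x)
      v = ψ β (to ∘ init′ y)

    Ψ-0 : Ψ (λ _ → R.0#) ≃ᶜ 1ᶜ
    Ψ-0 = K.≈trans {Ψ (λ _ → R.0#)} {1ᶜ *ᶜ 1ᶜ} {1ᶜ}
      (K.*-cong {χ ϕ (to R.0#)} {1ᶜ} {ψ β (λ _ → to R.0#)} {1ᶜ} (χ-0 ϕ) (ψ-0 β)) (K.*-identityˡ 1ᶜ)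

    Ψ-character : IsCharacter R (suc k) Ψ
    Ψ-character = record
      { isMagmaHomomorphism = record { isRelHomomorphism = record { cong = λ {x} {y} → Ψ-cong {x} {y} } ; homo = Ψ-homo }
      ; ε-homo = Ψ-0 }

    Ψ-nontrivial : ∀ {y} → ¬ χ ϕ y ≃ᶜ 1ᶜ → Nontrivial R (suc k) Ψ
    Ψ-nontrivial {y} nt trivial = nt (K.≈trans {χ ϕ y} {Ψ x} {1ᶜ} (K.≈sym {Ψ x} {χ ϕ y}
      (K.≈trans {Ψ x} {χ ϕ y *ᶜ 1ᶜ} {χ ϕ y}
        (K.*-cong {χ ϕ (to (last′ x))} {χ ϕ y} {ψ β (to ∘ init′ x)} {1ᶜ}
          (K.reflexive {χ ϕ (to (last′ x))} {χ ϕ y} (cong (χ ϕ) (trans (cong to (last-snoc {k = k} (λ _ → R.0#) (from y))) (strictlyInverseˡ y))))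
          (K.≈trans {ψ β (to ∘ init′ x)} {ψ β (λ _ → to R.0#)} {1ᶜ}
            (ψ-cong β (λ i → cong to (init-snoc {k = k} (λ _ → R.0#) (from y) i))) (ψ-0 β)))
        (K.*-identityʳ (χ ϕ y)))) (trivial x))
      where x = snoc {k = k} (λ _ → R.0#) (from y)

    at-graph : ∀ a → Ψ (point (graph a)) ≃ᶜ χ ϕ (F (fun a)) *ᶜ ψ β (fun a)
    at-graph a = K.*-cong {χ ϕ (to (last′ (point (graph a))))} {χ ϕ (F (fun a))} {ψ β (to ∘ init′ (point (graph a)))} {ψ β (fun a)}
      (K.reflexive {χ ϕ (to (last′ (point (graph a))))} {χ ϕ (F (fun a))} (cong (χ ϕ) (trans (strictlyInverseˡ (last′ (fun⁺ (graph a)))) (graph-last a))))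
      (ψ-cong β (λ i → trans (strictlyInverseˡ (init′ (fun⁺ (graph a)) i)) (graph-init a i)))

    open FilterSum K.+-commutativeMonoid

    step₁ : foldr _+ᶜ_ 0ᶜ (map Ψ (elements R (suc k) (V? R f))) ≃ᶜ K.sum (λ j → select (V? R f (point j)) (Ψ (point j)))
    step₁ = foldr-filter (V? R f) Ψ point (λ j → j)

    step₂ : K.sum (λ j → select (V? R f (point j)) (Ψ (point j))) ≃ᶜ K.sum (λ a → Ψ (point (graph a)))
    step₂ = select-sum (V? R f ∘ point) graph (λ {a} {b} → graph-inj {a} {b}) graph-on graph-cover (Ψ ∘ point)

    step₃ : K.sum (λ a → Ψ (point (graph a))) ≃ᶜ graphSum F ϕ β
    step₃ = graphSum-cong F ϕ β {λ a → Ψ (point (graph a))} at-graph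

    total≃ : foldr _+ᶜ_ 0ᶜ (map Ψ (elements R (suc k) (V? R f))) ≃ᶜ graphSum F ϕ β
    total≃ = K.≈trans {foldr _+ᶜ_ 0ᶜ (map Ψ (elements R (suc k) (V? R f)))} {K.sum (λ j → select (V? R f (point j)) (Ψ (point j)))} {graphSum F ϕ β}
      step₁ (K.≈trans {K.sum (λ j → select (V? R f (point j)) (Ψ (point j)))} {K.sum (λ a → Ψ (point (graph a)))} {graphSum F ϕ β} step₂ step₃)

  below⇒bd : ∀ {S u} → Below (S *ᶜ conjugate S) (ℕ⇒ℚ u) → Scalars.Bd ℂ-scalars (norm S) u
  below⇒bd h = h

  module _ (C : ℝ) (K₀ : ℕ) (C≤K : Eventually (λ n → ℚ.∣ ℝ.seq C n ∣ ℚ.≤ RealLemmas.toℚ K₀)) where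
    open NormBound C K₀ C≤K

    size : N ℕ.^ k ≡ suc (ℕ.pred (N ℕ.^ k))
    size = sym (ℕₚ.suc-pred (N ℕ.^ k) {{ℕₚ.m^n≢0 N k {{R.card-nonZero}}}})

    salem⇒below : IsSalem R (suc k) (V? R f) C → ∀ ϕ {y} → ¬ χ ϕ y ≃ᶜ 1ᶜ → ∀ β u → u ≡ constant ℕ.* N ℕ.^ k → ∀ {S} →
      foldr _+ᶜ_ 0ᶜ (map (Ψ ϕ β) (elements R (suc k) (V? R f))) ≃ᶜ S → Below (S *ᶜ conjugate S) (ℕ⇒ℚ u)
    salem⇒below salem ϕ nt β u u≡ {S} eq = subst (Below (S *ᶜ conjugate S))
      (trans (cong RealLemmas.toℚ (sym (trans u≡ (cong (constant ℕ.*_) size)))) (sym (ℕ⇒ℚ≡toℚ u)))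
      (salem⇒norm-bound R (suc k) (V? R f) C K₀ C≤K salem (Ψ ϕ β) (Ψ-character ϕ β) (Ψ-nontrivial ϕ β nt)
        (ℕ.pred (N ℕ.^ k)) (trans on-size size) {S} eq)

    salem⇒fourier : IsSalem R (suc k) (V? R f) C → FourierBound F constant
    salem⇒fourier salem = fourier-bound F constant λ ϕ nt β u u≡ →
      below⇒bd {graphSum F ϕ β} {u} (salem⇒below salem ϕ nt β u u≡ {graphSum F ϕ β} (total≃ ϕ β))

-- Prime factors and powers of natural numbers

prime-factor : ∀ m → 2 ℕ.≤ m → ∃[ p ] ∃[ q ] (Prime p × m ≡ q ℕ.* p)
prime-factor 1 (s≤s ())
prime-factor m@(suc (suc _)) _ = go factors isFactorisation factorsPrime
  where
  open PrimeFactorisation (factorise m)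
  go : ∀ ps → m ≡ product ps → All Prime ps → ∃[ p ] ∃[ q ] (Prime p × m ≡ q ℕ.* p)
  go (p ∷ ps) eq (pr ∷ _) = p , product ps , pr , trans eq (ℕₚ.*-comm p (product ps))

m≤m^k : ∀ m {k} → 1 ℕ.≤ k → m ℕ.≤ m ℕ.^ k
m≤m^k zero    {suc k} _ = z≤n
m≤m^k (suc m) {suc k} _ = ℕₚ.≤-trans (ℕₚ.≤-reflexive (sym (ℕₚ.*-identityʳ (suc m))))
  (ℕₚ.*-monoʳ-≤ (suc m) (ℕₚ.m^n>0 (suc m) k))

*-^ : ∀ m n k → (m ℕ.* n) ℕ.^ k ≡ m ℕ.^ k ℕ.* n ℕ.^ k
*-^ m n zero    = refl
*-^ m n (suc k) = trans (cong (m ℕ.* n ℕ.*_) (*-^ m n k))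
  (ℕS.solve 4 (λ a b c d → a ℕS.:* b ℕS.:* (c ℕS.:* d) ℕS.:= a ℕS.:* c ℕS.:* (b ℕS.:* d)) refl m n (m ℕ.^ k) (n ℕ.^ k))

-- This extracts a k-th root: m² > B N would give m^(2k) > B^k N^k, and B ≤ B^k for k ≥ 1.
square-root-bound : ∀ {m B N k} → 1 ℕ.≤ k → m ℕ.^ k ℕ.* m ℕ.^ k ℕ.≤ B ℕ.* N ℕ.^ k → m ℕ.* m ℕ.≤ B ℕ.* N
square-root-bound {m} {B} {N} {k} 1≤k h = ℕₚ.≮⇒≥ λ lt → ℕₚ.<-irrefl refl (ℕₚ.<-≤-trans
  (ℕₚ.^-monoˡ-< k {{ℕ.>-nonZero 1≤k}} lt) (ℕₚ.≤-trans (ℕₚ.≤-reflexive (*-^ m m k)) (ℕₚ.≤-trans h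
    (ℕₚ.≤-trans (ℕₚ.*-monoˡ-≤ (N ℕ.^ k) (m≤m^k B 1≤k)) (ℕₚ.≤-reflexive (sym (*-^ B N k)))))))

-- Noncommutative polynomials over a finite ring

module Evaluation (A : FinRing) where
  open RingTools A
  open SemiringMult (Ring.semiring ring) using (×-assoc-*) renaming (_×_ to _⋆_)
  open ≡-Reasoning

  _ℤ⋆_ : ℤ.ℤ → Fin N → Fin N
  (ℤ.+ n)    ℤ⋆ x = n ⋆ x
  ℤ.-[1+ n ] ℤ⋆ x = - (suc n ⋆ x)

  word : ∀ {k} → (Fin k → Fin N) → List (Fin k) → Fin N
  word x w = foldr _*_ 1# (map x w)

  eval : ∀ {k} → Polynomial k → (Fin k → Fin N) → Fin N
  eval []            x = 0#
  eval ((a , w) ∷ f) x = a ℤ⋆ word x w + eval f x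

  ℤ⋆-* : ∀ a x y → (a ℤ⋆ x) * y ≡ a ℤ⋆ (x * y)
  ℤ⋆-* (ℤ.+ n)    x y = ×-assoc-* n x y
  ℤ⋆-* ℤ.-[1+ n ] x y = trans (sym (-‿distribˡ-* (suc n ⋆ x) y)) (cong -_ (×-assoc-* (suc n) x y))

  -- A nonempty word ends in a variable, and right multiplication by e kills that variable.
  word-annihilated : ∀ {k e} {x : Fin k → Fin N} → (∀ i → x i * e ≡ 0#) → ∀ i w → word x (i ∷ w) * e ≡ 0#
  word-annihilated {e = e} {x} h i []      = trans (cong (_* e) (*-identityʳ (x i))) (h i)
  word-annihilated {e = e} {x} h i (j ∷ w) = trans (*-assoc (x i) _ e)
    (trans (cong (x i *_) (word-annihilated h j w)) (zeroʳ (x i)))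

  -- Only the empty words survive right multiplication by e, and they have the same value at x and
  -- y.
  eval-annihilated : ∀ {k e} (f : Polynomial k) {x y : Fin k → Fin N} → (∀ i → x i * e ≡ 0#) → (∀ i → y i * e ≡ 0#) →
                     eval f x * e ≡ eval f y * e
  eval-annihilated []            hx hy = refl
  eval-annihilated {e = e} ((a , w) ∷ f) {x} {y} hx hy = begin
    (a ℤ⋆ word x w + eval f x) * e        ≡⟨ distribʳ e _ _ ⟩
    a ℤ⋆ word x w * e + eval f x * e      ≡⟨ cong₂ _+_ (trans (ℤ⋆-* a _ e) (trans (cong (a ℤ⋆_) (words w)) (sym (ℤ⋆-* a _ e)))) (eval-annihilated f hx hy) ⟩
    a ℤ⋆ word y w * e + eval f y * e      ≡⟨ distribʳ e _ _ ⟨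
    (a ℤ⋆ word y w + eval f y) * e        ∎
    where
    words : ∀ w → word x w * e ≡ word y w * e
    words []      = refl
    words (i ∷ w) = trans (word-annihilated hx i w) (sym (word-annihilated hy i w))

  -- The product e z² e = (e z)(z e) involves z only through e z and z e.
  eval-squares : ∀ {k e} {x y : Fin k → Fin N} → (∀ i → e * x i ≡ e * y i) → (∀ i → x i * e ≡ y i * e) →
                 e * eval (sumOfSquares k) x * e ≡ e * eval (sumOfSquares k) y * e
  eval-squares {k} {e} {x} {y} l r = go (allFin k)
    where
    square : ∀ (z : Fin k → Fin N) i → e * ((ℤ.+ 1) ℤ⋆ word z (i ∷ i ∷ [])) * e ≡ (e * z i) * (z i * e)
    square z i = trans (cong (λ u → e * u * e) (trans (+-identityʳ _) (cong (z i *_) (*-identityʳ (z i)))))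
      (solve 2 (λ e z → (e ⊕ (z ⊕ z)) ⊕ e ⊜ (e ⊕ z) ⊕ (z ⊕ e)) refl e (z i))
    split : ∀ u v → e * (u + v) * e ≡ e * u * e + e * v * e
    split u v = trans (cong (_* e) (distribˡ e u v)) (distribʳ e _ _)
    go : ∀ is → e * eval (map (λ i → ℤ.+ 1 , i ∷ i ∷ []) is) x * e ≡ e * eval (map (λ i → ℤ.+ 1 , i ∷ i ∷ []) is) y * e
    go []       = refl
    go (i ∷ is) = trans (split _ _) (trans (cong₂ _+_
      (trans (square x i) (trans (cong₂ _*_ (l i) (r i)) (sym (square y i)))) (go is)) (sym (split _ _)))

-- Enlarging ideals by p A, and annihilators

module _ (A : FinRing) where
  open RingTools A
  open SemiringMult (Ring.semiring ring) using (×-assoc-*; ×-homo-+; ×-assocˡ) renaming (_×_ to _⋆_)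
  open AbelianGroupProperties (Ring.+-abelianGroup ring) using (⁻¹-∙-comm)
  open ≡-Reasoning

  ⋆≡*1 : ∀ n x → n ⋆ x ≡ (n ⋆ 1#) * x
  ⋆≡*1 n x = trans (cong (n ⋆_) (sym (*-identityˡ x))) (sym (×-assoc-* n 1# x))

  ⋆-+ : ∀ n x y → n ⋆ (x + y) ≡ n ⋆ x + n ⋆ y
  ⋆-+ n x y = trans (⋆≡*1 n (x + y)) (trans (distribˡ (n ⋆ 1#) x y) (sym (cong₂ _+_ (⋆≡*1 n x) (⋆≡*1 n y))))

  ⋆-neg : ∀ n x → n ⋆ (- x) ≡ - (n ⋆ x)
  ⋆-neg n x = trans (⋆≡*1 n (- x)) (trans (sym (-‿distribʳ-* (n ⋆ 1#) x)) (cong -_ (sym (⋆≡*1 n x))))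

  ⋆-*ʳ : ∀ n x r → n ⋆ x * r ≡ n ⋆ (x * r)
  ⋆-*ʳ n x r = ×-assoc-* n x r

  ⋆-*ˡ : ∀ n r x → r * (n ⋆ x) ≡ n ⋆ (r * x)
  ⋆-*ˡ n r x = SemiringMult.×-comm-* (Ring.semiring ring) n r x

  x-[]-+ : ∀ x y u v → (x + y) - (u + v) ≡ (x - u) + (y - v)
  x-[]-+ x y u v = begin
    x + y + - (u + v)         ≡⟨ cong (x + y +_) (⁻¹-∙-comm u v) ⟨
    x + y + (- u + - v)       ≡⟨ +-assoc x y _ ⟩
    x + (y + (- u + - v))     ≡⟨ cong (x +_) (+-assoc y (- u) (- v)) ⟨
    x + (y + - u + - v)       ≡⟨ cong (λ z → x + (z + - v)) (+-comm y (- u)) ⟩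
    x + (- u + y + - v)       ≡⟨ cong (x +_) (+-assoc (- u) y (- v)) ⟩
    x + (- u + (y + - v))     ≡⟨ +-assoc x (- u) _ ⟨
    x - u + (y - v)           ∎

  x-y-*ʳ : ∀ x y r → (x - y) * r ≡ x * r - y * r
  x-y-*ʳ x y r = trans (distribʳ r x (- y)) (cong (x * r +_) (sym (-‿distribˡ-* y r)))

  x-y-*ˡ : ∀ r x y → r * (x - y) ≡ r * x - r * y
  x-y-*ˡ r x y = trans (distribˡ r x (- y)) (cong (r * x +_) (sym (-‿distribʳ-* r y)))

  _+⋆_ : Ideal A → ℕ → Ideal A
  J +⋆ p = record
    { I   = λ z → ∃[ y ] I (z - p ⋆ y)
    ; I?  = λ z → Finₚ.any? (λ y → I? (z - p ⋆ y))
    ; 0∈  = 0# , subst I (sym (trans (+-identityˡ _) (trans (cong -_ (trans (⋆≡*1 p 0#) (zeroʳ _)))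
              (trans (sym (+-identityˡ _)) (-‿inverseʳ 0#))))) 0∈
    ; +∈  = λ { {x} {y} (u , h) (v , k) → u + v , subst I (sym (trans (cong (λ w → x + y - w) (⋆-+ p u v)) (x-[]-+ x y _ _))) (+∈ h k) }
    ; *∈ˡ = λ { r {x} (u , h) → r * u , subst I (trans (x-y-*ˡ r x _) (cong (λ w → r * x - w) (⋆-*ˡ p r u))) (*∈ˡ r h) }
    ; *∈ʳ = λ { {x} (u , h) r → u * r , subst I (trans (x-y-*ʳ x _ r) (cong (λ w → x * r - w) (⋆-*ʳ p u r))) (*∈ʳ h r) }
    }
    where open Ideal J

  multiple-of-1 : ∀ (J : Ideal A) → let open Ideal J in ∃[ m ] (I (suc m ⋆ 1#))
  multiple-of-1 J with Finₚ.pigeonhole (ℕₚ.n<1+n N) (λ i → toℕ i ⋆ 1#)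
  ... | i , j , i<j , eq = d , subst I (sym (+-cancelˡ (toℕ i ⋆ 1#) _ _ (begin
    toℕ i ⋆ 1# + suc d ⋆ 1#   ≡⟨ ×-homo-+ 1# (toℕ i) (suc d) ⟨
    (toℕ i ℕ.+ suc d) ⋆ 1#    ≡⟨ cong (_⋆ 1#) (trans (ℕₚ.+-suc (toℕ i) d) (ℕₚ.m+[n∸m]≡n i<j)) ⟩
    toℕ j ⋆ 1#                ≡⟨ eq ⟨
    toℕ i ⋆ 1#                ≡⟨ +-identityʳ _ ⟨
    toℕ i ⋆ 1# + 0#           ∎))) 0∈
    where
    open Ideal J
    d = toℕ j ℕ.∸ suc (toℕ i)

  -- p divides the least m ≥ 1 with m · 1 ∈ I
  proper-prime : (J : Ideal A) → ¬ Ideal.I J 1# → ∃[ p ] (Prime p × ¬ Ideal.I (J +⋆ p) 1#)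
  proper-prime J 1∉ with multiple-of-1 J
  ... | d , d∈ with least (λ m → I? (suc m ⋆ 1#)) d d∈
    where open Ideal J
  ... | zero , m∈ , _ = contradiction (subst (Ideal.I J) (+-identityʳ 1#) m∈) 1∉
  ... | suc m , m∈ , below with prime-factor (suc (suc m)) (s≤s (s≤s z≤n))
  ... | p , zero , _ , ()
  -- If 1 - p y lies in J, then so does (q + 1) · 1, as the sum of (q + 1)(1 - p y) and of (q + 1) p
  -- y = (m + 2) y. This contradicts the minimality of m + 2.
  ... | p , suc q , pr , eq = p , pr , λ { (y , h) → below q q<m (subst I (begin
      suc q ⋆ (1# - p ⋆ y) + (suc (suc m) ⋆ 1#) * y     ≡⟨ cong₂ _+_ (⋆-+ (suc q) 1# _) (sym (⋆≡*1 (suc (suc m)) y)) ⟩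
      suc q ⋆ 1# + suc q ⋆ (- (p ⋆ y)) + suc (suc m) ⋆ y ≡⟨ cong₂ (λ u v → suc q ⋆ 1# + u + v) (trans (⋆-neg (suc q) (p ⋆ y)) (cong -_ (×-assocˡ y (suc q) p))) (cong (_⋆ y) eq) ⟩
      suc q ⋆ 1# + - ((suc q ℕ.* p) ⋆ y) + (suc q ℕ.* p) ⋆ y ≡⟨ x-y+y≡x _ _ ⟩
      suc q ⋆ 1#                                        ∎)
      (+∈ (subst I (sym (⋆≡*1 (suc q) _)) (*∈ˡ (suc q ⋆ 1#) h)) (*∈ʳ m∈ y))) }
    where
    open Ideal J
    q<m : q ℕ.< suc m
    q<m = ℕₚ.≤-pred (subst (suc q ℕ.<_) (sym eq) (ℕₚ.m<m*n (suc q) p (ℕ.nonTrivial⇒n>1 p {{prime⇒nonTrivial pr}})))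

  left-annihilator : Ideal A → Ideal A
  left-annihilator J = record
    { I = λ r → ∀ x → I x → r * x ≡ 0#
    ; I? = λ r → Finₚ.all? (λ x → I? x →-dec (r * x ≟ 0#))
    ; 0∈ = λ x _ → zeroˡ x
    ; +∈ = λ {r} {s} p q x h → trans (distribʳ x r s) (trans (cong₂ _+_ (p x h) (q x h)) (+-identityˡ 0#))
    ; *∈ˡ = λ s {r} p x h → trans (*-assoc s r x) (trans (cong (s *_) (p x h)) (zeroʳ s))
    ; *∈ʳ = λ {r} p s x h → trans (*-assoc r s x) (p (s * x) (*∈ˡ s h)) }
    where
    open Ideal J
    open import Relation.Nullary.Decidable using (_→-dec_)

  -- A acts on I with kernel the annihilator, so A has at most |I|^|I| |Ann I| elements.
  module _ (J : Ideal A) (E : Enumeration (Ideal.I J)) (EA : Enumeration (Ideal.I (left-annihilator J))) where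
    open Ideal J
    private
      module E = Enumeration E
      module EA = Enumeration EA

    action : Fin N → Fin (E.size ℕ.^ E.size)
    action r = funToFin (λ i → E.index (*∈ˡ r (E.ι∈ i)))

    action≡ : ∀ {r s} → action r ≡ action s → ∀ x → I x → r * x ≡ s * x
    action≡ {r} {s} eq x h = begin
      r * x                          ≡⟨ cong (r *_) (E.ι-index h) ⟨
      r * E.ι (E.index h)            ≡⟨ E.index-inj (*∈ˡ r (E.ι∈ _)) (*∈ˡ s (E.ι∈ _)) (funToFin-inj eq (E.index h)) ⟩
      s * E.ι (E.index h)            ≡⟨ cong (s *_) (E.ι-index h) ⟩
      s * x                          ∎

    -- The choice depends on the value v alone, so elements that act alike get the same
    -- representative. The default `0#` is returned only for v outside the image of `action`.
    representative : ∀ v → Dec (∃[ r ] action r ≡ v) → Fin N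
    representative v (yes (r , _)) = r
    representative v (no _)        = 0#

    representative-action : ∀ r (d : Dec (∃[ s ] action s ≡ action r)) → action (representative (action r) d) ≡ action r
    representative-action r (yes (s , eq)) = eq
    representative-action r (no none)      = contradiction (r , refl) none

    rep : Fin N → Fin N
    rep r = representative (action r) (Finₚ.any? (λ s → action s Finₚ.≟ action r))

    rep-cong : ∀ {r s} → action r ≡ action s → rep r ≡ rep s
    rep-cong eq = cong (λ v → representative v (Finₚ.any? (λ s → action s Finₚ.≟ v))) eq

    difference∈ : ∀ r → Ideal.I (left-annihilator J) (r - rep r)
    difference∈ r x h = trans (x-y-*ʳ r (rep r) x) (trans (cong (λ u → r * x - u)
      (action≡ (representative-action r (Finₚ.any? (λ s → action s Finₚ.≟ action r))) x h)) (-‿inverseʳ (r * x)))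

    annihilator-bound : N ℕ.≤ E.size ℕ.^ E.size ℕ.* EA.size
    annihilator-bound = ≤-product action (λ r → EA.index (difference∈ r)) λ {r} {s} p q →
      +-cancelʳ (- rep r) _ _ (trans (EA.index-inj (difference∈ r) (difference∈ s) q) (cong (λ u → s - u) (sym (rep-cong p))))

-- Large rings

-- Squaring gives N^4 ≤ (a b c)² ≤ (B N)³, and N³ cancels.
product-cancel : ∀ {N B a b c} → a ℕ.* a ℕ.≤ B ℕ.* N → b ℕ.* b ℕ.≤ B ℕ.* N → c ℕ.* c ℕ.≤ B ℕ.* N →
  N ℕ.* N ℕ.≤ a ℕ.* b ℕ.* c → N ℕ.≤ B ℕ.* B ℕ.* B
product-cancel {zero} _ _ _ _ = z≤n
product-cancel {N@(suc _)} {B} {a} {b} {c} ha hb hc h = ℕₚ.*-cancelʳ-≤ N (B ℕ.* B ℕ.* B) (N ℕ.* N ℕ.* N) (begin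
  N ℕ.* (N ℕ.* N ℕ.* N)                      ≡⟨ solve 1 (λ n → n :* (n :* n :* n) := (n :* n) :* (n :* n)) refl N ⟩
  N ℕ.* N ℕ.* (N ℕ.* N)                      ≤⟨ ℕₚ.*-mono-≤ h h ⟩
  a ℕ.* b ℕ.* c ℕ.* (a ℕ.* b ℕ.* c)          ≡⟨ solve 3 (λ a b c → a :* b :* c :* (a :* b :* c) := (a :* a) :* (b :* b) :* (c :* c)) refl a b c ⟩
  a ℕ.* a ℕ.* (b ℕ.* b) ℕ.* (c ℕ.* c)        ≤⟨ ℕₚ.*-mono-≤ (ℕₚ.*-mono-≤ ha hb) hc ⟩
  B ℕ.* N ℕ.* (B ℕ.* N) ℕ.* (B ℕ.* N)        ≡⟨ solve 2 (λ b n → b :* n :* (b :* n) :* (b :* n) := b :* b :* b :* (n :* n :* n)) refl B N ⟩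
  B ℕ.* B ℕ.* B ℕ.* (N ℕ.* N ℕ.* N)          ∎)
  where
  open ℕₚ.≤-Reasoning
  open ℕS

module MatrixEntries (A : FinRing) {e} (mu : MatrixUnits A e)
  (E : Enumeration (λ x → FinRing._*_ A e x ≡ x × FinRing._*_ A x e ≡ x)) where
  open RingTools A
  open ≡-Reasoning
  open MatrixUnits mu using (p; q; ep; qe; qp-sum)
  private module E = Enumeration E

  entry∈ : ∀ x i j → e * (p i * x * q j) ≡ p i * x * q j × p i * x * q j * e ≡ p i * x * q j
  entry∈ x i j =
      trans (solve 4 (λ e p x q → e ⊕ ((p ⊕ x) ⊕ q) ⊜ ((e ⊕ p) ⊕ x) ⊕ q) refl e (p i) x (q j)) (cong (λ u → u * x * q j) (ep i))
    , trans (*-assoc (p i * x) (q j) e) (cong (p i * x *_) (qe j))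

  entry : Fin N → Fin 2 → Fin 2 → Fin E.size
  entry x i j = E.index (entry∈ x i j)

  -- x = Σ qᵢ (pᵢ x qⱼ) pⱼ
  recover : ∀ x → x ≡ (q zero * (p zero * x * q zero) * p zero + q zero * (p zero * x * q (suc zero)) * p (suc zero))
                    + (q (suc zero) * (p (suc zero) * x * q zero) * p zero + q (suc zero) * (p (suc zero) * x * q (suc zero)) * p (suc zero))
  recover x = begin
    x                                       ≡⟨ trans (*-identityʳ _) (*-identityˡ x) ⟨
    1# * x * 1#                             ≡⟨ cong₂ (λ u v → u * x * v) qp-sum qp-sum ⟨
    (a + b) * x * (a + b)                   ≡⟨ cong (_* (a + b)) (distribʳ x a b) ⟩
    (a * x + b * x) * (a + b)               ≡⟨ distribʳ (a + b) (a * x) (b * x) ⟩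
    a * x * (a + b) + b * x * (a + b)       ≡⟨ cong₂ _+_ (distribˡ (a * x) a b) (distribˡ (b * x) a b) ⟩
    (a * x * a + a * x * b) + (b * x * a + b * x * b)
      ≡⟨ cong₂ _+_ (cong₂ _+_ (shape zero zero) (shape zero (suc zero))) (cong₂ _+_ (shape (suc zero) zero) (shape (suc zero) (suc zero))) ⟩
    _ ∎
    where
    a = q zero * p zero
    b = q (suc zero) * p (suc zero)
    shape : ∀ i j → q i * p i * x * (q j * p j) ≡ q i * (p i * x * q j) * p j
    shape i j = solve 5 (λ q p x r s → ((q ⊕ p) ⊕ x) ⊕ (r ⊕ s) ⊜ (q ⊕ ((p ⊕ x) ⊕ r)) ⊕ s) refl (q i) (p i) x (q j) (p j)

  entries-inj : ∀ {x y} → (∀ i j → p i * x * q j ≡ p i * y * q j) → x ≡ y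
  entries-inj {x} {y} h = trans (recover x) (trans (cong₂ _+_ (cong₂ _+_ (term zero zero) (term zero (suc zero)))
    (cong₂ _+_ (term (suc zero) zero) (term (suc zero) (suc zero)))) (sym (recover y)))
    where
    term : ∀ i j → q i * (p i * x * q j) * p j ≡ q i * (p i * y * q j) * p j
    term i j = cong (λ u → q i * u * p j) (h i j)

  matrix-size : N ℕ.≤ (E.size ℕ.* E.size) ℕ.* (E.size ℕ.* E.size)
  matrix-size = ≤-product (row zero) (row (suc zero)) λ {x} {y} r₀ r₁ → entries-inj λ where
      zero       j → same zero r₀ j
      (suc zero) j → same (suc zero) r₁ j
    where
    row : Fin 2 → Fin N → Fin (E.size ℕ.* E.size)
    row i x = combine (entry x i zero) (entry x i (suc zero))
    same : ∀ {x y} i → row i x ≡ row i y → ∀ j → p i * x * q j ≡ p i * y * q j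
    same {x} {y} i eq zero       = E.index-inj (entry∈ x i zero) (entry∈ y i zero) (Finₚ.combine-injectiveˡ (entry x i zero) _ (entry y i zero) _ eq)
    same {x} {y} i eq (suc zero) = E.index-inj (entry∈ x i (suc zero)) (entry∈ y i (suc zero)) (Finₚ.combine-injectiveʳ (entry x i zero) _ (entry y i zero) _ eq)

-- Beyond B^B B the ring is simple, beyond B³ it has no three orthogonal idempotents with sum 1, and
-- B⁴ bounds a ring of 2 × 2 matrices over a corner of at most B elements. The sum exceeds all
-- three.
threshold : ℕ → ℕ
threshold B = B ℕ.^ B ℕ.* B ℕ.+ B ℕ.* B ℕ.* B ℕ.+ B ℕ.* B ℕ.* (B ℕ.* B)

module Structure (Sc : Scalars) (A : FinRing) {k} (1≤k : 1 ℕ.≤ k) (f : Polynomial k)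
  {F : (Fin k → Fin (FinRing.N A)) → Fin (FinRing.N A)} (F≡ : ∀ x → F x ≡ Evaluation.eval A f x)
  {B} (fourier : SalemBounds.FourierBound Sc A k F B) where
  open RingTools A
  open Evaluation A
  open SemiringMult (Ring.semiring ring) using () renaming (_×_ to _⋆_)
  open ≡-Reasoning
  open Characters Sc A using (Char; χ; module Char; module Separation)
  open SalemBounds Sc A k using (invariant⇒small; constant⇒small)

  _≈_ : Scalars.Carrier Sc → Scalars.Carrier Sc → Set
  _≈_ = Scalars._≈_ Sc

  module _ (J : Ideal A) where
    open Ideal J

    ℤ⋆-mod : ∀ a {u v} → I (u - v) → I (a ℤ⋆ u - a ℤ⋆ v)
    ℤ⋆-mod (ℤ.+ n) {u} {v} h = subst I (trans (x-y-*ˡ A (n ⋆ 1#) u v) (sym (cong₂ _-_ (⋆≡*1 A n u) (⋆≡*1 A n v)))) (*∈ˡ (n ⋆ 1#) h)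
    ℤ⋆-mod ℤ.-[1+ n ] {u} {v} h = subst I (begin
      - (suc n ⋆ u - suc n ⋆ v)            ≡⟨ -‿+-comm (suc n ⋆ u) (- (suc n ⋆ v)) ⟨
      - (suc n ⋆ u) + - - (suc n ⋆ v)      ∎) (-∈ (ℤ⋆-mod (ℤ.+ suc n) h))
      where
      open import Algebra.Properties.AbelianGroup (Ring.+-abelianGroup ring) using () renaming (⁻¹-∙-comm to -‿+-comm)

    word-mod : ∀ {x y : Fin k → Fin N} → (∀ c → I (x c - y c)) → ∀ w → I (word x w - word y w)
    word-mod h [] = subst I (sym (-‿inverseʳ 1#)) 0∈
    word-mod {x} {y} h (i ∷ w) = subst I (begin
      x i * (word x w - word y w) + (x i - y i) * word y w
        ≡⟨ cong₂ _+_ (x-y-*ˡ A (x i) _ _) (x-y-*ʳ A (x i) (y i) _) ⟩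
      x i * word x w - x i * word y w + (x i * word y w - y i * word y w)
        ≡⟨ +-assoc _ (x i * word y w) _ ⟨
      x i * word x w - x i * word y w + x i * word y w - y i * word y w
        ≡⟨ cong (_- y i * word y w) (x-y+y≡x _ _) ⟩
      x i * word x w - y i * word y w ∎)
      (+∈ (*∈ˡ (x i) (word-mod h w)) (*∈ʳ (h i) (word y w)))

    eval-mod : ∀ (g : Polynomial k) {x y} → (∀ c → I (x c - y c)) → I (eval g x - eval g y)
    eval-mod [] h = subst I (sym (-‿inverseʳ 0#)) 0∈
    eval-mod ((a , w) ∷ g) h = subst I (sym (x-[]-+ A _ _ _ _)) (+∈ (ℤ⋆-mod a (word-mod h w)) (eval-mod g h))

  F-mod : (J : Ideal A) → ∀ {x y} → (∀ c → Ideal.I J (x c - y c)) → Ideal.I J (F x - F y)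
  F-mod J {x} {y} h = subst (Ideal.I J) (sym (cong₂ _-_ (F≡ x) (F≡ y))) (eval-mod J f h)

  prime-suc : ∀ {p} → Prime p → ∃[ p′ ] p ≡ suc p′
  prime-suc {zero}  pr = contradiction (ℕ.nonTrivial⇒n>1 0 {{prime⇒nonTrivial pr}}) λ ()
  prime-suc {suc p} pr = p , refl

  -- A proper ideal can be enlarged to a proper ideal containing p A, modulo which F is well defined.
  ideal-small : (J : Ideal A) → ¬ Ideal.I J 1# → (E : Enumeration (Ideal.I J)) → Enumeration.size E ℕ.≤ B
  ideal-small J 1∉ E with proper-prime A J 1∉
  ... | p , pr , 1∉J+p with prime-suc pr
  ...   | p′ , refl = ℕₚ.≤-trans (size-mono E EH (λ {x} h → 0# , subst (Ideal.I J) (sym (x-p0 x)) h))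
          (ℕₚ.≤-trans (m≤m^k _ 1≤k) (invariant⇒small fourier p′ pr char nontrivial H EH
            (λ x y h → on-M (H⊑M (F-mod J+p h)))))
    where
    J+p = _+⋆_ A J (suc p′)
    open Separation p′ pr
    H : Congruence.PSubgroup A p′
    H = record { P = Ideal.I J+p ; P? = Ideal.I? J+p ; 0∈ = Ideal.0∈ J+p ; +∈ = Ideal.+∈ J+p ; -∈ = Ideal.-∈ J+p
               ; p⋆∈ = λ x → x , subst (Ideal.I J) (sym (-‿inverseʳ (suc p′ ⋆ x))) (Ideal.0∈ J) }
    EH = enumerate (Ideal.I? J+p)
    open Separating (separate H 1∉J+p)
    x-p0 : ∀ x → x - suc p′ ⋆ 0# ≡ x
    x-p0 x = trans (cong (λ u → x - u) (trans (⋆≡*1 A (suc p′) 0#) (zeroʳ _)))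
      (trans (cong (x +_) (trans (sym (+-identityˡ (- 0#))) (-‿inverseʳ 0#))) (+-identityʳ x))

  -- A proper J containing x ≠ 0 has a proper annihilator, since 1 x = x ≠ 0. Both ideals then have
  -- at most B elements.
  simple : B ℕ.^ B ℕ.* B ℕ.< N → Simple A
  simple large J {x} x∈ x≢0 = decidable-stable (Ideal.I? J 1#) λ 1∉ →
    let E  = enumerate (Ideal.I? J)
        EA = enumerate (Ideal.I? (left-annihilator A J))
        m≤B = ideal-small J 1∉ E
        instance
          B≢0 : ℕ.NonZero B
          B≢0 = ℕ.>-nonZero (ℕₚ.≤-trans (nonempty E) m≤B)
    in ℕₚ.<-irrefl refl (ℕₚ.<-≤-trans large (ℕₚ.≤-trans (annihilator-bound A J E EA) (ℕₚ.*-mono-≤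
      (ℕₚ.≤-trans (ℕₚ.^-monoˡ-≤ (Enumeration.size E) m≤B) (ℕₚ.^-monoʳ-≤ B {{B≢0}} m≤B))
      (ideal-small (left-annihilator A J) (λ ann → x≢0 (trans (sym (*-identityˡ x)) (ann x x∈))) EA))))
    where
    nonempty : (E : Enumeration (Ideal.I J)) → 1 ℕ.≤ Enumeration.size E
    nonempty E = go (Enumeration.index E (Ideal.0∈ J))
      where
      go : ∀ {n} → Fin n → 1 ℕ.≤ n
      go {suc n} _ = s≤s z≤n

  module Large (simp : Simple A) where

    -- For a prime p with 1 outside p A the ideal p A is proper, and simplicity makes it zero.
    characteristic : ∃[ p′ ] (Prime (suc p′) × (∀ x → suc p′ ⋆ x ≡ 0#))
    characteristic with proper-prime A (zeroIdeal A) 1≢0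
    ... | p , pr , 1∉ with prime-suc pr
    ...   | p′ , refl = p′ , pr , λ x → decidable-stable (suc p′ ⋆ x ≟ 0#) λ ≢0 →
            1∉ (simp (_+⋆_ A (zeroIdeal A) (suc p′)) {suc p′ ⋆ x} (x , -‿inverseʳ (suc p′ ⋆ x)) ≢0)

    p′ = proj₁ characteristic
    pr = proj₁ (proj₂ characteristic)
    open Separation p′ pr
    open Congruence A p′ using (PSubgroup)

    -- In characteristic p every kernel of an additive map contains p A = 0, as the separation of
    -- points demands.
    kernel : (h : Fin N → Fin N) → (∀ x y → h (x + y) ≡ h x + h y) → PSubgroup
    kernel h h-+ = record
      { P = λ x → h x ≡ 0# ; P? = λ x → h x ≟ 0# ; 0∈ = h-0
      ; +∈ = λ {x} {y} p q → trans (h-+ x y) (trans (cong₂ _+_ p q) (+-identityˡ 0#))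
      ; -∈ = λ {x} p → trans (sym (+-identityˡ _)) (trans (cong (_+ h (- x)) (sym p)) (trans (sym (h-+ x (- x)))
               (trans (cong h (-‿inverseʳ x)) h-0)))
      ; p⋆∈ = λ x → trans (cong h (proj₂ (proj₂ characteristic) x)) h-0 }
      where
      h-0 : h 0# ≡ 0#
      h-0 = +-cancelˡ (h 0#) _ _ (trans (sym (h-+ 0# 0#)) (trans (cong h (+-identityˡ 0#)) (sym (+-identityʳ _))))

    _∩_ : PSubgroup → PSubgroup → PSubgroup
    H ∩ K = record
      { P = λ x → H.P x × K.P x ; P? = λ x → H.P? x ×-dec K.P? x ; 0∈ = H.0∈ , K.0∈
      ; +∈ = λ (a , b) (c , d) → H.+∈ a c , K.+∈ b d ; -∈ = λ (a , b) → H.-∈ a , K.-∈ b ; p⋆∈ = λ x → H.p⋆∈ x , K.p⋆∈ x }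
      where
      module H = PSubgroup H
      module K = PSubgroup K

    rightKernel leftKernel : Fin N → PSubgroup
    rightKernel e = kernel (_* e) (distribʳ e)
    leftKernel e  = kernel (e *_) (distribˡ e)

    module Idempotent {e} (ee : e * e ≡ e) (e≢0 : e ≢ 0#) where

      -- A character trivial on this kernel sees an element u only through e u e, and the one that
      -- separates e from it is nontrivial.
      cornerKernel : PSubgroup
      cornerKernel = kernel (λ x → e * x * e) (λ x y → trans (cong (_* e) (distribˡ e x y)) (distribʳ e _ _))

      e∉ : ¬ PSubgroup.P cornerKernel e
      e∉ eq = e≢0 (trans (sym (trans (cong (_* e) ee) ee)) eq)

      open Separating (separate cornerKernel e∉)

      corner-difference : ∀ {u v} → e * u * e ≡ e * v * e → PSubgroup.P cornerKernel (u - v)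
      corner-difference {u} {v} eq = trans (cong (_* e) (x-y-*ˡ A e u v)) (trans (x-y-*ʳ A (e * u) (e * v) e)
        (trans (cong (_- e * v * e) eq) (-‿inverseʳ _)))

      -- On tuples with x_i e = 0 only the constant term of f contributes to f(x) e, so e f(x) e has
      -- its value at the zero tuple `z`. The character then has the constant value χ(f(z)) there.
      right-kernel-bound : (E : Enumeration (PSubgroup.P (rightKernel e))) →
        Enumeration.size E ℕ.* Enumeration.size E ℕ.≤ B ℕ.* N
      right-kernel-bound E = square-root-bound {B = B} {N} 1≤k (constant⇒small {F} {B} fourier p′ pr char nontrivial (rightKernel e) E
        (χ-unit (F z)) (λ x h → difference-trivial (F x) (F z) (on-M (H⊑M (corner-difference (values h))))))
        where
        open Char char using (χ-unit; χ-difference; χ-+)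
        z : Fin k → Fin N
        z _ = 0#
        values : ∀ {x} → (∀ i → x i * e ≡ 0#) → e * F x * e ≡ e * F z * e
        values {x} h = begin
          e * F x * e          ≡⟨ trans (cong (λ u → e * u * e) (F≡ x)) (*-assoc e _ e) ⟩
          e * (eval f x * e)   ≡⟨ cong (e *_) (eval-annihilated f h (λ _ → zeroˡ e)) ⟩
          e * (eval f z * e)   ≡⟨ trans (sym (*-assoc e _ e)) (cong (λ u → e * u * e) (sym (F≡ z))) ⟩
          e * F z * e          ∎
        difference-trivial : ∀ u v → χ char (u - v) ≈ Scalars.1# Sc → χ char u ≈ χ char v
        difference-trivial u v eq = S.≈trans (S.reflexive (cong (χ char) (sym (x-y+y≡x u v))))
          (S.≈trans (χ-+ (u - v) v) (S.≈trans (S.*-congʳ eq) (S.*-identityˡ _)))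
          where module S = Scalars Sc

      squares-bound : f ≡ sumOfSquares k → (E : Enumeration (PSubgroup.P (leftKernel e ∩ rightKernel e))) →
        Enumeration.size E ℕ.≤ B
      squares-bound f≡ E = ℕₚ.≤-trans (m≤m^k _ 1≤k) (invariant⇒small fourier p′ pr char nontrivial (leftKernel e ∩ rightKernel e) E
        (λ x y h → on-M (H⊑M (corner-difference (begin
          e * F x * e                          ≡⟨ cong (λ u → e * u * e) (F≡′ x) ⟩
          e * eval (sumOfSquares k) x * e      ≡⟨ eval-squares
                                                    (λ c → x-y≡0⇒x≡y _ _ (trans (sym (x-y-*ˡ A e (x c) (y c))) (proj₁ (h c))))
                                                    (λ c → x-y≡0⇒x≡y _ _ (trans (sym (x-y-*ʳ A (x c) (y c) e)) (proj₂ (h c)))) ⟩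
          e * eval (sumOfSquares k) y * e      ≡⟨ cong (λ u → e * u * e) (F≡′ y) ⟨
          e * F y * e                          ∎)))))
        where
        F≡′ : ∀ x → F x ≡ eval (sumOfSquares k) x
        F≡′ x = trans (F≡ x) (cong (λ g → eval g x) f≡)

    -- Three orthogonal idempotents e₁ + e₂ + e₃ = 1 give |A|² ≤ Π |A(eᵢ + eⱼ)| and |A(eᵢ + eⱼ)|² ≤ B |A|.
    module Orthogonal {e₁ e₂ e₃} (i₁ : e₁ * e₁ ≡ e₁) (i₂ : e₂ * e₂ ≡ e₂) (i₃ : e₃ * e₃ ≡ e₃)
      (o₁₂ : e₁ * e₂ ≡ 0#) (o₂₁ : e₂ * e₁ ≡ 0#) (o₁₃ : e₁ * e₃ ≡ 0#) (o₃₁ : e₃ * e₁ ≡ 0#)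
      (o₂₃ : e₂ * e₃ ≡ 0#) (o₃₂ : e₃ * e₂ ≡ 0#) (total : e₁ + (e₂ + e₃) ≡ 1#) where

      Fixed : Fin N → Fin N → Set
      Fixed e x = x * e ≡ x

      fixed : ∀ {e} → e * e ≡ e → ∀ x → Fixed e (x * e)
      fixed {e} ee x = trans (*-assoc x e e) (cong (x *_) ee)

      kill : ∀ {e e′ x} → Fixed e x → e * e′ ≡ 0# → x * e′ ≡ 0#
      kill {e} {e′} {x} p o = trans (cong (_* e′) (sym p)) (trans (*-assoc x e e′) (trans (cong (x *_) o) (zeroʳ x)))

      -- Orthogonality makes the sum of A e and A e′ direct, with right multiplication by e and e′
      -- as projections, and e″ kills both summands.
      pair-size : ∀ {e e′ e″} (E : Enumeration (Fixed e)) (E′ : Enumeration (Fixed e′))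
        (K : Enumeration (PSubgroup.P (rightKernel e″))) →
        e * e′ ≡ 0# → e′ * e ≡ 0# → e * e″ ≡ 0# → e′ * e″ ≡ 0# →
        Enumeration.size E ℕ.* Enumeration.size E′ ℕ.≤ Enumeration.size K
      pair-size {e} {e′} {e″} E E′ K oo′ o′o oo″ o′o″ = product-size K (λ i j → E.ι i + E′.ι j)
        (λ {i} {j} {i′} {j′} eq → cong₂ _,_
          (E.ι-inj (trans (sym (left i j)) (trans (cong (_* e) eq) (left i′ j′))))
          (E′.ι-inj (trans (sym (right i j)) (trans (cong (_* e′) eq) (right i′ j′)))))
        (λ i j → trans (distribʳ e″ _ _) (trans (cong₂ _+_ (kill (E.ι∈ i) oo″) (kill (E′.ι∈ j) o′o″)) (+-identityˡ 0#)))
        where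
        module E = Enumeration E
        module E′ = Enumeration E′
        left : ∀ i j → (E.ι i + E′.ι j) * e ≡ E.ι i
        left i j = trans (distribʳ e _ _) (trans (cong₂ _+_ (E.ι∈ i) (kill (E′.ι∈ j) o′o)) (+-identityʳ _))
        right : ∀ i j → (E.ι i + E′.ι j) * e′ ≡ E′.ι j
        right i j = trans (distribʳ e′ _ _) (trans (cong₂ _+_ (kill (E.ι∈ i) oo′) (E′.ι∈ j)) (+-identityˡ _))

      module _ (E₁ : Enumeration (Fixed e₁)) (E₂ : Enumeration (Fixed e₂)) (E₃ : Enumeration (Fixed e₃)) where
        private
          module E₁ = Enumeration E₁
          module E₂ = Enumeration E₂
          module E₃ = Enumeration E₃

        sum-size : N ℕ.≤ E₁.size ℕ.* (E₂.size ℕ.* E₃.size)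
        sum-size = ≤-product (λ x → E₁.index (fixed i₁ x)) (λ x → combine (E₂.index (fixed i₂ x)) (E₃.index (fixed i₃ x)))
          λ {x} {y} p q → begin
            x                            ≡⟨ expand x ⟩
            x * e₁ + (x * e₂ + x * e₃)   ≡⟨ cong₂ _+_ (E₁.index-inj (fixed i₁ x) (fixed i₁ y) p) (cong₂ _+_
                                              (E₂.index-inj (fixed i₂ x) (fixed i₂ y) (Finₚ.combine-injectiveˡ _ _ _ _ q))
                                              (E₃.index-inj (fixed i₃ x) (fixed i₃ y) (Finₚ.combine-injectiveʳ (E₂.index (fixed i₂ x)) _ (E₂.index (fixed i₂ y)) _ q))) ⟩
            y * e₁ + (y * e₂ + y * e₃)   ≡⟨ expand y ⟨
            y                            ∎
          where
          expand : ∀ x → x ≡ x * e₁ + (x * e₂ + x * e₃)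
          expand x = trans (sym (*-identityʳ x)) (trans (cong (x *_) (sym total))
            (trans (distribˡ x e₁ _) (cong (x * e₁ +_) (distribˡ x e₂ e₃))))

        module _ (K₁ : Enumeration (PSubgroup.P (rightKernel e₁))) (K₂ : Enumeration (PSubgroup.P (rightKernel e₂)))
          (K₃ : Enumeration (PSubgroup.P (rightKernel e₃))) where

          -- For the orders a, b, c of the three left ideals, (a b c)² = (a b)(a c)(b c), and each
          -- pair sits in the kernel of the third idempotent.
          square-size : N ℕ.* N ℕ.≤ Enumeration.size K₃ ℕ.* Enumeration.size K₂ ℕ.* Enumeration.size K₁
          square-size = ℕₚ.≤-trans (ℕₚ.*-mono-≤ sum-size sum-size) (ℕₚ.≤-trans (ℕₚ.≤-reflexive
            (ℕS.solve 3 (λ a b c → a ℕS.:* (b ℕS.:* c) ℕS.:* (a ℕS.:* (b ℕS.:* c)) ℕS.:= a ℕS.:* b ℕS.:* (a ℕS.:* c) ℕS.:* (b ℕS.:* c))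
              refl E₁.size E₂.size E₃.size))
            (ℕₚ.*-mono-≤ (ℕₚ.*-mono-≤ (pair-size E₁ E₂ K₃ o₁₂ o₂₁ o₁₃ o₂₃) (pair-size E₁ E₃ K₂ o₁₃ o₃₁ o₁₂ o₃₂))
              (pair-size E₂ E₃ K₁ o₂₃ o₃₂ o₂₁ o₃₁)))

          orthogonal-bound : e₁ ≢ 0# → e₂ ≢ 0# → e₃ ≢ 0# → N ℕ.≤ B ℕ.* B ℕ.* B
          orthogonal-bound n₁ n₂ n₃ = product-cancel {N} {B} {Enumeration.size K₃} {Enumeration.size K₂} {Enumeration.size K₁} (Idempotent.right-kernel-bound i₃ n₃ K₃)
            (Idempotent.right-kernel-bound i₂ n₂ K₂) (Idempotent.right-kernel-bound i₁ n₁ K₁) square-size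

    module Split (large : B ℕ.* B ℕ.* B ℕ.< N) {e e′} (ee : e * e ≡ e) (e′e′ : e′ * e′ ≡ e′)
      (ee′ : e * e′ ≡ 0#) (e′e : e′ * e ≡ 0#) (total : e + e′ ≡ 1#) (e≢0 : e ≢ 0#) (e′≢0 : e′ ≢ 0#) where

      -- An idempotent f under e other than 0 and e would give three orthogonal nonzero idempotents
      -- f, e - f and e′ with sum 1.
      primitive-left : Primitive A e
      primitive-left f ff ef fe with f ≟ 0#
      ... | yes f≡0 = inj₁ f≡0
      ... | no f≢0 with f ≟ e
      ...   | yes f≡e = inj₂ f≡e
      ...   | no f≢e = contradiction
        (orthogonal-bound (enumerate λ x → x * f ≟ x) (enumerate λ x → x * g ≟ x) (enumerate λ x → x * e′ ≟ x)
          (enumerate (PSubgroup.P? (rightKernel f))) (enumerate (PSubgroup.P? (rightKernel g))) (enumerate (PSubgroup.P? (rightKernel e′)))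
          f≢0 (λ g≡0 → f≢e (sym (x-y≡0⇒x≡y e f g≡0))) e′≢0)
        (ℕₚ.<⇒≱ large)
        where
        g = e - f
        fg : f * g ≡ 0#
        fg = trans (x-y-*ˡ A f e f) (trans (cong₂ _-_ fe ff) (-‿inverseʳ f))
        gf : g * f ≡ 0#
        gf = trans (x-y-*ʳ A e f f) (trans (cong₂ _-_ ef ff) (-‿inverseʳ f))
        eg : e * g ≡ g
        eg = trans (x-y-*ˡ A e e f) (cong₂ _-_ ee ef)
        ge : g * e ≡ g
        ge = trans (x-y-*ʳ A e f e) (cong₂ _-_ ee fe)
        gg : g * g ≡ g
        gg = trans (x-y-*ʳ A e f g) (trans (cong₂ _-_ eg fg) (trans (cong (g +_) (trans (sym (+-identityˡ _)) (-‿inverseʳ 0#))) (+-identityʳ g)))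
        through : ∀ {x} → x * e ≡ x → x * e′ ≡ 0#
        through {x} p = trans (cong (_* e′) (sym p)) (trans (*-assoc x e e′) (trans (cong (x *_) ee′) (zeroʳ x)))
        through′ : ∀ {x} → e * x ≡ x → e′ * x ≡ 0#
        through′ {x} p = trans (cong (e′ *_) (sym p)) (trans (sym (*-assoc e′ e x)) (trans (cong (_* x) e′e) (zeroˡ x)))
        open Orthogonal ff gg e′e′ fg gf (through fe) (through′ ef) (through ge) (through′ eg)
          (trans (sym (+-assoc f g e′)) (trans (cong (_+ e′) (trans (+-comm f g) (x-y+y≡x e f))) total))

    -- the corner eAe is the intersection of the kernels of multiplication by 1 - e
    corner-bound : f ≡ sumOfSquares k → ∀ {e e′} → e′ * e′ ≡ e′ → e′ ≢ 0# → e + e′ ≡ 1# →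
      (E : Enumeration (λ x → e * x ≡ x × x * e ≡ x)) → Enumeration.size E ℕ.≤ B
    corner-bound f≡ {e} {e′} e′e′ e′≢0 total E = ℕₚ.≤-trans
      (size-mono E K (λ {x} (l , r) → killˡ l , killʳ r)) (Idempotent.squares-bound e′e′ e′≢0 f≡ K)
      where
      K = enumerate (PSubgroup.P? (leftKernel e′ ∩ rightKernel e′))
      killˡ : ∀ {x} → e * x ≡ x → e′ * x ≡ 0#
      killˡ {x} l = +-cancelˡ x _ _ (trans (trans (cong (_+ e′ * x) (sym l)) (trans (sym (distribʳ x e e′))
        (trans (cong (_* x) total) (*-identityˡ x)))) (sym (+-identityʳ x)))
      killʳ : ∀ {x} → x * e ≡ x → x * e′ ≡ 0#
      killʳ {x} r = +-cancelˡ x _ _ (trans (trans (cong (_+ x * e′) (sym r)) (trans (sym (distribˡ x e e′))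
        (trans (cong (x *_) total) (*-identityʳ x)))) (sym (+-identityʳ x)))

  -- A ≅ M₂(eAe) with eAe a division ring
  record MatrixRing : Set where
    field
      {e e′} : Fin N
      ee : e * e ≡ e
      e≢0 : e ≢ 0#
      e′e′ : e′ * e′ ≡ e′
      e′≢0 : e′ ≢ 0#
      total : e + e′ ≡ 1#
      units : MatrixUnits A e

    E : Enumeration (λ x → e * x ≡ x × x * e ≡ x)
    E = enumerate (SubRing.P? (Corner.corner A ee e≢0))

    cornerRing : FinRing
    cornerRing = SubRingAsRing.subRing (Corner.corner A ee e≢0) E

    field
      division : RingTools.IsDivision cornerRing

  module _ (large : threshold B ℕ.< N) where
    simple-A : Simple A
    simple-A = simple (ℕₚ.≤-<-trans (ℕₚ.≤-trans (ℕₚ.m≤m+n _ _) (ℕₚ.m≤m+n _ _)) large)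

    open Large simple-A

    large₃ : B ℕ.* B ℕ.* B ℕ.< N
    large₃ = ℕₚ.≤-<-trans (ℕₚ.≤-trans (ℕₚ.m≤n+m _ (B ℕ.^ B ℕ.* B)) (ℕₚ.m≤m+n _ _)) large

    from-idempotent : ∀ {e} → e * e ≡ e → e ≢ 0# → e ≢ 1# → MatrixRing
    from-idempotent {e} ee e≢0 e≢1 = record
      { ee = ee ; e≢0 = e≢0 ; e′e′ = e′e′ ; e′≢0 = e′≢0 ; total = total
      ; units = Complementary.matrixUnits A ee e≢0 L.primitive-left simple-A E total e′≢0 R.primitive-left
      ; division = corner-division A ee e≢0 L.primitive-left simple-A E }
      where
      e′ = 1# - e
      E = enumerate (SubRing.P? (Corner.corner A ee e≢0))
      total : e + e′ ≡ 1#
      total = trans (+-comm e e′) (x-y+y≡x 1# e)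
      e′≢0 : e′ ≢ 0#
      e′≢0 eq = e≢1 (sym (x-y≡0⇒x≡y 1# e eq))
      ee′ : e * e′ ≡ 0#
      ee′ = trans (x-y-*ˡ A e 1# e) (trans (cong₂ _-_ (*-identityʳ e) ee) (-‿inverseʳ e))
      e′e : e′ * e ≡ 0#
      e′e = trans (x-y-*ʳ A 1# e e) (trans (cong₂ _-_ (*-identityˡ e) ee) (-‿inverseʳ e))
      e′e′ : e′ * e′ ≡ e′
      e′e′ = trans (sym (+-identityˡ _)) (trans (cong (_+ e′ * e′) (sym ee′)) (trans (sym (distribʳ e′ e e′))
        (trans (cong (_* e′) total) (*-identityˡ e′))))
      module L = Split large₃ ee e′e′ ee′ e′e total e≢0 e′≢0
      module R = Split large₃ e′e′ ee e′e ee′ (trans (+-comm e′ e) total) e′≢0 e≢0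

    division-or-matrix : IsDivision ⊎ MatrixRing
    division-or-matrix with Finₚ.any? (λ e → (e * e ≟ e) ×-dec (¬? (e ≟ 0#) ×-dec ¬? (e ≟ 1#)))
    ... | yes (e , ee , e≢0 , e≢1) = inj₂ (from-idempotent ee e≢0 e≢1)
    ... | no none = inj₁ (Local.simple⇒division A (λ e ee → trivial e ee (e ≟ 0#) (e ≟ 1#)) simple-A)
      where
      trivial : ∀ e → e * e ≡ e → Dec (e ≡ 0#) → Dec (e ≡ 1#) → e ≡ 0# ⊎ e ≡ 1#
      trivial e ee (yes p) _       = inj₁ p
      trivial e ee (no _)  (yes p) = inj₂ p
      trivial e ee (no ≢0) (no ≢1) = contradiction (e , ee , ≢0 , ≢1) none

    squares⇒¬matrix : f ≡ sumOfSquares k → ¬ MatrixRing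
    squares⇒¬matrix f≡ M = ℕₚ.<-irrefl refl (ℕₚ.≤-<-trans (ℕₚ.≤-trans (MatrixEntries.matrix-size A units E) (ℕₚ.≤-trans
      (ℕₚ.*-mono-≤ (ℕₚ.*-mono-≤ m≤B m≤B) (ℕₚ.*-mono-≤ m≤B m≤B)) (ℕₚ.m≤n+m _ (B ℕ.^ B ℕ.* B ℕ.+ B ℕ.* B ℕ.* B)))) large)
      where
      open MatrixRing M
      m≤B = corner-bound f≡ e′e′ e′≢0 total E

-- Two by two matrices over a division ring

module MatrixIsomorphism (A : FinRing) {e} (ee : FinRing._*_ A e e ≡ e) (e≢0 : e ≢ FinRing.0# A)
  (mu : MatrixUnits A e) (E : Enumeration (SubRing.P (Corner.corner A ee e≢0))) where
  open RingTools A
  open MatrixUnits mu using (p; q; ep; qe; pq-diag; pq-off; qp-sum)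
  open MatrixEntries A mu E public using (entry; entry∈; entries-inj)
  open SubRingAsRing (Corner.corner A ee e≢0) E public
  open ≡-Reasoning
  private module D = FinRing subRing

  ι-entry : ∀ x i j → ι (entry x i j) ≡ p i * x * q j
  ι-entry x i j = ι-index (entry∈ x i j)

  entry-inj : ∀ {x y} → (∀ i j → entry x i j ≡ entry y i j) → x ≡ y
  entry-inj {x} {y} h = entries-inj λ i j → trans (sym (ι-entry x i j)) (trans (cong ι (h i j)) (ι-entry y i j))

  entry-+ : ∀ x y i j → entry (x + y) i j ≡ entry x i j ⊞ entry y i j
  entry-+ x y i j = ι-inj (begin
    ι (entry (x + y) i j)                ≡⟨ ι-entry (x + y) i j ⟩
    p i * (x + y) * q j                  ≡⟨ trans (cong (_* q j) (distribˡ (p i) x y)) (distribʳ (q j) _ _) ⟩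
    p i * x * q j + p i * y * q j        ≡⟨ cong₂ _+_ (ι-entry x i j) (ι-entry y i j) ⟨
    ι (entry x i j) + ι (entry y i j)    ≡⟨ ι-⊞ (entry x i j) (entry y i j) ⟨
    ι (entry x i j ⊞ entry y i j)        ∎)

  entry-neg : ∀ x i j → entry (- x) i j ≡ ⊟ entry x i j
  entry-neg x i j = ι-inj (begin
    ι (entry (- x) i j)      ≡⟨ ι-entry (- x) i j ⟩
    p i * - x * q j          ≡⟨ trans (cong (_* q j) (sym (-‿distribʳ-* (p i) x))) (sym (-‿distribˡ-* _ (q j))) ⟩
    - (p i * x * q j)        ≡⟨ cong -_ (ι-entry x i j) ⟨
    - ι (entry x i j)        ≡⟨ ι-⊟ (entry x i j) ⟨
    ι (⊟ entry x i j)        ∎)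

  entry-0 : ∀ i j → entry 0# i j ≡ D.0#
  entry-0 i j = ι-inj (trans (ι-entry 0# i j) (trans (trans (cong (_* q j) (zeroʳ (p i))) (zeroˡ (q j))) (sym ι-0)))

  ι-entry-1 : ∀ i j → ι (entry 1# i j) ≡ p i * q j
  ι-entry-1 i j = trans (ι-entry 1# i j) (cong (_* q j) (*-identityʳ (p i)))

  entry-1-diag : ∀ i → entry 1# i i ≡ D.1#
  entry-1-diag i = ι-inj (trans (ι-entry-1 i i) (trans (pq-diag i) (sym ι-1)))

  entry-1-off : ∀ i j → i ≢ j → entry 1# i j ≡ D.0#
  entry-1-off i j ne = ι-inj (trans (ι-entry-1 i j) (trans (pq-off i j ne) (sym ι-0)))

  -- The decomposition of 1 as the sum of the q_l p_l is inserted between x and y. The trailing zero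
  -- is the one that ends the sum over `Fin 2` in `matrixRing`.
  entry-* : ∀ x y i j →
    entry (x * y) i j ≡ entry x i zero ⊠ entry y zero j ⊞ (entry x i (suc zero) ⊠ entry y (suc zero) j ⊞ D.0#)
  entry-* x y i j = ι-inj (begin
    ι (entry (x * y) i j)                          ≡⟨ ι-entry (x * y) i j ⟩
    p i * (x * y) * q j                            ≡⟨ cong (λ u → p i * (x * u) * q j) (*-identityˡ y) ⟨
    p i * (x * (1# * y)) * q j                     ≡⟨ cong (λ u → p i * (x * (u * y)) * q j) qp-sum ⟨
    p i * (x * ((a + b) * y)) * q j                ≡⟨ cong (λ u → p i * (x * u) * q j) (distribʳ y a b) ⟩
    p i * (x * (a * y + b * y)) * q j              ≡⟨ cong (λ u → p i * u * q j) (distribˡ x _ _) ⟩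
    p i * (x * (a * y) + x * (b * y)) * q j        ≡⟨ trans (cong (_* q j) (distribˡ (p i) _ _)) (distribʳ (q j) _ _) ⟩
    p i * (x * (a * y)) * q j + p i * (x * (b * y)) * q j
                                                   ≡⟨ cong₂ _+_ (shape zero) (shape (suc zero)) ⟩
    ι g₀ + ι g₁                                    ≡⟨ cong (ι g₀ +_) (trans (ι-⊞ g₁ D.0#) (trans (cong (ι g₁ +_) ι-0) (+-identityʳ (ι g₁)))) ⟨
    ι g₀ + ι (g₁ ⊞ D.0#)                           ≡⟨ ι-⊞ g₀ (g₁ ⊞ D.0#) ⟨
    ι (g₀ ⊞ (g₁ ⊞ D.0#))                           ∎)
    where
    a = q zero * p zero
    b = q (suc zero) * p (suc zero)
    g₀ = entry x i zero ⊠ entry y zero j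
    g₁ = entry x i (suc zero) ⊠ entry y (suc zero) j
    shape : ∀ l → p i * (x * (q l * p l * y)) * q j ≡ ι (entry x i l ⊠ entry y l j)
    shape l = begin
      p i * (x * (q l * p l * y)) * q j    ≡⟨ solve 6 (λ p x q r y s → (p ⊕ (x ⊕ ((q ⊕ r) ⊕ y))) ⊕ s ⊜ ((p ⊕ x) ⊕ q) ⊕ ((r ⊕ y) ⊕ s)) refl (p i) x (q l) (p l) y (q j) ⟩
      p i * x * q l * (p l * y * q j)      ≡⟨ cong₂ _*_ (ι-entry x i l) (ι-entry y l j) ⟨
      ι (entry x i l) * ι (entry y l j)    ≡⟨ ι-⊠ (entry x i l) (entry y l j) ⟨
      ι (entry x i l ⊠ entry y l j)        ∎

  preimage : (Fin 2 → Fin 2 → Fin size) → Fin N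
  preimage Y = (part zero zero + part zero (suc zero)) + (part (suc zero) zero + part (suc zero) (suc zero))
    where
    part : Fin 2 → Fin 2 → Fin N
    part i j = q i * ι (Y i j) * p j

  -- As p_i q_a is e for a = i and 0 otherwise, only the summand of Y at (i, j) survives.
  preimage-entry : ∀ Y i j → p i * preimage Y * q j ≡ ι (Y i j)
  preimage-entry Y i j = trans (trans (split _ _) (cong₂ _+_ (split _ _) (split _ _))) (select i j)
    where
    split : ∀ {i j} u v → p i * (u + v) * q j ≡ p i * u * q j + p i * v * q j
    split {i} {j} u v = trans (cong (_* q j) (distribˡ (p i) u v)) (distribʳ (q j) _ _)
    sandwich : ∀ i j a b → Fin N
    sandwich i j a b = p i * (q a * ι (Y a b) * p b) * q j
    regroup : ∀ i j a b → sandwich i j a b ≡ (p i * q a) * ι (Y a b) * (p b * q j)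
    regroup i j a b = solve 5 (λ p q u r s → (p ⊕ ((q ⊕ u) ⊕ r)) ⊕ s ⊜ ((p ⊕ q) ⊕ u) ⊕ (r ⊕ s)) refl (p i) (q a) (ι (Y a b)) (p b) (q j)
    hit : ∀ i j → sandwich i j i j ≡ ι (Y i j)
    hit i j = trans (regroup i j i j) (trans (cong₂ (λ u v → u * ι (Y i j) * v) (pq-diag i) (pq-diag j))
      (trans (cong (_* e) (proj₁ (ι∈ (Y i j)))) (proj₂ (ι∈ (Y i j)))))
    missˡ : ∀ i j a b → i ≢ a → sandwich i j a b ≡ 0#
    missˡ i j a b ne = trans (regroup i j a b) (trans (cong (λ u → u * ι (Y a b) * (p b * q j)) (pq-off i a ne))
      (trans (cong (_* (p b * q j)) (zeroˡ _)) (zeroˡ _)))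
    missʳ : ∀ i j a b → b ≢ j → sandwich i j a b ≡ 0#
    missʳ i j a b ne = trans (regroup i j a b) (trans (cong (p i * q a * ι (Y a b) *_) (pq-off b j ne)) (zeroʳ _))
    four : ∀ {x y z w x′ y′ z′ w′} → x ≡ x′ → y ≡ y′ → z ≡ z′ → w ≡ w′ → (x + y) + (z + w) ≡ (x′ + y′) + (z′ + w′)
    four a b c d = cong₂ _+_ (cong₂ _+_ a b) (cong₂ _+_ c d)
    0+0 = +-identityˡ 0#
    select : ∀ i j → (sandwich i j zero zero + sandwich i j zero (suc zero)) + (sandwich i j (suc zero) zero + sandwich i j (suc zero) (suc zero)) ≡ ι (Y i j)
    select zero zero = trans (four (hit zero zero) (missʳ zero zero zero (suc zero) λ ()) (missˡ zero zero (suc zero) zero λ ()) (missˡ zero zero (suc zero) (suc zero) λ ()))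
      (trans (cong₂ _+_ (+-identityʳ _) 0+0) (+-identityʳ _))
    select zero (suc zero) = trans (four (missʳ zero (suc zero) zero zero λ ()) (hit zero (suc zero)) (missˡ zero (suc zero) (suc zero) zero λ ()) (missˡ zero (suc zero) (suc zero) (suc zero) λ ()))
      (trans (cong₂ _+_ (+-identityˡ _) 0+0) (+-identityʳ _))
    select (suc zero) zero = trans (four (missˡ (suc zero) zero zero zero λ ()) (missˡ (suc zero) zero zero (suc zero) λ ()) (hit (suc zero) zero) (missʳ (suc zero) zero (suc zero) (suc zero) λ ()))
      (trans (cong₂ _+_ 0+0 (+-identityʳ _)) (+-identityˡ _))
    select (suc zero) (suc zero) = trans (four (missˡ (suc zero) (suc zero) zero zero λ ()) (missˡ (suc zero) (suc zero) zero (suc zero) λ ()) (missʳ (suc zero) (suc zero) (suc zero) zero λ ()) (hit (suc zero) (suc zero)))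
      (trans (cong₂ _+_ 0+0 (+-identityˡ _)) (+-identityˡ _))

  entry-preimage : ∀ Y i j → entry (preimage Y) i j ≡ Y i j
  entry-preimage Y i j = ι-inj (trans (ι-entry (preimage Y) i j) (preimage-entry Y i j))

-- D is kept abstract here: the ring operations of a corner unfold to large terms.
record MatrixModel (A D : FinRing) : Set where
  private
    module A = FinRing A
    module D = FinRing D
  field
    entry : Fin A.N → Fin 2 → Fin 2 → Fin D.N
    entry-inj : ∀ {x y} → (∀ i j → entry x i j ≡ entry y i j) → x ≡ y
    entry-+ : ∀ x y i j → entry (x A.+ y) i j ≡ entry x i j D.+ entry y i j
    entry-neg : ∀ x i j → entry (A.- x) i j ≡ D.- entry x i j
    entry-0 : ∀ i j → entry A.0# i j ≡ D.0#
    entry-1-diag : ∀ i → entry A.1# i i ≡ D.1#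
    entry-1-off : ∀ i j → i ≢ j → entry A.1# i j ≡ D.0#
    entry-* : ∀ x y i j → entry (x A.* y) i j ≡
      entry x i zero D.* entry y zero j D.+ (entry x i (suc zero) D.* entry y (suc zero) j D.+ D.0#)
    preimage : (Fin 2 → Fin 2 → Fin D.N) → Fin A.N
    entry-preimage : ∀ Y i j → entry (preimage Y) i j ≡ Y i j

matrixModel : ∀ A {e} (ee : FinRing._*_ A e e ≡ e) (e≢0 : e ≢ FinRing.0# A) (mu : MatrixUnits A e)
  (E : Enumeration (SubRing.P (Corner.corner A ee e≢0))) →
  MatrixModel A (SubRingAsRing.subRing (Corner.corner A ee e≢0) E)
matrixModel A ee e≢0 mu E = record { MatrixIsomorphism A ee e≢0 mu E }

-- The field in `IsSmallMatrixRing` has the universe levels of the given ring, while a corner is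
-- carried by `Fin N` at level 0.
module Lifted (c ℓ : Level.Level) (D : FinRing) where
  open RingTools D

  raw : RawRing c ℓ
  raw = record
    { Carrier = Lift c (Fin N)
    ; _≈_ = λ x y → Lift ℓ (lower x ≡ lower y)
    ; _+_ = λ x y → lift (lower x + lower y)
    ; _*_ = λ x y → lift (lower x * lower y)
    ; -_  = λ x → lift (- lower x)
    ; 0#  = lift 0#
    ; 1#  = lift 1#
    }

  lower-mono : IsRingMonomorphism raw (Ring.rawRing ring) lower
  lower-mono = record
    { isRingHomomorphism = record
      { isSemiringHomomorphism = record
        { isNearSemiringHomomorphism = record
          { +-isMonoidHomomorphism = record
            { isMagmaHomomorphism = record
              { isRelHomomorphism = record { cong = lower } ; homo = λ _ _ → refl }
            ; ε-homo = refl }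
          ; *-homo = λ _ _ → refl }
        ; 1#-homo = refl }
      ; -‿homo = λ _ → refl }
    ; injective = lift }

  finiteRing : FiniteRing c ℓ
  finiteRing = record
    { ring = record { isRing = RingMono.isRing lower-mono (Ring.isRing ring) }
    ; card = N
    ; enumeration = record
      { to = lower ; from = lift ; to-cong = lower ; from-cong = lift
      ; inverse = lower , lift }
    ; 1≉0 = λ eq → 1≢0 (lower eq)
    }

  isField : IsDivision → IsField finiteRing
  isField div = (λ x y → lift (wedderburn D div (lower x) (lower y)))
              , λ x x≉0 → let y , xy≡1 , _ = div (lower x) (λ eq → x≉0 (lift eq)) in lift y , lift xy≡1

module _ {c ℓ} (R : FiniteRing c ℓ) (A : FinRing) (D : FinRing) (model : MatrixModel A D) where
  private
    module R = FiniteRing R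
    module A = FinRing A
    F = Lifted.finiteRing c ℓ D
    M = matrixRing F 2
    module M = RawRing M
  open MatrixModel model

  module _ (to : R.Carrier → Fin A.N) (from : Fin A.N → R.Carrier)
    (to-cong : ∀ {x y} → x R.≈ y → to x ≡ to y) (to-inj : ∀ {x y} → to x ≡ to y → x R.≈ y)
    (to-from : ∀ i → to (from i) ≡ i)
    (to-+ : ∀ x y → to (x R.+ y) ≡ to x A.+ to y) (to-* : ∀ x y → to (x R.* y) ≡ to x A.* to y)
    (to-neg : ∀ x → to (R.- x) ≡ A.- to x) (to-0 : to R.0# ≡ A.0#) (to-1 : to R.1# ≡ A.1#) where

    φ : R.Carrier → Fin 2 → Fin 2 → Lift c (Fin (FinRing.N D))
    φ x i j = lift (entry (to x) i j)

    entry-cong : ∀ {x y} i j → x ≡ y → entry x i j ≡ entry y i j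
    entry-cong i j = cong (λ u → entry u i j)

    φ-1 : φ R.1# M.≈ M.1#
    φ-1 zero       zero       = lift (trans (entry-cong zero zero to-1) (entry-1-diag zero))
    φ-1 zero       (suc zero) = lift (trans (entry-cong zero (suc zero) to-1) (entry-1-off zero (suc zero) λ ()))
    φ-1 (suc zero) zero       = lift (trans (entry-cong (suc zero) zero to-1) (entry-1-off (suc zero) zero λ ()))
    φ-1 (suc zero) (suc zero) = lift (trans (entry-cong (suc zero) (suc zero) to-1) (entry-1-diag (suc zero)))

    φ-isomorphism : IsRingIsomorphism R.rawRing M φ
    φ-isomorphism = record
      { isRingMonomorphism = record
        { isRingHomomorphism = record
          { isSemiringHomomorphism = record
            { isNearSemiringHomomorphism = record
              { +-isMonoidHomomorphism = record
                { isMagmaHomomorphism = record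
                  { isRelHomomorphism = record { cong = λ eq i j → lift (entry-cong i j (to-cong eq)) }
                  ; homo = λ x y i j → lift (trans (entry-cong i j (to-+ x y)) (entry-+ (to x) (to y) i j)) }
                ; ε-homo = λ i j → lift (trans (entry-cong i j to-0) (entry-0 i j)) }
              ; *-homo = λ x y i j → lift (trans (entry-cong i j (to-* x y)) (entry-* (to x) (to y) i j)) }
            ; 1#-homo = φ-1 }
          ; -‿homo = λ x i j → lift (trans (entry-cong i j (to-neg x)) (entry-neg (to x) i j)) }
        ; injective = λ h → to-inj (entry-inj λ i j → lower (h i j)) }
      ; surjective = λ Y → from (preimage (λ i j → lower (Y i j))) , λ eq i j → lift (trans
          (entry-cong i j (trans (to-cong eq) (to-from _))) (entry-preimage (λ i j → lower (Y i j)) i j)) }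

    small-matrix-ring : ∀ d → RingTools.IsDivision D → IsSmallMatrixRing d R
    -- Of the small dimensions only n = 2 arises, whatever d is.
    small-matrix-ring d div = F , Lifted.isField c ℓ D div , 2 , inj₁ refl , φ , φ-isomorphism

module _ (Sc : Scalars) (A : FinRing) {k} (1≤k : 1 ≤ k) (f : Polynomial k) {F : (Fin k → Fin (FinRing.N A)) → Fin (FinRing.N A)}
  (F≡ : ∀ x → F x ≡ Evaluation.eval A f x) {B} (fourier : SalemBounds.FourierBound Sc A k F B)
  (large : threshold B ℕ.< FinRing.N A) where
  private module S = Structure Sc A 1≤k f {F} F≡ {B} fourier

  division-or-model : RingTools.IsDivision A ⊎ (∃[ D ] (MatrixModel A D × RingTools.IsDivision D))
  division-or-model = by-cases (S.division-or-matrix large)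
    where
    by-cases : RingTools.IsDivision A ⊎ S.MatrixRing → RingTools.IsDivision A ⊎ (∃[ D ] (MatrixModel A D × RingTools.IsDivision D))
    by-cases (inj₁ div) = inj₁ div
    by-cases (inj₂ m)   = inj₂ (cornerRing , matrixModel A ee e≢0 units E , division)
      where open S.MatrixRing m

  squares⇒division : f ≡ sumOfSquares k → RingTools.IsDivision A
  squares⇒division f≡ = by-cases (S.division-or-matrix large)
    where
    by-cases : RingTools.IsDivision A ⊎ S.MatrixRing → RingTools.IsDivision A
    by-cases (inj₁ div) = div
    by-cases (inj₂ m)   = ⊥-elim (S.squares⇒¬matrix large f≡ m)

-- Transfer of the classification to the given rings

module _ {c ℓ} (R : FiniteRing c ℓ) where
  open Transport R
  private
    module R = FiniteRing R
    A = finRing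
  open RingTools A
  open RawMonoidDefs R.+-rawMonoid using () renaming (_×_ to _·_)
  open SemiringMult (Ring.semiring ring) using () renaming (_×_ to _⋆_)

  to-+ : ∀ x y → to (x R.+ y) ≡ to x + to y
  to-+ x y = to-cong (R.+-cong (R.sym (strictlyInverseʳ x)) (R.sym (strictlyInverseʳ y)))

  to-* : ∀ x y → to (x R.* y) ≡ to x * to y
  to-* x y = to-cong (R.*-cong (R.sym (strictlyInverseʳ x)) (R.sym (strictlyInverseʳ y)))

  to-neg : ∀ x → to (R.- x) ≡ - to x
  to-neg x = to-cong (R.-‿cong (R.sym (strictlyInverseʳ x)))

  to-· : ∀ n x → to (n · x) ≡ n ⋆ to x
  to-· zero    x = refl
  to-· (suc n) x = trans (to-+ x (n · x)) (cong (to x +_) (to-· n x))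

  to-evaluate : ∀ {k} (f : Polynomial k) x → to (evaluate R f (from ∘ x)) ≡ Evaluation.eval A f x
  to-evaluate []            x = refl
  to-evaluate ((a , w) ∷ f) x = trans (to-+ _ _) (cong₂ _+_ (to-ℤ· a (word≡ w)) (to-evaluate f x))
    where
    open Evaluation A using (_ℤ⋆_; word)
    word≡ : ∀ w → to (foldr R._*_ R.1# (map (from ∘ x) w)) ≡ word x w
    word≡ []      = refl
    word≡ (i ∷ w) = trans (to-* _ _) (cong₂ _*_ (strictlyInverseˡ (x i)) (word≡ w))
    to-ℤ· : ∀ a {u v} → to u ≡ v → to ((R ℤ· a) u) ≡ a ℤ⋆ v
    to-ℤ· (ℤ.+ n)    {u} refl = to-· n u
    to-ℤ· ℤ.-[1+ n ] {u} refl = trans (to-neg (suc n · u)) (cong -_ (to-· (suc n) u))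

  division⇒field : IsDivision → IsField R
  division⇒field div =
      (λ x y → to-inj (trans (to-* x y) (trans (wedderburn A div (to x) (to y)) (sym (to-* y x)))))
    , λ x x≉0 → let y , xy≡1 , _ = div (to x) (x≉0 ∘ to-inj)
                in from y , to-inj (trans (to-* x (from y)) (trans (cong (to x *_) (strictlyInverseˡ y)) xy≡1))

  matrix⇒small : ∀ {D} → MatrixModel A D → ∀ d → RingTools.IsDivision D → IsSmallMatrixRing d R
  matrix⇒small {D} model = small-matrix-ring R A D model to from to-cong to-inj strictlyInverseˡ to-+ to-* to-neg refl refl

module _ {c ℓ} (R : FiniteRing c ℓ) {k} (1≤k : 1 ≤ k) (f : Polynomial k) where
  open Transport R using () renaming (finRing to A)
  open SalemTransfer R k f using () renaming (F to values)

  fourier⇒classification : ∀ B → SalemBounds.FourierBound ℂ-scalars (Transport.finRing R) k (SalemTransfer.F R k f) B → threshold B ℕ.< FiniteRing.card R →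
    (IsField R ⊎ IsSmallMatrixRing (suc k) R) × (f ≡ sumOfSquares k → IsField R)
  fourier⇒classification B fourier large =
      by-cases (division-or-model ℂ-scalars A 1≤k f {values} (to-evaluate R f) {B} fourier large)
    , λ f≡ → division⇒field R (squares⇒division ℂ-scalars A 1≤k f {values} (to-evaluate R f) {B} fourier large f≡)
    where
    by-cases : RingTools.IsDivision A ⊎ (∃[ D ] (MatrixModel A D × RingTools.IsDivision D)) → IsField R ⊎ IsSmallMatrixRing (suc k) R
    by-cases (inj₁ div)               = inj₁ (division⇒field R div)
    by-cases (inj₂ (D , model , div)) = inj₂ (matrix⇒small R model (suc k) div)

  salem⇒classification : ∀ C K (C≤K : Eventually (λ n → ℚ.∣ ℝ.seq C n ∣ ℚ.≤ RealLemmas.toℚ K)) → IsSalem R (suc k) (V? R f) C →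
    threshold (NormBound.constant C K C≤K) ℕ.< FiniteRing.card R →
    (IsField R ⊎ IsSmallMatrixRing (suc k) R) × (f ≡ sumOfSquares k → IsField R)
  salem⇒classification C K C≤K salem =
    fourier⇒classification (NormBound.constant C K C≤K) (SalemTransfer.salem⇒fourier R k f C K C≤K salem)

mainTheorem1 : ∀ {c ℓ} (k : ℕ) → let d = suc k in 2 ≤ d →
    (f : Polynomial k) (R : ℕ → FiniteRing c ℓ) →
    TendsToInfinity (FiniteRing.card ∘ R) →
    ∃[ C ] (∀ i → IsSalem (R i) d (V? (R i) f) C) →
    AllButFinitelyMany (λ i → IsField (R i) ⊎ IsSmallMatrixRing d (R i)) ×
    (f ≡ sumOfSquares k → AllButFinitelyMany (λ i → IsField (R i)))
mainTheorem1 k (s≤s 1≤k) f R tends (C , salem) =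
    (proj₁ eventually , λ i le → proj₁ (classification i le))
  , λ f≡ → proj₁ eventually , λ i le → proj₂ (classification i le) f≡
  where
  K : ℕ
  K = proj₁ (natural-bound C)
  C≤K : Eventually (λ n → ℚ.∣ ℝ.seq C n ∣ ℚ.≤ RealLemmas.toℚ K)
  C≤K = proj₂ (natural-bound C)
  -- The bound comes from C alone, so one threshold serves every ring of the sequence.
  B : ℕ
  B = NormBound.constant C K C≤K
  eventually : ∃[ n ] (∀ i → n ≤ i → suc (threshold B) ≤ FiniteRing.card (R i))
  eventually = tends (suc (threshold B))
  classification : ∀ i → proj₁ eventually ≤ i →
    (IsField (R i) ⊎ IsSmallMatrixRing (suc k) (R i)) × (f ≡ sumOfSquares k → IsField (R i))
  classification i le = salem⇒classification (R i) 1≤k f C K C≤K (salem i) (proj₂ eventually i le)
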